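{- There is a constant $c>0$ such that the number of pairwise non-isomorphic $n$-vertex graphs that are determined by their signless Laplacian spectrum is at least $e^{cn}$.
   Context: All graphs are finite and simple. For a graph $G$ with vertices $v_1,\dots,v_n$, let $\mathrm{D}(G)$ be the diagonal matrix of degrees and $\mathrm{A}(G)$ the adjacency matrix. The signless Laplacian is $|\mathrm{L}(G)|=\mathrm{D}(G)+\mathrm{A}(G)$, and its spectrum (multiset of eigenvalues) is the signless Laplacian spectrum of $G$. A graph $G$ is determined by its signless Laplacian spectrum if every graph with the same signless Laplacian spectrum as $G$ is isomorphic to $G$.
   Formalization: The bound is stated for all sufficiently large n, since for n = 1 there is only one graph and 1 < e^c for every c > 0; e^{cn} is expressed as r^n with a rational r > 1, which is equivalent. -}

module Defs where

open import Data.Nat using (ℕ; zero; suc; _≤_; _<_; _^_) renaming (_*_ to _*ℕ_)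
open import Data.Integer using (ℤ; +_; _+_; _-_; _*_)
open import Data.Fin using (Fin; zero; suc; punchIn; _≟_)
open import Data.Fin.Permutation using (Permutation′; _⟨$⟩ʳ_)
open import Data.Bool using (Bool; true; false; if_then_else_)
open import Data.Product using (Σ; ∃; _×_; _,_)
open import Relation.Binary.PropositionalEquality using (_≡_; _≢_)
open import Relation.Nullary using (¬_; Dec; yes; no)

record Graph (n : ℕ) : Set where
  field
    adj    : Fin n → Fin n → Bool
    sym    : ∀ i j → adj i j ≡ adj j i
    irrefl : ∀ i → adj i i ≡ false
open Graph public

_≅_ : {n : ℕ} → Graph n → Graph n → Set
_≅_ {n} G H = Σ (Permutation′ n) λ σ → ∀ i j → adj H (σ ⟨$⟩ʳ i) (σ ⟨$⟩ʳ j) ≡ adj G i j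

Matrix : ℕ → Set
Matrix n = Fin n → Fin n → ℤ

sumFin : {n : ℕ} → (Fin n → ℤ) → ℤ
sumFin {zero}  f = + 0
sumFin {suc n} f = f zero + sumFin (λ j → f (suc j))

altSum : {n : ℕ} → (Fin n → ℤ) → ℤ
altSum {zero}  f = + 0
altSum {suc n} f = f zero - altSum (λ j → f (suc j))

det : {n : ℕ} → Matrix n → ℤ
det {zero}  M = + 1
det {suc n} M = altSum (λ j → M zero j * det (λ i k → M (suc i) (punchIn j k)))

b2z : Bool → ℤ
b2z true  = + 1
b2z false = + 0

δ : {n : ℕ} → Fin n → Fin n → ℤ
δ i j with i ≟ j
... | yes _ = + 1
... | no  _ = + 0

adjMatrix : {n : ℕ} → Graph n → Matrix n
adjMatrix G i j = b2z (adj G i j)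

degree : {n : ℕ} → Graph n → Fin n → ℤ
degree G i = sumFin (λ j → b2z (adj G i j))

degMatrix : {n : ℕ} → Graph n → Matrix n
degMatrix G i j = δ i j * degree G i

signlessLaplacian : {n : ℕ} → Graph n → Matrix n
signlessLaplacian G i j = degMatrix G i j + adjMatrix G i j

charPoly : {n : ℕ} → Matrix n → ℤ → ℤ
charPoly M x = det (λ i j → x * δ i j - M i j)

-- Same signless Laplacian spectrum (for symmetric real matrices: equal
-- multisets of eigenvalues ⇔ equal characteristic polynomials ⇔ equal
-- evaluations at all integers).
QCospectral : {n : ℕ} → Graph n → Graph n → Set
QCospectral G H = ∀ (x : ℤ) → charPoly (signlessLaplacian G) x ≡ charPoly (signlessLaplacian H) x

DQS : {n : ℕ} → Graph n → Set
DQS {n} G = ∀ (H : Graph n) → QCospectral G H → H ≅ G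

{-# OPTIONS --safe #-}
-- The graphs are suns: an odd cycle with pendant leaves at some of its vertices, the hubs, encoded by the cyclic
-- list of gaps between consecutive hubs. In the family every gap is 4 or 5 except two adjacent long ones, and the
-- short gaps form a word in the blocks 45 and 54, which gives exponentially many suns on n vertices.
--
-- A cospectral mate H of such a sun has the same traces of powers of Q - 2, up to the fourth. Measured against
-- the sun, the third and fourth traces are sums of nonnegative local defects of H, so H has degrees 1, 2, 3 only,
-- and every leaf is adjacent to a hub, while no two hubs are adjacent. H is connected, since otherwise 8 divides
-- det Q, which is ± 4; no two leaves share a hub, since otherwise 1 is an eigenvalue, which the residues of the
-- gaps mod 3 exclude. Hence H is a sun.
--
-- For a sun the form det (a - t Q) is, up to known terms, the trace of a product of 2 × 2 transfer matrices. Over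
-- ℤ[[q]], at a = (1 + q)², t = q, it becomes the trace of the product of the matrices hub · diag (1, q^2g) over
-- the gaps g. Its low order terms count the short gaps of H. Once these are known, H has exactly two long gaps
-- and the two long gaps separate four polynomials by degree; comparing them shows that the long gaps of H are
-- adjacent too, have the same lengths, and that the word between them is the original one or its reversal.
module Submission where

-- Cospectrality gives equal values of `charPoly` at all integers. These fix the coefficients of the
-- form det (a - tQ), which may then be evaluated in any commutative ring. In ℤ[[q]], with constant
-- terms 1 for a and 0 for t, every pivot is a unit, so elimination needs neither fractions nor
-- eigenvalues. The obstacle is that the trace of a product of 2 × 2 matrices does not visibly
-- determine the cyclic word of its factors. Two long gaps of very different lengths remove it: the
-- trace splits into four products, each of an entry of one block between them and an entry of the
-- other. For adjacent long gaps one block is a single hub, whose entries are known, so all four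
-- entries of the other block can be read off. Every pair 45 or 54 uses each short gap once, so the
-- order does not depend on the word. Such a pair costs 11 vertices, and long gaps that dominate all
-- degrees of the short part cost about 72 more per pair. Hence n / 100 binary choices fit into n
-- vertices, and the base 401 / 400 of the exponential bound comes from (401 / 400)^200 ≤ 2.

module IntegerCoefficients where
 open import Algebra.Bundles using (CommutativeRing)
 open import Level using (0ℓ)
 open import Data.Nat.Base as ℕ using (ℕ; zero; suc)
 open import Data.Integer.Base as ℤ using (ℤ; +_; -[1+_]; _⊖_)
 import Data.Integer.Properties as ℤ
 import Data.Nat.Properties as ℕ
 open import Data.Maybe.Base using (just; nothing)
 open import Relation.Nullary using (yes; no)
 import Relation.Binary.PropositionalEquality as ≡
 import Algebra.Solver.Ring
 open import Algebra.Solver.Ring.AlmostCommutativeRing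

 module RingZ (R : CommutativeRing 0ℓ 0ℓ) where
   open CommutativeRing R
   open import Algebra.Properties.Semiring.Mult.TCOptimised semiring
   open import Algebra.Properties.Ring ring
   open import Relation.Binary.Reasoning.Setoid setoid

   -- The canonical homomorphism from ℤ serves as the coefficient map of the ring solver. Only
   -- integers have to be compared, so the solver also works in rings without decidable equality,
   -- such as power series.
   ι : ℤ → Carrier
   ι (+ n)     = n × 1#
   ι -[1+ n ]  = - (suc n × 1#)

   private
     ι-⊖ : ∀ m n → ι (m ⊖ n) ≈ m × 1# - n × 1#
     ι-⊖ m zero = begin
       ι (m ⊖ 0) ≡⟨⟩
       m × 1# ≈⟨ +-identityʳ _ ⟨
       m × 1# + 0# ≈⟨ +-congˡ -0#≈0# ⟨
       m × 1# - 0# ∎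
     ι-⊖ zero (suc n) = sym (+-identityˡ (- (suc n × 1#)))
     ι-⊖ (suc m) (suc n) = begin
       ι (suc m ⊖ suc n) ≡⟨ ≡.cong ι (ℤ.[1+m]⊖[1+n]≡m⊖n m n) ⟩
       ι (m ⊖ n) ≈⟨ ι-⊖ m n ⟩
       m × 1# - n × 1# ≈⟨ cancel (m × 1#) (n × 1#) ⟩
       (1# + m × 1#) - (1# + n × 1#) ≈⟨ +-cong (1+× m 1#) (-‿cong (1+× n 1#)) ⟨
       suc m × 1# - suc n × 1# ∎
       where
       cancel : ∀ a b → a - b ≈ (1# + a) - (1# + b)
       cancel a b = begin
         a - b ≈⟨ +-congʳ (+-identityˡ a) ⟨
         (0# + a) - b ≈⟨ +-congʳ (+-congʳ (-‿inverseʳ 1#)) ⟨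
         ((1# - 1#) + a) - b ≈⟨ +-congʳ (+-assoc 1# (- 1#) a) ⟩
         (1# + (- 1# + a)) - b ≈⟨ +-congʳ (+-congˡ (+-comm (- 1#) a)) ⟩
         (1# + (a - 1#)) - b ≈⟨ +-congʳ (+-assoc 1# a (- 1#)) ⟨
         ((1# + a) - 1#) - b ≈⟨ +-assoc (1# + a) (- 1#) (- b) ⟩
         (1# + a) + (- 1# - b) ≈⟨ +-congˡ (-‿+-comm 1# b) ⟩
         (1# + a) - (1# + b) ∎

   ι-neg : ∀ i → ι (ℤ.- i) ≈ - ι i
   ι-neg (+ zero)  = sym -0#≈0#
   ι-neg (+ suc n) = refl
   ι-neg -[1+ n ]  = sym (-‿involutive _)

   ι-+ : ∀ i j → ι (i ℤ.+ j) ≈ ι i + ι j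
   ι-+ (+ m) (+ n) = ×-homo-+ 1# m n
   ι-+ (+ m) -[1+ n ] = ι-⊖ m (suc n)
   ι-+ -[1+ m ] (+ n) = trans (ι-⊖ n (suc m)) (+-comm _ _)
   ι-+ -[1+ m ] -[1+ n ] = begin
     - (suc (suc (m ℕ.+ n)) × 1#) ≡⟨ ≡.cong (λ k → - (suc k × 1#)) (≡.sym (ℕ.+-suc m n)) ⟩
     - ((suc m ℕ.+ suc n) × 1#) ≈⟨ -‿cong (×-homo-+ 1# (suc m) (suc n)) ⟩
     - (suc m × 1# + suc n × 1#) ≈⟨ -‿+-comm _ _ ⟨
     - (suc m × 1#) - suc n × 1# ∎

   private
     ι-*ℕ : ∀ m j → ι (+ m ℤ.* j) ≈ ι (+ m) * ι j
     ι-*ℕ zero j = trans (reflexive (≡.cong ι (ℤ.*-zeroˡ j))) (sym (zeroˡ _))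
     ι-*ℕ (suc m) j = begin
       ι (+ suc m ℤ.* j) ≡⟨ ≡.cong ι (ℤ.suc-* (+ m) j) ⟩
       ι (j ℤ.+ + m ℤ.* j) ≈⟨ ι-+ j (+ m ℤ.* j) ⟩
       ι j + ι (+ m ℤ.* j) ≈⟨ +-cong (sym (*-identityˡ _)) (ι-*ℕ m j) ⟩
       1# * ι j + ι (+ m) * ι j ≈⟨ distribʳ (ι j) 1# (ι (+ m)) ⟨
       (1# + ι (+ m)) * ι j ≈⟨ *-congʳ (1+× m 1#) ⟨
       ι (+ suc m) * ι j ∎

   ι-* : ∀ i j → ι (i ℤ.* j) ≈ ι i * ι j
   ι-* (+ m) j = ι-*ℕ m j
   ι-* -[1+ m ] j = begin
     ι (-[1+ m ] ℤ.* j) ≡⟨ ≡.cong ι (≡.sym (ℤ.neg-distribˡ-* (+ suc m) j)) ⟩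
     ι (ℤ.- (+ suc m ℤ.* j)) ≈⟨ ι-neg (+ suc m ℤ.* j) ⟩
     - ι (+ suc m ℤ.* j) ≈⟨ -‿cong (ι-*ℕ (suc m) j) ⟩
     - (ι (+ suc m) * ι j) ≈⟨ -‿distribˡ-* _ _ ⟩
     ι -[1+ m ] * ι j ∎

   private
     ℤ-raw = CommutativeRing.rawRing ℤ.+-*-commutativeRing
     acr = fromCommutativeRing R
     morphism : ℤ-raw -Raw-AlmostCommutative⟶ acr
     morphism = record
       { ⟦_⟧ = ι ; +-homo = ι-+ ; *-homo = ι-* ; -‿homo = ι-neg
       ; 0-homo = refl ; 1-homo = refl }
     dec : ∀ i j → _
     dec i j with i ℤ.≟ j
     ... | yes p = just (reflexive (≡.cong ι p))
     ... | no  _ = nothing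

   open Algebra.Solver.Ring ℤ-raw acr morphism dec public
     using (solve; _:=_; _:+_; _:*_; _:-_; :-_; con; _:^_)

-- The ring of formal power series over ℤ and its units.

module SeriesRing where
 open import Level using (0ℓ)
 open import Algebra.Bundles using (CommutativeRing)
 open import Data.Nat.Base as ℕ using (ℕ; zero; suc; _≤_; _<_; z≤n; s≤s)
 import Data.Nat.Properties as ℕ
 open import Data.Integer.Base as ℤ using (ℤ; +_)
 import Data.Integer.Properties as ℤ
 open import Data.Integer.Solver using (module +-*-Solver)
 open import Data.Product using (_,_)
 open import Relation.Binary.PropositionalEquality

 Series : Set
 Series = ℕ → ℤ

 module SeriesOps where
   infix 4 _≈_
   infixl 6 _+_
   infixl 7 _*_
   infixr 7 _·_
   infix 8 -_

   _≈_ : Series → Series → Set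
   f ≈ g = ∀ n → f n ≡ g n

   _+_ : Series → Series → Series
   (f + g) n = f n ℤ.+ g n

   -_ : Series → Series
   (- f) n = ℤ.- f n

   tail : Series → Series
   tail f n = f (suc n)

   -- The Cauchy product in the form f = f(0) + X · tail f. It avoids sums over antidiagonals, so
   -- that the ring laws follow by induction on the index.
   _*_ : Series → Series → Series
   (f * g) zero    = f 0 ℤ.* g 0
   (f * g) (suc n) = f 0 ℤ.* g (suc n) ℤ.+ (tail f * g) n

   _·_ : ℤ → Series → Series
   (c · f) n = c ℤ.* f n

   0# 1# X : Series
   0# _ = + 0
   1# zero    = + 1
   1# (suc _) = + 0
   X zero    = + 0
   X (suc n) = 1# n

   open +-*-Solver

   *-cong : ∀ {f f′ g g′} → f ≈ f′ → g ≈ g′ → f * g ≈ f′ * g′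
   *-cong p q zero    = cong₂ ℤ._*_ (p 0) (q 0)
   *-cong p q (suc n) = cong₂ ℤ._+_ (cong₂ ℤ._*_ (p 0) (q (suc n))) (*-cong (λ k → p (suc k)) q n)

   *-distribʳ : ∀ h f g → (f + g) * h ≈ f * h + g * h
   *-distribʳ h f g zero = ℤ.*-distribʳ-+ (h 0) (f 0) (g 0)
   *-distribʳ h f g (suc n) = trans (cong (λ z → ((f 0 ℤ.+ g 0) ℤ.* h (suc n)) ℤ.+ z) (*-distribʳ h (tail f) (tail g) n))
     (solve 5 (λ a b c d e → (a :+ b) :* c :+ (d :+ e) := (a :* c :+ d) :+ (b :* c :+ e)) refl
       (f 0) (g 0) (h (suc n)) ((tail f * h) n) ((tail g * h) n))

   ·-*-assoc : ∀ c f g → (c · f) * g ≈ c · (f * g)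
   ·-*-assoc c f g zero = ℤ.*-assoc c (f 0) (g 0)
   ·-*-assoc c f g (suc n) = trans (cong (λ z → ((c ℤ.* f 0) ℤ.* g (suc n)) ℤ.+ z) (·-*-assoc c (tail f) g n))
     (solve 4 (λ c a b d → (c :* a) :* b :+ c :* d := c :* (a :* b :+ d)) refl
       c (f 0) (g (suc n)) ((tail f * g) n))

   -- The recursion peels only the left factor, so commuting means peeling both: the index drops by
   -- two, to `tail f * tail g`, and the induction uses the two preceding indices.
   *-comm : ∀ f g → f * g ≈ g * f
   *-comm f g zero = ℤ.*-comm (f 0) (g 0)
   *-comm f g (suc zero) = solve 4 (λ a b c d → a :* b :+ c :* d := d :* c :+ b :* a) refl
     (f 0) (g 1) (f 1) (g 0)
   *-comm f g (suc (suc n)) = begin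
     f 0 ℤ.* g (suc (suc n)) ℤ.+ (tail f * g) (suc n)
       ≡⟨ cong (λ z → (f 0 ℤ.* g (suc (suc n))) ℤ.+ z) (*-comm (tail f) g (suc n)) ⟩
     f 0 ℤ.* g (suc (suc n)) ℤ.+ (g 0 ℤ.* f (suc (suc n)) ℤ.+ (tail g * tail f) n)
       ≡⟨ cong (λ z → f 0 ℤ.* g (suc (suc n)) ℤ.+ (g 0 ℤ.* f (suc (suc n)) ℤ.+ z)) (*-comm (tail g) (tail f) n) ⟩
     f 0 ℤ.* g (suc (suc n)) ℤ.+ (g 0 ℤ.* f (suc (suc n)) ℤ.+ (tail f * tail g) n)
       ≡⟨ solve 3 (λ a b c → a :+ (b :+ c) := b :+ (a :+ c)) refl
           (f 0 ℤ.* g (suc (suc n))) (g 0 ℤ.* f (suc (suc n))) ((tail f * tail g) n) ⟩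
     g 0 ℤ.* f (suc (suc n)) ℤ.+ (f * tail g) (suc n)
       ≡⟨ cong (λ z → (g 0 ℤ.* f (suc (suc n))) ℤ.+ z) (*-comm f (tail g) (suc n)) ⟩
     g 0 ℤ.* f (suc (suc n)) ℤ.+ (tail g * f) (suc n) ∎
     where open ≡-Reasoning

   *-assoc : ∀ f g h → (f * g) * h ≈ f * (g * h)
   *-assoc f g h zero = ℤ.*-assoc (f 0) (g 0) (h 0)
   *-assoc f g h (suc n) = begin
     (f 0 ℤ.* g 0) ℤ.* h (suc n) ℤ.+ ((f 0 · tail g + tail f * g) * h) n
       ≡⟨ cong (λ z → ((f 0 ℤ.* g 0) ℤ.* h (suc n)) ℤ.+ z) (*-distribʳ h (f 0 · tail g) (tail f * g) n) ⟩
     (f 0 ℤ.* g 0) ℤ.* h (suc n) ℤ.+ (((f 0 · tail g) * h) n ℤ.+ ((tail f * g) * h) n)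
       ≡⟨ cong₂ (λ x y → (f 0 ℤ.* g 0) ℤ.* h (suc n) ℤ.+ (x ℤ.+ y)) (·-*-assoc (f 0) (tail g) h n) (*-assoc (tail f) g h n) ⟩
     (f 0 ℤ.* g 0) ℤ.* h (suc n) ℤ.+ (f 0 ℤ.* (tail g * h) n ℤ.+ (tail f * (g * h)) n)
       ≡⟨ solve 5 (λ a b c d e → (a :* b) :* c :+ (a :* d :+ e) := a :* (b :* c :+ d) :+ e) refl
           (f 0) (g 0) (h (suc n)) ((tail g * h) n) ((tail f * (g * h)) n) ⟩
     f 0 ℤ.* (g 0 ℤ.* h (suc n) ℤ.+ (tail g * h) n) ℤ.+ (tail f * (g * h)) n ∎
     where open ≡-Reasoning

   *-zeroˡ : ∀ f → 0# * f ≈ 0#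
   *-zeroˡ f zero    = ℤ.*-zeroˡ (f 0)
   *-zeroˡ f (suc n) = trans (cong₂ ℤ._+_ (ℤ.*-zeroˡ (f (suc n))) (*-zeroˡ f n)) refl

   *-identityˡ : ∀ f → 1# * f ≈ f
   *-identityˡ f zero    = ℤ.*-identityˡ (f 0)
   *-identityˡ f (suc n) = trans (cong₂ ℤ._+_ (ℤ.*-identityˡ (f (suc n))) (*-zeroˡ f n)) (ℤ.+-identityʳ _)

 seriesRing : CommutativeRing 0ℓ 0ℓ
 seriesRing = record
   { Carrier = Series ; _≈_ = _≈_ ; _+_ = _+_ ; _*_ = _*_ ; -_ = -_ ; 0# = 0# ; 1# = 1#
   ; isCommutativeRing = record
     { isRing = record
       { +-isAbelianGroup = record
         { isGroup = record
           { isMonoid = record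
             { isSemigroup = record
               { isMagma = record
                 { isEquivalence = record { refl = λ _ → refl ; sym = λ p n → sym (p n) ; trans = λ p q n → trans (p n) (q n) }
                 ; ∙-cong = λ p q n → cong₂ ℤ._+_ (p n) (q n) }
               ; assoc = λ f g h n → ℤ.+-assoc (f n) (g n) (h n) }
             ; identity = (λ f n → ℤ.+-identityˡ (f n)) , (λ f n → ℤ.+-identityʳ (f n)) }
           ; inverse = (λ f n → ℤ.+-inverseˡ (f n)) , (λ f n → ℤ.+-inverseʳ (f n))
           ; ⁻¹-cong = λ p n → cong ℤ.-_ (p n) }
         ; comm = λ f g n → ℤ.+-comm (f n) (g n) }
       ; *-cong = *-cong
       ; *-assoc = *-assoc
       ; *-identity = *-identityˡ , (λ f n → trans (*-comm f 1# n) (*-identityˡ f n))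
       ; distrib = (λ f g h n → trans (*-comm f (g + h) n) (trans (*-distribʳ f g h n) (cong₂ ℤ._+_ (*-comm g f n) (*-comm h f n)))) , *-distribʳ }
     ; *-comm = *-comm } }
   where open SeriesOps

 module SeriesProps where
   open SeriesOps using (X; tail; *-zeroˡ) renaming (_*_ to _*ₛ_)
   open CommutativeRing seriesRing hiding (zero; refl; sym; trans)
   module S = CommutativeRing seriesRing
   open import Algebra.Properties.Semiring.Exp semiring public using (_^_)

   X*-suc : ∀ f n → (X * f) (suc n) ≡ f n
   X*-suc f n = trans (cong₂ ℤ._+_ (ℤ.*-zeroˡ (f (suc n))) (*-identityˡ f n)) (ℤ.+-identityˡ _)

   AgreeTo : ℕ → Series → Series → Set
   AgreeTo n f g = ∀ i → i ≤ n → f i ≡ g i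

   *-local : ∀ n f {g h} → AgreeTo n g h → (f * g) n ≡ (f * h) n
   *-local zero    f p = cong (f 0 ℤ.*_) (p 0 z≤n)
   *-local (suc n) f p = cong₂ ℤ._+_ (cong (f 0 ℤ.*_) (p (suc n) ℕ.≤-refl))
                                      (*-local n (tail f) (λ i i≤n → p i (ℕ.m≤n⇒m≤1+n i≤n)))

   -- The truncated geometric series 1 + u + ... + u^m in Horner form.
   approx : Series → ℕ → Series
   approx u zero    = 1#
   approx u (suc m) = 1# + u * approx u m

   -- The diagonal of the truncations: coefficient n is final from the n-th one on when the constant
   -- term of f is 1. The function is total, so elimination can be defined without carrying proofs;
   -- it is an inverse under the hypothesis of `inv-inverse`.
   inv : Series → Series
   inv f n = approx (1# - f) n n

   inv-cong : ∀ f g → f ≈ g → inv f ≈ inv g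
   inv-cong f g p n = agree n n
     where
     agree : ∀ m → approx (1# - f) m ≈ approx (1# - g) m
     agree zero    k = refl
     agree (suc m) k = cong (λ z → 1# k ℤ.+ z) (SeriesOps.*-cong (λ i → cong (λ z → 1# i ℤ.- z) (p i)) (agree m) k)

   module _ (u : Series) (u₀ : u 0 ≡ + 0) where
     private
       -- Since u has constant term 0, the map g ↦ 1 + u g gains one correct coefficient at each
       -- application. Its iterates are the truncations, so they stabilise and their limit is a
       -- fixed point.
       contract : ∀ n {g h} → AgreeTo n g h → AgreeTo (suc n) (1# + u * g) (1# + u * h)
       contract n {g} {h} p zero    _         = cong (λ z → + 1 ℤ.+ z) (trans (cong (ℤ._* g 0) u₀) (sym (cong (ℤ._* h 0) u₀)))
       contract n {g} {h} p (suc i) (s≤s i≤n) = cong (λ z → + 0 ℤ.+ z) (cong₂ ℤ._+_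
         (trans (cong (ℤ._* g (suc i)) u₀) (sym (cong (ℤ._* h (suc i)) u₀)))
         (*-local i (tail u) (λ j j≤i → p j (ℕ.≤-trans j≤i i≤n))))

     approx-stable : ∀ n k → AgreeTo n (approx u n) (approx u (n ℕ.+ k))
     approx-stable zero    zero    _ _   = refl
     approx-stable zero    (suc k) zero z≤n = sym (cong (λ z → + 1 ℤ.+ z) (cong (ℤ._* approx u k 0) u₀))
     approx-stable (suc n) k = contract n (approx-stable n k)

     fixpoint : (λ n → approx u n n) ≈ 1# + u * (λ n → approx u n n)
     fixpoint n = trans (stable n (suc n) (ℕ.n≤1+n n))
         (cong (λ z → 1# n ℤ.+ z) (*-local n u (λ i i≤n → sym (stable i n i≤n))))
       where
       stable : ∀ i n → i ≤ n → approx u i i ≡ approx u n i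
       stable i n i≤n = trans (approx-stable i (n ℕ.∸ i) i ℕ.≤-refl) (cong (λ m → approx u m i) (ℕ.m+[n∸m]≡n i≤n))

   -- The fixed point equation g = 1 + (1 - f) g of the geometric series is f g = 1, rearranged.
   inv-inverse : ∀ f → f 0 ≡ + 1 → f * inv f ≈ 1#
   inv-inverse f f₀ n = begin
     (f * g) n ≡⟨ solve 3 (λ a b c → a := b :- (b :- a)) refl ((f * g) n) (g n) (+ 0) ⟩
     g n ℤ.- (g n ℤ.- (f * g) n) ≡⟨ cong₂ ℤ._-_ (fix n) (sym (step n)) ⟩
     (1# n ℤ.+ (u * g) n) ℤ.- (u * g) n ≡⟨ solve 2 (λ a b → (a :+ b) :- b := a) refl (1# n) ((u * g) n) ⟩
     1# n ∎
     where
     open ≡-Reasoning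
     open +-*-Solver
     u = 1# - f
     g = inv f
     fix : g ≈ 1# + u * g
     fix = fixpoint u (cong (λ z → + 1 ℤ.+ ℤ.- z) f₀)
     neg-* : ∀ k a b → ((- a) * b) k ≡ ℤ.- (a * b) k
     neg-* zero    a b = sym (ℤ.neg-distribˡ-* (a 0) (b 0))
     neg-* (suc k) a b = trans (cong₂ ℤ._+_ (sym (ℤ.neg-distribˡ-* (a 0) (b (suc k)))) (neg-* k (tail a) b))
                               (sym (ℤ.neg-distrib-+ (a 0 ℤ.* b (suc k)) ((tail a * b) k)))
     step : ∀ k → (u * g) k ≡ g k ℤ.- (f * g) k
     step k = trans (SeriesOps.*-distribʳ g 1# (- f) k) (cong₂ ℤ._+_ (SeriesOps.*-identityˡ g k) (neg-* k f g))

-- Determinants over a commutative ring: columns, transposition and Schur complements.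

module Determinant where
 open IntegerCoefficients using (module RingZ)
 open import Algebra.Bundles using (CommutativeRing)
 open import Level using (0ℓ)
 open import Data.Nat.Base as ℕ using (ℕ; zero; suc; z≤n; s≤s)
 import Data.Nat.Properties as ℕ
 open import Data.Integer.Base using (+_)
 open import Data.Fin.Base using (Fin; zero; suc; punchIn; punchOut; inject₁; toℕ; fromℕ<)
 open import Data.Fin.Properties using (_≟_; punchInᵢ≢i; punchIn-punchOut; punchIn-injective; toℕ-fromℕ<; toℕ-injective; toℕ<n; toℕ-inject₁)
 open import Data.Product using (Σ; _×_; _,_)
 open import Data.Sum using (_⊎_; inj₁; inj₂)
 open import Function.Base using (_∘_)
 open import Relation.Nullary using (yes; no; contradiction)
 open import Relation.Binary using (tri<; tri≈; tri>)
 open import Relation.Binary.PropositionalEquality as ≡ using (_≡_; _≢_)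

 module Det (R : CommutativeRing 0ℓ 0ℓ) where
   open CommutativeRing R renaming (zero to *-zero)
   open RingZ R
   open import Relation.Binary.Reasoning.Setoid setoid
   open import Algebra.Properties.Ring ring using (-0#≈0#)

   sum alt : {n : ℕ} → (Fin n → Carrier) → Carrier
   sum {zero}  f = 0#
   sum {suc n} f = f zero + sum (f ∘ suc)
   alt {zero}  f = 0#
   alt {suc n} f = f zero - alt (f ∘ suc)

   Mat : ℕ → Set
   Mat n = Fin n → Fin n → Carrier

   det : {n : ℕ} → Mat n → Carrier
   det {zero}  M = 1#
   det {suc n} M = alt (λ j → M zero j * det (λ i k → M (suc i) (punchIn j k)))

   sum-cong : ∀ {n} {f g : Fin n → Carrier} → (∀ i → f i ≈ g i) → sum f ≈ sum g
   sum-cong {zero}  p = refl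
   sum-cong {suc n} p = +-cong (p zero) (sum-cong (p ∘ suc))

   sum-0 : ∀ {n} {f : Fin n → Carrier} → (∀ i → f i ≈ 0#) → sum f ≈ 0#
   sum-0 {zero}  p = refl
   sum-0 {suc n} p = trans (+-cong (p zero) (sum-0 (p ∘ suc))) (+-identityˡ 0#)

   sum-+ : ∀ {n} (f g : Fin n → Carrier) → sum (λ i → f i + g i) ≈ sum f + sum g
   sum-+ {zero}  f g = sym (+-identityˡ 0#)
   sum-+ {suc n} f g = trans (+-congˡ (sum-+ (f ∘ suc) (g ∘ suc)))
     (solve 4 (λ a b c d → (a :+ b) :+ (c :+ d) := (a :+ c) :+ (b :+ d)) refl _ _ _ _)

   sum-* : ∀ {n} c (f : Fin n → Carrier) → sum (λ i → c * f i) ≈ c * sum f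
   sum-* {zero}  c f = sym (zeroʳ c)
   sum-* {suc n} c f = trans (+-congˡ (sum-* c (f ∘ suc))) (sym (distribˡ c _ _))

   sum-*ʳ : ∀ {n} c (f : Fin n → Carrier) → sum (λ i → f i * c) ≈ sum f * c
   sum-*ʳ c f = trans (sum-cong (λ i → *-comm (f i) c)) (trans (sum-* c f) (*-comm c _))

   sum-swap : ∀ {m n} (f : Fin m → Fin n → Carrier) → sum (λ i → sum (f i)) ≈ sum (λ j → sum (λ i → f i j))
   sum-swap {zero}  {n} f = sym (sum-0 {n} {λ _ → 0#} (λ _ → refl))
   sum-swap {suc m} f = trans (+-congˡ (sum-swap (f ∘ suc))) (sym (sum-+ (f zero) _))

   sum-single : ∀ {n} (r : Fin n) {f : Fin n → Carrier} → (∀ j → j ≢ r → f j ≈ 0#) → sum f ≈ f r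
   sum-single zero    p = trans (+-congˡ (sum-0 (λ i → p (suc i) (λ ())))) (+-identityʳ _)
   sum-single (suc r) p = trans (+-cong (p zero (λ ())) (sum-single r (λ j j≢r → p (suc j) (λ { ≡.refl → j≢r ≡.refl })))) (+-identityˡ _)

   alt-cong : ∀ {n} {f g : Fin n → Carrier} → (∀ i → f i ≈ g i) → alt f ≈ alt g
   alt-cong {zero}  p = refl
   alt-cong {suc n} p = +-cong (p zero) (-‿cong (alt-cong (p ∘ suc)))

   alt-0 : ∀ {n} {f : Fin n → Carrier} → (∀ i → f i ≈ 0#) → alt f ≈ 0#
   alt-0 {zero}  p = refl
   alt-0 {suc n} p = trans (+-cong (p zero) (trans (-‿cong (alt-0 (p ∘ suc))) -0#≈0#)) (+-identityˡ 0#)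

   alt-lin : ∀ {n} c (f g : Fin n → Carrier) → alt (λ i → c * f i + g i) ≈ c * alt f + alt g
   alt-lin {zero}  c f g = solve 1 (λ c → con (+ 0) := c :* con (+ 0) :+ con (+ 0)) refl c
   alt-lin {suc n} c f g = trans (+-congˡ (-‿cong (alt-lin c (f ∘ suc) (g ∘ suc))))
     (solve 5 (λ c a b d e → (c :* a :+ b) :- (c :* d :+ e) := c :* (a :- d) :+ (b :- e)) refl _ _ _ _ _)

   alt-* : ∀ {n} c (f : Fin n → Carrier) → alt (λ i → c * f i) ≈ c * alt f
   alt-* {zero}  c f = sym (zeroʳ c)
   alt-* {suc n} c f = trans (+-congˡ (-‿cong (alt-* c (f ∘ suc))))
     (solve 3 (λ c a d → c :* a :- c :* d := c :* (a :- d)) refl _ _ _)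

   alt-- : ∀ {n} (f g : Fin n → Carrier) → alt (λ i → f i - g i) ≈ alt f - alt g
   alt-- {zero}  f g = solve 0 (con (+ 0) := con (+ 0) :- con (+ 0)) refl
   alt-- {suc n} f g = trans (+-congˡ (-‿cong (alt-- (f ∘ suc) (g ∘ suc))))
     (solve 4 (λ a b c d → (a :- b) :- (c :- d) := (a :- c) :- (b :- d)) refl _ _ _ _)

   alt-swap : ∀ {m n} (f : Fin m → Fin n → Carrier) → alt (λ i → alt (f i)) ≈ alt (λ j → alt (λ i → f i j))
   alt-swap {zero}  {n} f = sym (alt-0 {n} {λ _ → 0#} (λ _ → refl))
   alt-swap {suc m} f = trans (+-congˡ (-‿cong (alt-swap (f ∘ suc)))) (sym (alt-- (f zero) _))

   det-cong : ∀ {n} {M N : Mat n} → (∀ i j → M i j ≈ N i j) → det M ≈ det N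
   det-cong {zero}  p = refl
   det-cong {suc n} p = alt-cong (λ j → *-cong (p zero j) (det-cong (λ i k → p (suc i) (punchIn j k))))

   -- The corner terms of the two expansions coincide. In the others, expanding each minor along its
   -- first column gives a double alternating sum that is symmetric in rows and columns, so the two
   -- sums may be exchanged.
   det-firstCol : ∀ {n} (M : Mat (suc n)) →
     det M ≈ alt (λ i → M i zero * det (λ a b → M (punchIn i a) (suc b)))
   det-firstCol {zero}  M = refl
   det-firstCol {suc n} M = +-congˡ (-‿cong (begin
     alt (λ j → M zero (suc j) * det (λ a b → M (suc a) (punchIn (suc j) b)))
       ≈⟨ alt-cong (λ j → trans (*-congˡ {M zero (suc j)} (det-firstCol (λ a b → M (suc a) (punchIn (suc j) b)))) (sym (alt-* (M zero (suc j)) (λ i → M (suc i) zero * D i j)))) ⟩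
     alt (λ j → alt (λ i → M zero (suc j) * (M (suc i) zero * D i j)))
       ≈⟨ alt-swap (λ j i → M zero (suc j) * (M (suc i) zero * D i j)) ⟩
     alt (λ i → alt (λ j → M zero (suc j) * (M (suc i) zero * D i j)))
       ≈⟨ alt-cong (λ i → trans (alt-cong (λ j → solve 3 (λ a b c → a :* (b :* c) := b :* (a :* c)) refl (M zero (suc j)) (M (suc i) zero) (D i j))) (alt-* (M (suc i) zero) (λ j → M zero (suc j) * D i j))) ⟩
     alt (λ i → M (suc i) zero * det (λ a b → M (punchIn (suc i) a) (suc b))) ∎))
     where
     D : Fin (suc n) → Fin (suc n) → Carrier
     D i j = det (λ a b → M (suc (punchIn i a)) (suc (punchIn j b)))

   det-transpose : ∀ {n} (M : Mat n) → det M ≈ det (λ i j → M j i)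
   det-transpose {zero}  M = refl
   det-transpose {suc n} M = trans (det-firstCol M)
     (alt-cong (λ i → *-congˡ {M i zero} (det-transpose (λ a b → M (punchIn i a) (suc b)))))

   -- The three matrices are related by pointwise equations and not by replacing a column: this form
   -- passes to minors, where column k reappears at the place `punchOut`.
   det-col-linear : ∀ {n} (k : Fin n) c (M M₁ M₂ : Mat n) →
     (∀ i j → j ≢ k → M i j ≈ M₁ i j) → (∀ i j → j ≢ k → M i j ≈ M₂ i j) →
     (∀ i → M i k ≈ c * M₁ i k + M₂ i k) → det M ≈ c * det M₁ + det M₂
   det-col-linear {suc n} k c M M₁ M₂ e₁ e₂ l = trans (alt-cong term) (alt-lin c (λ j → M₁ zero j * det (λ a b → M₁ (suc a) (punchIn j b))) (λ j → M₂ zero j * det (λ a b → M₂ (suc a) (punchIn j b))))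
     where
     term : ∀ j → M zero j * det (λ a b → M (suc a) (punchIn j b))
                ≈ c * (M₁ zero j * det (λ a b → M₁ (suc a) (punchIn j b))) + M₂ zero j * det (λ a b → M₂ (suc a) (punchIn j b))
     term j with j ≟ k
     ... | yes ≡.refl = trans (*-congʳ (l zero)) (trans (distribʳ _ _ _) (+-cong
             (trans (*-assoc c _ _) (*-congˡ (*-congˡ (det-cong (λ a b → e₁ (suc a) (punchIn j b) (punchInᵢ≢i j b))))))
             (*-congˡ (det-cong (λ a b → e₂ (suc a) (punchIn j b) (punchInᵢ≢i j b))))))
     ... | no j≢k = begin
       M zero j * det (λ a b → M (suc a) (punchIn j b))
         ≈⟨ *-congˡ (det-col-linear k′ c (λ a b → M (suc a) (punchIn j b)) (λ a b → M₁ (suc a) (punchIn j b)) (λ a b → M₂ (suc a) (punchIn j b)) (λ a b b≢ → e₁ (suc a) (punchIn j b) (other b b≢)) (λ a b b≢ → e₂ (suc a) (punchIn j b) (other b b≢))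
              (λ a → ≡.subst (λ z → M (suc a) z ≈ c * M₁ (suc a) z + M₂ (suc a) z) (≡.sym at) (l (suc a)))) ⟩
       M zero j * (c * D₁ + D₂)
         ≈⟨ solve 4 (λ x c a b → x :* (c :* a :+ b) := c :* (x :* a) :+ x :* b) refl _ _ _ _ ⟩
       c * (M zero j * D₁) + M zero j * D₂
         ≈⟨ +-cong (*-congˡ (*-congʳ (e₁ zero j j≢k))) (*-congʳ (e₂ zero j j≢k)) ⟩
       c * (M₁ zero j * D₁) + M₂ zero j * D₂ ∎
       where
       D₁ = det (λ a b → M₁ (suc a) (punchIn j b))
       D₂ = det (λ a b → M₂ (suc a) (punchIn j b))
       k′ = punchOut j≢k
       at : punchIn j k′ ≡ k
       at = punchIn-punchOut j≢k
       other : ∀ b → b ≢ k′ → punchIn j b ≢ k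
       other b b≢ eq = b≢ (punchIn-injective j b k′ (≡.trans eq (≡.sym at)))

   private
     alt-pair : ∀ {n} (k : Fin (suc n)) (f : Fin (suc (suc n)) → Carrier) → f (inject₁ k) ≈ f (suc k) →
       (∀ j → j ≢ inject₁ k → j ≢ suc k → f j ≈ 0#) → alt f ≈ 0#
     alt-pair zero f e z = begin
       f zero - (f (suc zero) - alt (λ i → f (suc (suc i)))) ≈⟨ +-cong e (-‿cong (+-congˡ (-‿cong (alt-0 (λ i → z (suc (suc i)) (λ ()) (λ ())))))) ⟩
       f (suc zero) - (f (suc zero) - 0#) ≈⟨ solve 1 (λ a → a :- (a :- con (+ 0)) := con (+ 0)) refl _ ⟩
       0# ∎
     alt-pair {suc n} (suc k) f e z = begin
       f zero - alt (f ∘ suc) ≈⟨ +-cong (z zero (λ ()) (λ ())) (-‿cong (alt-pair k (f ∘ suc) e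
           (λ j p q → z (suc j) (λ { ≡.refl → p ≡.refl }) (λ { ≡.refl → q ≡.refl })))) ⟩
       0# - 0# ≈⟨ -‿inverseʳ 0# ⟩
       0# ∎

     -- Deleting a column other than the two adjacent ones keeps them adjacent. The equation for n
     -- records that the minor still has room for both.
     minor-adjacent : ∀ {n} (j : Fin (suc (suc n))) (k : Fin (suc n)) → j ≢ inject₁ k → j ≢ suc k →
       Σ ℕ λ m → Σ (n ≡ suc m) λ e → Σ (Fin (suc m)) λ k′ →
         (punchIn j (≡.subst (Fin ∘ suc) (≡.sym e) (inject₁ k′)) ≡ inject₁ k)
         × (punchIn j (≡.subst (Fin ∘ suc) (≡.sym e) (suc k′)) ≡ suc k)
     minor-adjacent zero zero p q = contradiction ≡.refl p
     minor-adjacent {suc n} zero (suc k) p q = n , ≡.refl , k , ≡.refl , ≡.refl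
     minor-adjacent (suc zero) zero p q = contradiction ≡.refl q
     minor-adjacent {suc n} (suc (suc j)) zero p q = n , ≡.refl , zero , ≡.refl , ≡.refl
     minor-adjacent {suc n} (suc j) (suc k) p q
       with minor-adjacent j k (λ { ≡.refl → p ≡.refl }) (λ { ≡.refl → q ≡.refl })
     ... | m , ≡.refl , k′ , x , y = suc m , ≡.refl , suc k′ , ≡.cong suc x , ≡.cong suc y

     -- Skipping column k or column k + 1 leaves the same list of columns but for one slot, which
     -- holds the other of the two.
     punchIn-adjacent : ∀ {n} (k : Fin (suc n)) (b : Fin (suc n)) →
       (punchIn (inject₁ k) b ≡ punchIn (suc k) b) ⊎ ((punchIn (inject₁ k) b ≡ suc k) × (punchIn (suc k) b ≡ inject₁ k))
     punchIn-adjacent zero    zero    = inj₂ (≡.refl , ≡.refl)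
     punchIn-adjacent zero    (suc b) = inj₁ ≡.refl
     punchIn-adjacent (suc k) zero    = inj₁ ≡.refl
     punchIn-adjacent {suc n} (suc k) (suc b) with punchIn-adjacent k b
     ... | inj₁ e       = inj₁ (≡.cong suc e)
     ... | inj₂ (x , y) = inj₂ (≡.cong suc x , ≡.cong suc y)

   -- In the row expansion the terms of the two equal columns have the same minor and opposite
   -- signs. Every other minor again has two equal adjacent columns.
   det-adjacentCols : ∀ {n} (k : Fin (suc n)) (M : Mat (suc (suc n))) →
     (∀ i → M i (inject₁ k) ≈ M i (suc k)) → det M ≈ 0#
   det-adjacentCols k M e = alt-pair k (λ j → M zero j * det (λ a b → M (suc a) (punchIn j b))) (*-cong (e zero) (det-cong (λ a b → col a b (punchIn-adjacent k b)))) other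
     where
     col : ∀ a b → _ → M (suc a) (punchIn (inject₁ k) b) ≈ M (suc a) (punchIn (suc k) b)
     col a b (inj₁ x)       = reflexive (≡.cong (M (suc a)) x)
     col a b (inj₂ (x , y)) = trans (reflexive (≡.cong (M (suc a)) x)) (trans (sym (e (suc a))) (reflexive (≡.cong (M (suc a)) (≡.sym y))))
     other : ∀ j → j ≢ inject₁ k → j ≢ suc k → M zero j * det (λ a b → M (suc a) (punchIn j b)) ≈ 0#
     other j p q with minor-adjacent j k p q
     ... | m , ≡.refl , k′ , x , y = trans (*-congˡ (det-adjacentCols k′ (λ a b → M (suc a) (punchIn j b))
             (λ a → trans (reflexive (≡.cong (M (suc a)) x)) (trans (e (suc a)) (reflexive (≡.cong (M (suc a)) (≡.sym y))))))) (zeroʳ _)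

   setCol : ∀ {n} → Mat n → Fin n → (Fin n → Carrier) → Mat n
   setCol M k v i j with j ≟ k
   ... | yes _ = v i
   ... | no  _ = M i j

   setCol-at : ∀ {n} (M : Mat n) k v i → setCol M k v i k ≡ v i
   setCol-at M k v i with k ≟ k
   ... | yes _ = ≡.refl
   ... | no p  = contradiction ≡.refl p

   setCol-other : ∀ {n} (M : Mat n) k v i j → j ≢ k → setCol M k v i j ≡ M i j
   setCol-other M k v i j j≢k with j ≟ k
   ... | yes p = contradiction p j≢k
   ... | no _  = ≡.refl

   setCol-self : ∀ {n} (M : Mat n) k i j → setCol M k (λ i → M i k) i j ≡ M i j
   setCol-self M k i j with j ≟ k
   ... | yes ≡.refl = ≡.refl
   ... | no _       = ≡.refl

   setCol-linear : ∀ {n} (M : Mat n) k c u v →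
     det (setCol M k (λ i → c * u i + v i)) ≈ c * det (setCol M k u) + det (setCol M k v)
   setCol-linear M k c u v = det-col-linear k c (setCol M k (λ i → c * u i + v i)) (setCol M k u) (setCol M k v) (same u) (same v)
     (λ i → trans (reflexive (setCol-at M k _ i)) (sym (+-cong (*-congˡ (reflexive (setCol-at M k u i))) (reflexive (setCol-at M k v i)))))
     where
     same : ∀ w i j → j ≢ k → setCol M k (λ i → c * u i + v i) i j ≈ setCol M k w i j
     same w i j p = reflexive (≡.trans (setCol-other M k _ i j p) (≡.sym (setCol-other M k w i j p)))

   private
     -- Moving one of the two equal columns next to the other: with u = col i = col j and
     -- v = col (j - 1), expand the vanishing determinant whose columns j - 1 and j are both u + v.
     equalCols : ∀ d {n} (i j : Fin n) → toℕ j ≡ suc (toℕ i ℕ.+ d) → (M : Mat n) → (∀ a → M a i ≈ M a j) → det M ≈ 0#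
     equalCols d {suc (suc n)} i (suc k) eq M e with d
     ... | zero  = det-adjacentCols k M (λ a → trans (reflexive (≡.cong (M a) (≡.sym i≡))) (e a))
       where
       i≡ : i ≡ inject₁ k
       i≡ = toℕ-injective (≡.trans (≡.sym (≡.trans (ℕ.suc-injective eq) (ℕ.+-identityʳ _))) (≡.sym (toℕ-inject₁ k)))
     ... | suc d′ = begin
       det M ≈⟨ det-cong (λ a b → sym (reflexive (vu-b a b))) ⟩
       det vu ≈⟨ solve 1 (λ x → x := (con (+ 1) :* x :+ con (+ 0))) refl _ ⟩
       1# * det vu + 0# ≈⟨ +-congˡ vv≈0 ⟨
       1# * det vu + det vv ≈⟨ sym (setCol-linear V (suc k) 1# u v) ⟩
       det (setCol V (suc k) w) ≈⟨ det-cong VW ⟩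
       det (setCol W m v) ≈⟨ solve 1 (λ x → x := (con (+ 1) :* con (+ 0) :+ x)) refl _ ⟩
       1# * 0# + det (setCol W m v) ≈⟨ +-congʳ (*-congˡ uw≈0) ⟨
       1# * det (setCol W m u) + det (setCol W m v) ≈⟨ sym (setCol-linear W m 1# u v) ⟩
       det (setCol W m w) ≈⟨ det-adjacentCols k (setCol W m w) (λ a → trans (reflexive (setCol-at W m w a))
                               (sym (trans (reflexive (setCol-other W m w a (suc k) sk≢m)) (reflexive (setCol-at M (suc k) w a))))) ⟩
       0# ∎
       where
       m = inject₁ k
       u v w : Fin (suc (suc n)) → Carrier
       u a = M a (suc k)
       v a = M a m
       w a = 1# * u a + v a
       sk≢m : suc k ≢ m
       sk≢m p = ℕ.1+n≢n (≡.trans (≡.cong toℕ p) (toℕ-inject₁ k))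
       i≢m : i ≢ m
       i≢m ≡.refl = ℕ.m≢1+m+n (toℕ m) (≡.trans (toℕ-inject₁ k) (≡.trans (ℕ.suc-injective eq) (ℕ.+-suc (toℕ m) d′)))
       i≢sk : i ≢ suc k
       i≢sk ≡.refl = ℕ.m≢1+m+n (toℕ (suc k)) eq
       V W vu vv : Mat (suc (suc n))
       V = setCol M m v
       W = setCol M (suc k) w
       vu = setCol V (suc k) u
       vv = setCol V (suc k) v
       vu-b : ∀ a b → vu a b ≡ M a b
       vu-b a b with b ≟ suc k
       ... | yes ≡.refl = ≡.refl
       ... | no _       = setCol-self M m a b
       vv≈0 : det vv ≈ 0#
       vv≈0 = det-adjacentCols k vv (λ a → trans (reflexive (≡.trans (setCol-other V (suc k) v a m (sk≢m ∘ ≡.sym)) (setCol-at M m v a)))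
                                          (sym (reflexive (setCol-at V (suc k) v a))))
       VW : ∀ a b → setCol V (suc k) w a b ≈ setCol W m v a b
       VW a b with b ≟ suc k | b ≟ m
       ... | yes ≡.refl | yes p = contradiction p sk≢m
       ... | yes ≡.refl | no _  = sym (reflexive (setCol-at M (suc k) w a))
       ... | no _ | yes ≡.refl  = reflexive (setCol-at M m v a)
       ... | no p | no q        = reflexive (≡.trans (setCol-other M m v a b q) (≡.sym (setCol-other M (suc k) w a b p)))
       uw≈0 : det (setCol W m u) ≈ 0#
       uw≈0 = equalCols d′ i m (≡.trans (toℕ-inject₁ k) (≡.trans (ℕ.suc-injective eq) (ℕ.+-suc (toℕ i) d′))) (setCol W m u)
         (λ a → trans (reflexive (≡.trans (setCol-other W m u a i i≢m) (setCol-other M (suc k) w a i i≢sk)))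
                  (trans (e a) (sym (reflexive (setCol-at W m u a)))))
     equalCols d {suc zero} zero zero () M e

   det-equalCols : ∀ {n} (i j : Fin n) → i ≢ j → (M : Mat n) → (∀ a → M a i ≈ M a j) → det M ≈ 0#
   det-equalCols i j i≢j M e with ℕ.<-cmp (toℕ i) (toℕ j)
   ... | tri< lt _ _ = equalCols (toℕ j ℕ.∸ suc (toℕ i)) i j (≡.sym (ℕ.m+[n∸m]≡n lt)) M e
   ... | tri≈ _ eq _ = contradiction (toℕ-injective eq) i≢j
   ... | tri> _ _ gt = equalCols (toℕ i ℕ.∸ suc (toℕ j)) j i (≡.sym (ℕ.m+[n∸m]≡n gt)) M (λ a → sym (e a))

   private
     setCol-sum : ∀ {n m} (M : Mat n) k (c : Fin m → Carrier) (u : Fin m → Fin n → Carrier) →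
       det (setCol M k (λ i → sum (λ j → c j * u j i))) ≈ sum (λ j → c j * det (setCol M k (u j)))
     setCol-sum {m = zero} M k c u = begin
       det (setCol M k (λ _ → 0#)) ≈⟨ det-cong (λ i j → setCol-cong i j) ⟩
       -- The zero column is written as -1 times itself plus itself, so linearity gives x = -x + x.
       det (setCol M k (λ _ → (- 1#) * 0# + 0#)) ≈⟨ setCol-linear M k (- 1#) (λ _ → 0#) (λ _ → 0#) ⟩
       - 1# * det (setCol M k (λ _ → 0#)) + det (setCol M k (λ _ → 0#)) ≈⟨ solve 1 (λ x → (:- con (+ 1)) :* x :+ x := con (+ 0)) refl _ ⟩
       0# ∎
       where
       setCol-cong : ∀ i j → setCol M k (λ _ → 0#) i j ≈ setCol M k (λ _ → (- 1#) * 0# + 0#) i j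
       setCol-cong i j with j ≟ k
       ... | yes _ = solve 0 (con (+ 0) := (:- con (+ 1)) :* con (+ 0) :+ con (+ 0)) refl
       ... | no _  = refl
     setCol-sum {m = suc m} M k c u = trans (setCol-linear M k (c zero) (u zero) (λ i → sum (λ j → c (suc j) * u (suc j) i))) (+-congˡ (setCol-sum M k (c ∘ suc) (u ∘ suc)))

   -- By linearity the summand j puts column j in place r, which creates two equal columns unless j
   -- = r. With c r = 1 this pulls a common factor out of a combination of columns without dividing.
   det-setCol-combination : ∀ {n} (M : Mat n) r (c : Fin n → Carrier) →
     det (setCol M r (λ i → sum (λ j → c j * M i j))) ≈ c r * det M
   det-setCol-combination M r c = trans (setCol-sum M r c (λ j i → M i j))
     (trans (sum-single r (λ j j≢r → trans (*-congˡ (det-equalCols r j (j≢r ∘ ≡.sym) (setCol M r (λ a → M a j)) (λ a → reflexive (≡.trans (setCol-at M r _ a) (≡.sym (setCol-other M r _ a j j≢r)))))) (zeroʳ _)))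
            (*-congˡ (det-cong (λ i j → reflexive (setCol-self M r i j)))))

   private
     module ColumnOps {n} (M : Mat (suc n)) (c : Fin (suc n) → Carrier) (c₀ : c zero ≈ 0#) where
       -- Column operations done on the first t columns only. One more column changes the
       -- determinant by a multiple of one in which column 0 occurs twice; as `c zero` vanishes,
       -- column 0 itself stays fixed.
       part : ℕ → Mat (suc n)
       part t i j with toℕ j ℕ.<? t
       ... | yes _ = M i j + c j * M i zero
       ... | no _  = M i j

       part-0 : ∀ i j → part 0 i j ≡ M i j
       part-0 i j with toℕ j ℕ.<? 0
       ... | no _ = ≡.refl

       part-yes : ∀ t i j → toℕ j ℕ.< t → part t i j ≡ M i j + c j * M i zero
       part-yes t i j lt with toℕ j ℕ.<? t
       ... | yes _ = ≡.refl
       ... | no p  = contradiction lt p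

       part-no : ∀ t i j → t ℕ.≤ toℕ j → part t i j ≡ M i j
       part-no t i j le with toℕ j ℕ.<? t
       ... | yes p = contradiction p (ℕ.≤⇒≯ le)
       ... | no _  = ≡.refl

       part-col0 : ∀ t i → part t i zero ≈ M i zero
       part-col0 zero    i = reflexive (part-0 i zero)
       part-col0 (suc t) i = trans (reflexive (part-yes (suc t) i zero (s≤s z≤n)))
         (trans (+-congˡ (trans (*-congʳ c₀) (zeroˡ _))) (+-identityʳ _))

       part-step : ∀ t → t ℕ.< suc n → det (part (suc t)) ≈ det (part t)
       part-step t lt = trans (det-col-linear k (c k) (part (suc t)) N (part t)
           (λ i j p → trans (same i j p) (sym (reflexive (setCol-other (part t) k _ i j p)))) same at)
         (trans (+-congʳ vanish) (+-identityˡ _))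
         where
         k = fromℕ< lt
         k≡ : toℕ k ≡ t
         k≡ = toℕ-fromℕ< lt
         N = setCol (part t) k (λ i → M i zero)
         at : ∀ i → part (suc t) i k ≈ c k * N i k + part t i k
         at i = begin
           part (suc t) i k ≡⟨ part-yes (suc t) i k (s≤s (ℕ.≤-reflexive k≡)) ⟩
           M i k + c k * M i zero ≈⟨ +-comm _ _ ⟩
           c k * M i zero + M i k ≡⟨ ≡.cong₂ (λ x y → c k * x + y) (≡.sym (setCol-at (part t) k _ i)) (≡.sym (part-no t i k (ℕ.≤-reflexive (≡.sym k≡)))) ⟩
           c k * N i k + part t i k ∎
         same : ∀ i j → j ≢ k → part (suc t) i j ≈ part t i j
         same i j j≢k with ℕ.<-cmp (toℕ j) t
         ... | tri< p _ _ = reflexive (≡.trans (part-yes (suc t) i j (ℕ.m≤n⇒m≤1+n p)) (≡.sym (part-yes t i j p)))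
         ... | tri≈ _ p _ = contradiction (toℕ-injective (≡.trans p (≡.sym k≡))) j≢k
         ... | tri> _ _ p = reflexive (≡.trans (part-no (suc t) i j p) (≡.sym (part-no t i j (ℕ.<⇒≤ p))))
         vanish : c k * det N ≈ 0#
         vanish with k ≟ zero
         ... | yes p = trans (*-congʳ (trans (reflexive (≡.cong c p)) c₀)) (zeroˡ _)
         ... | no p  = trans (*-congˡ (det-equalCols k zero p N (λ a → trans (reflexive (setCol-at (part t) k _ a))
                 (sym (trans (reflexive (setCol-other (part t) k _ a zero (p ∘ ≡.sym))) (part-col0 t a)))))) (zeroʳ _)

       part-all : ∀ t → t ℕ.≤ suc n → det (part t) ≈ det M
       part-all zero    _  = det-cong (λ i j → reflexive (part-0 i j))
       part-all (suc t) le = trans (part-step t le) (part-all t (ℕ.<⇒≤ le))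

   schur : ∀ {n} → Carrier → Mat (suc n) → Mat n
   schur p⁻¹ M i j = M (suc i) (suc j) - M (suc i) zero * (p⁻¹ * M zero (suc j))

   -- Subtracting multiples of column 0 clears the rest of the first row, so the expansion along
   -- that row has a single term. The corner only has to be a unit, so no field is involved.
   det-schur : ∀ {n} (M : Mat (suc n)) p⁻¹ → M zero zero * p⁻¹ ≈ 1# → det M ≈ M zero zero * det (schur p⁻¹ M)
   det-schur {n} M p⁻¹ inv = begin
     det M ≈⟨ part-all (suc n) ℕ.≤-refl ⟨
     det (part (suc n)) ≈⟨ +-cong (*-cong (part-col0 (suc n) zero) (det-cong block)) (trans (-‿cong (alt-0 row)) -0#≈0#) ⟩
     M zero zero * det (schur p⁻¹ M) + 0# ≈⟨ +-identityʳ _ ⟩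
     M zero zero * det (schur p⁻¹ M) ∎
     where
     c : Fin (suc n) → Carrier
     c zero    = 0#
     c (suc j) = - (p⁻¹ * M zero (suc j))
     open ColumnOps M c refl
     full : ∀ i j → part (suc n) i j ≡ M i j + c j * M i zero
     full i j = part-yes (suc n) i j (toℕ<n j)
     block : ∀ i j → part (suc n) (suc i) (suc j) ≈ schur p⁻¹ M i j
     block i j = trans (reflexive (full (suc i) (suc j)))
       (solve 3 (λ a b c → a :+ (:- b) :* c := a :- c :* b) refl _ _ _)
     row : ∀ j → part (suc n) zero (suc j) * det (λ a b → part (suc n) (suc a) (punchIn (suc j) b)) ≈ 0#
     row j = trans (*-congʳ (begin
       part (suc n) zero (suc j) ≡⟨ full zero (suc j) ⟩
       M zero (suc j) + (- (p⁻¹ * M zero (suc j))) * M zero zero ≈⟨ solve 3 (λ a b c → a :+ (:- (b :* a)) :* c := a :- a :* (c :* b)) refl _ _ _ ⟩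
       M zero (suc j) - M zero (suc j) * (M zero zero * p⁻¹) ≈⟨ +-congˡ (-‿cong (*-congˡ inv)) ⟩
       M zero (suc j) - M zero (suc j) * 1# ≈⟨ solve 1 (λ a → a :- a :* con (+ 1) := con (+ 0)) refl _ ⟩
       0# ∎)) (zeroˡ _)

   setCol-scale : ∀ {n} (M : Mat n) k c u → det (setCol M k (λ i → c * u i)) ≈ c * det (setCol M k u)
   setCol-scale M k c u = trans (det-cong (λ i j → pad i j)) (trans (setCol-sum {m = 1} M k (λ _ → c) (λ _ → u)) (+-identityʳ _))
     where
     pad : ∀ i j → setCol M k (λ i → c * u i) i j ≈ setCol M k (λ i → c * u i + 0#) i j
     pad i j with j ≟ k
     ... | yes _ = sym (+-identityʳ _)
     ... | no _  = refl

open import Data.Nat.Base as ℕ using (ℕ; zero; suc; z≤n; s≤s)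
open import Data.Integer.Base as ℤ using (ℤ; +_; -[1+_])
open import Data.Bool.Base using (Bool; true; false)
open import Data.Fin.Base as Fin using (Fin)
open import Data.List.Base using (List; []; _∷_; _++_; length)
open import Data.Product using (Σ; _×_; _,_; proj₁; proj₂)
open import Data.Sum using (_⊎_; inj₁; inj₂)
open import Data.Empty using (⊥; ⊥-elim)
open import Function.Base using (_∘_)
open import Data.List.Membership.Propositional using (_∈_)
open import Data.List.Relation.Unary.Any using (here; there)
open import Relation.Binary.PropositionalEquality as ≡ using (_≡_; _≢_; cong; cong₂)
open import Defs using (Graph; adj; b2z; signlessLaplacian; charPoly; QCospectral; DQS; _≅_)
open import Relation.Nullary using (Dec; yes; no; ¬_; contradiction)
import Data.Nat.Properties as ℕ
import Data.Integer.Properties as ℤ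
import Data.Fin.Properties as Fin
import Data.List.Properties as List

-- Calculus in ℤ[[q]]: coefficients, cancellation, the Euler operator and degrees.

module PowerSeries where
 open IntegerCoefficients using (module RingZ)
 open SeriesRing
 open import Level using (0ℓ)
 open import Algebra.Bundles using (CommutativeRing)
 open import Data.Nat.Base using (_≤_; _<_)
 open import Data.Integer.Tactic.RingSolver using (solve-∀)

 -- The ring ℤ[[q]], sealed so that its operations never unfold.
 module Power where
   abstract
     𝕊 : CommutativeRing 0ℓ 0ℓ
     𝕊 = seriesRing

   open CommutativeRing 𝕊 public using (Carrier; _≈_; _+_; _*_; -_; _-_; 0#; 1#; setoid; refl; sym; trans; reflexive)
   module 𝕊 = CommutativeRing 𝕊
   open RingZ 𝕊 public

   abstract
     coeff : Carrier → ℕ → ℤ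
     coeff f = f

     series : (ℕ → ℤ) → Carrier
     series f = f

     tail : Carrier → Carrier
     tail = SeriesOps.tail

     q : Carrier
     q = SeriesOps.X

     inv : Carrier → Carrier
     inv = SeriesProps.inv

     coeff-series : ∀ f n → coeff (series f) n ≡ f n
     coeff-series f n = ≡.refl

     coeff-cong : ∀ {f g} → f ≈ g → ∀ n → coeff f n ≡ coeff g n
     coeff-cong p = p

     coeff-ext : ∀ {f g} → (∀ n → coeff f n ≡ coeff g n) → f ≈ g
     coeff-ext p = p

     coeff-+ : ∀ f g n → coeff (f + g) n ≡ coeff f n ℤ.+ coeff g n
     coeff-+ f g n = ≡.refl

     coeff-neg : ∀ f n → coeff (- f) n ≡ ℤ.- coeff f n
     coeff-neg f n = ≡.refl

     coeff-0 : ∀ n → coeff 0# n ≡ + 0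
     coeff-0 n = ≡.refl

     coeff-1-zero : coeff 1# 0 ≡ + 1
     coeff-1-zero = ≡.refl

     coeff-1-suc : ∀ n → coeff 1# (suc n) ≡ + 0
     coeff-1-suc n = ≡.refl

     coeff-*-zero : ∀ f g → coeff (f * g) 0 ≡ coeff f 0 ℤ.* coeff g 0
     coeff-*-zero f g = ≡.refl

     coeff-*-suc : ∀ f g n → coeff (f * g) (suc n) ≡ coeff f 0 ℤ.* coeff g (suc n) ℤ.+ coeff (tail f * g) n
     coeff-*-suc f g n = ≡.refl

     coeff-tail : ∀ f n → coeff (tail f) n ≡ coeff f (suc n)
     coeff-tail f n = ≡.refl

     coeff-q-zero : coeff q 0 ≡ + 0
     coeff-q-zero = ≡.refl

     inv-inverse : ∀ f → coeff f 0 ≡ + 1 → f * inv f ≈ 1#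
     inv-inverse = SeriesProps.inv-inverse

     inv-cong : ∀ {f g} → f ≈ g → inv f ≈ inv g
     inv-cong {f} {g} = SeriesProps.inv-cong f g

     q*-suc : ∀ f n → coeff (q * f) (suc n) ≡ coeff f n
     q*-suc = SeriesProps.X*-suc

   open import Algebra.Properties.Semiring.Exp 𝕊.semiring public using (_^_; ^-homo-*; ^-congˡ; ^-congʳ)

   q*-zero : ∀ f → coeff (q * f) 0 ≡ + 0
   q*-zero f = ≡.trans (coeff-*-zero q f) (≡.trans (cong (ℤ._* coeff f 0) coeff-q-zero) (ℤ.*-zeroˡ (coeff f 0)))

   q^*-shift : ∀ k f n → coeff (q ^ k * f) (k ℕ.+ n) ≡ coeff f n
   q^*-shift zero    f n = coeff-cong (𝕊.*-identityˡ f) n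
   q^*-shift (suc k) f n = ≡.trans (coeff-cong (𝕊.*-assoc q (q ^ k) f) (suc (k ℕ.+ n)))
     (≡.trans (q*-suc (q ^ k * f) (k ℕ.+ n)) (q^*-shift k f n))

   q^*-low : ∀ k f n → n < k → coeff (q ^ k * f) n ≡ + 0
   q^*-low (suc k) f zero    _       = ≡.trans (coeff-cong (𝕊.*-assoc q (q ^ k) f) 0) (q*-zero (q ^ k * f))
   q^*-low (suc k) f (suc n) (s≤s p) = ≡.trans (coeff-cong (𝕊.*-assoc q (q ^ k) f) (suc n))
     (≡.trans (q*-suc (q ^ k * f) n) (q^*-low k f n p))

   coeff-sub : ∀ f g n → coeff (f - g) n ≡ coeff f n ℤ.- coeff g n
   coeff-sub f g n = ≡.trans (coeff-+ f (- g) n) (cong (λ z → coeff f n ℤ.+ z) (coeff-neg g n))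

   q^-cancel : ∀ k {f g} → q ^ k * f ≈ q ^ k * g → f ≈ g
   q^-cancel k {f} {g} p = coeff-ext (λ n → ≡.trans (≡.sym (q^*-shift k f n)) (≡.trans (coeff-cong p (k ℕ.+ n)) (q^*-shift k g n)))

   unit-cancel : ∀ u → coeff u 0 ≡ + 1 → ∀ {f g} → u * f ≈ u * g → f ≈ g
   unit-cancel u u₀ {f} {g} p = trans (expand f) (trans (𝕊.*-congˡ p) (sym (expand g)))
     where
     expand : ∀ h → h ≈ inv u * (u * h)
     expand h = trans (sym (𝕊.*-identityˡ h)) (trans (𝕊.*-congʳ (sym (inv-inverse u u₀)))
       (solve 3 (λ a b c → (a :* b) :* c := b :* (a :* c)) refl u (inv u) h))

   private
     coeff-ι⁺-zero : ∀ n → coeff (ι (+ n)) 0 ≡ + n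
     coeff-ι⁺-zero zero    = coeff-0 0
     coeff-ι⁺-zero (suc n) = ≡.trans (coeff-cong (ι-+ (+ 1) (+ n)) 0) (≡.trans (coeff-+ (ι (+ 1)) (ι (+ n)) 0)
       (cong₂ ℤ._+_ coeff-1-zero (coeff-ι⁺-zero n)))

     coeff-ι⁺-suc : ∀ n k → coeff (ι (+ n)) (suc k) ≡ + 0
     coeff-ι⁺-suc zero    k = coeff-0 (suc k)
     coeff-ι⁺-suc (suc n) k = ≡.trans (coeff-cong (ι-+ (+ 1) (+ n)) (suc k)) (≡.trans (coeff-+ (ι (+ 1)) (ι (+ n)) (suc k))
       (cong₂ ℤ._+_ (coeff-1-suc k) (coeff-ι⁺-suc n k)))

   coeff-ι-zero : ∀ c → coeff (ι c) 0 ≡ c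
   coeff-ι-zero (+ n)    = coeff-ι⁺-zero n
   coeff-ι-zero -[1+ n ] = ≡.trans (coeff-neg (ι (+ suc n)) 0) (cong ℤ.-_ (coeff-ι⁺-zero (suc n)))

   coeff-ι-suc : ∀ c k → coeff (ι c) (suc k) ≡ + 0
   coeff-ι-suc (+ n)    k = coeff-ι⁺-suc n k
   coeff-ι-suc -[1+ n ] k = ≡.trans (coeff-neg (ι (+ suc n)) (suc k)) (cong ℤ.-_ (coeff-ι⁺-suc (suc n) k))

   coeff-0#* : ∀ g n → coeff (0# * g) n ≡ + 0
   coeff-0#* g n = ≡.trans (coeff-cong (𝕊.zeroˡ g) n) (coeff-0 n)

   coeff-ι* : ∀ c f n → coeff (ι c * f) n ≡ c ℤ.* coeff f n
   coeff-ι* c f zero    = ≡.trans (coeff-*-zero (ι c) f) (cong (ℤ._* coeff f 0) (coeff-ι-zero c))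
   coeff-ι* c f (suc n) = ≡.trans (coeff-*-suc (ι c) f n) (≡.trans
     (cong₂ ℤ._+_ (cong (ℤ._* coeff f (suc n)) (coeff-ι-zero c))
       (≡.trans (coeff-cong (𝕊.*-congʳ (coeff-ext (λ k → ≡.trans (coeff-tail (ι c) k) (≡.trans (coeff-ι-suc c k) (≡.sym (coeff-0 k)))))) n) (coeff-0#* f n)))
     (ℤ.+-identityʳ _))

   -- The Euler operator q·d/dq.
   δ : Carrier → Carrier
   δ f = series (λ n → + n ℤ.* coeff f n)

   coeff-δ : ∀ f n → coeff (δ f) n ≡ + n ℤ.* coeff f n
   coeff-δ f n = coeff-series _ n

   δ-cong : ∀ {f g} → f ≈ g → δ f ≈ δ g
   δ-cong {f} {g} p = coeff-ext (λ n → ≡.trans (coeff-δ f n) (≡.trans (cong (+ n ℤ.*_) (coeff-cong p n)) (≡.sym (coeff-δ g n))))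

   δ-+ : ∀ f g → δ (f + g) ≈ δ f + δ g
   δ-+ f g = coeff-ext (λ n → ≡.trans (coeff-δ (f + g) n) (≡.trans (cong (+ n ℤ.*_) (coeff-+ f g n))
     (≡.trans (ℤ.*-distribˡ-+ (+ n) (coeff f n) (coeff g n))
       (≡.sym (≡.trans (coeff-+ (δ f) (δ g) n) (cong₂ ℤ._+_ (coeff-δ f n) (coeff-δ g n)))))))

   δ-neg : ∀ f → δ (- f) ≈ - δ f
   δ-neg f = coeff-ext (λ n → ≡.trans (coeff-δ (- f) n) (≡.trans (cong (+ n ℤ.*_) (coeff-neg f n))
     (≡.trans (≡.sym (ℤ.neg-distribʳ-* (+ n) (coeff f n)))
       (≡.sym (≡.trans (coeff-neg (δ f) n) (cong ℤ.-_ (coeff-δ f n)))))))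

   δ-ι : ∀ c → δ (ι c) ≈ 0#
   δ-ι c = coeff-ext λ { zero → ≡.trans (coeff-δ (ι c) 0) (≡.trans (ℤ.*-zeroˡ (coeff (ι c) 0)) (≡.sym (coeff-0 0)))
                       ; (suc n) → ≡.trans (coeff-δ (ι c) (suc n)) (≡.trans (cong (+ suc n ℤ.*_) (coeff-ι-suc c n)) (≡.trans (ℤ.*-zeroʳ (+ suc n)) (≡.sym (coeff-0 (suc n))))) }

   private
     -- Dropping the constant term lowers all indices by one, and (n + 1) f(n + 1) = n f(n + 1) +
     -- f(n + 1). This is what the Leibniz rule needs, as the product is defined by recursion on
     -- `tail`.
     tail-δ : ∀ f → tail (δ f) ≈ δ (tail f) + tail f
     tail-δ f = coeff-ext (λ n → ≡.trans (coeff-tail (δ f) n) (≡.trans (coeff-δ f (suc n)) (≡.trans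
       (ℤ.suc-* (+ n) (coeff f (suc n))) (≡.trans (ℤ.+-comm (coeff f (suc n)) (+ n ℤ.* coeff f (suc n)))
         (≡.sym (≡.trans (coeff-+ (δ (tail f)) (tail f) n) (cong₂ ℤ._+_ (≡.trans (coeff-δ (tail f) n) (cong (+ n ℤ.*_) (coeff-tail f n))) (coeff-tail f n))))))))

     coeff-δ-* : ∀ n f g → + n ℤ.* coeff (f * g) n ≡ coeff (δ f * g) n ℤ.+ coeff (f * δ g) n
     coeff-δ-* zero f g = ≡.sym (≡.trans (cong₂ ℤ._+_
        (≡.trans (coeff-*-zero (δ f) g) (cong (ℤ._* coeff g 0) (≡.trans (coeff-δ f 0) (ℤ.*-zeroˡ (coeff f 0)))))
        (≡.trans (coeff-*-zero f (δ g)) (cong (coeff f 0 ℤ.*_) (≡.trans (coeff-δ g 0) (ℤ.*-zeroˡ (coeff g 0))))))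
        (zs (coeff g 0) (coeff f 0) (coeff (f * g) 0)))
       where
       zs : ∀ a b c → + 0 ℤ.* a ℤ.+ b ℤ.* + 0 ≡ + 0 ℤ.* c
       zs = solve-∀
     coeff-δ-* (suc n) f g = begin
       + suc n ℤ.* coeff (f * g) (suc n) ≡⟨ cong (+ suc n ℤ.*_) (coeff-*-suc f g n) ⟩
       + suc n ℤ.* (a ℤ.* b ℤ.+ c) ≡⟨ rearr₁ (+ n) a b c ⟩
       (a ℤ.* (+ suc n ℤ.* b) ℤ.+ c) ℤ.+ + n ℤ.* c ≡⟨ cong (λ z → (a ℤ.* (+ suc n ℤ.* b) ℤ.+ c) ℤ.+ z) (coeff-δ-* n (tail f) g) ⟩
       (a ℤ.* (+ suc n ℤ.* b) ℤ.+ c) ℤ.+ (x ℤ.+ y) ≡⟨ rearr₂ a (+ suc n ℤ.* b) c x y b ⟩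
       (+ 0 ℤ.* b ℤ.+ (x ℤ.+ c)) ℤ.+ (a ℤ.* (+ suc n ℤ.* b) ℤ.+ y) ≡⟨ cong₂ ℤ._+_ left right ⟨
       coeff (δ f * g) (suc n) ℤ.+ coeff (f * δ g) (suc n) ∎
       where
       open ≡.≡-Reasoning
       a = coeff f 0
       b = coeff g (suc n)
       c = coeff (tail f * g) n
       x = coeff (δ (tail f) * g) n
       y = coeff (tail f * δ g) n
       rearr₁ : ∀ n a b c → (+ 1 ℤ.+ n) ℤ.* (a ℤ.* b ℤ.+ c) ≡ (a ℤ.* ((+ 1 ℤ.+ n) ℤ.* b) ℤ.+ c) ℤ.+ n ℤ.* c
       rearr₁ = solve-∀
       rearr₂ : ∀ a b c x y d → (a ℤ.* b ℤ.+ c) ℤ.+ (x ℤ.+ y) ≡ (+ 0 ℤ.* d ℤ.+ (x ℤ.+ c)) ℤ.+ (a ℤ.* b ℤ.+ y)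
       rearr₂ = solve-∀
       left : coeff (δ f * g) (suc n) ≡ + 0 ℤ.* b ℤ.+ (x ℤ.+ c)
       left = ≡.trans (coeff-*-suc (δ f) g n) (cong₂ ℤ._+_ (cong (ℤ._* b) (≡.trans (coeff-δ f 0) (ℤ.*-zeroˡ a)))
         (≡.trans (coeff-cong (trans (𝕊.*-congʳ (tail-δ f)) (𝕊.distribʳ g (δ (tail f)) (tail f))) n) (coeff-+ (δ (tail f) * g) (tail f * g) n)))
       right : coeff (f * δ g) (suc n) ≡ a ℤ.* (+ suc n ℤ.* b) ℤ.+ y
       right = ≡.trans (coeff-*-suc f (δ g) n) (cong (λ z → a ℤ.* z ℤ.+ y) (coeff-δ g (suc n)))

   δ-* : ∀ f g → δ (f * g) ≈ δ f * g + f * δ g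
   δ-* f g = coeff-ext (λ n → ≡.trans (coeff-δ (f * g) n) (≡.trans (coeff-δ-* n f g) (≡.sym (coeff-+ (δ f * g) (f * δ g) n))))

   -- Polynomials are series satisfying this predicate, so that they share one ring with the
   -- inverses that occur during elimination.
   Deg≤ : ℕ → Carrier → Set
   Deg≤ d f = ∀ n → d < n → coeff f n ≡ + 0

   deg-weaken : ∀ {d d′ f} → d ≤ d′ → Deg≤ d f → Deg≤ d′ f
   deg-weaken le p n lt = p n (ℕ.≤-<-trans le lt)

   deg-cong : ∀ {d f g} → f ≈ g → Deg≤ d f → Deg≤ d g
   deg-cong e p n lt = ≡.trans (≡.sym (coeff-cong e n)) (p n lt)

   deg-+ : ∀ {d f g} → Deg≤ d f → Deg≤ d g → Deg≤ d (f + g)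
   deg-+ {f = f} {g} p r n lt = ≡.trans (coeff-+ f g n) (cong₂ ℤ._+_ (p n lt) (r n lt))

   deg-neg : ∀ {d f} → Deg≤ d f → Deg≤ d (- f)
   deg-neg {f = f} p n lt = ≡.trans (coeff-neg f n) (cong ℤ.-_ (p n lt))

   deg-ι : ∀ c → Deg≤ 0 (ι c)
   deg-ι c (suc n) _ = coeff-ι-suc c n

   coeff-*-top : ∀ d d′ f g → Deg≤ d f → Deg≤ d′ g → coeff (f * g) (d ℕ.+ d′) ≡ coeff f d ℤ.* coeff g d′
   deg-* : ∀ {d d′ f g} → Deg≤ d f → Deg≤ d′ g → Deg≤ (d ℕ.+ d′) (f * g)

   private
     deg0-* : ∀ f g → Deg≤ 0 f → ∀ n → coeff (f * g) n ≡ coeff f 0 ℤ.* coeff g n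
     deg0-* f g p zero    = coeff-*-zero f g
     deg0-* f g p (suc n) = ≡.trans (coeff-*-suc f g n) (≡.trans (cong (λ z → coeff f 0 ℤ.* coeff g (suc n) ℤ.+ z)
       (≡.trans (coeff-cong (𝕊.*-congʳ (coeff-ext (λ k → ≡.trans (coeff-tail f k) (≡.trans (p (suc k) (s≤s z≤n)) (≡.sym (coeff-0 k)))))) n) (coeff-0#* g n)))
       (ℤ.+-identityʳ _))

     deg-tail : ∀ {d f} → Deg≤ (suc d) f → Deg≤ d (tail f)
     deg-tail {f = f} p n lt = ≡.trans (coeff-tail f n) (p (suc n) (s≤s lt))

   deg-* {zero}  {d′} {f} {g} p r n lt = ≡.trans (deg0-* f g p n) (≡.trans (cong (coeff f 0 ℤ.*_) (r n lt)) (ℤ.*-zeroʳ (coeff f 0)))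
   deg-* {suc d} {d′} {f} {g} p r (suc n) (s≤s lt) = ≡.trans (coeff-*-suc f g n) (cong₂ ℤ._+_
     (≡.trans (cong (coeff f 0 ℤ.*_) (r (suc n) (ℕ.≤-<-trans (ℕ.m≤n+m d′ d) (ℕ.m≤n⇒m≤1+n lt)))) (ℤ.*-zeroʳ (coeff f 0)))
     (deg-* (deg-tail p) r n lt))

   coeff-*-top zero    d′ f g p r = deg0-* f g p d′
   coeff-*-top (suc d) d′ f g p r = ≡.trans (coeff-*-suc f g (d ℕ.+ d′)) (≡.trans (cong₂ ℤ._+_
     (≡.trans (cong (coeff f 0 ℤ.*_) (r (suc (d ℕ.+ d′)) (s≤s (ℕ.m≤n+m d′ d)))) (ℤ.*-zeroʳ (coeff f 0)))
     (≡.trans (coeff-*-top d d′ (tail f) g (deg-tail p) r) (cong (ℤ._* coeff g d′) (coeff-tail f d))))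
     (ℤ.+-identityˡ _))

-- The determinant of aA + bB as a form with integer coefficients.

module BinaryForms where
 open IntegerCoefficients using (module RingZ)
 open Determinant using (module Det)
 open import Algebra.Bundles using (CommutativeRing)
 open import Level using (0ℓ)
 open import Data.Integer.Tactic.RingSolver using (solve-∀)
 open import Data.Fin.Base using (zero; suc; punchIn)
 open import Data.Vec.Base using (Vec; []; _∷_; zipWith; map)

 ℤ-ring : CommutativeRing 0ℓ 0ℓ
 ℤ-ring = ℤ.+-*-commutativeRing

 module DZ = Det ℤ-ring

 -- A vector c₀ ∷ … ∷ cₙ ∷ [] stands for the binary form Σ cₖ aᵏ bⁿ⁻ᵏ.
 Form : ℕ → Set
 Form n = Vec ℤ (suc n)

 timesB : ∀ {n} → Form n → Form (suc n)
 timesB {zero}  (c ∷ [])     = c ∷ + 0 ∷ []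
 timesB {suc n} (c ∷ cs)     = c ∷ timesB cs

 timesLinear : ∀ {n} → ℤ → ℤ → Form n → Form (suc n)
 timesLinear α β p = zipWith ℤ._+_ (map (α ℤ.*_) (+ 0 ∷ p)) (map (β ℤ.*_) (timesB p))

 altForm : ∀ {n} m → (Fin m → Form n) → Form n
 altForm {n} zero f = Data.Vec.Base.replicate (suc n) (+ 0)
 altForm (suc m) f = zipWith ℤ._-_ (f zero) (altForm m (λ j → f (suc j)))

 -- The row expansion of det (aA + bB), carried out on coefficient vectors. One integer vector can
 -- then be evaluated in every commutative ring, by `eval-detForm`.
 detForm : ∀ {n} → (Fin n → Fin n → ℤ) → (Fin n → Fin n → ℤ) → Form n
 detForm {zero}  A B = + 1 ∷ []
 detForm {suc n} A B = altForm (suc n) (λ j → timesLinear (A zero j) (B zero j)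
   (detForm (λ i k → A (suc i) (punchIn j k)) (λ i k → B (suc i) (punchIn j k))))

 module Evaluation (R : CommutativeRing 0ℓ 0ℓ) where
   open CommutativeRing R renaming (zero to *-zero)
   open RingZ R
   open Det R using (det; alt-cong; alt)
   open import Relation.Binary.Reasoning.Setoid setoid
   open import Algebra.Properties.Semiring.Exp semiring public using (_^_)

   module _ (a b : Carrier) where
     eval : ∀ {n} → Form n → Carrier
     eval {zero}  (c ∷ []) = ι c
     eval {suc n} (c ∷ cs) = ι c * b ^ suc n + a * eval cs

     eval-timesB : ∀ {n} (p : Form n) → eval (timesB p) ≈ b * eval p
     eval-timesB {zero}  (c ∷ []) = solve 3 (λ c a b → c :* (b :* con (+ 1)) :+ a :* con (+ 0) := b :* c) refl (ι c) a b
     eval-timesB {suc n} (c ∷ cs) = trans (+-congˡ (*-congˡ (eval-timesB cs)))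
       (solve 5 (λ c a b x y → c :* (b :* x) :+ a :* (b :* y) := b :* (c :* x :+ a :* y)) refl (ι c) a b (b ^ suc n) (eval cs))

     eval-scale : ∀ {n} α (p : Form n) → eval (map (α ℤ.*_) p) ≈ ι α * eval p
     eval-scale {zero}  α (c ∷ []) = ι-* α c
     eval-scale {suc n} α (c ∷ cs) = trans (+-cong (*-congʳ (ι-* α c)) (*-congˡ (eval-scale α cs)))
       (solve 5 (λ α c a x y → (α :* c) :* x :+ a :* (α :* y) := α :* (c :* x :+ a :* y)) refl (ι α) (ι c) a (b ^ suc n) (eval cs))

     eval-+ : ∀ {n} (p r : Form n) → eval (zipWith ℤ._+_ p r) ≈ eval p + eval r
     eval-+ {zero}  (c ∷ []) (d ∷ []) = ι-+ c d
     eval-+ {suc n} (c ∷ cs) (d ∷ ds) = trans (+-cong (*-congʳ (ι-+ c d)) (*-congˡ (eval-+ cs ds)))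
       (solve 6 (λ c d a x y z → (c :+ d) :* x :+ a :* (y :+ z) := (c :* x :+ a :* y) :+ (d :* x :+ a :* z)) refl (ι c) (ι d) a (b ^ suc n) (eval cs) (eval ds))

     ι-sub : ∀ c d → ι (c ℤ.- d) ≈ ι c - ι d
     ι-sub c d = trans (ι-+ c (ℤ.- d)) (+-congˡ (ι-neg d))

     eval-- : ∀ {n} (p r : Form n) → eval (zipWith ℤ._-_ p r) ≈ eval p - eval r
     eval-- {zero}  (c ∷ []) (d ∷ []) = ι-sub c d
     eval-- {suc n} (c ∷ cs) (d ∷ ds) = trans (+-cong (*-congʳ (ι-sub c d)) (*-congˡ (eval-- cs ds)))
       (solve 6 (λ c d a x y z → (c :- d) :* x :+ a :* (y :- z) := (c :* x :+ a :* y) :- (d :* x :+ a :* z)) refl (ι c) (ι d) a (b ^ suc n) (eval cs) (eval ds))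

     eval-0 : ∀ n → eval (Data.Vec.Base.replicate (suc n) (+ 0)) ≈ 0#
     eval-0 zero    = refl
     eval-0 (suc n) = trans (+-congˡ (*-congˡ (eval-0 n))) (solve 2 (λ a x → con (+ 0) :* x :+ a :* con (+ 0) := con (+ 0)) refl a (b ^ suc n))

     eval-alt : ∀ {n} m (f : Fin m → Form n) → eval (altForm m f) ≈ alt (λ j → eval (f j))
     eval-alt {n} zero f = eval-0 n
     eval-alt (suc m) f  = trans (eval-- (f zero) (altForm m (λ j → f (suc j)))) (+-congˡ (-‿cong (eval-alt m (λ j → f (suc j)))))

     eval-timesLinear : ∀ {n} α β (p : Form n) → eval (timesLinear α β p) ≈ (ι α * a + ι β * b) * eval p
     eval-timesLinear {n} α β p = begin
       eval (timesLinear α β p) ≈⟨ eval-+ (map (α ℤ.*_) (+ 0 ∷ p)) (map (β ℤ.*_) (timesB p)) ⟩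
       eval (map (α ℤ.*_) (+ 0 ∷ p)) + eval (map (β ℤ.*_) (timesB p)) ≈⟨ +-cong (eval-scale α (+ 0 ∷ p)) (trans (eval-scale β (timesB p)) (*-congˡ (eval-timesB p))) ⟩
       ι α * (0# * b ^ suc n + a * eval p) + ι β * (b * eval p) ≈⟨ solve 6 (λ α β a b x y → α :* (con (+ 0) :* x :+ a :* y) :+ β :* (b :* y) := (α :* a :+ β :* b) :* y) refl (ι α) (ι β) a b (b ^ suc n) (eval p) ⟩
       (ι α * a + ι β * b) * eval p ∎

     eval-detForm : ∀ {n} (A B : Fin n → Fin n → ℤ) → eval (detForm A B) ≈ det (λ i j → ι (A i j) * a + ι (B i j) * b)
     eval-detForm {zero}  A B = refl
     eval-detForm {suc n} A B = trans (eval-alt (suc n) (λ j → timesLinear (A zero j) (B zero j) (minor j)))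
       (alt-cong (λ j → trans (eval-timesLinear (A zero j) (B zero j) (minor j))
         (*-congˡ {ι (A zero j) * a + ι (B zero j) * b} (eval-detForm (λ i k → A (suc i) (punchIn j k)) (λ i k → B (suc i) (punchIn j k))))))
       where
       minor : Fin (suc n) → Form n
       minor j = detForm (λ i k → A (suc i) (punchIn j k)) (λ i k → B (suc i) (punchIn j k))

 private
   module EZ = Evaluation ℤ-ring
   module RZ = RingZ ℤ-ring

   ι-id⁺ : ∀ n → RZ.ι (+ n) ≡ + n
   ι-id⁺ zero    = ≡.refl
   ι-id⁺ (suc n) = ≡.trans (RZ.ι-+ (+ 1) (+ n)) (cong (λ z → + 1 ℤ.+ z) (ι-id⁺ n))

   ι-id : ∀ i → RZ.ι i ≡ i
   ι-id (+ n)    = ι-id⁺ n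
   ι-id -[1+ n ] = cong ℤ.-_ (ι-id⁺ (suc n))

   altSum≡alt : ∀ {n} {f g : Fin n → ℤ} → (∀ i → f i ≡ g i) → Defs.altSum f ≡ DZ.alt g
   altSum≡alt {zero}  p = ≡.refl
   altSum≡alt {suc n} p = cong₂ ℤ._-_ (p zero) (altSum≡alt (λ i → p (suc i)))

 det≡ : ∀ {n} {M N : Fin n → Fin n → ℤ} → (∀ i j → M i j ≡ N i j) → Defs.det M ≡ DZ.det N
 det≡ {zero}  p = ≡.refl
 det≡ {suc n} p = altSum≡alt (λ j → cong₂ ℤ._*_ (p zero j) (det≡ (λ i k → p (suc i) (punchIn j k))))

 private
   horner : ∀ {n} → Vec ℤ n → ℤ → ℤ
   horner []       x = + 0
   horner (c ∷ cs) x = c ℤ.+ x ℤ.* horner cs x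

   horner-sub : ∀ {n} (c d : Vec ℤ n) x → horner (zipWith ℤ._-_ c d) x ≡ horner c x ℤ.- horner d x
   horner-sub []       []       x = ≡.refl
   horner-sub (c ∷ cs) (d ∷ ds) x = ≡.trans (cong (λ z → (c ℤ.- d) ℤ.+ x ℤ.* z) (horner-sub cs ds x)) (rearr c d x (horner cs x) (horner ds x))
     where
     rearr : ∀ c d x y z → (c ℤ.- d) ℤ.+ x ℤ.* (y ℤ.- z) ≡ (c ℤ.+ x ℤ.* y) ℤ.- (d ℤ.+ x ℤ.* z)
     rearr = solve-∀

   -- Divide by x = |c| + 1, which exceeds |c|.
   constantTerm≡0 : ∀ c r → c ℤ.+ + suc ℤ.∣ c ∣ ℤ.* r ≡ + 0 → c ≡ + 0
   constantTerm≡0 c r e = byCases ℤ.∣ r ∣ ≡.refl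
     where
     c≡ : c ≡ ℤ.- (+ suc ℤ.∣ c ∣ ℤ.* r)
     c≡ = ≡.trans (isolate c (+ suc ℤ.∣ c ∣ ℤ.* r)) (≡.trans (cong (ℤ._- + suc ℤ.∣ c ∣ ℤ.* r) e) (ℤ.+-identityˡ _))
       where
       isolate : ∀ a b → a ≡ (a ℤ.+ b) ℤ.- b
       isolate = solve-∀
     byCases : ∀ k → ℤ.∣ r ∣ ≡ k → c ≡ + 0
     byCases zero ∣r∣≡0 = ≡.trans c≡ (cong ℤ.-_ (≡.trans (cong (+ suc ℤ.∣ c ∣ ℤ.*_) (ℤ.∣i∣≡0⇒i≡0 {r} ∣r∣≡0)) (ℤ.*-zeroʳ (+ suc ℤ.∣ c ∣))))
     byCases (suc k) ∣r∣≡ = contradiction (ℕ.≤-trans (ℕ.m≤m*n (suc ℤ.∣ c ∣) (suc k)) (ℕ.≤-reflexive size)) (ℕ.<-irrefl ≡.refl)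
       where
       size : suc ℤ.∣ c ∣ ℕ.* suc k ≡ ℤ.∣ c ∣
       size = ≡.sym (≡.trans (cong ℤ.∣_∣ c≡) (≡.trans (ℤ.∣-i∣≡∣i∣ (+ suc ℤ.∣ c ∣ ℤ.* r)) (≡.trans (ℤ.abs-* (+ suc ℤ.∣ c ∣) r) (cong (suc ℤ.∣ c ∣ ℕ.*_) ∣r∣≡))))

   -- One suitable positive argument kills the constant term of the difference; then every positive
   -- argument may be cancelled and the remaining coefficients follow in the same way.
   horner-≡ : ∀ {n} (c d : Vec ℤ n) → (∀ m → horner (zipWith ℤ._-_ c d) (+ suc m) ≡ + 0) → c ≡ d
   horner-≡ []       []       h = ≡.refl
   horner-≡ (c ∷ cs) (d ∷ ds) h = cong₂ _∷_ (ℤ.i-j≡0⇒i≡j c d c-d≡0) (horner-≡ cs ds rest)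
     where
     c-d≡0 : c ℤ.- d ≡ + 0
     c-d≡0 = constantTerm≡0 (c ℤ.- d) _ (h ℤ.∣ c ℤ.- d ∣)
     rest : ∀ m → horner (zipWith ℤ._-_ cs ds) (+ suc m) ≡ + 0
     rest m = ℤ.*-cancelˡ-≡ (+ suc m) _ (+ 0) (≡.trans (≡.trans (≡.sym (ℤ.+-identityˡ _)) (≡.trans (cong (ℤ._+ + suc m ℤ.* horner (zipWith ℤ._-_ cs ds) (+ suc m)) (≡.sym c-d≡0)) (h m))) (≡.sym (ℤ.*-zeroʳ (+ suc m))))

   1^n : ∀ n → (+ 1) EZ.^ n ≡ + 1
   1^n zero    = ≡.refl
   1^n (suc n) = ≡.trans (ℤ.*-identityˡ _) (1^n n)

   eval≡horner : ∀ {n} (p : Form n) x → EZ.eval x (+ 1) p ≡ horner p x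
   eval≡horner {zero}  (c ∷ []) x = ≡.trans (ι-id c) (≡.trans (≡.sym (ℤ.+-identityʳ c)) (cong (λ z → c ℤ.+ z) (≡.sym (ℤ.*-zeroʳ x))))
   eval≡horner {suc n} (c ∷ cs) x = cong₂ ℤ._+_ (≡.trans (cong₂ ℤ._*_ (ι-id c) (1^n (suc n))) (ℤ.*-identityʳ c)) (cong (x ℤ.*_) (eval≡horner cs x))

 charForm : ∀ {n} → (Fin n → Fin n → ℤ) → Form n
 charForm M = detForm Defs.δ (λ i j → ℤ.- M i j)

 private
   charPoly≡eval : ∀ {n} (M : Fin n → Fin n → ℤ) x → Defs.charPoly M x ≡ EZ.eval x (+ 1) (charForm M)
   charPoly≡eval M x = ≡.trans (det≡ (λ i j → entry i j)) (≡.sym (EZ.eval-detForm x (+ 1) Defs.δ (λ i j → ℤ.- M i j)))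
     where
     entry : ∀ i j → x ℤ.* Defs.δ i j ℤ.- M i j ≡ RZ.ι (Defs.δ i j) ℤ.* x ℤ.+ RZ.ι (ℤ.- M i j) ℤ.* + 1
     entry i j = cong₂ ℤ._+_ (≡.trans (ℤ.*-comm x (Defs.δ i j)) (cong (ℤ._* x) (≡.sym (ι-id (Defs.δ i j)))))
                           (≡.trans (≡.sym (ι-id (ℤ.- M i j))) (≡.sym (ℤ.*-identityʳ _)))

 -- This turns agreement of values at integers into equality of coefficients; afterwards the forms
 -- may be evaluated outside ℤ.
 charForm-unique : ∀ {n} (M N : Fin n → Fin n → ℤ) → (∀ x → Defs.charPoly M x ≡ Defs.charPoly N x) → charForm M ≡ charForm N
 charForm-unique M N h = horner-≡ (charForm M) (charForm N) (λ m → ≡.trans (horner-sub (charForm M) (charForm N) (+ suc m))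
   (ℤ.i≡j⇒i-j≡0 (≡.trans (value M (+ suc m)) (≡.trans (h (+ suc m)) (≡.sym (value N (+ suc m)))))))
   where
   value : ∀ M x → horner (charForm M) x ≡ Defs.charPoly M x
   value M x = ≡.trans (≡.sym (eval≡horner (charForm M) x)) (≡.sym (charPoly≡eval M x))

-- Gaussian elimination indexed by lists of vertices.

module Elimination where
 open PowerSeries using (module Power)
 open Determinant using (module Det)
 open import Data.Fin.Base using (zero; suc)
 open import Data.List.Base using (tabulate)
 open import Data.List.Relation.Unary.All using (All; []; _∷_)
 import Data.List.Relation.Unary.All as All
 open import Data.List.Relation.Unary.AllPairs using ([]; _∷_)
 open import Data.List.Relation.Unary.Unique.Propositional using (Unique)
 open import Data.List.Relation.Binary.Permutation.Propositional as Perm using (_↭_; prep; swap)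
 open import Data.List.Relation.Binary.Permutation.Propositional.Properties using (∈-resp-↭)
 import Data.List.Relation.Binary.Permutation.Setoid.Properties as PermS

 open Power
 module DS = Det 𝕊
 open DS using (det)
 open import Relation.Binary.Reasoning.Setoid setoid

 private variable
   V : Set

 eliminate : (V → V → Carrier) → V → V → V → Carrier
 eliminate M x i j = M i j - M i x * (inv (M x x) * M x j)

 -- The determinant as the product of successive pivots. Rows and columns are labelled by a list
 -- over an arbitrary type, so that vertices can be reordered and eliminated in a convenient order.
 pivots : (V → V → Carrier) → List V → Carrier
 pivots M []       = 1#
 pivots M (x ∷ xs) = M x x * pivots (eliminate M x) xs

 -- Congruence to the identity modulo q. Elimination preserves it, so every pivot that ever occurs
 -- has constant term 1 and is inverted by `inv`.
 record Unital {V : Set} (M : V → V → Carrier) (xs : List V) : Set where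
   constructor unital
   field
     diag : ∀ {i} → i ∈ xs → coeff (M i i) 0 ≡ + 1
     off  : ∀ {i j} → i ∈ xs → j ∈ xs → i ≢ j → coeff (M i j) 0 ≡ + 0
 open Unital

 coeff₀-*0 : ∀ f g → coeff f 0 ≡ + 0 → coeff (f * g) 0 ≡ + 0
 coeff₀-*0 f g e = ≡.trans (coeff-*-zero f g) (≡.trans (cong (ℤ._* coeff g 0) e) (ℤ.*-zeroˡ (coeff g 0)))

 coeff₀-minus0 : ∀ f g {c} → coeff f 0 ≡ c → coeff g 0 ≡ + 0 → coeff (f - g) 0 ≡ c
 coeff₀-minus0 f g {c} p r = ≡.trans (coeff-sub f g 0) (≡.trans (cong₂ ℤ._-_ p r) (ℤ.+-identityʳ c))

 head∉tail : ∀ {x : V} {xs} → Unique (x ∷ xs) → ∀ {i} → i ∈ xs → i ≢ x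
 head∉tail (x∉ ∷ _) i∈ i≡x = All.lookup x∉ i∈ (≡.sym i≡x)

 unital-eliminate : ∀ {M : V → V → Carrier} {x xs} → Unique (x ∷ xs) → Unital M (x ∷ xs) → Unital (eliminate M x) xs
 unital-eliminate {M = M} {x} u U = unital
   (λ {i} i∈ → coeff₀-minus0 _ _ (diag U (there i∈)) (coeff₀-*0 _ _ (off U (there i∈) (here ≡.refl) (head∉tail u i∈))))
   (λ {i} {j} i∈ j∈ i≢j → coeff₀-minus0 _ _ (off U (there i∈) (there j∈) i≢j) (coeff₀-*0 _ _ (off U (there i∈) (here ≡.refl) (head∉tail u i∈))))

 eliminate-cong : ∀ {M N : V → V → Carrier} → (∀ i j → M i j ≈ N i j) → ∀ x i j → eliminate M x i j ≈ eliminate N x i j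
 eliminate-cong e x i j = 𝕊.+-cong (e i j) (𝕊.-‿cong (𝕊.*-cong (e i x) (𝕊.*-cong (inv-cong (e x x)) (e x j))))

 pivots-cong : ∀ {M N : V → V → Carrier} → (∀ i j → M i j ≈ N i j) → ∀ xs → pivots M xs ≈ pivots N xs
 pivots-cong e []       = refl
 pivots-cong e (x ∷ xs) = 𝕊.*-cong (e x x) (pivots-cong (eliminate-cong e x) xs)

 -- Equality on the listed vertices is enough. This is the form required when a contracted matrix
 -- matches its closed formula only on the vertices that remain.
 pivots-cong-∈ : ∀ {M N : V → V → Carrier} xs → (∀ {i j} → i ∈ xs → j ∈ xs → M i j ≈ N i j) → pivots M xs ≈ pivots N xs
 pivots-cong-∈ []       e = refl
 pivots-cong-∈ (x ∷ xs) e = 𝕊.*-cong (e (here ≡.refl) (here ≡.refl)) (pivots-cong-∈ xs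
   (λ i∈ j∈ → 𝕊.+-cong (e (there i∈) (there j∈)) (𝕊.-‿cong (𝕊.*-cong (e (there i∈) (here ≡.refl))
     (𝕊.*-cong (inv-cong (e (here ≡.refl) (here ≡.refl))) (e (here ≡.refl) (there j∈)))))))

 inverse-unique : ∀ f {g h} → f * g ≈ 1# → f * h ≈ 1# → g ≈ h
 inverse-unique f {g} {h} p r = begin
   g ≈⟨ 𝕊.*-identityʳ g ⟨
   g * 1# ≈⟨ 𝕊.*-congˡ r ⟨
   g * (f * h) ≈⟨ solve 3 (λ g f h → g :* (f :* h) := (f :* g) :* h) refl g f h ⟩
   (f * g) * h ≈⟨ 𝕊.*-congʳ p ⟩
   1# * h ≈⟨ 𝕊.*-identityˡ h ⟩
   h ∎

 -- Eliminating x and then y is a Schur complement for the 2 × 2 block (p a; b s), hence symmetric in x and y.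
 private
   module TwoSteps (M : V → V → Carrier) (x y : V)
     (dx : coeff (M x x) 0 ≡ + 1) (dy : coeff (M y y) 0 ≡ + 1)
     (ox : coeff (M x y) 0 ≡ + 0) (oy : coeff (M y x) 0 ≡ + 0) where
     p = M x x
     s = M y y
     a = M x y
     b = M y x
     u = inv p
     Δ = p * s - b * a
     D = inv Δ
     pu : p * u ≈ 1#
     pu = inv-inverse p dx
     Δ₀ : coeff Δ 0 ≡ + 1
     Δ₀ = coeff₀-minus0 (p * s) (b * a) (≡.trans (coeff-*-zero p s) (cong₂ ℤ._*_ dx dy)) (coeff₀-*0 b a oy)
     ΔD : Δ * D ≈ 1#
     ΔD = inv-inverse Δ Δ₀
     P = eliminate M x y y
     P₀ : coeff P 0 ≡ + 1
     P₀ = coeff₀-minus0 s (b * (u * a)) dy (coeff₀-*0 b (u * a) oy)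
     pP : p * P ≈ Δ
     pP = begin
       p * (s - b * (u * a)) ≈⟨ solve 5 (λ p s b u a → p :* (s :- b :* (u :* a)) := p :* s :- (p :* u) :* (b :* a)) refl p s b u a ⟩
       p * s - (p * u) * (b * a) ≈⟨ 𝕊.+-congˡ (𝕊.-‿cong (trans (𝕊.*-congʳ pu) (𝕊.*-identityˡ (b * a)))) ⟩
       Δ ∎
     invP : inv P ≈ p * D
     invP = inverse-unique P (inv-inverse P P₀) (begin
       P * (p * D) ≈⟨ solve 3 (λ P p D → P :* (p :* D) := (p :* P) :* D) refl P p D ⟩
       (p * P) * D ≈⟨ 𝕊.*-congʳ pP ⟩
       Δ * D ≈⟨ ΔD ⟩
       1# ∎)

     twoSteps : ∀ i j → eliminate (eliminate M x) y i j ≈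
       M i j - D * ((s * (M i x * M x j) + p * (M i y * M y j)) - (b * (M i y * M x j) + a * (M i x * M y j)))
     twoSteps i j = begin
       (m - ix * (u * xj)) - (iy - ix * (u * a)) * (inv P * (yj - b * (u * xj)))
         ≈⟨ 𝕊.+-congˡ (𝕊.-‿cong (𝕊.*-congˡ (𝕊.*-congʳ invP))) ⟩
       (m - ix * (u * xj)) - (iy - ix * (u * a)) * ((p * D) * (yj - b * (u * xj)))
         ≈⟨ solve 10 (λ m ix u xj iy a p D yj b →
              (m :- ix :* (u :* xj)) :- (iy :- ix :* (u :* a)) :* ((p :* D) :* (yj :- b :* (u :* xj)))
              := (m :- ix :* (u :* xj)) :- D :* ((p :* (iy :* yj) :- (p :* u) :* (b :* (iy :* xj) :+ a :* (ix :* yj)) ) :+ (p :* u) :* (u :* (a :* b) :* (ix :* xj))))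
              refl m ix u xj iy a p D yj b ⟩
       (m - ix * (u * xj)) - D * ((p * (iy * yj) - (p * u) * (b * (iy * xj) + a * (ix * yj))) + (p * u) * (u * (a * b) * (ix * xj)))
         ≈⟨ 𝕊.+-congˡ (𝕊.-‿cong (𝕊.*-congˡ (𝕊.+-cong (𝕊.+-congˡ (𝕊.-‿cong (trans (𝕊.*-congʳ pu) (𝕊.*-identityˡ (b * (iy * xj) + a * (ix * yj)))))) (trans (𝕊.*-congʳ pu) (𝕊.*-identityˡ (u * (a * b) * (ix * xj))))))) ⟩
       (m - ix * (u * xj)) - D * ((p * (iy * yj) - (b * (iy * xj) + a * (ix * yj))) + u * (a * b) * (ix * xj))
         ≈⟨ solve 7 (λ m ix xj u D r ab → (m :- ix :* (u :* xj)) :- D :* (r :+ u :* ab :* (ix :* xj)) := m :- D :* r :- (u :* (ix :* xj) :+ D :* (u :* ab :* (ix :* xj)))) refl m ix xj u D (p * (iy * yj) - (b * (iy * xj) + a * (ix * yj))) (a * b) ⟩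
       m - D * (p * (iy * yj) - (b * (iy * xj) + a * (ix * yj))) - (u * (ix * xj) + D * (u * (a * b) * (ix * xj)))
         ≈⟨ 𝕊.+-congˡ (𝕊.-‿cong corner) ⟩
       m - D * (p * (iy * yj) - (b * (iy * xj) + a * (ix * yj))) - D * (s * (ix * xj))
         ≈⟨ solve 5 (λ m D r t z → m :- D :* (r :- t) :- D :* z := m :- D :* ((z :+ r) :- t)) refl m D (p * (iy * yj)) (b * (iy * xj) + a * (ix * yj)) (s * (ix * xj)) ⟩
       m - D * ((s * (ix * xj) + p * (iy * yj)) - (b * (iy * xj) + a * (ix * yj))) ∎
       where
       m = M i j
       ix = M i x
       iy = M i y
       xj = M x j
       yj = M y j
       corner : u * (ix * xj) + D * (u * (a * b) * (ix * xj)) ≈ D * (s * (ix * xj))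
       corner = begin
         u * (ix * xj) + D * (u * (a * b) * (ix * xj)) ≈⟨ 𝕊.+-congʳ (trans (sym (𝕊.*-identityˡ (u * (ix * xj)))) (𝕊.*-congʳ (sym ΔD))) ⟩
         (Δ * D) * (u * (ix * xj)) + D * (u * (a * b) * (ix * xj)) ≈⟨ solve 7 (λ p s a b D u z → ((p :* s :- b :* a) :* D) :* (u :* z) :+ D :* (u :* (a :* b) :* z) := (p :* u) :* (D :* (s :* z))) refl p s a b D u (ix * xj) ⟩
         (p * u) * (D * (s * (ix * xj))) ≈⟨ trans (𝕊.*-congʳ pu) (𝕊.*-identityˡ _) ⟩
         D * (s * (ix * xj)) ∎

   eliminate-comm : ∀ (M : V → V → Carrier) x y →
     coeff (M x x) 0 ≡ + 1 → coeff (M y y) 0 ≡ + 1 → coeff (M x y) 0 ≡ + 0 → coeff (M y x) 0 ≡ + 0 →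
     ∀ i j → eliminate (eliminate M x) y i j ≈ eliminate (eliminate M y) x i j
   eliminate-comm M x y dx dy ox oy i j = begin
     eliminate (eliminate M x) y i j ≈⟨ A.twoSteps i j ⟩
     M i j - A.D * ((A.s * (M i x * M x j) + A.p * (M i y * M y j)) - (A.b * (M i y * M x j) + A.a * (M i x * M y j)))
       ≈⟨ 𝕊.+-congˡ (𝕊.-‿cong (𝕊.*-cong (inv-cong (solve 4 (λ p s a b → p :* s :- b :* a := s :* p :- a :* b) refl A.p A.s A.a A.b))
            (solve 4 (λ a b c d → (a :+ b) :- (c :+ d) := (b :+ a) :- (d :+ c)) refl _ _ _ _))) ⟩
     M i j - B.D * ((B.s * (M i y * M y j) + B.p * (M i x * M x j)) - (B.b * (M i x * M y j) + B.a * (M i y * M x j)))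
       ≈⟨ B.twoSteps i j ⟨
     eliminate (eliminate M y) x i j ∎
     where
     module A = TwoSteps M x y dx dy ox oy
     module B = TwoSteps M y x dy dx oy ox

   -- Both products are the 2 × 2 minor on x and y.
   pivots-swap : ∀ (M : V → V → Carrier) x y →
     coeff (M x x) 0 ≡ + 1 → coeff (M y y) 0 ≡ + 1 → coeff (M x y) 0 ≡ + 0 → coeff (M y x) 0 ≡ + 0 →
     M x x * eliminate M x y y ≈ M y y * eliminate M y x x
   pivots-swap M x y dx dy ox oy = trans A.pP (trans (solve 4 (λ p s a b → p :* s :- b :* a := s :* p :- a :* b) refl A.p A.s A.a A.b) (sym B.pP))
     where
     module A = TwoSteps M x y dx dy ox oy
     module B = TwoSteps M y x dy dx oy ox

 unique-↭ : ∀ {xs ys : List V} → xs ↭ ys → Unique xs → Unique ys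
 unique-↭ p = PermS.Unique-resp-↭ (≡.setoid _) (Perm.↭⇒↭ₛ p)

 unital-↭ : ∀ {M : V → V → Carrier} {xs ys} → xs ↭ ys → Unital M xs → Unital M ys
 unital-↭ p U = unital (λ i∈ → diag U (∈-resp-↭ (Perm.↭-sym p) i∈))
                       (λ i∈ j∈ → off U (∈-resp-↭ (Perm.↭-sym p) i∈) (∈-resp-↭ (Perm.↭-sym p) j∈))

 -- Rows and columns are permuted together, so no signs occur. The only case with content is the
 -- swap of the first two vertices, settled by the symmetry of their joint Schur complement.
 pivots-↭ : ∀ {M : V → V → Carrier} {xs ys} → xs ↭ ys → Unique xs → Unital M xs → pivots M xs ≈ pivots M ys
 pivots-↭ Perm.refl uq U = refl
 pivots-↭ (prep x p) uq@(_ ∷ uq′) U = 𝕊.*-congˡ (pivots-↭ p uq′ (unital-eliminate uq U))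
 pivots-↭ {M = M} {xs = _ ∷ _ ∷ xs} {ys = _ ∷ _ ∷ ys} (swap x y p) uq@((x≢y ∷ _) ∷ uq′@(_ ∷ uq″)) U = begin
   M x x * (eliminate M x y y * pivots (eliminate (eliminate M x) y) xs) ≈⟨ 𝕊.*-assoc _ _ _ ⟨
   (M x x * eliminate M x y y) * pivots (eliminate (eliminate M x) y) xs
     ≈⟨ 𝕊.*-cong (pivots-swap M x y dx dy ox oy) (trans (pivots-↭ p uq″ (unital-eliminate uq′ (unital-eliminate uq U)))
          (pivots-cong (eliminate-comm M x y dx dy ox oy) ys)) ⟩
   (M y y * eliminate M y x x) * pivots (eliminate (eliminate M y) x) ys ≈⟨ 𝕊.*-assoc _ _ _ ⟩
   M y y * (eliminate M y x x * pivots (eliminate (eliminate M y) x) ys) ∎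
   where
   dx = diag U (here ≡.refl)
   dy = diag U (there (here ≡.refl))
   ox = off U (here ≡.refl) (there (here ≡.refl)) x≢y
   oy = off U (there (here ≡.refl)) (here ≡.refl) (x≢y ∘ ≡.sym)
 pivots-↭ (Perm.trans p r) uq U = trans (pivots-↭ p uq U) (pivots-↭ r (unique-↭ p uq) (unital-↭ p U))

 det-pivots : ∀ {n} (f : Fin n → V) (M : V → V → Carrier) → Unique (tabulate f) → Unital M (tabulate f) →
   det (λ i j → M (f i) (f j)) ≈ pivots M (tabulate f)
 det-pivots {n = zero}  f M uq U = refl
 det-pivots {n = suc n} f M uq@(_ ∷ uq′) U =
   trans (DS.det-schur (λ i j → M (f i) (f j)) (inv (M (f zero) (f zero))) (inv-inverse _ (diag U (here ≡.refl))))
         (𝕊.*-congˡ (det-pivots (f ∘ suc) (eliminate M (f zero)) uq′ (unital-eliminate uq U)))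

-- Jacobi's formula, and the traces of powers as a logarithmic derivative.

module Jacobi where
 open PowerSeries using (module Power)
 open BinaryForms
 open Elimination using (module DS; coeff₀-*0; coeff₀-minus0)
 open import Data.Integer.Base using (-1ℤ)
 open import Data.Fin.Base using (zero; suc)
 open import Data.Fin.Properties using (_≟_)

 open Power
 open DS using (det; sum; sum-cong; sum-+; sum-*; sum-*ʳ; sum-swap; schur; det-schur; det-cong)
 open import Relation.Binary.Reasoning.Setoid setoid

 kron : ∀ {n} → Fin n → Fin n → ℤ
 kron zero    zero    = + 1
 kron zero    (suc j) = + 0
 kron (suc i) zero    = + 0
 kron (suc i) (suc j) = kron i j

 kron-same : ∀ {n} (i : Fin n) → kron i i ≡ + 1
 kron-same zero    = ≡.refl
 kron-same (suc i) = kron-same i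

 kron-diff : ∀ {n} {i j : Fin n} → i ≢ j → kron i j ≡ + 0
 kron-diff {i = zero}  {zero}  p = contradiction ≡.refl p
 kron-diff {i = zero}  {suc j} p = ≡.refl
 kron-diff {i = suc i} {zero}  p = ≡.refl
 kron-diff {i = suc i} {suc j} p = kron-diff (p ∘ cong suc)

 δ≡kron : ∀ {n} (i j : Fin n) → Defs.δ i j ≡ kron i j
 δ≡kron i j with i ≟ j
 ... | yes ≡.refl = ≡.sym (kron-same i)
 ... | no p       = ≡.sym (kron-diff p)

 Mat𝕊 : ℕ → Set
 Mat𝕊 n = Fin n → Fin n → Carrier

 δ-1 : δ 1# ≈ 0#
 δ-1 = δ-ι (+ 1)

 private
   x+y≈0⇒y≈-x : ∀ {x y} → x + y ≈ 0# → y ≈ - x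
   x+y≈0⇒y≈-x {x} {y} e = begin
     y ≈⟨ solve 2 (λ x y → y := (x :+ y) :- x) refl x y ⟩
     (x + y) - x ≈⟨ 𝕊.+-congʳ e ⟩
     0# - x ≈⟨ 𝕊.+-identityˡ (- x) ⟩
     - x ∎

   x+y≈z⇒y≈z-x : ∀ {x y z} → x + y ≈ z → y ≈ z - x
   x+y≈z⇒y≈z-x {x} {y} {z} e = trans (solve 2 (λ x y → y := (x :+ y) :- x) refl x y) (𝕊.+-congʳ e)

   sum-4 : ∀ {m} (f g h k : Fin m → Carrier) →
     sum (λ i → (f i + g i) + (h i + k i)) ≈ (sum f + sum g) + (sum h + sum k)
   sum-4 f g h k = trans (sum-+ (λ i → f i + g i) (λ i → h i + k i)) (𝕊.+-cong (sum-+ f g) (sum-+ h k))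

 module _ where
   private
     module Step {n} (W V : Mat𝕊 (suc n)) (W₀ : coeff (W zero zero) 0 ≡ + 1)
       (right : ∀ i j → sum (λ k → W i k * V k j) ≈ ι (kron i j))
       (left  : ∀ i j → sum (λ k → V i k * W k j) ≈ ι (kron i j)) where
       p = W zero zero
       u = inv p
       w = V zero zero
       r c x y : Fin n → Carrier
       r j = W zero (suc j)
       c i = W (suc i) zero
       x j = V zero (suc j)
       y i = V (suc i) zero
       B V′ S : Mat𝕊 n
       B i j = W (suc i) (suc j)
       V′ i j = V (suc i) (suc j)
       S = schur u W

       pu : p * u ≈ 1#
       pu = inv-inverse p W₀

       rV : ∀ j → sum (λ k → r k * V′ k j) ≈ - (p * x j)
       rV j = x+y≈0⇒y≈-x (right zero (suc j))

       Vc : ∀ i → sum (λ k → V′ i k * c k) ≈ - (y i * p)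
       Vc i = x+y≈0⇒y≈-x (left (suc i) zero)

       xc : sum (λ k → x k * c k) ≈ 1# - w * p
       xc = x+y≈z⇒y≈z-x (left zero zero)

       -- The lower right block of the inverse of W inverts the Schur complement: the correction
       -- term of S meets the row identity `rV`, and p u = 1 makes the two surplus terms cancel.
       right′ : ∀ i j → sum (λ k → S i k * V′ k j) ≈ ι (kron i j)
       right′ i j = begin
         sum (λ k → S i k * V′ k j)
           ≈⟨ sum-cong (λ k → solve 5 (λ b c u r v → (b :- c :* (u :* r)) :* v := b :* v :+ (:- (c :* u)) :* (r :* v)) refl (B i k) (c i) u (r k) (V′ k j)) ⟩
         sum (λ k → B i k * V′ k j + - (c i * u) * (r k * V′ k j))
           ≈⟨ trans (sum-+ (λ k → B i k * V′ k j) (λ k → - (c i * u) * (r k * V′ k j))) (𝕊.+-congˡ (sum-* (- (c i * u)) (λ k → r k * V′ k j))) ⟩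
         sum (λ k → B i k * V′ k j) + - (c i * u) * sum (λ k → r k * V′ k j)
           ≈⟨ 𝕊.+-cong (x+y≈z⇒y≈z-x (right (suc i) (suc j))) (𝕊.*-congˡ (rV j)) ⟩
         (ι (kron i j) - c i * x j) + - (c i * u) * - (p * x j)
           ≈⟨ solve 5 (λ k c x u p → (k :- c :* x) :+ (:- (c :* u)) :* (:- (p :* x)) := (k :- c :* x) :+ (p :* u) :* (c :* x)) refl (ι (kron i j)) (c i) (x j) u p ⟩
         (ι (kron i j) - c i * x j) + (p * u) * (c i * x j) ≈⟨ 𝕊.+-congˡ (𝕊.*-congʳ pu) ⟩
         (ι (kron i j) - c i * x j) + 1# * (c i * x j) ≈⟨ solve 2 (λ k z → (k :- z) :+ con (+ 1) :* z := k) refl (ι (kron i j)) (c i * x j) ⟩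
         ι (kron i j) ∎

       left′ : ∀ i j → sum (λ k → V′ i k * S k j) ≈ ι (kron i j)
       left′ i j = begin
         sum (λ k → V′ i k * S k j)
           ≈⟨ sum-cong (λ k → solve 5 (λ b c u r v → v :* (b :- c :* (u :* r)) := v :* b :+ (:- (u :* r)) :* (v :* c)) refl (B k j) (c k) u (r j) (V′ i k)) ⟩
         sum (λ k → V′ i k * B k j + - (u * r j) * (V′ i k * c k))
           ≈⟨ trans (sum-+ (λ k → V′ i k * B k j) (λ k → - (u * r j) * (V′ i k * c k))) (𝕊.+-congˡ (sum-* (- (u * r j)) (λ k → V′ i k * c k))) ⟩
         sum (λ k → V′ i k * B k j) + - (u * r j) * sum (λ k → V′ i k * c k)
           ≈⟨ 𝕊.+-cong (x+y≈z⇒y≈z-x (left (suc i) (suc j))) (𝕊.*-congˡ (Vc i)) ⟩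
         (ι (kron i j) - y i * r j) + - (u * r j) * - (y i * p)
           ≈⟨ solve 5 (λ k y r u p → (k :- y :* r) :+ (:- (u :* r)) :* (:- (y :* p)) := (k :- y :* r) :+ (p :* u) :* (y :* r)) refl (ι (kron i j)) (y i) (r j) u p ⟩
         (ι (kron i j) - y i * r j) + (p * u) * (y i * r j) ≈⟨ 𝕊.+-congˡ (𝕊.*-congʳ pu) ⟩
         (ι (kron i j) - y i * r j) + 1# * (y i * r j) ≈⟨ solve 2 (λ k z → (k :- z) :+ con (+ 1) :* z := k) refl (ι (kron i j)) (y i * r j) ⟩
         ι (kron i j) ∎

       δS : ∀ j i → δ (S j i) ≈ δ (B j i) - (δ (c j) * (u * r i) + c j * (δ u * r i + u * δ (r i)))
       δS j i = trans (δ-+ _ _) (𝕊.+-congˡ (trans (δ-neg _) (𝕊.-‿cong (trans (δ-* _ _) (𝕊.+-congˡ (𝕊.*-congˡ (δ-* _ _)))))))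

       pδu : p * δ u ≈ - (δ p * u)
       pδu = x+y≈0⇒y≈-x (trans (sym (δ-* p u)) (trans (δ-cong pu) δ-1))

       ΣB Σx Σy : Carrier
       ΣB = sum (λ i → sum (λ j → V′ i j * δ (B j i)))
       Σx = sum (λ j → x j * δ (c j))
       Σy = sum (λ i → y i * δ (r i))

       -- Differentiating the correction c u r of the Schur complement and contracting with V′
       -- yields exactly the part of the full trace that belongs to the first row and column, except
       -- for - u δ p. That term cancels the derivative of the pivot in `jacobi`.
       trace-S : sum (λ i → sum (λ j → V′ i j * δ (S j i))) ≈ (ΣB + Σx) + (- (u * δ p) + w * δ p + Σy)
       trace-S = begin
         sum (λ i → sum (λ j → V′ i j * δ (S j i)))
           ≈⟨ sum-cong (λ i → sum-cong (λ j → trans (𝕊.*-congˡ (δS j i))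
                (solve 8 (λ v b δc u r c δu δr → v :* (b :- (δc :* (u :* r) :+ c :* (δu :* r :+ u :* δr)))
                   := (v :* b :+ (:- (u :* δc)) :* (r :* v)) :+ ((:- (δu :* c)) :* (r :* v) :+ (:- (u :* δr)) :* (v :* c))) refl
                   (V′ i j) (δ (B j i)) (δ (c j)) u (r i) (c j) (δ u) (δ (r i))))) ⟩
         sum (λ i → sum (λ j → (V′ i j * δ (B j i) + t₂ i j) + (t₃ i j + t₄ i j)))
           ≈⟨ sum-cong (λ i → sum-4 (λ j → V′ i j * δ (B j i)) (t₂ i) (t₃ i) (t₄ i)) ⟩
         sum (λ i → (sum (λ j → V′ i j * δ (B j i)) + sum (t₂ i)) + (sum (t₃ i) + sum (t₄ i)))
           ≈⟨ sum-4 (λ i → sum (λ j → V′ i j * δ (B j i))) (λ i → sum (t₂ i)) (λ i → sum (t₃ i)) (λ i → sum (t₄ i)) ⟩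
         (ΣB + sum (λ i → sum (t₂ i))) + (sum (λ i → sum (t₃ i)) + sum (λ i → sum (t₄ i)))
           ≈⟨ 𝕊.+-cong (𝕊.+-congˡ T₂) (𝕊.+-cong T₃ T₄) ⟩
         (ΣB + Σx) + (- (u * δ p) + w * δ p + Σy) ∎
         where
         t₂ t₃ t₄ : Fin n → Fin n → Carrier
         t₂ i j = - (u * δ (c j)) * (r i * V′ i j)
         t₃ i j = - (δ u * c j) * (r i * V′ i j)
         t₄ i j = - (u * δ (r i)) * (V′ i j * c j)
         T₂ : sum (λ i → sum (t₂ i)) ≈ Σx
         T₂ = trans (sum-swap t₂) (sum-cong (λ j → begin
           sum (λ i → t₂ i j) ≈⟨ sum-* (- (u * δ (c j))) (λ i → r i * V′ i j) ⟩
           - (u * δ (c j)) * sum (λ i → r i * V′ i j) ≈⟨ 𝕊.*-congˡ (rV j) ⟩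
           - (u * δ (c j)) * - (p * x j) ≈⟨ solve 4 (λ u d p x → (:- (u :* d)) :* (:- (p :* x)) := (p :* u) :* (x :* d)) refl u (δ (c j)) p (x j) ⟩
           (p * u) * (x j * δ (c j)) ≈⟨ trans (𝕊.*-congʳ pu) (𝕊.*-identityˡ _) ⟩
           x j * δ (c j) ∎))
         T₃ : sum (λ i → sum (t₃ i)) ≈ - (u * δ p) + w * δ p
         T₃ = begin
           sum (λ i → sum (t₃ i)) ≈⟨ sum-swap t₃ ⟩
           sum (λ j → sum (λ i → t₃ i j)) ≈⟨ sum-cong (λ j → trans (sum-* (- (δ u * c j)) (λ i → r i * V′ i j)) (trans (𝕊.*-congˡ (rV j))
               (solve 4 (λ d c p x → (:- (d :* c)) :* (:- (p :* x)) := (p :* d) :* (x :* c)) refl (δ u) (c j) p (x j)))) ⟩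
           sum (λ j → (p * δ u) * (x j * c j)) ≈⟨ sum-* (p * δ u) (λ j → x j * c j) ⟩
           (p * δ u) * sum (λ j → x j * c j) ≈⟨ 𝕊.*-cong pδu xc ⟩
           - (δ p * u) * (1# - w * p) ≈⟨ solve 4 (λ d u w p → (:- (d :* u)) :* (con (+ 1) :- w :* p) := (:- (u :* d)) :+ (p :* u) :* (w :* d)) refl (δ p) u w p ⟩
           - (u * δ p) + (p * u) * (w * δ p) ≈⟨ 𝕊.+-congˡ (trans (𝕊.*-congʳ pu) (𝕊.*-identityˡ _)) ⟩
           - (u * δ p) + w * δ p ∎
         T₄ : sum (λ i → sum (t₄ i)) ≈ Σy
         T₄ = sum-cong (λ i → begin
           sum (t₄ i) ≈⟨ sum-* (- (u * δ (r i))) (λ j → V′ i j * c j) ⟩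
           - (u * δ (r i)) * sum (λ j → V′ i j * c j) ≈⟨ 𝕊.*-congˡ (Vc i) ⟩
           - (u * δ (r i)) * - (y i * p) ≈⟨ solve 4 (λ u d p y → (:- (u :* d)) :* (:- (y :* p)) := (p :* u) :* (y :* d)) refl u (δ (r i)) p (y i) ⟩
           (p * u) * (y i * δ (r i)) ≈⟨ trans (𝕊.*-congʳ pu) (𝕊.*-identityˡ _) ⟩
           y i * δ (r i) ∎)

   -- Jacobi's formula δ (det W) = det W · tr (W⁻¹ δ W), with V as the inverse. The induction passes
   -- to the Schur complement; `right′` and `left′` show that its inverse is a block of V.
   jacobi : ∀ {n} (W V : Mat𝕊 n) → (∀ i j → coeff (W i j) 0 ≡ kron i j) →
     (∀ i j → sum (λ k → W i k * V k j) ≈ ι (kron i j)) → (∀ i j → sum (λ k → V i k * W k j) ≈ ι (kron i j)) →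
     δ (det W) ≈ det W * sum (λ i → sum (λ j → V i j * δ (W j i)))
   jacobi {zero} W V W₀ right left = trans δ-1 (sym (𝕊.zeroʳ 1#))
   jacobi {suc n} W V W₀ right left = begin
     δ (det W) ≈⟨ δ-cong (det-schur W u pu) ⟩
     δ (p * det S) ≈⟨ δ-* p (det S) ⟩
     δ p * det S + p * δ (det S) ≈⟨ 𝕊.+-congˡ (𝕊.*-congˡ (trans (jacobi S V′ S₀ right′ left′) (𝕊.*-congˡ trace-S))) ⟩
     δ p * D + p * (D * ((ΣB + Σx) + (- (u * δ p) + w * δ p + Σy)))
       ≈⟨ solve 8 (λ dp D p B X u w Y → dp :* D :+ p :* (D :* ((B :+ X) :+ ((:- (u :* dp)) :+ w :* dp :+ Y)))
            := (dp :* D :- (p :* u) :* (dp :* D)) :+ (p :* D) :* ((w :* dp :+ X) :+ (Y :+ B))) refl (δ p) D p ΣB Σx u w Σy ⟩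
     (δ p * D - (p * u) * (δ p * D)) + (p * D) * ((w * δ p + Σx) + (Σy + ΣB))
       ≈⟨ 𝕊.+-congʳ (trans (𝕊.+-congˡ (𝕊.-‿cong (trans (𝕊.*-congʳ pu) (𝕊.*-identityˡ _)))) (𝕊.-‿inverseʳ _)) ⟩
     0# + (p * D) * ((w * δ p + Σx) + (Σy + ΣB)) ≈⟨ 𝕊.+-identityˡ _ ⟩
     (p * D) * ((w * δ p + Σx) + (Σy + ΣB)) ≈⟨ 𝕊.*-cong (sym (det-schur W u pu)) (𝕊.+-congˡ (sym (sum-+ (λ i → y i * δ (r i)) (λ i → sum (λ j → V′ i j * δ (B j i)))))) ⟩
     det W * sum (λ i → sum (λ j → V i j * δ (W j i))) ∎
     where
     open Step W V (W₀ zero zero) right left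
     D = det S
     S₀ : ∀ i j → coeff (S i j) 0 ≡ kron i j
     S₀ i j = coeff₀-minus0 (B i j) (c i * (u * r j)) (W₀ (suc i) (suc j)) (coeff₀-*0 (c i) (u * r j) (W₀ (suc i) zero))

 power : ∀ {n} → (Fin n → Fin n → ℤ) → ℕ → Fin n → Fin n → ℤ
 power M zero    i j = kron i j
 power M (suc k) i j = DZ.sum (λ l → M i l ℤ.* power M k l j)

 trace : ∀ {n} → (Fin n → Fin n → ℤ) → ℤ
 trace M = DZ.sum (λ i → M i i)

 kron-sum : ∀ {n} (i : Fin n) (f : Fin n → ℤ) → DZ.sum (λ l → kron i l ℤ.* f l) ≡ f i
 kron-sum i f = ≡.trans (DZ.sum-single i (λ j j≢i → ≡.trans (cong (ℤ._* f j) (kron-diff (j≢i ∘ ≡.sym))) (ℤ.*-zeroˡ (f j))))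
                        (≡.trans (cong (ℤ._* f i) (kron-same i)) (ℤ.*-identityˡ (f i)))

 kron-sumʳ : ∀ {n} (j : Fin n) (f : Fin n → ℤ) → DZ.sum (λ l → f l ℤ.* kron l j) ≡ f j
 kron-sumʳ j f = ≡.trans (DZ.sum-single j (λ l l≢j → ≡.trans (cong (f l ℤ.*_) (kron-diff l≢j)) (ℤ.*-zeroʳ (f l))))
                        (≡.trans (cong (f j ℤ.*_) (kron-same j)) (ℤ.*-identityʳ (f j)))

 power-sucʳ : ∀ {n} (M : Fin n → Fin n → ℤ) k i j → power M (suc k) i j ≡ DZ.sum (λ l → power M k i l ℤ.* M l j)
 power-sucʳ M zero    i j = ≡.trans (kron-sumʳ j (M i)) (≡.sym (kron-sum i (λ l → M l j)))
 power-sucʳ M (suc k) i j =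
   ≡.trans (DZ.sum-cong (λ l → ≡.trans (cong (M i l ℤ.*_) (power-sucʳ M k l j)) (≡.sym (DZ.sum-* (M i l) (λ m → power M k l m ℤ.* M m j)))))
   (≡.trans (DZ.sum-swap (λ l m → M i l ℤ.* (power M k l m ℤ.* M m j)))
   (DZ.sum-cong (λ m → ≡.trans (DZ.sum-cong (λ l → ≡.sym (ℤ.*-assoc (M i l) (power M k l m) (M m j))))
                               (DZ.sum-*ʳ (M m j) (λ l → M i l ℤ.* power M k l m)))))

 coeff-sum : ∀ {m} (f : Fin m → Carrier) n → coeff (sum f) n ≡ DZ.sum (λ i → coeff (f i) n)
 coeff-sum {zero}  f n = coeff-0 n
 coeff-sum {suc m} f n = ≡.trans (coeff-+ (f zero) (sum (f ∘ suc)) n) (cong (λ z → coeff (f zero) n ℤ.+ z) (coeff-sum (f ∘ suc) n))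

 module LogDerivative {n} (M : Fin n → Fin n → ℤ) where
   -- W is 1 - qM, and V is its inverse, the Neumann series of M.
   W V : Mat𝕊 n
   W i j = ι (kron i j) - q * ι (M i j)
   V i j = series (λ k → power M k i j)

   W₀ : ∀ i j → coeff (W i j) 0 ≡ kron i j
   W₀ i j = coeff₀-minus0 (ι (kron i j)) (q * ι (M i j)) (coeff-ι-zero (kron i j)) (q*-zero (ι (M i j)))

   private
     coeff-W-entry : ∀ i j f k → coeff (W i j * f) (suc k) ≡ kron i j ℤ.* coeff f (suc k) ℤ.- M i j ℤ.* coeff f k
     coeff-W-entry i j f k = ≡.trans (coeff-cong (solve 4 (λ d q m f → (d :- q :* m) :* f := d :* f :- q :* (m :* f)) refl (ι (kron i j)) q (ι (M i j)) f) (suc k))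
       (≡.trans (coeff-sub _ _ (suc k)) (cong₂ ℤ._-_ (coeff-ι* (kron i j) f (suc k)) (≡.trans (q*-suc (ι (M i j) * f) k) (coeff-ι* (M i j) f k))))

     coeff-W-zero : ∀ i j f → coeff (W i j * f) 0 ≡ kron i j ℤ.* coeff f 0
     coeff-W-zero i j f = ≡.trans (coeff-*-zero (W i j) f) (cong (ℤ._* coeff f 0) (W₀ i j))

     sum-minus : ∀ {m} (f g : Fin m → ℤ) → DZ.sum (λ i → f i ℤ.- g i) ≡ DZ.sum f ℤ.- DZ.sum g
     sum-minus f g = ≡.trans (DZ.sum-+ f (λ i → ℤ.- g i)) (cong (λ z → DZ.sum f ℤ.+ z)
       (≡.trans (DZ.sum-cong (λ i → ≡.sym (ℤ.-1*i≡-i (g i)))) (≡.trans (DZ.sum-* -1ℤ g) (ℤ.-1*i≡-i (DZ.sum g)))))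

   right : ∀ i j → sum (λ k → W i k * V k j) ≈ ι (kron i j)
   right i j = coeff-ext λ { zero → ≡.trans (coeff-sum (λ l → W i l * V l j) 0) (≡.trans (DZ.sum-cong (λ l → ≡.trans (coeff-W-zero i l (V l j)) (cong (kron i l ℤ.*_) (coeff-series _ 0))))
                                 (≡.trans (kron-sum i (λ l → kron l j)) (≡.sym (coeff-ι-zero (kron i j)))))
     ; (suc k) → ≡.trans (coeff-sum (λ l → W i l * V l j) (suc k)) (≡.trans (DZ.sum-cong (λ l → ≡.trans (coeff-W-entry i l (V l j) k)
                     (cong₂ (λ a b → kron i l ℤ.* a ℤ.- M i l ℤ.* b) (coeff-series _ (suc k)) (coeff-series _ k))))
                 (≡.trans (sum-minus (λ l → kron i l ℤ.* power M (suc k) l j) (λ l → M i l ℤ.* power M k l j)) (≡.trans (cong (ℤ._- power M (suc k) i j) (kron-sum i (λ l → power M (suc k) l j)))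
                   (≡.trans (ℤ.+-inverseʳ (power M (suc k) i j)) (≡.sym (coeff-ι-suc (kron i j) k)))))) }

   left : ∀ i j → sum (λ k → V i k * W k j) ≈ ι (kron i j)
   left i j = coeff-ext λ { zero → ≡.trans (coeff-sum (λ l → V i l * W l j) 0) (≡.trans (DZ.sum-cong (λ l → ≡.trans (comm l 0) (≡.trans (coeff-W-zero l j (V i l)) (≡.trans (cong (kron l j ℤ.*_) (coeff-series _ 0)) (ℤ.*-comm (kron l j) (kron i l))))))
                                 (≡.trans (kron-sumʳ j (λ l → kron i l)) (≡.sym (coeff-ι-zero (kron i j)))))
     ; (suc k) → ≡.trans (coeff-sum (λ l → V i l * W l j) (suc k)) (≡.trans (DZ.sum-cong (λ l → ≡.trans (comm l (suc k)) (≡.trans (coeff-W-entry l j (V i l) k)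
                     (cong₂ ℤ._-_ (≡.trans (cong (kron l j ℤ.*_) (coeff-series _ (suc k))) (ℤ.*-comm (kron l j) (power M (suc k) i l)))
                                  (≡.trans (cong (M l j ℤ.*_) (coeff-series _ k)) (ℤ.*-comm (M l j) (power M k i l)))))))
                 (≡.trans (sum-minus (λ l → power M (suc k) i l ℤ.* kron l j) (λ l → power M k i l ℤ.* M l j)) (≡.trans (cong₂ ℤ._-_ (kron-sumʳ j (λ l → power M (suc k) i l)) (≡.sym (power-sucʳ M k i j)))
                   (≡.trans (ℤ.+-inverseʳ (power M (suc k) i j)) (≡.sym (coeff-ι-suc (kron i j) k)))))) }
     where
     comm : ∀ l m → coeff (V i l * W l j) m ≡ coeff (W l j * V i l) m
     comm l m = coeff-cong (𝕊.*-comm (V i l) (W l j)) m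

   δW : ∀ i j → δ (W i j) ≈ - (q * ι (M i j))
   δW i j = trans (δ-+ (ι (kron i j)) (- (q * ι (M i j)))) (trans (𝕊.+-cong (δ-ι (kron i j)) (trans (δ-neg (q * ι (M i j))) (𝕊.-‿cong (δ-q* (M i j))))) (𝕊.+-identityˡ _))
     where
     δ-q* : ∀ c → δ (q * ι c) ≈ q * ι c
     δ-q* c = coeff-ext λ { zero → ≡.trans (coeff-δ (q * ι c) 0) (≡.trans (ℤ.*-zeroˡ (coeff (q * ι c) 0)) (≡.sym (q*-zero (ι c))))
       ; (suc zero) → ≡.trans (coeff-δ (q * ι c) 1) (ℤ.*-identityˡ _)
       ; (suc (suc k)) → ≡.trans (coeff-δ (q * ι c) (suc (suc k))) (≡.trans (cong (+ suc (suc k) ℤ.*_) (zero-coeff k)) (≡.trans (ℤ.*-zeroʳ (+ suc (suc k))) (≡.sym (zero-coeff k)))) }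
       where
       zero-coeff : ∀ k → coeff (q * ι c) (suc (suc k)) ≡ + 0
       zero-coeff k = ≡.trans (q*-suc (ι c) (suc k)) (coeff-ι-suc c k)

   T : Carrier
   T = sum (λ i → sum (λ j → ι (M j i) * V i j))

   log-derivative : δ (det W) ≈ det W * - (q * T)
   log-derivative = trans (jacobi W V W₀ right left) (𝕊.*-congˡ (begin
     sum (λ i → sum (λ j → V i j * δ (W j i)))
       ≈⟨ sum-cong (λ i → trans (sum-cong (λ j → trans (𝕊.*-congˡ (δW j i)) (solve 3 (λ v q m → v :* (:- (q :* m)) := (:- q) :* (m :* v)) refl (V i j) q (ι (M j i))))) (sum-* (- q) (λ j → ι (M j i) * V i j))) ⟩
     sum (λ i → - q * sum (λ j → ι (M j i) * V i j)) ≈⟨ sum-* (- q) (λ i → sum (λ j → ι (M j i) * V i j)) ⟩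
     - q * T ≈⟨ solve 2 (λ q t → (:- q) :* t := :- (q :* t)) refl q T ⟩
     - (q * T) ∎))

   coeff-T : ∀ k → coeff T k ≡ trace (power M (suc k))
   coeff-T k = ≡.trans (coeff-sum (λ i → sum (λ j → ι (M j i) * V i j)) k) (≡.trans (DZ.sum-cong (λ i → ≡.trans (coeff-sum (λ j → ι (M j i) * V i j) k) (DZ.sum-cong (λ j → ≡.trans (coeff-ι* (M j i) (V i j) k) (cong (M j i ℤ.*_) (coeff-series _ k))))))
     (DZ.sum-swap (λ i j → M j i ℤ.* power M k i j)))

   det-W₀ : coeff (det W) 0 ≡ + 1
   det-W₀ = unit W W₀
     where
     unit : ∀ {m} (W : Mat𝕊 m) → (∀ i j → coeff (W i j) 0 ≡ kron i j) → coeff (det W) 0 ≡ + 1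
     unit {zero}  W W₀ = coeff-1-zero
     unit {suc m} W W₀ = ≡.trans (coeff-cong (det-schur W (inv (W zero zero)) (inv-inverse _ (W₀ zero zero))) 0)
       (≡.trans (coeff-*-zero (W zero zero) _) (cong₂ ℤ._*_ (W₀ zero zero)
         (unit (schur (inv (W zero zero)) W) (λ i j → coeff₀-minus0 _ _ (W₀ (suc i) (suc j)) (coeff₀-*0 _ _ (W₀ (suc i) zero))))))

 -- The logarithmic derivative of det (1 - qM) is minus the generating series of the traces of M,
 -- M², .... This replaces Newton's identities and needs no division by integers.
 traces-agree : ∀ {n} (M N : Fin n → Fin n → ℤ) →
   det (λ i j → ι (kron i j) - q * ι (M i j)) ≈ det (λ i j → ι (kron i j) - q * ι (N i j)) →
   ∀ k → trace (power M (suc k)) ≡ trace (power N (suc k))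
 traces-agree M N e k = ≡.trans (≡.sym (A.coeff-T k)) (≡.trans (coeff-cong T≈ k) (B.coeff-T k))
   where
   module A = LogDerivative M
   module B = LogDerivative N
   neg-T : - (q * A.T) ≈ - (q * B.T)
   neg-T = unit-cancel (det A.W) A.det-W₀ (trans (sym A.log-derivative) (trans (δ-cong e) (trans B.log-derivative (𝕊.*-congʳ (sym e)))))
   T≈ : A.T ≈ B.T
   T≈ = coeff-ext (λ m → ≡.trans (≡.sym (q*-suc A.T m)) (≡.trans (coeff-cong (trans (sym (neg-neg (q * A.T))) (trans (𝕊.-‿cong neg-T) (neg-neg (q * B.T)))) (suc m)) (q*-suc B.T m)))
     where
     neg-neg : ∀ x → - - x ≈ x
     neg-neg x = solve 1 (λ x → :- (:- x) := x) refl x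

-- Traces of the first four powers of Q - 2 in terms of degrees and short walks.

module SpectralMoments where
 open BinaryForms using (module DZ)
 open Jacobi using (kron; kron-same; kron-diff; kron-sum; kron-sumʳ; δ≡kron; power; trace)
 open import Data.Integer.Base using (_≤_; +≤+; _+_; _*_; _-_; -_)
 open import Data.Integer.Tactic.RingSolver using (solve-∀)
 open import Data.Fin.Base using (zero; suc)
 open import Data.Fin.Properties using (_≟_)
 open ≡
 open import Defs using (sumFin)

 private
   Σ-cong : ∀ {n} {f g : Fin n → ℤ} → (∀ i → f i ≡ g i) → DZ.sum f ≡ DZ.sum g
   Σ-cong = DZ.sum-cong

 sumFin≡sum : ∀ {n} (f : Fin n → ℤ) → sumFin f ≡ DZ.sum f
 sumFin≡sum {zero}  f = refl
 sumFin≡sum {suc n} f = cong (λ z → f zero + z) (sumFin≡sum (f ∘ suc))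

 sum-nonneg : ∀ {n} (f : Fin n → ℤ) → (∀ i → + 0 ≤ f i) → + 0 ≤ DZ.sum f
 sum-nonneg {zero}  f p = ℤ.≤-refl
 sum-nonneg {suc n} f p = ℤ.+-mono-≤ (p zero) (sum-nonneg (f ∘ suc) (p ∘ suc))

 +-nonneg-zero : ∀ {a b} → + 0 ≤ a → + 0 ≤ b → a + b ≡ + 0 → (a ≡ + 0) × (b ≡ + 0)
 +-nonneg-zero {+ zero} {+ b} _ _ e = refl , trans (sym (ℤ.+-identityˡ (+ b))) e

 sum-nonneg-zero : ∀ {n} (f : Fin n → ℤ) → (∀ i → + 0 ≤ f i) → DZ.sum f ≡ + 0 → ∀ i → f i ≡ + 0
 sum-nonneg-zero {suc n} f p e zero    = proj₁ (+-nonneg-zero (p zero) (sum-nonneg (f ∘ suc) (p ∘ suc)) e)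
 sum-nonneg-zero {suc n} f p e (suc i) = sum-nonneg-zero (f ∘ suc) (p ∘ suc) (proj₂ (+-nonneg-zero (p zero) (sum-nonneg (f ∘ suc) (p ∘ suc)) e)) i

 power-+ : ∀ {n} (M : Fin n → Fin n → ℤ) m k i j → power M (m ℕ.+ k) i j ≡ DZ.sum (λ l → power M m i l * power M k l j)
 power-+ M zero    k i j = sym (kron-sum i (λ l → power M k l j))
 power-+ M (suc m) k i j = trans (Σ-cong (λ l → trans (cong (M i l *_) (power-+ M m k l j)) (sym (DZ.sum-* (M i l) (λ r → power M m l r * power M k r j)))))
   (trans (DZ.sum-swap (λ l r → M i l * (power M m l r * power M k r j)))
     (Σ-cong (λ r → trans (Σ-cong (λ l → sym (ℤ.*-assoc (M i l) (power M m l r) (power M k r j)))) (DZ.sum-*ʳ (power M k r j) (λ l → M i l * power M m l r)))))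

 module GraphOf {n} (G : Graph n) where
   A : Fin n → Fin n → ℤ
   A i j = b2z (adj G i j)

   d h : Fin n → ℤ
   d i = DZ.sum (A i)
   h i = d i - + 2

   -- This is Q - 2. The shift puts -1, 0 and 1 on the diagonal at degrees 1, 2 and 3, which are the
   -- roots of h³ = h.
   M : Fin n → Fin n → ℤ
   M i j = kron i j * h i + A i j

   walks₂ : Fin n → Fin n → ℤ
   walks₂ i j = DZ.sum (λ l → A i l * A l j)

   A-sym : ∀ i j → A i j ≡ A j i
   A-sym i j = cong b2z (Graph.sym G i j)

   A-irrefl : ∀ i → A i i ≡ + 0
   A-irrefl i = cong b2z (Graph.irrefl G i)

   A-idem : ∀ i j → A i j * A i j ≡ A i j
   A-idem i j with adj G i j
   ... | true  = refl
   ... | false = refl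

   A-nonneg : ∀ i j → + 0 ≤ A i j
   A-nonneg i j with adj G i j
   ... | true  = +≤+ ℕ.z≤n
   ... | false = +≤+ ℕ.z≤n

   A-kron : ∀ i j → A i j * kron i j ≡ + 0
   A-kron i j with i ≟ j
   ... | yes refl = trans (cong (_* kron i i) (A-irrefl i)) (ℤ.*-zeroˡ (kron i i))
   ... | no p     = trans (cong (A i j *_) (kron-diff p)) (ℤ.*-zeroʳ (A i j))

   *-nonneg : ∀ {a b} → + 0 ≤ a → + 0 ≤ b → + 0 ≤ a * b
   *-nonneg {+ a} {+ b} _ _ = subst (+ 0 ≤_) (ℤ.pos-* a b) (+≤+ ℕ.z≤n)

   walks₂-nonneg : ∀ i j → + 0 ≤ walks₂ i j
   walks₂-nonneg i j = sum-nonneg (λ l → A i l * A l j) (λ l → *-nonneg (A-nonneg i l) (A-nonneg l j))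

   d-nonneg : ∀ i → + 0 ≤ d i
   d-nonneg i = sum-nonneg (A i) (A-nonneg i)

   walks₂-sym : ∀ i j → walks₂ i j ≡ walks₂ j i
   walks₂-sym i j = Σ-cong (λ l → trans (cong₂ _*_ (A-sym i l) (A-sym l j)) (ℤ.*-comm (A l i) (A j l)))

   walks₂-diag : ∀ i → walks₂ i i ≡ d i
   walks₂-diag i = Σ-cong (λ l → trans (cong (A i l *_) (A-sym l i)) (A-idem i l))

   M≡Q-2 : ∀ i j → M i j ≡ signlessLaplacian G i j - + 2 * kron i j
   M≡Q-2 i j = trans (rearr (kron i j) (d i) (A i j)) (cong (λ z → (z + A i j) - + 2 * kron i j) (cong₂ _*_ (sym (δ≡kron i j)) (sym (sumFin≡sum (A i)))))
     where
     rearr : ∀ k d a → k * (d - + 2) + a ≡ (k * d + a) - + 2 * k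
     rearr = solve-∀

   power-1 : ∀ i j → power M 1 i j ≡ M i j
   power-1 i j = kron-sumʳ j (M i)

   P : Fin n → Fin n → ℤ
   P i j = kron i j * (h i * h i) + (h i + h j) * A i j + walks₂ i j

   power-2 : ∀ i j → power M 2 i j ≡ P i j
   power-2 i j = trans (Σ-cong (λ l → trans (cong (M i l *_) (power-1 l j)) (expand (kron i l) (h i) (A i l) (kron l j) (h l) (A l j))))
     (trans (DZ.sum-+ (λ l → kron i l * (h i * (kron l j * h l + A l j)) + (A i l * h l) * kron l j) (λ l → A i l * A l j))
       (cong (_+ walks₂ i j) (trans (DZ.sum-+ (λ l → kron i l * (h i * (kron l j * h l + A l j))) (λ l → (A i l * h l) * kron l j))
         (trans (cong₂ _+_ (kron-sum i (λ l → h i * (kron l j * h l + A l j))) (kron-sumʳ j (λ l → A i l * h l)))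
           (collect (h i) (h j) (kron i j) (A i j))))))
     where
     expand : ∀ k h a k′ h′ a′ → (k * h + a) * (k′ * h′ + a′) ≡ (k * (h * (k′ * h′ + a′)) + (a * h′) * k′) + a * a′
     expand = solve-∀
     collect : ∀ h h′ k a → h * (k * h + a) + a * h′ ≡ k * (h * h) + (h + h′) * a
     collect = solve-∀

   P-diag : ∀ i → P i i ≡ h i * h i + d i
   P-diag i = trans (cong₂ (λ k a → k * (h i * h i) + (h i + h i) * a + walks₂ i i) (kron-same i) (A-irrefl i))
     (trans (cong (λ c → + 1 * (h i * h i) + (h i + h i) * + 0 + c) (walks₂-diag i)) (simplify (h i) (d i)))
     where
     simplify : ∀ h d → + 1 * (h * h) + (h + h) * + 0 + d ≡ h * h + d
     simplify = solve-∀

   -- The trace of the cube of the adjacency matrix, six times the number of triangles.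
   C : ℤ
   C = DZ.sum (λ i → DZ.sum (λ j → A i j * walks₂ i j))

   A-weighted : ∀ (f : Fin n → ℤ) → DZ.sum (λ i → DZ.sum (λ j → A i j * f j)) ≡ DZ.sum (λ i → d i * f i)
   A-weighted f = trans (DZ.sum-swap (λ i j → A i j * f j)) (Σ-cong (λ j → trans (Σ-cong (λ i → cong (_* f j) (A-sym i j))) (DZ.sum-*ʳ (f j) (A j))))

   A-weightedˡ : ∀ (f : Fin n → ℤ) → DZ.sum (λ i → DZ.sum (λ j → A i j * f i)) ≡ DZ.sum (λ i → d i * f i)
   A-weightedˡ f = Σ-cong (λ i → DZ.sum-*ʳ (f i) (A i))

   tr₁ : trace (power M 1) ≡ DZ.sum h
   tr₁ = Σ-cong (λ i → trans (power-1 i i) (trans (cong₂ (λ k a → k * h i + a) (kron-same i) (A-irrefl i)) (trans (ℤ.+-identityʳ _) (ℤ.*-identityˡ (h i)))))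

   tr₂ : trace (power M 2) ≡ DZ.sum (λ i → h i * h i + d i)
   tr₂ = Σ-cong (λ i → trans (power-2 i i) (P-diag i))

   tr₃ : trace (power M 3) ≡ DZ.sum (λ i → h i * (h i * h i + d i)) + (DZ.sum (λ i → d i * h i) + DZ.sum (λ i → d i * h i) + C)
   tr₃ = trans (Σ-cong (λ i → trans (Σ-cong (λ l → trans (cong (M i l *_) (power-2 l i)) (term i l)))
       (trans (DZ.sum-+ (λ l → kron i l * (h i * P l i)) (λ l → (A i l * h i + A i l * h l) + A i l * walks₂ i l))
         (cong₂ _+_ (trans (kron-sum i (λ l → h i * P l i)) (cong (h i *_) (P-diag i)))
           (trans (DZ.sum-+ (λ l → A i l * h i + A i l * h l) (λ l → A i l * walks₂ i l))
             (cong (_+ DZ.sum (λ l → A i l * walks₂ i l)) (DZ.sum-+ (λ l → A i l * h i) (λ l → A i l * h l))))))))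
     (trans (DZ.sum-+ (λ i → h i * (h i * h i + d i)) (λ i → (DZ.sum (λ l → A i l * h i) + DZ.sum (λ l → A i l * h l)) + DZ.sum (λ l → A i l * walks₂ i l)))
       (cong (λ z → DZ.sum (λ i → h i * (h i * h i + d i)) + z)
         (trans (DZ.sum-+ (λ i → DZ.sum (λ l → A i l * h i) + DZ.sum (λ l → A i l * h l)) (λ i → DZ.sum (λ l → A i l * walks₂ i l)))
           (cong (_+ C) (trans (DZ.sum-+ (λ i → DZ.sum (λ l → A i l * h i)) (λ i → DZ.sum (λ l → A i l * h l))) (cong₂ _+_ (A-weightedˡ h) (A-weighted h)))))))
     where
     expand : ∀ k h a kk h′ a′ c → (k * h + a) * (kk * (h′ * h′) + (h′ + h) * a′ + c)
       ≡ k * (h * (kk * (h′ * h′) + (h′ + h) * a′ + c)) + (((a * kk) * (h′ * h′) + (a * a′) * (h + h′)) + a * c)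
     expand = solve-∀
     tidy : ∀ a h h′ → + 0 * (h′ * h′) + a * (h + h′) ≡ a * h + a * h′
     tidy = solve-∀
     term : ∀ i l → M i l * P l i ≡ kron i l * (h i * P l i) + ((A i l * h i + A i l * h l) + A i l * walks₂ i l)
     term i l = trans (expand (kron i l) (h i) (A i l) (kron l i) (h l) (A l i) (walks₂ l i))
       (cong (λ z → kron i l * (h i * P l i) + z) (cong₂ _+_
         (trans (cong₂ (λ x y → x * (h l * h l) + y * (h i + h l)) (trans (cong (_* kron l i) (A-sym i l)) (A-kron l i)) (trans (cong (A i l *_) (A-sym l i)) (A-idem i l)))
           (tidy (A i l) (h i) (h l)))
         (cong (A i l *_) (walks₂-sym l i))))

   -- With h = d - 2 the cubic is (d - 1)(d - 2)(d - 3), which is nonnegative at every positive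
   -- degree and vanishes only at 1, 2 and 3 there. Triangles contribute nonnegatively as well.
   excess : ℤ
   excess = DZ.sum (λ i → h i * h i * h i - h i) + C

   order : ℤ
   order = DZ.sum {n} (λ _ → + 1)

   private
     sum₃ : ∀ (f g k : Fin n → ℤ) a b c → DZ.sum (λ i → a * f i + b * g i + c * k i) ≡ a * DZ.sum f + b * DZ.sum g + c * DZ.sum k
     sum₃ f g k a b c = trans (DZ.sum-+ (λ i → a * f i + b * g i) (λ i → c * k i)) (cong₂ _+_
       (trans (DZ.sum-+ (λ i → a * f i) (λ i → b * g i)) (cong₂ _+_ (DZ.sum-* a f) (DZ.sum-* b g))) (DZ.sum-* c k))

   -- The third trace is the sum of h³ + 3 h d plus C, and 3 h d = 3 h² + 6 h. The second trace
   -- removes the square; the remaining coefficients are then forced.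
   excess-spectral : excess ≡ trace (power M 3) + (- (+ 3) * trace (power M 2) + - (+ 4) * trace (power M 1) + + 6 * order)
   excess-spectral = sym (trans (cong₂ _+_ tr₃ (trans (cong₂ (λ x y → - (+ 3) * x + - (+ 4) * y + + 6 * order) tr₂ tr₁)
        (sym (sum₃ (λ i → h i * h i + d i) h (λ _ → + 1) (- (+ 3)) (- (+ 4)) (+ 6)))))
      (trans (rearr (DZ.sum f₁) (DZ.sum f₂) C (DZ.sum f₃)) (cong (_+ C) (trans (cong₂ _+_ (sym (DZ.sum-+ f₁ f₂)) (sym (DZ.sum-+ f₂ f₃)))
        (trans (sym (DZ.sum-+ (λ i → f₁ i + f₂ i) (λ i → f₂ i + f₃ i))) (Σ-cong (λ i → pointwise (d i))))))))
     where
     f₁ f₂ f₃ : Fin n → ℤ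
     f₁ i = h i * (h i * h i + d i)
     f₂ i = d i * h i
     f₃ i = - (+ 3) * (h i * h i + d i) + - (+ 4) * h i + + 6 * + 1
     rearr : ∀ a b c e → (a + (b + b + c)) + e ≡ ((a + b) + (b + e)) + c
     rearr = solve-∀
     pointwise : ∀ d → (((d - + 2) * ((d - + 2) * (d - + 2) + d)) + d * (d - + 2))
       + (d * (d - + 2) + (- (+ 3) * ((d - + 2) * (d - + 2) + d) + - (+ 4) * (d - + 2) + + 6 * + 1))
       ≡ (d - + 2) * (d - + 2) * (d - + 2) - (d - + 2)
     pointwise = solve-∀

   -- For h in -1, 0, 1 the bracket is 6 for two leaves, 2 for a leaf and a vertex of degree 2, 2
   -- for two hubs, and 0 otherwise. The second defect vanishes when two distinct vertices have at
   -- most one common neighbour, so it detects 4-cycles.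
   edgeDefect pathDefect : Fin n → Fin n → ℤ
   edgeDefect i j = A i j * (+ 2 * (h i * h j) + (h i * h i - h i) + (h j * h j - h j))
   pathDefect i j = (+ 1 - kron i j) * (walks₂ i j * walks₂ i j - walks₂ i j)

   defect : ℤ
   defect = DZ.sum (λ i → DZ.sum (λ j → edgeDefect i j + pathDefect i j))

   module _ (cube : ∀ i → h i * h i * h i ≡ h i) (triangleFree : ∀ i j → A i j * walks₂ i j ≡ + 0) where
     private
       g : Fin n → ℤ
       g i = h i * h i - h i
       f : Fin n → ℤ
       f i = h i * h i * (h i * h i) + + 2 * (h i * h i) * d i + (d i * d i - d i)
       rest : Fin n → Fin n → ℤ
       rest i j = kron i j * f i + A i j * h i + A i j * h j + walks₂ i j

       kron-idem : ∀ (i j : Fin n) → kron i j * kron i j ≡ kron i j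
       kron-idem i j with i ≟ j
       ... | yes refl = trans (cong (_* kron i i) (kron-same i)) (ℤ.*-identityˡ _)
       ... | no p     = trans (cong (_* kron i j) (kron-diff p)) (trans (ℤ.*-zeroˡ (kron i j)) (sym (kron-diff p)))

       kron-walks : ∀ i j → kron i j * walks₂ i j ≡ kron i j * d i
       kron-walks i j with i ≟ j
       ... | yes refl = cong (kron i i *_) (walks₂-diag i)
       ... | no p     = trans (cong (_* walks₂ i j) (kron-diff p)) (trans (ℤ.*-zeroˡ (walks₂ i j)) (sym (trans (cong (_* d i) (kron-diff p)) (ℤ.*-zeroˡ (d i)))))

       -- Mixed products disappear: adjacency and identity have disjoint supports, and the product
       -- of adjacency and `walks₂` is zero without triangles. What is not a defect goes into
       -- `rest`, whose total depends on degrees only.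
       square : ∀ i j → P i j * P i j ≡ (edgeDefect i j + pathDefect i j) + rest i j
       square i j = trans (expand (kron i j) (h i) (h j) (A i j) (walks₂ i j))
         (trans (cong₅ (λ kk kc aa ak ac → (kk * (h i * h i * (h i * h i)) + (+ 2 * (h i * h i)) * kc)
             + ((h i + h j) * (h i + h j) * aa + ((+ 2 * (h i * h i) * (h i + h j)) * ak + (+ 2 * (h i + h j)) * ac + walks₂ i j * walks₂ i j)))
             (kron-idem i j) (kron-walks i j) (A-idem i j) (A-kron i j) (triangleFree i j))
          (trans (shuffle (kron i j) (h i) (h j) (A i j) (walks₂ i j) (d i))
             (cong (λ z → (edgeDefect i j + pathDefect i j) + (kron i j * (h i * h i * (h i * h i) + + 2 * (h i * h i) * d i) + z + A i j * h i + A i j * h j + walks₂ i j)) kd ⟫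
             regroup (edgeDefect i j + pathDefect i j) (kron i j) (h i) (d i) (A i j * h i) (A i j * h j) (walks₂ i j))))
         where
         cong₅ : ∀ (F : ℤ → ℤ → ℤ → ℤ → ℤ → ℤ) {a a′ b b′ c c′ d d′ e e′} → a ≡ a′ → b ≡ b′ → c ≡ c′ → d ≡ d′ → e ≡ e′ → F a b c d e ≡ F a′ b′ c′ d′ e′
         cong₅ F refl refl refl refl refl = refl
         infixr 1 _⟫_
         _⟫_ : ∀ {x y z : ℤ} → x ≡ y → y ≡ z → x ≡ z
         _⟫_ = trans
         expand : ∀ k h h′ a c → (k * (h * h) + (h + h′) * a + c) * (k * (h * h) + (h + h′) * a + c)
           ≡ ((k * k) * (h * h * (h * h)) + (+ 2 * (h * h)) * (k * c))
             + ((h + h′) * (h + h′) * (a * a) + ((+ 2 * (h * h) * (h + h′)) * (a * k) + (+ 2 * (h + h′)) * (a * c) + c * c))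
         expand = solve-∀
         shuffle : ∀ k h h′ a c d → (k * (h * h * (h * h)) + (+ 2 * (h * h)) * (k * d))
             + ((h + h′) * (h + h′) * a + ((+ 2 * (h * h) * (h + h′)) * + 0 + (+ 2 * (h + h′)) * + 0 + c * c))
           ≡ (a * (+ 2 * (h * h′) + (h * h - h) + (h′ * h′ - h′)) + (+ 1 - k) * (c * c - c))
             + (k * (h * h * (h * h) + + 2 * (h * h) * d) + ((k * c) * c - k * c) + a * h + a * h′ + c)
         shuffle = solve-∀
         kd : (kron i j * walks₂ i j) * walks₂ i j - kron i j * walks₂ i j ≡ kron i j * (d i * d i - d i)
         kd = trans (cong (λ z → z * walks₂ i j - z) (kron-walks i j)) (trans (reassoc (kron i j) (d i) (walks₂ i j))
                (trans (cong (λ z → d i * z - kron i j * d i) (kron-walks i j)) (back (kron i j) (d i))))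
           where
           reassoc : ∀ k d c → (k * d) * c - k * d ≡ d * (k * c) - k * d
           reassoc = solve-∀
           back : ∀ k d → d * (k * d) - k * d ≡ k * (d * d - d)
           back = solve-∀
         regroup : ∀ e k h d x y c → e + (k * (h * h * (h * h) + + 2 * (h * h) * d) + k * (d * d - d) + x + y + c)
           ≡ e + (k * (h * h * (h * h) + + 2 * (h * h) * d + (d * d - d)) + x + y + c)
         regroup = solve-∀

       P-sym : ∀ i j → P i j ≡ P j i
       P-sym i j with i ≟ j
       ... | yes refl = refl
       ... | no p     = cong₂ _+_ (cong₂ _+_ (trans (cong (_* (h i * h i)) (kron-diff p)) (sym (trans (cong (_* (h j * h j)) (kron-diff (p ∘ sym))) refl)))
                                             (cong₂ _*_ (ℤ.+-comm (h i) (h j)) (A-sym i j))) (walks₂-sym i j)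

       sum-walks₂ : DZ.sum (λ i → DZ.sum (λ j → walks₂ i j)) ≡ DZ.sum (λ i → d i * d i)
       sum-walks₂ = trans (Σ-cong (λ i → trans (DZ.sum-swap (λ j l → A i l * A l j)) (Σ-cong (λ l → DZ.sum-* (A i l) (A l))))) (A-weighted d)

       sum-rest : DZ.sum (λ i → DZ.sum (rest i)) ≡ DZ.sum (λ i → ((f i + d i * h i) + d i * h i) + d i * d i)
       sum-rest = trans (Σ-cong (λ i → trans (DZ.sum-+ (λ j → kron i j * f i + A i j * h i + A i j * h j) (walks₂ i)) (cong (_+ DZ.sum (walks₂ i))
            (trans (DZ.sum-+ (λ j → kron i j * f i + A i j * h i) (λ j → A i j * h j)) (cong (_+ DZ.sum (λ j → A i j * h j))
               (trans (DZ.sum-+ (λ j → kron i j * f i) (λ j → A i j * h i)) (cong₂ _+_ (kron-sum i (λ _ → f i)) refl)))))))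
          (trans (DZ.sum-+ (λ i → f i + DZ.sum (λ j → A i j * h i) + DZ.sum (λ j → A i j * h j)) (λ i → DZ.sum (walks₂ i)))
            (trans (cong₂ _+_ (trans (DZ.sum-+ (λ i → f i + DZ.sum (λ j → A i j * h i)) (λ i → DZ.sum (λ j → A i j * h j)))
                 (cong₂ _+_ (trans (DZ.sum-+ f (λ i → DZ.sum (λ j → A i j * h i))) (cong (λ z → DZ.sum f + z) (A-weightedˡ h))) (A-weighted h))) sum-walks₂)
              (trans (cong (λ z → (z + DZ.sum (λ i → d i * h i)) + DZ.sum (λ i → d i * d i)) (sym (DZ.sum-+ f (λ i → d i * h i))))
                (trans (cong (_+ DZ.sum (λ i → d i * d i)) (sym (DZ.sum-+ (λ i → f i + d i * h i) (λ i → d i * h i))))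
                  (sym (DZ.sum-+ (λ i → (f i + d i * h i) + d i * h i) (λ i → d i * d i)))))))

       -- The relation h³ = h lowers the quartic in h to a quadratic, and a quadratic is expressible
       -- by the traces of M² and M and the order.
       reduce : ∀ i → ((f i + d i * h i) + d i * h i) + d i * d i ≡ + 9 * (h i * h i + d i) + + 4 * h i + - (+ 12) * + 1
       reduce i = trans (poly (d i)) (trans (cong (λ z → z * h i + + 2 * z + (+ 8 * (h i * h i) + + 11 * h i + + 6)) (cube i)) (final (d i)))
         where
         poly : ∀ d → let h = d - + 2 in ((h * h * (h * h) + + 2 * (h * h) * d + (d * d - d) + d * h) + d * h) + d * d
           ≡ (h * h * h) * h + + 2 * (h * h * h) + (+ 8 * (h * h) + + 11 * h + + 6)
         poly = solve-∀
         final : ∀ d → let h = d - + 2 in h * h + + 2 * h + (+ 8 * (h * h) + + 11 * h + + 6)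
           ≡ + 9 * (h * h + d) + + 4 * h + - (+ 12) * + 1
         final = solve-∀

     -- As M² is symmetric, the trace of its square is the sum of the squares of its entries, to
     -- which `square` and `reduce` apply.
     tr₄ : trace (power M 4) ≡ defect + (+ 9 * trace (power M 2) + + 4 * trace (power M 1) + - (+ 12) * order)
     tr₄ = trans (Σ-cong (λ i → trans (power-+ M 2 2 i i) (trans (Σ-cong (λ l → trans (cong₂ _*_ (power-2 i l) (trans (power-2 l i) (P-sym l i))) (square i l)))
             (DZ.sum-+ (λ l → edgeDefect i l + pathDefect i l) (rest i)))))
       (trans (DZ.sum-+ (λ i → DZ.sum (λ l → edgeDefect i l + pathDefect i l)) (λ i → DZ.sum (rest i)))
         (cong (λ z → defect + z) (trans sum-rest (trans (Σ-cong reduce) (trans (sum₃ (λ i → h i * h i + d i) h (λ _ → + 1) (+ 9) (+ 4) (- (+ 12)))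
           (sym (cong₂ (λ x y → + 9 * x + + 4 * y + - (+ 12) * order) tr₂ tr₁)))))))

-- From the spectrum to local structure: degrees, edges, components and twin leaves.

module LocalStructure where
 open BinaryForms using (module DZ; charForm-unique; module Evaluation; det≡)
 open PowerSeries using (module Power)
 open Elimination using (module DS)
 open Jacobi using (kron; kron-same; kron-diff; kron-sum; kron-sumʳ; δ≡kron; power; trace; traces-agree)
 open SpectralMoments
 open import Data.Integer.Base using (_≤_; +≤+; -1ℤ; _+_; _*_; _-_; -_)
 open import Data.Integer.Tactic.RingSolver using (solve-∀)
 open import Data.Bool.Base using (not)
 open import Data.Fin.Base using (zero; suc)
 open import Data.Fin.Properties using (_≟_)
 open ≡

 private
   module 𝕡 = Power

 qDet : ∀ {n} → Graph n → 𝕡.Carrier → 𝕡.Carrier → 𝕡.Carrier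
 qDet G a b = DS.det (λ i j → 𝕡.ι (Defs.δ i j) 𝕡.* a 𝕡.+ 𝕡.ι (- signlessLaplacian G i j) 𝕡.* b)

 qDet-cospectral : ∀ {n} {G H : Graph n} → QCospectral G H → ∀ a b → qDet G a b 𝕡.≈ qDet H a b
 qDet-cospectral {G = G} {H} c a b = 𝕡.trans (𝕡.sym (E.eval-detForm a b Defs.δ (λ i j → - signlessLaplacian G i j)))
   (𝕡.trans (𝕡.reflexive (cong (E.eval a b) (charForm-unique (signlessLaplacian G) (signlessLaplacian H) c))) (E.eval-detForm a b Defs.δ (λ i j → - signlessLaplacian H i j)))
   where
   module E = Evaluation 𝕡.𝕊

 -- At a = 1 + 2q, t = q the matrix a - tQ is 1 - q (Q - 2), so the common form yields the
 -- determinant whose logarithmic derivative carries the traces.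
 cospectral-traces : ∀ {n} {G H : Graph n} → QCospectral G H → ∀ k → trace (power (GraphOf.M G) (suc k)) ≡ trace (power (GraphOf.M H) (suc k))
 cospectral-traces {G = G} {H} c = traces-agree (GraphOf.M G) (GraphOf.M H)
   (𝕡.trans (𝕡.sym (shift G)) (𝕡.trans (qDet-cospectral {G = G} {H} c (𝕡.1# 𝕡.+ 𝕡.ι (+ 2) 𝕡.* 𝕡.q) 𝕡.q) (shift H)))
   where
   open 𝕡 hiding (trans; sym; refl; _+_; _*_; _-_; -_)
   shift : ∀ (G : Graph _) → qDet G (1# 𝕡.+ ι (+ 2) 𝕡.* q) q ≈ DS.det (λ i j → ι (kron i j) 𝕡.- q 𝕡.* ι (GraphOf.M G i j))
   shift G = DS.det-cong (λ i j → 𝕡.trans (𝕊.+-cong (𝕊.*-congʳ (reflexive (cong ι (δ≡kron i j)))) (𝕊.*-congʳ (ι-neg (signlessLaplacian G i j))))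
     (𝕡.trans (solve 4 (λ k l q t → k :* (con (+ 1) :+ t :* q) :+ (:- l) :* q := k :- q :* (l :- t :* k)) 𝕡.refl (ι (kron i j)) (ι (signlessLaplacian G i j)) q (ι (+ 2)))
       (𝕊.+-congˡ (𝕊.-‿cong (𝕊.*-congˡ (𝕡.sym (𝕡.trans (reflexive (cong ι (GraphOf.M≡Q-2 G i j)))
         (𝕡.trans (ι-+ (signlessLaplacian G i j) (- (+ 2 * kron i j))) (𝕊.+-congˡ (𝕡.trans (ι-neg (+ 2 * kron i j)) (𝕊.-‿cong (ι-* (+ 2) (kron i j)))))))))))))

 -- The local conditions that make excess and defect vanish term by term.
 record Tame {n} (G : Graph n) : Set where
   open GraphOf G
   field
     cube         : ∀ i → h i * h i * h i ≡ h i
     triangleFree : ∀ i j → A i j * walks₂ i j ≡ + 0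
     edges        : ∀ i j → edgeDefect i j ≡ + 0
     paths        : ∀ i j → pathDefect i j ≡ + 0

 private
   i*i-i-nonneg : ∀ i → + 0 ≤ i * i - i
   i*i-i-nonneg (+ zero)  = ℤ.≤-refl
   i*i-i-nonneg (+ suc n) = subst (+ 0 ≤_) (trans (ℤ.pos-* (suc n) n) (rearr (+ n))) (+≤+ ℕ.z≤n)
     where
     rearr : ∀ n → (+ 1 + n) * n ≡ (+ 1 + n) * (+ 1 + n) - (+ 1 + n)
     rearr = solve-∀
   i*i-i-nonneg -[1+ n ] = +≤+ ℕ.z≤n

   -- At d = 0 the value is -6. This is why isolated vertices have to be excluded before the third
   -- trace can be exploited.
   cube-nonneg : ∀ d → + 0 ≤ d → d ≢ + 0 → + 0 ≤ (d - + 2) * (d - + 2) * (d - + 2) - (d - + 2)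
   cube-nonneg (+ zero) _ p = contradiction refl p
   cube-nonneg (+ suc zero) _ _ = ℤ.≤-refl
   cube-nonneg (+ suc (suc k)) _ _ = subst (+ 0 ≤_) (sym (rearr (+ k))) (GraphOf.*-nonneg {0} (record { adj = λ () ; sym = λ () ; irrefl = λ () }) {+ suc k} (+≤+ ℕ.z≤n) (i*i-i-nonneg (+ k)))
     where
     rearr : ∀ k → ((+ 2 + k) - + 2) * ((+ 2 + k) - + 2) * ((+ 2 + k) - + 2) - ((+ 2 + k) - + 2) ≡ (+ 1 + k) * (k * k - k)
     rearr = solve-∀

 private
   +-cancelʳ : ∀ c a b → a + c ≡ b + c → a ≡ b
   +-cancelʳ c a b e = trans (isolate a c) (trans (cong (_- c) e) (sym (isolate b c)))
     where
     isolate : ∀ a c → a ≡ (a + c) - c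
     isolate = solve-∀

 h-values : ∀ z → z * z * z ≡ z → (z ≡ -1ℤ) ⊎ (z ≡ + 0) ⊎ (z ≡ + 1)
 h-values z e with ℤ.i*j≡0⇒i≡0∨j≡0 (z * z - + 1) {z} (trans (factor z) (trans (cong (_- z) e) (ℤ.+-inverseʳ z)))
   where
   factor : ∀ z → (z * z - + 1) * z ≡ z * z * z - z
   factor = solve-∀
 ... | inj₂ z≡0 = inj₂ (inj₁ z≡0)
 ... | inj₁ p with ℤ.i*j≡0⇒i≡0∨j≡0 (z - + 1) {z + + 1} (trans (factor z) p)
   where
   factor : ∀ z → (z - + 1) * (z + + 1) ≡ z * z - + 1
   factor = solve-∀
 ...   | inj₁ r = inj₂ (inj₂ (ℤ.i-j≡0⇒i≡j z (+ 1) r))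
 ...   | inj₂ r = inj₁ (ℤ.i-j≡0⇒i≡j z -1ℤ r)

 module _ {n} {G H : Graph n} (c : QCospectral G H) (tame : Tame G) (noIsolated : ∀ i → GraphOf.d H i ≢ + 0) where
   private
     module G = GraphOf G
     module H = GraphOf H
     open Tame tame
     tr≡ = cospectral-traces {G = G} {H} c

     excess-G : G.excess ≡ + 0
     excess-G = cong₂ _+_ (DZ.sum-0 (λ i → trans (cong (_- G.h i) (cube i)) (ℤ.+-inverseʳ (G.h i))))
       (DZ.sum-0 (λ i → DZ.sum-0 (triangleFree i)))

     excess-H : H.excess ≡ + 0
     excess-H = trans H.excess-spectral (trans (cong₂ _+_ (sym (tr≡ 2)) (cong₂ (λ x y → - (+ 3) * x + - (+ 4) * y + + 6 * H.order) (sym (tr≡ 1)) (sym (tr≡ 0))))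
       (trans (sym G.excess-spectral) excess-G))

     cubes-nonneg : ∀ i → + 0 ≤ H.h i * H.h i * H.h i - H.h i
     cubes-nonneg i = cube-nonneg (H.d i) (H.d-nonneg i) (noIsolated i)

     triangles-nonneg : ∀ i j → + 0 ≤ H.A i j * H.walks₂ i j
     triangles-nonneg i j = H.*-nonneg (H.A-nonneg i j) (H.walks₂-nonneg i j)

     split : (DZ.sum (λ i → H.h i * H.h i * H.h i - H.h i) ≡ + 0) × (H.C ≡ + 0)
     split = +-nonneg-zero (sum-nonneg _ cubes-nonneg) (sum-nonneg _ (λ i → sum-nonneg _ (triangles-nonneg i))) excess-H

   cospectral-cube : ∀ i → H.h i * H.h i * H.h i ≡ H.h i
   cospectral-cube i = ℤ.i-j≡0⇒i≡j _ (H.h i) (sum-nonneg-zero _ cubes-nonneg (proj₁ split) i)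

   private
     triangleFree-H : ∀ i j → H.A i j * H.walks₂ i j ≡ + 0
     triangleFree-H i = sum-nonneg-zero _ (triangles-nonneg i) (sum-nonneg-zero _ (λ i → sum-nonneg _ (triangles-nonneg i)) (proj₂ split) i)

     defect-G : G.defect ≡ + 0
     defect-G = DZ.sum-0 (λ i → DZ.sum-0 (λ j → cong₂ _+_ (edges i j) (paths i j)))

     defect-H : H.defect ≡ + 0
     defect-H = trans (+-cancelʳ (+ 9 * trace (power H.M 2) + + 4 * trace (power H.M 1) + - (+ 12) * H.order) H.defect G.defect
       (trans (sym (H.tr₄ cospectral-cube triangleFree-H)) (trans (sym (tr≡ 3)) (trans (G.tr₄ cube triangleFree)
         (cong₂ (λ x y → G.defect + (+ 9 * x + + 4 * y + - (+ 12) * G.order)) (tr≡ 1) (tr≡ 0)))))) defect-G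

     edge-nonneg : ∀ i j → + 0 ≤ H.edgeDefect i j
     edge-nonneg i j = H.*-nonneg (H.A-nonneg i j) (cases (h-values (H.h i) (cospectral-cube i)) (h-values (H.h j) (cospectral-cube j)))
       where
       E : ℤ → ℤ → ℤ
       E x y = + 2 * (x * y) + (x * x - x) + (y * y - y)
       cases : ∀ {x y} → (x ≡ -1ℤ) ⊎ (x ≡ + 0) ⊎ (x ≡ + 1) → (y ≡ -1ℤ) ⊎ (y ≡ + 0) ⊎ (y ≡ + 1) → + 0 ≤ E x y
       cases (inj₁ refl) (inj₁ refl) = +≤+ ℕ.z≤n
       cases (inj₁ refl) (inj₂ (inj₁ refl)) = +≤+ ℕ.z≤n
       cases (inj₁ refl) (inj₂ (inj₂ refl)) = +≤+ ℕ.z≤n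
       cases (inj₂ (inj₁ refl)) (inj₁ refl) = +≤+ ℕ.z≤n
       cases (inj₂ (inj₁ refl)) (inj₂ (inj₁ refl)) = +≤+ ℕ.z≤n
       cases (inj₂ (inj₁ refl)) (inj₂ (inj₂ refl)) = +≤+ ℕ.z≤n
       cases (inj₂ (inj₂ refl)) (inj₁ refl) = +≤+ ℕ.z≤n
       cases (inj₂ (inj₂ refl)) (inj₂ (inj₁ refl)) = +≤+ ℕ.z≤n
       cases (inj₂ (inj₂ refl)) (inj₂ (inj₂ refl)) = +≤+ ℕ.z≤n

     path-nonneg : ∀ i j → + 0 ≤ H.pathDefect i j
     path-nonneg i j = H.*-nonneg kr (i*i-i-nonneg (H.walks₂ i j))
       where
       kr : + 0 ≤ + 1 - kron i j
       kr with i ≟ j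
       ... | yes refl = subst (λ z → + 0 ≤ + 1 - z) (sym (kron-same i)) ℤ.≤-refl
       ... | no p     = subst (λ z → + 0 ≤ + 1 - z) (sym (kron-diff p)) (+≤+ ℕ.z≤n)

     terms-nonneg : ∀ i j → + 0 ≤ H.edgeDefect i j + H.pathDefect i j
     terms-nonneg i j = ℤ.+-mono-≤ (edge-nonneg i j) (path-nonneg i j)

   -- The formula for the fourth trace applies to H only after the third trace has bounded its
   -- degrees and excluded its triangles.
   cospectral-edges : ∀ i j → H.edgeDefect i j ≡ + 0
   cospectral-edges i j = proj₁ (+-nonneg-zero (edge-nonneg i j) (path-nonneg i j)
     (sum-nonneg-zero _ (terms-nonneg i) (sum-nonneg-zero _ (λ i → sum-nonneg _ (terms-nonneg i)) defect-H i) j))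

 cospectral-sum-h : ∀ {n} {G H : Graph n} → QCospectral G H → DZ.sum (GraphOf.h G) ≡ DZ.sum (GraphOf.h H)
 cospectral-sum-h {G = G} {H} c = trans (sym (GraphOf.tr₁ G)) (trans (cospectral-traces {G = G} {H} c 0) (GraphOf.tr₁ H))

 private
   -- The handshake argument: entries off the diagonal come in equal pairs.
   even-symmetric : ∀ {n} (f : Fin n → Fin n → ℤ) → (∀ i j → f i j ≡ f j i) → (∀ i → f i i ≡ + 0) →
     Σ ℤ λ e → DZ.sum (λ i → DZ.sum (f i)) ≡ + 2 * e
   even-symmetric {zero} f s z = + 0 , refl
   even-symmetric {suc n} f s z with even-symmetric (λ i j → f (suc i) (suc j)) (λ i j → s (suc i) (suc j)) (λ i → z (suc i))
   ... | e , p = DZ.sum (λ j → f zero (suc j)) + e ,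
     trans (cong₂ _+_ (cong (_+ DZ.sum (λ j → f zero (suc j))) (z zero))
       (trans (DZ.sum-+ (λ i → f (suc i) zero) (λ i → DZ.sum (λ j → f (suc i) (suc j)))) (cong₂ _+_ (DZ.sum-cong (λ i → s (suc i) zero)) p)))
       (rearr (DZ.sum (λ j → f zero (suc j))) e)
     where
     rearr : ∀ a e → (+ 0 + a) + (a + + 2 * e) ≡ + 2 * (a + e)
     rearr = solve-∀

 -- If S is a union of components, the columns of Q over S add up to twice the degree vector on S, and likewise
 -- for the complement and for rows; each of the three sums contributes a factor 2.
 disconnected⇒8∣det : ∀ {n} (G : Graph n) (S : Fin n → Bool) → (∀ i j → adj G i j ≡ true → S i ≡ S j) →
   ∀ r r′ → S r ≡ true → S r′ ≡ false → Σ ℤ λ X → charPoly (signlessLaplacian G) (+ 0) ≡ + 8 * X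
 disconnected⇒8∣det {n} G S closed r r′ Sr Sr′ = DZ.det K , trans (det≡ (λ i j → entry i j)) total
   where
   open GraphOf G
   N : Fin n → Fin n → ℤ
   N i j = - (kron i j * d i + A i j)
   entry : ∀ i j → + 0 * Defs.δ i j - signlessLaplacian G i j ≡ N i j
   entry i j = trans (cong (_- signlessLaplacian G i j) (ℤ.*-zeroˡ (Defs.δ i j))) (trans (ℤ.+-identityˡ _)
     (cong (λ z → - (z + A i j)) (cong₂ _*_ (δ≡kron i j) (sumFin≡sum (A i)))))
   s s′ : Fin n → ℤ
   s i = b2z (S i)
   s′ i = b2z (not (S i))
   closed-A : ∀ (t : Bool → ℤ) i j → t (S j) * A i j ≡ A i j * t (S i)
   closed-A t i j with adj G i j in e
   ... | true  = trans (ℤ.*-identityʳ (t (S j))) (trans (cong t (sym (closed i j e))) (sym (ℤ.*-identityˡ (t (S i)))))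
   ... | false = trans (ℤ.*-zeroʳ (t (S j))) (sym (ℤ.*-zeroˡ (t (S i))))

   N-sym : ∀ i j → N i j ≡ N j i
   N-sym i j with i ≟ j
   ... | yes refl = refl
   ... | no p     = cong -_ (cong₂ _+_ (trans (cong (_* d i) (kron-diff p)) (sym (cong (_* d j) (kron-diff (p ∘ sym))))) (A-sym i j))

   colSum : ∀ (t : Bool → ℤ) i → DZ.sum (λ j → t (S j) * N i j) ≡ - (+ 2) * (t (S i) * d i)
   colSum t i = trans (DZ.sum-cong (λ j → trans (expand (t (S j)) (kron i j) (d i) (A i j)) (cong (λ z → kron i j * (- (t (S j) * d i)) + -1ℤ * z) (closed-A t i j))))
     (trans (DZ.sum-+ (λ j → kron i j * (- (t (S j) * d i))) (λ j → -1ℤ * (A i j * t (S i))))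
       (trans (cong₂ _+_ (kron-sum i (λ j → - (t (S j) * d i))) (trans (DZ.sum-* -1ℤ (λ j → A i j * t (S i))) (cong (-1ℤ *_) (DZ.sum-*ʳ (t (S i)) (A i)))))
         (combine (t (S i)) (d i))))
     where
     expand : ∀ t k d a → t * (- (k * d + a)) ≡ k * (- (t * d)) + -1ℤ * (t * a)
     expand = solve-∀
     combine : ∀ t d → - (t * d) + -1ℤ * (d * t) ≡ - (+ 2) * (t * d)
     combine = solve-∀

   N₁ N₂ N₂ᵀ K : Fin n → Fin n → ℤ
   N₁ = DZ.setCol N r (λ i → s i * d i)
   N₂ = DZ.setCol N₁ r′ (λ i → s′ i * d i)
   N₂ᵀ i j = N₂ j i

   setCol-ext : ∀ (M : Fin n → Fin n → ℤ) k {u v : Fin n → ℤ} → (∀ i → u i ≡ v i) → ∀ i j → DZ.setCol M k u i j ≡ DZ.setCol M k v i j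
   setCol-ext M k p i j with j ≟ k
   ... | yes _ = p i
   ... | no _  = refl

   s-r : s r ≡ + 1
   s-r = cong b2z Sr
   s′-r : s′ r ≡ + 0
   s′-r = cong (b2z ∘ not) Sr
   s′-r′ : s′ r′ ≡ + 1
   s′-r′ = cong (b2z ∘ not) Sr′

   step : ∀ (M : Fin n → Fin n → ℤ) k (t : Fin n → ℤ) c u → t k ≡ + 1 → (∀ i → DZ.sum (λ j → t j * M i j) ≡ c * u i) → DZ.det M ≡ c * DZ.det (DZ.setCol M k u)
   step M k t c u t₁ e = trans (sym (trans (cong (_* DZ.det M) t₁) (ℤ.*-identityˡ _))) (trans (sym (DZ.det-setCol-combination M k t))
     (trans (DZ.det-cong (setCol-ext M k e)) (DZ.setCol-scale M k c u)))

   N₁-sum : ∀ i → DZ.sum (λ j → s′ j * N₁ i j) ≡ - (+ 2) * (s′ i * d i)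
   N₁-sum i = trans (DZ.sum-cong term) (colSum (b2z ∘ not) i)
     where
     byCases : ∀ j → Dec (j ≡ r) → s′ j * N₁ i j ≡ s′ j * N i j
     byCases j (yes refl) = trans (cong (_* N₁ i r) s′-r) (trans (ℤ.*-zeroˡ (N₁ i r)) (sym (trans (cong (_* N i r) s′-r) (ℤ.*-zeroˡ (N i r)))))
     byCases j (no p)     = cong (s′ j *_) (DZ.setCol-other N r (λ i → s i * d i) i j p)
     term : ∀ j → s′ j * N₁ i j ≡ s′ j * N i j
     term j = byCases j (j ≟ r)

   degreeSum : Σ ℤ λ e → DZ.sum (λ i → s i * d i) ≡ + 2 * e
   degreeSum with even-symmetric (λ i j → A i j * s i)
       (λ i j → trans (sym (closed-A b2z i j)) (trans (cong (s j *_) (A-sym i j)) (ℤ.*-comm (s j) (A j i))))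
       (λ i → trans (cong (_* s i) (A-irrefl i)) (ℤ.*-zeroˡ (s i)))
   ... | e , p = e , trans (DZ.sum-cong (λ i → trans (ℤ.*-comm (s i) (d i)) (sym (DZ.sum-*ʳ (s i) (A i))))) p

   -- Half of the sum of the rows of `N₂` over S. In column r this is half the degree sum of S, an
   -- integer by the handshake lemma; in column r′ the two indicators annihilate each other;
   -- elsewhere the old column sum of the symmetric matrix remains.
   wOf : ∀ j → Dec (j ≡ r′) → Dec (j ≡ r) → ℤ
   wOf j (yes _) _       = + 0
   wOf j (no _)  (yes _) = proj₁ degreeSum
   wOf j (no _)  (no _)  = - (s j * d j)

   w : Fin n → ℤ
   w j = wOf j (j ≟ r′) (j ≟ r)

   ss′ : ∀ i → s i * (s′ i * d i) ≡ + 0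
   ss′ i with S i
   ... | true  = trans (ℤ.*-identityˡ _) (ℤ.*-zeroˡ (d i))
   ... | false = ℤ.*-zeroˡ (+ 1 * d i)

   ss : ∀ i → s i * (s i * d i) ≡ s i * d i
   ss i with S i
   ... | true  = ℤ.*-identityˡ _
   ... | false = trans (ℤ.*-zeroˡ (+ 0 * d i)) (sym (ℤ.*-zeroˡ (d i)))

   rowSum : ∀ j p p′ → DZ.sum (λ i → s i * N₂ᵀ j i) ≡ + 2 * wOf j p p′
   rowSum j (yes refl) _ = DZ.sum-0 (λ i → trans (cong (s i *_) (DZ.setCol-at N₁ r′ (λ i → s′ i * d i) i)) (ss′ i))
   rowSum j (no p) (yes refl) = trans (DZ.sum-cong (λ i → trans (cong (s i *_) (trans (DZ.setCol-other N₁ r′ (λ i → s′ i * d i) i j p) (DZ.setCol-at N r (λ i → s i * d i) i))) (ss i))) (proj₂ degreeSum)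
   rowSum j (no p) (no p′) = trans (DZ.sum-cong (λ i → cong (s i *_) (trans (DZ.setCol-other N₁ r′ (λ i → s′ i * d i) i j p) (trans (DZ.setCol-other N r (λ i → s i * d i) i j p′) (N-sym i j))))) (trans (colSum b2z j) (rearr (s j * d j)))
     where
     rearr : ∀ z → - (+ 2) * z ≡ + 2 * (- z)
     rearr = solve-∀

   K = DZ.setCol N₂ᵀ r w

   total : DZ.det N ≡ + 8 * DZ.det K
   total = trans (step N r s (- (+ 2)) (λ i → s i * d i) s-r (colSum b2z))
     (trans (cong (- (+ 2) *_) (trans (step N₁ r′ s′ (- (+ 2)) (λ i → s′ i * d i) s′-r′ N₁-sum)
        (cong (- (+ 2) *_) (trans (DZ.det-transpose N₂) (step N₂ᵀ r s (+ 2) w s-r (λ j → rowSum j (j ≟ r′) (j ≟ r))))))) (collect (DZ.det K)))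
     where
     collect : ∀ z → - (+ 2) * (- (+ 2) * (+ 2 * z)) ≡ + 8 * z
     collect = solve-∀

 -- Subtracting f w at the place w leaves a nonnegative family with sum zero.
 sum-at : ∀ {n} (f : Fin n → ℤ) → (∀ i → + 0 ≤ f i) → ∀ w → DZ.sum f ≡ f w → ∀ i → i ≢ w → f i ≡ + 0
 sum-at {n} f p w e i i≢w = trans (sym at-i) (sum-nonneg-zero g g≥0 Σg≡0 i)
   where
   g : Fin n → ℤ
   g i = f i + (- f w) * kron i w
   at-i : g i ≡ f i
   at-i = trans (cong (λ z → f i + (- f w) * z) (kron-diff i≢w)) (trans (cong (λ z → f i + z) (ℤ.*-zeroʳ (- f w))) (ℤ.+-identityʳ (f i)))
   g≥0 : ∀ i → + 0 ≤ g i
   g≥0 i with i ≟ w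
   ... | yes refl = subst (+ 0 ≤_) (sym (trans (cong (λ z → f w + (- f w) * z) (kron-same w)) (cancel (f w)))) ℤ.≤-refl
     where
     cancel : ∀ z → z + (- z) * + 1 ≡ + 0
     cancel = solve-∀
   ... | no q = subst (+ 0 ≤_) (sym (trans (cong (λ z → f i + (- f w) * z) (kron-diff q)) (trans (cong (λ z → f i + z) (ℤ.*-zeroʳ (- f w))) (ℤ.+-identityʳ (f i))))) (p i)
   Σg≡0 : DZ.sum g ≡ + 0
   Σg≡0 = trans (DZ.sum-+ f (λ i → (- f w) * kron i w)) (trans (cong₂ _+_ e (kron-sumʳ w (λ _ → - f w))) (ℤ.+-inverseʳ (f w)))

 module _ {n} (G : Graph n) where
   open GraphOf G

   leaf-neighbour : ∀ {u w} → d u ≡ + 1 → adj G u w ≡ true → ∀ {x} → adj G u x ≡ true → x ≡ w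
   leaf-neighbour {u} {w} du uw {x} ux with x ≟ w
   ... | yes p = p
   ... | no p  with () ← trans (sym (cong b2z ux)) (sum-at (A u) (A-nonneg u) w (trans du (sym (cong b2z uw))) x p)

   -- At a leaf the diagonal entry of 1 - Q is zero, so its column is minus the indicator of its
   -- neighbour. Two leaves at the same vertex give equal columns.
   twinLeaves⇒charPoly-1≡0 : ∀ {u v w} → u ≢ v → d u ≡ + 1 → d v ≡ + 1 → adj G u w ≡ true → adj G v w ≡ true →
     charPoly (signlessLaplacian G) (+ 1) ≡ + 0
   twinLeaves⇒charPoly-1≡0 {u} {v} {w} u≢v du dv uw vw = trans (det≡ {M = λ i j → + 1 * Defs.δ i j - signlessLaplacian G i j} (λ i j → refl)) (DZ.det-equalCols u v u≢v (λ i j → + 1 * Defs.δ i j - signlessLaplacian G i j) (λ a → trans (col u du a) (trans (cong (-_) (same a)) (sym (col v dv a)))))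
     where
     same : ∀ a → A a u ≡ A a v
     same a with adj G a u in au | adj G a v in av
     ... | true  | true  = refl
     ... | false | false = refl
     ... | true  | false with refl ← leaf-neighbour du uw (trans (Graph.sym G u a) au) with () ← trans (sym vw) (trans (Graph.sym G v a) av)
     ... | false | true  with refl ← leaf-neighbour dv vw (trans (Graph.sym G v a) av) with () ← trans (sym uw) (trans (Graph.sym G u a) au)
     col : ∀ x → d x ≡ + 1 → ∀ a → + 1 * Defs.δ a x - signlessLaplacian G a x ≡ - A a x
     col x dx a = trans (cong₂ (λ k m → + 1 * k - (k * m + A a x)) (δ≡kron a x) (sumFin≡sum (A a))) (entry a)
       where
       zeroCase : ∀ m b → + 1 * + 0 - (+ 0 * m + b) ≡ - b
       zeroCase = solve-∀
       oneCase : ∀ b → + 1 * + 1 - (+ 1 * + 1 + b) ≡ - b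
       oneCase = solve-∀
       entry : ∀ a → + 1 * kron a x - (kron a x * d a + A a x) ≡ - A a x
       entry a with a ≟ x
       ... | yes refl = trans (cong₂ (λ k m → + 1 * k - (k * m + A a a)) (kron-same a) dx) (oneCase (A a a))
       ... | no p     = trans (cong (λ k → + 1 * k - (k * d a + A a x)) (kron-diff p)) (zeroCase (d a) (A a x))

-- Algebra of 2 × 2 matrices and the transfer matrices of a sun.

module TransferMatrices where
 open IntegerCoefficients using (module RingZ)
 open import Algebra.Bundles using (CommutativeRing)
 open import Level using (0ℓ)

 trues : List Bool → ℕ
 trues []           = 0
 trues (true ∷ bs)  = suc (trues bs)
 trues (false ∷ bs) = trues bs

 module Two (R : CommutativeRing 0ℓ 0ℓ) where
   open CommutativeRing R renaming (zero to *-zero)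
   open RingZ R
   open import Relation.Binary.Reasoning.Setoid setoid
   open import Algebra.Properties.Semiring.Exp semiring using (_^_)

   record M₂ : Set where
     constructor mat
     field e₁₁ e₁₂ e₂₁ e₂₂ : Carrier
   open M₂ public

   infix 4 _≋_
   record _≋_ (A B : M₂) : Set where
     constructor mat≈
     field
       p₁₁ : e₁₁ A ≈ e₁₁ B
       p₁₂ : e₁₂ A ≈ e₁₂ B
       p₂₁ : e₂₁ A ≈ e₂₁ B
       p₂₂ : e₂₂ A ≈ e₂₂ B
   open _≋_ public

   ≋-refl : ∀ {A} → A ≋ A
   ≋-refl = mat≈ refl refl refl refl

   ≋-sym : ∀ {A B} → A ≋ B → B ≋ A
   ≋-sym (mat≈ a b c d) = mat≈ (sym a) (sym b) (sym c) (sym d)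

   ≋-trans : ∀ {A B C} → A ≋ B → B ≋ C → A ≋ C
   ≋-trans (mat≈ a b c d) (mat≈ a′ b′ c′ d′) = mat≈ (trans a a′) (trans b b′) (trans c c′) (trans d d′)

   I₂ : M₂
   I₂ = mat 1# 0# 0# 1#

   infixr 7 _⊗_
   _⊗_ : M₂ → M₂ → M₂
   mat a b c d ⊗ mat a′ b′ c′ d′ = mat (a * a′ + b * c′) (a * b′ + b * d′) (c * a′ + d * c′) (c * b′ + d * d′)

   infixr 7 _⊙_
   _⊙_ : Carrier → M₂ → M₂
   s ⊙ mat a b c d = mat (s * a) (s * b) (s * c) (s * d)

   tr : M₂ → Carrier
   tr A = e₁₁ A + e₂₂ A

   det₂ : M₂ → Carrier
   det₂ A = e₁₁ A * e₂₂ A - e₁₂ A * e₂₁ A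

   ⊗-cong : ∀ {A B C D} → A ≋ B → C ≋ D → A ⊗ C ≋ B ⊗ D
   ⊗-cong (mat≈ a b c d) (mat≈ a′ b′ c′ d′) = mat≈
     (+-cong (*-cong a a′) (*-cong b c′)) (+-cong (*-cong a b′) (*-cong b d′))
     (+-cong (*-cong c a′) (*-cong d c′)) (+-cong (*-cong c b′) (*-cong d d′))

   ⊙-cong : ∀ {s s′ A B} → s ≈ s′ → A ≋ B → s ⊙ A ≋ s′ ⊙ B
   ⊙-cong e (mat≈ a b c d) = mat≈ (*-cong e a) (*-cong e b) (*-cong e c) (*-cong e d)

   tr-cong : ∀ {A B} → A ≋ B → tr A ≈ tr B
   tr-cong (mat≈ a _ _ d) = +-cong a d

   private
     assoc-entry : ∀ a b a′ b′ c′ d′ x y → (a * a′ + b * c′) * x + (a * b′ + b * d′) * y ≈ a * (a′ * x + b′ * y) + b * (c′ * x + d′ * y)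
     assoc-entry = solve 8 (λ a b a′ b′ c′ d′ x y → (a :* a′ :+ b :* c′) :* x :+ (a :* b′ :+ b :* d′) :* y := a :* (a′ :* x :+ b′ :* y) :+ b :* (c′ :* x :+ d′ :* y)) refl

   ⊗-assoc : ∀ A B C → (A ⊗ B) ⊗ C ≋ A ⊗ (B ⊗ C)
   ⊗-assoc (mat a b c d) (mat a′ b′ c′ d′) (mat x z y w) = mat≈
     (assoc-entry a b a′ b′ c′ d′ x y) (assoc-entry a b a′ b′ c′ d′ z w)
     (assoc-entry c d a′ b′ c′ d′ x y) (assoc-entry c d a′ b′ c′ d′ z w)

   ⊗-identityˡ : ∀ A → I₂ ⊗ A ≋ A
   ⊗-identityˡ (mat a b c d) = mat≈ (l a c) (l b d) (r a c) (r b d)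
     where
     l : ∀ x y → 1# * x + 0# * y ≈ x
     l = solve 2 (λ x y → con (+ 1) :* x :+ con (+ 0) :* y := x) refl
     r : ∀ x y → 0# * x + 1# * y ≈ y
     r = solve 2 (λ x y → con (+ 0) :* x :+ con (+ 1) :* y := y) refl

   ⊗-identityʳ : ∀ A → A ⊗ I₂ ≋ A
   ⊗-identityʳ (mat a b c d) = mat≈ (l a b) (r a b) (l c d) (r c d)
     where
     l : ∀ x y → x * 1# + y * 0# ≈ x
     l = solve 2 (λ x y → x :* con (+ 1) :+ y :* con (+ 0) := x) refl
     r : ∀ x y → x * 0# + y * 1# ≈ y
     r = solve 2 (λ x y → x :* con (+ 0) :+ y :* con (+ 1) := y) refl

   ⊙-⊗ : ∀ s A B → (s ⊙ A) ⊗ B ≋ s ⊙ (A ⊗ B)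
   ⊙-⊗ s (mat a b c d) (mat a′ b′ c′ d′) = mat≈ (f a b a′ c′) (f a b b′ d′) (f c d a′ c′) (f c d b′ d′)
     where
     f : ∀ a b x y → s * a * x + s * b * y ≈ s * (a * x + b * y)
     f a b x y = solve 5 (λ s a b x y → s :* a :* x :+ s :* b :* y := s :* (a :* x :+ b :* y)) refl s a b x y

   ⊗-⊙ : ∀ s A B → A ⊗ (s ⊙ B) ≋ s ⊙ (A ⊗ B)
   ⊗-⊙ s (mat a b c d) (mat a′ b′ c′ d′) = mat≈ (f a b a′ c′) (f a b b′ d′) (f c d a′ c′) (f c d b′ d′)
     where
     f : ∀ a b x y → a * (s * x) + b * (s * y) ≈ s * (a * x + b * y)
     f a b x y = solve 5 (λ s a b x y → a :* (s :* x) :+ b :* (s :* y) := s :* (a :* x :+ b :* y)) refl s a b x y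

   tr-⊙ : ∀ s A → tr (s ⊙ A) ≈ s * tr A
   tr-⊙ s A = sym (distribˡ s (e₁₁ A) (e₂₂ A))

   det₂-⊗ : ∀ A B → det₂ (A ⊗ B) ≈ det₂ A * det₂ B
   det₂-⊗ (mat a b c d) (mat a′ b′ c′ d′) = solve 8 (λ a b c d a′ b′ c′ d′ →
     (a :* a′ :+ b :* c′) :* (c :* b′ :+ d :* d′) :- (a :* b′ :+ b :* d′) :* (c :* a′ :+ d :* c′)
     := (a :* d :- b :* c) :* (a′ :* d′ :- b′ :* c′)) refl a b c d a′ b′ c′ d′

   -- Multiplying the relation AS = SB by the adjugate of S uses no inverse. The factor det S stays
   -- on both sides because S need not be invertible.
   tr-conjugate : ∀ A B S → A ⊗ S ≋ S ⊗ B → det₂ S * tr A ≈ det₂ S * tr B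
   tr-conjugate A@(mat a b c d) B@(mat a′ b′ c′ d′) S@(mat x y z w) e = begin
     det₂ S * tr A ≈⟨ solve 8 (λ a b c d x y z w → (x :* w :- y :* z) :* (a :+ d) := ((a :* x :+ b :* z) :* w :- (a :* y :+ b :* w) :* z) :+ ((c :* y :+ d :* w) :* x :- (c :* x :+ d :* z) :* y)) refl a b c d x y z w ⟩
     (e₁₁ (A ⊗ S) * w - e₁₂ (A ⊗ S) * z) + (e₂₂ (A ⊗ S) * x - e₂₁ (A ⊗ S) * y)
       ≈⟨ +-cong (+-cong (*-congʳ (p₁₁ e)) (-‿cong (*-congʳ (p₁₂ e)))) (+-cong (*-congʳ (p₂₂ e)) (-‿cong (*-congʳ (p₂₁ e)))) ⟩
     (e₁₁ (S ⊗ B) * w - e₁₂ (S ⊗ B) * z) + (e₂₂ (S ⊗ B) * x - e₂₁ (S ⊗ B) * y)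
       ≈⟨ solve 8 (λ a b c d x y z w → ((x :* a :+ y :* c) :* w :- (x :* b :+ y :* d) :* z) :+ ((z :* b :+ w :* d) :* x :- (z :* a :+ w :* c) :* y) := (x :* w :- y :* z) :* (a :+ d)) refl a′ b′ c′ d′ x y z w ⟩
     det₂ S * tr B ∎

   product : (Bool → M₂) → List Bool → M₂
   product T []       = I₂
   product T (b ∷ bs) = T b ⊗ product T bs

   product-++ : ∀ T bs cs → product T (bs ++ cs) ≋ product T bs ⊗ product T cs
   product-++ T []       cs = ≋-sym (⊗-identityˡ _)
   product-++ T (b ∷ bs) cs = ≋-trans (⊗-cong ≋-refl (product-++ T bs cs)) (≋-sym (⊗-assoc (T b) (product T bs) (product T cs)))

   intertwine : ∀ {T U : Bool → M₂} {S} → (∀ b → T b ⊗ S ≋ S ⊗ U b) → ∀ bs → product T bs ⊗ S ≋ S ⊗ product U bs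
   intertwine {S = S} e [] = ≋-trans (⊗-identityˡ S) (≋-sym (⊗-identityʳ S))
   intertwine {T} {U} {S} e (b ∷ bs) = ≋-trans (⊗-assoc (T b) (product T bs) S) (≋-trans (⊗-cong ≋-refl (intertwine {T} {U} {S} e bs))
     (≋-trans (≋-sym (⊗-assoc (T b) S (product U bs))) (≋-trans (⊗-cong (e b) ≋-refl) (⊗-assoc S (U b) (product U bs)))))

   -- This serves three times: to clear the denominators that come from leaves, to clear 1 - q in
   -- the eigenbasis, and to collect signs at a = 0.
   product-scale : ∀ (T U : Bool → M₂) s → (U true ≋ s ⊙ T true) → (U false ≋ T false) → ∀ bs → product U bs ≋ s ^ trues bs ⊙ product T bs
   product-scale T U s et ef [] = mat≈ (sym (*-identityˡ _)) (sym (*-identityˡ _)) (sym (*-identityˡ _)) (sym (*-identityˡ _))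
   product-scale T U s et ef (false ∷ bs) = ≋-trans (⊗-cong ef (product-scale T U s et ef bs)) (⊗-⊙ (s ^ trues bs) (T false) (product T bs))
   product-scale T U s et ef (true ∷ bs) = ≋-trans (⊗-cong et (product-scale T U s et ef bs)) (≋-trans (⊙-⊗ s (T true) _)
     (≋-trans (⊙-cong refl (⊗-⊙ (s ^ trues bs) (T true) (product T bs))) (mat≈ (sym (*-assoc _ _ _)) (sym (*-assoc _ _ _)) (sym (*-assoc _ _ _)) (sym (*-assoc _ _ _)))))

   -- Transfer matrices of the recurrence (a - t deg) x = t (x⁻ + x⁺) along the cycle; a vertex carrying a
   -- leaf is scaled by a - t.
   transfer : Carrier → Carrier → Bool → M₂
   transfer a t false = mat (a - ι (+ 2) * t) (- t) t 0#
   transfer a t true  = mat ((a - ι (+ 3) * t) * (a - t) - t * t) (- (t * (a - t))) (t * (a - t)) 0#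

   -- The determinant of a periodic tridiagonal matrix: the trace of the monodromy, corrected by
   -- twice the product of the off-diagonal entries. A factor a - t is attached to each hub by its
   -- eliminated leaf.
   cycleDet : Carrier → Carrier → List Bool → Carrier
   cycleDet a t bs = tr (product (transfer a t) bs) - ι (+ 2) * (t ^ length bs * (a - t) ^ trues bs)

-- Elimination around a weighted cycle and of pendant leaves.

module CycleElimination where
 open PowerSeries using (module Power)
 open Elimination
 open TransferMatrices using (module Two; trues)
 open import Data.Nat.Base using (_≤_; _<_)
 open import Data.Bool.Base using (if_then_else_)
 open import Data.List.Base using (map)
 open import Data.List.Relation.Unary.All using (All; []; _∷_)
 import Data.List.Relation.Unary.All as All
 open import Data.List.Relation.Unary.AllPairs using ([]; _∷_)
 open import Data.List.Relation.Unary.Unique.Propositional using (Unique)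

 open Power
 open import Relation.Binary.Reasoning.Setoid setoid
 module T𝕊 = Two 𝕊
 open T𝕊

 upFrom : ℕ → ℕ → List ℕ
 upFrom k zero    = []
 upFrom k (suc m) = k ∷ upFrom (suc k) m

 ∈-upFrom⁻ : ∀ k m {i} → i ∈ upFrom k m → k ≤ i × i < k ℕ.+ m
 ∈-upFrom⁻ k (suc m) (here ≡.refl) = ℕ.≤-refl , ≡.subst (k <_) (≡.sym (ℕ.+-suc k m)) (s≤s (ℕ.m≤m+n k m))
 ∈-upFrom⁻ k (suc m) {i} (there p) with ∈-upFrom⁻ (suc k) m p
 ... | l , u = ℕ.<⇒≤ l , ≡.subst (i <_) (≡.sym (ℕ.+-suc k m)) u

 ∈-upFrom⁺ : ∀ k m {i} → k ≤ i → i < k ℕ.+ m → i ∈ upFrom k m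
 ∈-upFrom⁺ k zero    l u = contradiction (ℕ.<-≤-trans u (ℕ.≤-trans (ℕ.≤-reflexive (ℕ.+-identityʳ k)) l)) (ℕ.<-irrefl ≡.refl)
 ∈-upFrom⁺ k (suc m) {i} l u with k ℕ.≟ i
 ... | yes ≡.refl = here ≡.refl
 ... | no k≢i     = there (∈-upFrom⁺ (suc k) m (ℕ.≤∧≢⇒< l k≢i) (≡.subst (i <_) (ℕ.+-suc k m) u))

 upFrom-unique : ∀ k m → Unique (upFrom k m)
 upFrom-unique k zero    = []
 upFrom-unique k (suc m) = All.tabulate (λ i∈ → ℕ.<⇒≢ (proj₁ (∈-upFrom⁻ (suc k) m i∈))) ∷ upFrom-unique (suc k) m

 hubs : (ℕ → Bool) → ℕ → ℕ → List ℕ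
 hubs b s zero    = []
 hubs b s (suc m) = if b s then s ∷ hubs b (suc s) m else hubs b (suc s) m

 ∈-hubs⁻ : ∀ b s m {k} → k ∈ hubs b s m → s ≤ k × k < s ℕ.+ m × b k ≡ true
 ∈-hubs⁻ b s (suc m) {k} p with b s in bs
 ∈-hubs⁻ b s (suc m) {k} (here ≡.refl) | true = ℕ.≤-refl , ≡.subst (s <_) (≡.sym (ℕ.+-suc s m)) (s≤s (ℕ.m≤m+n s m)) , bs
 ∈-hubs⁻ b s (suc m) {k} (there p) | true with ∈-hubs⁻ b (suc s) m p
 ... | l , u , t = ℕ.<⇒≤ l , ≡.subst (k <_) (≡.sym (ℕ.+-suc s m)) u , t
 ∈-hubs⁻ b s (suc m) {k} p | false with ∈-hubs⁻ b (suc s) m p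
 ... | l , u , t = ℕ.<⇒≤ l , ≡.subst (k <_) (≡.sym (ℕ.+-suc s m)) u , t

 ∈-hubs⁺ : ∀ b s m {k} → s ≤ k → k < s ℕ.+ m → b k ≡ true → k ∈ hubs b s m
 ∈-hubs⁺ b s zero l u t = contradiction (ℕ.<-≤-trans u (ℕ.≤-trans (ℕ.≤-reflexive (ℕ.+-identityʳ s)) l)) (ℕ.<-irrefl ≡.refl)
 ∈-hubs⁺ b s (suc m) {k} l u t with b s in bs | s ℕ.≟ k
 ... | true  | yes ≡.refl = here ≡.refl
 ... | true  | no s≢k     = there (∈-hubs⁺ b (suc s) m (ℕ.≤∧≢⇒< l s≢k) (≡.subst (k <_) (ℕ.+-suc s m) u) t)
 ... | false | yes ≡.refl with () ← ≡.trans (≡.sym t) bs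
 ... | false | no s≢k     = ∈-hubs⁺ b (suc s) m (ℕ.≤∧≢⇒< l s≢k) (≡.subst (k <_) (ℕ.+-suc s m) u) t

 hubs-unique : ∀ b s m → Unique (hubs b s m)
 hubs-unique b s zero = []
 hubs-unique b s (suc m) with b s
 ... | true  = All.tabulate (λ i∈ → ℕ.<⇒≢ (proj₁ (∈-hubs⁻ b (suc s) m i∈))) ∷ hubs-unique b (suc s) m
 ... | false = hubs-unique b (suc s) m

 length-hubs : ∀ b s m → length (hubs b s m) ≡ trues (map b (upFrom s m))
 length-hubs b s zero = ≡.refl
 length-hubs b s (suc m) with b s
 ... | true  = cong suc (length-hubs b (suc s) m)
 ... | false = length-hubs b (suc s) m

 choose : ∀ {A P : Set} → Dec P → A → A → A
 choose (yes _) x y = x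
 choose (no _)  x y = y

 e : ℕ → ℕ → Carrier
 e k i = choose (k ℕ.≟ i) 1# 0#

 e-same : ∀ k → e k k ≡ 1#
 e-same k with k ℕ.≟ k
 ... | yes _ = ≡.refl
 ... | no p  = contradiction ≡.refl p

 e-diff : ∀ {k i} → k ≢ i → e k i ≡ 0#
 e-diff {k} {i} k≢i with k ℕ.≟ i
 ... | yes p = contradiction p k≢i
 ... | no _  = ≡.refl

 step : Carrier → Carrier → M₂
 step t y = mat y (- t) t 0#

 next : ℕ → ℕ → ℕ
 next ℓ i = choose (suc i ℕ.≟ ℓ) 0 (suc i)

 module Cycle (t : Carrier) (y : ℕ → Carrier) (t₀ : coeff t 0 ≡ + 0) (y₀ : ∀ i → coeff (y i) 0 ≡ + 1) (z : ℕ) where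
   private
     -- All positions enter through indicator values, so that one polynomial identity proves the
     -- elimination step for all i and j at once, without case distinctions.
     Wf : (x₁ x₂ x₃ kᵢ kⱼ zᵢ zⱼ yᵢ γ yk α yz β : Carrier) → Carrier
     Wf x₁ x₂ x₃ kᵢ kⱼ zᵢ zⱼ yᵢ γ yk α yz β =
       (x₁ * yᵢ - t * (x₂ + x₃)) + (kᵢ * kⱼ * (γ - yk) + (zᵢ * zⱼ * (α - yz) + β * (kᵢ * zⱼ + zᵢ * kⱼ)))

   -- The cycle k, …, z obtained by contracting 0, …, k - 1: weights γ and α at k and z, and an extra weight β on kz.
   W : ℕ → Carrier → Carrier → Carrier → ℕ → ℕ → Carrier
   W k γ β α i j = Wf (e i j) (e (suc i) j) (e (suc j) i) (e k i) (e k j) (e z i) (e z j) (y i) γ (y k) α (y z) β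

   private
     W≡ : ∀ k γ β α i j {x₁ x₂ x₃ kᵢ kⱼ zᵢ zⱼ} → e i j ≡ x₁ → e (suc i) j ≡ x₂ → e (suc j) i ≡ x₃ → e k i ≡ kᵢ → e k j ≡ kⱼ → e z i ≡ zᵢ → e z j ≡ zⱼ →
       W k γ β α i j ≡ Wf x₁ x₂ x₃ kᵢ kⱼ zᵢ zⱼ (y i) γ (y k) α (y z) β
     W≡ k γ β α i j ≡.refl ≡.refl ≡.refl ≡.refl ≡.refl ≡.refl ≡.refl = ≡.refl

     n≢1+n : ∀ {n} → suc n ≢ n
     n≢1+n = ℕ.1+n≢n

   -- The closed form for the contracted cycle. Its bracket is the determinant of the path from k to
   -- z, the (1,1) entry of step γ · X · step α, minus β² times that of the interior; the last term
   -- comes from going around the cycle, with m the number of edges of the path.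
   D : Carrier → Carrier → Carrier → ℕ → M₂ → Carrier
   D γ β α m X = ((α * (γ * e₁₁ X - t * e₂₁ X) + t * (γ * e₁₂ X - t * e₂₂ X)) - β * β * e₁₁ X) + ι (+ 2) * (β * t ^ m)

   X : ℕ → ℕ → M₂
   X k zero    = I₂
   X k (suc m) = step t (y k) ⊗ X (suc k) m

   module _ {k : ℕ} {γ β α : Carrier} (k<z : k < z) where
     private
       k≢z : k ≢ z
       k≢z = ℕ.<⇒≢ k<z

     W-kk : W k γ β α k k ≈ γ
     W-kk = trans (reflexive (W≡ k γ β α k k (e-same k) (e-diff n≢1+n) (e-diff n≢1+n) (e-same k) (e-same k) (e-diff (k≢z ∘ ≡.sym)) (e-diff (k≢z ∘ ≡.sym))))
       (solve 6 (λ t yk γ α yz β → (con (+ 1) :* yk :- t :* (con (+ 0) :+ con (+ 0))) :+ (con (+ 1) :* con (+ 1) :* (γ :- yk) :+ (con (+ 0) :* con (+ 0) :* (α :- yz) :+ β :* (con (+ 1) :* con (+ 0) :+ con (+ 0) :* con (+ 1)))) := γ)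
          refl t (y k) γ α (y z) β)

     W-ik : ∀ {i} → k < i → W k γ β α i k ≈ β * e z i - t * e (suc k) i
     W-ik {i} k<i = trans (reflexive (W≡ k γ β α i k (e-diff (ℕ.<⇒≢ k<i ∘ ≡.sym)) (e-diff (λ p → ℕ.<⇒≢ (ℕ.m<n⇒m<1+n k<i) (≡.sym p))) ≡.refl (e-diff (ℕ.<⇒≢ k<i)) (e-same k) ≡.refl (e-diff (k≢z ∘ ≡.sym))))
       (solve 9 (λ t yi γ α yz β x zi yk → (con (+ 0) :* yi :- t :* (con (+ 0) :+ x)) :+ (con (+ 0) :* con (+ 1) :* (γ :- yk) :+ (zi :* con (+ 0) :* (α :- yz) :+ β :* (con (+ 0) :* con (+ 0) :+ zi :* con (+ 1)))) := β :* zi :- t :* x)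
          refl t (y i) γ α (y z) β (e (suc k) i) (e z i) (y k))

     W-ki : ∀ {j} → k < j → W k γ β α k j ≈ β * e z j - t * e (suc k) j
     W-ki {j} k<j = trans (reflexive (W≡ k γ β α k j (e-diff (ℕ.<⇒≢ k<j)) ≡.refl (e-diff (λ p → ℕ.<⇒≢ (ℕ.m<n⇒m<1+n k<j) (≡.sym p))) (e-same k) (e-diff (ℕ.<⇒≢ k<j)) (e-diff (k≢z ∘ ≡.sym)) ≡.refl))
       (solve 9 (λ t yi γ α yz β x zi yk → (con (+ 0) :* yi :- t :* (x :+ con (+ 0))) :+ (con (+ 1) :* con (+ 0) :* (γ :- yk) :+ (con (+ 0) :* zi :* (α :- yz) :+ β :* (con (+ 1) :* zi :+ con (+ 0) :* con (+ 0)))) := β :* zi :- t :* x)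
          refl t (y k) γ α (y z) β (e (suc k) j) (e z j) (y k))

     W-zz : W k γ β α z z ≈ α
     W-zz = trans (reflexive (W≡ k γ β α z z (e-same z) (e-diff n≢1+n) (e-diff n≢1+n) (e-diff k≢z) (e-diff k≢z) (e-same z) (e-same z)))
       (solve 6 (λ t yk γ α yz β → (con (+ 1) :* yz :- t :* (con (+ 0) :+ con (+ 0))) :+ (con (+ 0) :* con (+ 0) :* (γ :- yk) :+ (con (+ 1) :* con (+ 1) :* (α :- yz) :+ β :* (con (+ 0) :* con (+ 1) :+ con (+ 1) :* con (+ 0)))) := α)
          refl t (y k) γ α (y z) β)

     private
       γ⁺ β⁺ α⁺ : Carrier
       γ⁺ = y (suc k) - t * t * inv γ
       β⁺ = t * (β * inv γ)
       α⁺ = α - β * β * inv γ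

     -- Vertex k has only the neighbours k + 1 and z, so elimination changes just their two weights
     -- and the weight between them. The result has the same shape, one vertex shorter.
     W-eliminate : ∀ {i j} → k < i → k < j → eliminate (W k γ β α) k i j ≈ W (suc k) γ⁺ β⁺ α⁺ i j
     W-eliminate {i} {j} k<i k<j = trans (𝕊.+-cong
         (reflexive (W≡ k γ β α i j ≡.refl ≡.refl ≡.refl (e-diff (ℕ.<⇒≢ k<i)) (e-diff (ℕ.<⇒≢ k<j)) ≡.refl ≡.refl))
         (𝕊.-‿cong (𝕊.*-cong (W-ik k<i) (𝕊.*-cong (inv-cong W-kk) (W-ki k<j)))))
       (solve 16 (λ t x₁ x₂ x₃ yi pi pj zi zj γ yk α yz β u yk′ →
           ((x₁ :* yi :- t :* (x₂ :+ x₃)) :+ (con (+ 0) :* con (+ 0) :* (γ :- yk) :+ (zi :* zj :* (α :- yz) :+ β :* (con (+ 0) :* zj :+ zi :* con (+ 0)))))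
             :- (β :* zi :- t :* pi) :* (u :* (β :* zj :- t :* pj))
           := (x₁ :* yi :- t :* (x₂ :+ x₃)) :+ (pi :* pj :* ((yk′ :- t :* t :* u) :- yk′) :+ (zi :* zj :* ((α :- β :* β :* u) :- yz) :+ (t :* (β :* u)) :* (pi :* zj :+ zi :* pj))))
         refl t (e i j) (e (suc i) j) (e (suc j) i) (y i) (e (suc k) i) (e (suc k) j) (e z i) (e z j) γ (y k) α (y z) β (inv γ) (y (suc k)))

   private
     coeff₀-sq : ∀ f → coeff (t * t * f) 0 ≡ + 0
     coeff₀-sq f = coeff₀-*0 (t * t) f (coeff₀-*0 t t t₀)

   -- Induction on the length of the path. In the base case the path edge and the extra weight join
   -- the same two vertices and merge into β - t.
   pivots-W : ∀ m k γ β α → z ≡ suc m ℕ.+ k → coeff γ 0 ≡ + 1 →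
     pivots (W k γ β α) (upFrom k (suc (suc m))) ≈ D γ β α (suc m) (X (suc k) m)
   pivots-W zero k γ β α ≡.refl γ₀ = begin
     W k γ β α k k * ((W k γ β α (suc k) (suc k) - W k γ β α (suc k) k * (inv (W k γ β α k k) * W k γ β α k (suc k))) * 1#)
       ≈⟨ 𝕊.*-cong (W-kk k<z) (𝕊.*-congʳ (𝕊.+-cong (W-zz k<z) (𝕊.-‿cong (𝕊.*-cong corner (𝕊.*-cong (inv-cong (W-kk k<z)) corner′))))) ⟩
     γ * ((α - (β - t) * (inv γ * (β - t))) * 1#)
       ≈⟨ solve 5 (λ γ α β t u → γ :* ((α :- (β :- t) :* (u :* (β :- t))) :* con (+ 1)) := γ :* α :- (γ :* u) :* ((β :- t) :* (β :- t))) refl γ α β t (inv γ) ⟩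
     γ * α - (γ * inv γ) * ((β - t) * (β - t)) ≈⟨ 𝕊.+-congˡ (𝕊.-‿cong (𝕊.*-congʳ (inv-inverse γ γ₀))) ⟩
     γ * α - 1# * ((β - t) * (β - t))
       ≈⟨ solve 4 (λ γ α β t → γ :* α :- con (+ 1) :* ((β :- t) :* (β :- t))
            := ((α :* (γ :* con (+ 1) :- t :* con (+ 0)) :+ t :* (γ :* con (+ 0) :- t :* con (+ 1))) :- β :* β :* con (+ 1)) :+ con (+ 2) :* (β :* (t :* con (+ 1)))) refl γ α β t ⟩
     D γ β α 1 I₂ ∎
     where
     k<z : k < suc k
     k<z = ℕ.≤-refl
     corner : W k γ β α (suc k) k ≈ β - t
     corner = trans (W-ik k<z k<z) (trans (reflexive (cong₂ (λ x w → β * x - t * w) (e-same (suc k)) (e-same (suc k)))) (solve 2 (λ β t → β :* con (+ 1) :- t :* con (+ 1) := β :- t) refl β t))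
     corner′ : W k γ β α k (suc k) ≈ β - t
     corner′ = trans (W-ki k<z k<z) (trans (reflexive (cong₂ (λ x w → β * x - t * w) (e-same (suc k)) (e-same (suc k)))) (solve 2 (λ β t → β :* con (+ 1) :- t :* con (+ 1) := β :- t) refl β t))
   pivots-W (suc m) k γ β α z≡ γ₀ = begin
     W k γ β α k k * pivots (eliminate (W k γ β α) k) (upFrom (suc k) (suc (suc m)))
       ≈⟨ 𝕊.*-cong (W-kk k<z) (pivots-cong-∈ (upFrom (suc k) (suc (suc m))) (λ i∈ j∈ → W-eliminate k<z (proj₁ (∈-upFrom⁻ (suc k) (suc (suc m)) i∈)) (proj₁ (∈-upFrom⁻ (suc k) (suc (suc m)) j∈)))) ⟩
     γ * pivots (W (suc k) γ⁺ β⁺ α⁺) (upFrom (suc k) (suc (suc m)))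
       ≈⟨ 𝕊.*-congˡ (pivots-W m (suc k) γ⁺ β⁺ α⁺ (≡.trans z≡ (cong suc (≡.sym (ℕ.+-suc m k)))) (coeff₀-minus0 (y (suc k)) (t * t * inv γ) (y₀ (suc k)) (coeff₀-sq (inv γ)))) ⟩
     γ * D γ⁺ β⁺ α⁺ (suc m) X′
       ≈⟨ solve 11 (λ γ u y′ t β α a b c d p →
            γ :* (((((α :- β :* β :* u) :* ((y′ :- t :* t :* u) :* a :- t :* c)) :+ t :* ((y′ :- t :* t :* u) :* b :- t :* d)) :- (t :* (β :* u)) :* (t :* (β :* u)) :* a) :+ con (+ 2) :* ((t :* (β :* u)) :* p))
            := (((γ :* α) :* (y′ :* a :- t :* c) :- (γ :* u) :* (α :* t :* t :* a :+ β :* β :* (y′ :* a :- t :* c) :- β :* β :* u :* (t :* t :* a) :+ t :* t :* β :* β :* u :* a)) :+ t :* (γ :* (y′ :* b :- t :* d) :- (γ :* u) :* (t :* t :* b))) :+ con (+ 2) :* ((γ :* u) :* (β :* (t :* p))))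
            refl γ (inv γ) (y (suc k)) t β α (e₁₁ X′) (e₁₂ X′) (e₂₁ X′) (e₂₂ X′) (t ^ suc m) ⟩
     -- The solver treats `inv γ` as a variable; every product with γ is therefore gathered into one
     -- argument, where it can be replaced by 1.
     expr (γ * inv γ) ≈⟨ expr-cong (inv-inverse γ γ₀) ⟩
     expr 1#
       ≈⟨ solve 11 (λ γ u y′ t β α a b c d p →
            (((γ :* α) :* (y′ :* a :- t :* c) :- con (+ 1) :* (α :* t :* t :* a :+ β :* β :* (y′ :* a :- t :* c) :- β :* β :* u :* (t :* t :* a) :+ t :* t :* β :* β :* u :* a)) :+ t :* (γ :* (y′ :* b :- t :* d) :- con (+ 1) :* (t :* t :* b))) :+ con (+ 2) :* (con (+ 1) :* (β :* (t :* p)))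
            := ((α :* (γ :* (y′ :* a :+ (:- t) :* c) :- t :* (t :* a :+ con (+ 0) :* c)) :+ t :* (γ :* (y′ :* b :+ (:- t) :* d) :- t :* (t :* b :+ con (+ 0) :* d))) :- β :* β :* (y′ :* a :+ (:- t) :* c)) :+ con (+ 2) :* (β :* (t :* p)))
            refl γ (inv γ) (y (suc k)) t β α (e₁₁ X′) (e₁₂ X′) (e₂₁ X′) (e₂₂ X′) (t ^ suc m) ⟩
     D γ β α (suc (suc m)) (X (suc k) (suc m)) ∎
     where
     k<z : k < z
     k<z = ≡.subst (k <_) (≡.sym z≡) (s≤s (ℕ.m≤n+m k (suc m)))
     X′ = X (suc (suc k)) m
     γ⁺ = y (suc k) - t * t * inv γ
     β⁺ = t * (β * inv γ)
     α⁺ = α - β * β * inv γ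
     a = e₁₁ X′
     b = e₁₂ X′
     c = e₂₁ X′
     d = e₂₂ X′
     y′ = y (suc k)
     u = inv γ
     expr : Carrier → Carrier
     expr o = (((γ * α) * (y′ * a - t * c) - o * (α * t * t * a + β * β * (y′ * a - t * c) - β * β * u * (t * t * a) + t * t * β * β * u * a)) + t * (γ * (y′ * b - t * d) - o * (t * t * b))) + ι (+ 2) * (o * (β * (t * t ^ suc m)))
     expr-cong : ∀ {o o′} → o ≈ o′ → expr o ≈ expr o′
     expr-cong p = 𝕊.+-cong (𝕊.+-cong (𝕊.+-congˡ (𝕊.-‿cong (𝕊.*-congʳ p))) (𝕊.*-congˡ (𝕊.+-congˡ (𝕊.-‿cong (𝕊.*-congʳ p))))) (𝕊.*-congˡ (𝕊.*-congʳ p))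

   cycleMatrix : ℕ → ℕ → Carrier
   cycleMatrix i j = e i j * y i - t * (e (next (suc z) i) j + e (next (suc z) j) i)

   private
     e-next : ∀ {i j} → j < suc z → e (next (suc z) i) j ≈ e (suc i) j + e z i * e 0 j
     e-next {i} {j} j≤z with suc i ℕ.≟ suc z
     ... | yes ≡.refl = sym (trans (reflexive (cong₂ (λ x w → x + w * e 0 j) (e-diff (λ p → ℕ.<⇒≢ j≤z (≡.sym p))) (e-same i))) (solve 1 (λ x → con (+ 0) :+ con (+ 1) :* x := x) refl (e 0 j)))
     ... | no p = sym (trans (reflexive (cong (λ w → e (suc i) j + w * e 0 j) (e-diff {z} {i} (λ q → p (cong suc (≡.sym q)))))) (solve 2 (λ x w → w :+ con (+ 0) :* x := w) refl (e 0 j) (e (suc i) j)))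

     -- The edge from z back to 0 is taken as the extra weight of the contracted cycle, so the
     -- induction starts with β = - t.
     cycleMatrix≈W : ∀ {i j} → i < suc z → j < suc z → cycleMatrix i j ≈ W 0 (y 0) (- t) (y z) i j
     cycleMatrix≈W {i} {j} i<ℓ j<ℓ = trans (𝕊.+-congˡ (𝕊.-‿cong (𝕊.*-congˡ (𝕊.+-cong (e-next j<ℓ) (e-next i<ℓ)))))
       (solve 11 (λ x₁ yi t x₂ x₃ zi zj oi oj y0 yz →
          x₁ :* yi :- t :* ((x₂ :+ zi :* oj) :+ (x₃ :+ zj :* oi)) := (x₁ :* yi :- t :* (x₂ :+ x₃)) :+ (oi :* oj :* (y0 :- y0) :+ (zi :* zj :* (yz :- yz) :+ (:- t) :* (oi :* zj :+ zi :* oj))))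
          refl (e i j) (y i) t (e (suc i) j) (e (suc j) i) (e z i) (e z j) (e 0 i) (e 0 j) (y 0) (y z))

   pivots-cycle : ∀ {m} → z ≡ suc m → pivots cycleMatrix (upFrom 0 (suc z)) ≈ tr (step t (y 0) ⊗ X 1 m ⊗ step t (y z)) - ι (+ 2) * t ^ suc z
   pivots-cycle {m} z≡ = begin
     pivots cycleMatrix (upFrom 0 (suc z)) ≈⟨ pivots-cong-∈ (upFrom 0 (suc z)) (λ i∈ j∈ → cycleMatrix≈W (proj₂ (∈-upFrom⁻ 0 (suc z) i∈)) (proj₂ (∈-upFrom⁻ 0 (suc z) j∈))) ⟩
     pivots (W 0 (y 0) (- t) (y z)) (upFrom 0 (suc z)) ≡⟨ cong (λ w → pivots (W 0 (y 0) (- t) (y z)) (upFrom 0 (suc w))) z≡ ⟩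
     pivots (W 0 (y 0) (- t) (y z)) (upFrom 0 (suc (suc m))) ≈⟨ pivots-W m 0 (y 0) (- t) (y z) (≡.trans z≡ (≡.sym (ℕ.+-identityʳ (suc m)))) (y₀ 0) ⟩
     D (y 0) (- t) (y z) (suc m) (X 1 m)
       ≈⟨ solve 8 (λ y0 t yz a b c d p → ((yz :* (y0 :* a :- t :* c) :+ t :* (y0 :* b :- t :* d)) :- (:- t) :* (:- t) :* a) :+ con (+ 2) :* ((:- t) :* (t :* p))
            := ((y0 :* (a :* yz :+ b :* t) :+ (:- t) :* (c :* yz :+ d :* t)) :+ (t :* (a :* (:- t) :+ b :* con (+ 0)) :+ con (+ 0) :* (c :* (:- t) :+ d :* con (+ 0)))) :- con (+ 2) :* (t :* (t :* p)))
            refl (y 0) t (y z) (e₁₁ (X 1 m)) (e₁₂ (X 1 m)) (e₂₁ (X 1 m)) (e₂₂ (X 1 m)) (t ^ m) ⟩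
     tr (step t (y 0) ⊗ X 1 m ⊗ step t (y z)) - ι (+ 2) * t ^ suc (suc m) ≡⟨ cong (λ w → tr (step t (y 0) ⊗ X 1 m ⊗ step t (y z)) - ι (+ 2) * t ^ suc w) (≡.sym z≡) ⟩
     tr (step t (y 0) ⊗ X 1 m ⊗ step t (y z)) - ι (+ 2) * t ^ suc z ∎

 private variable
   V : Set

 ΣL : (ℕ → Carrier) → List ℕ → Carrier
 ΣL f []       = 0#
 ΣL f (k ∷ ks) = f k + ΣL f ks

 ΣL-cong : ∀ {f g} ks → (∀ {k} → k ∈ ks → f k ≈ g k) → ΣL f ks ≈ ΣL g ks
 ΣL-cong []       p = refl
 ΣL-cong (k ∷ ks) p = 𝕊.+-cong (p (here ≡.refl)) (ΣL-cong ks (p ∘ there))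

 ΣL-0 : ∀ {f} ks → (∀ {k} → k ∈ ks → f k ≈ 0#) → ΣL f ks ≈ 0#
 ΣL-0 []       p = refl
 ΣL-0 (k ∷ ks) p = trans (𝕊.+-cong (p (here ≡.refl)) (ΣL-0 ks (p ∘ there))) (𝕊.+-identityˡ 0#)

 ΣL-single : ∀ {f} ks i → Unique ks → i ∈ ks → (∀ {k} → k ≢ i → f k ≈ 0#) → ΣL f ks ≈ f i
 ΣL-single (k ∷ ks) i u@(_ ∷ _) (here ≡.refl) p = trans (𝕊.+-congˡ (ΣL-0 ks (λ k∈ → p (head∉tail u k∈)))) (𝕊.+-identityʳ _)
 ΣL-single (k ∷ ks) i u@(_ ∷ u′) (there i∈) p = trans (𝕊.+-cong (p (λ { ≡.refl → head∉tail u i∈ ≡.refl })) (ΣL-single ks i u′ i∈ p)) (𝕊.+-identityˡ _)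

 module Pendant (leaf : ℕ → V) (π : Carrier) (π₀ : coeff π 0 ≡ + 1) where
   reduced : (V → V → Carrier) → List ℕ → V → V → Carrier
   reduced M ks i j = M i j - ΣL (λ k → M i (leaf k) * (inv π * M (leaf k) j)) ks

   -- Leaves are pairwise nonadjacent, so eliminating one does not touch the rows and columns of the
   -- others. All leaf pivots equal π and the corrections simply add up.
   pivots-leaves : ∀ (M : V → V → Carrier) ks ys → Unique ks →
     (∀ {k} → k ∈ ks → M (leaf k) (leaf k) ≈ π) →
     (∀ {k k′} → k ∈ ks → k′ ∈ ks → k ≢ k′ → M (leaf k) (leaf k′) ≈ 0#) →
     pivots M (map leaf ks ++ ys) ≈ π ^ length ks * pivots (reduced M ks) ys
   pivots-leaves M [] ys u dπ o = trans (pivots-cong (λ i j → solve 1 (λ m → m := m :- con (+ 0)) refl (M i j)) ys) (sym (𝕊.*-identityˡ _))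
   pivots-leaves M (l ∷ ks) ys u@(_ ∷ u′) dπ o = begin
     M (leaf l) (leaf l) * pivots M₁ (map leaf ks ++ ys)
       ≈⟨ 𝕊.*-cong (dπ (here ≡.refl)) (pivots-leaves M₁ ks ys u′
            (λ {k} k∈ → trans (row k∈ (leaf k)) (dπ (there k∈)))
            (λ {k} {k′} k∈ k′∈ p → trans (row k∈ (leaf k′)) (o (there k∈) (there k′∈) p))) ⟩
     π * (π ^ length ks * pivots (reduced M₁ ks) ys) ≈⟨ 𝕊.*-assoc _ _ _ ⟨
     π ^ suc (length ks) * pivots (reduced M₁ ks) ys ≈⟨ 𝕊.*-congˡ (pivots-cong same ys) ⟩
     π ^ suc (length ks) * pivots (reduced M (l ∷ ks)) ys ∎
     where
     M₁ = eliminate M (leaf l)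
     l≢ : ∀ {k} → k ∈ ks → k ≢ l
     l≢ = head∉tail u
     row : ∀ {k} → k ∈ ks → ∀ j → M₁ (leaf k) j ≈ M (leaf k) j
     row {k} k∈ j = trans (𝕊.+-congˡ (𝕊.-‿cong (𝕊.*-congʳ (o (there k∈) (here ≡.refl) (l≢ k∈))))) (solve 2 (λ m x → m :- con (+ 0) :* x := m) refl (M (leaf k) j) _)
     col : ∀ {k} → k ∈ ks → ∀ i → M₁ i (leaf k) ≈ M i (leaf k)
     col {k} k∈ i = trans (𝕊.+-congˡ (𝕊.-‿cong (𝕊.*-congˡ (𝕊.*-congˡ (o (here ≡.refl) (there k∈) (l≢ k∈ ∘ ≡.sym)))))) (solve 3 (λ m x w → m :- x :* (w :* con (+ 0)) := m) refl (M i (leaf k)) _ _)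
     same : ∀ i j → reduced M₁ ks i j ≈ reduced M (l ∷ ks) i j
     same i j = trans (𝕊.+-cong (𝕊.+-congˡ (𝕊.-‿cong (𝕊.*-congˡ (𝕊.*-congʳ (inv-cong (dπ (here ≡.refl)))))))
                                (𝕊.-‿cong (ΣL-cong ks (λ k∈ → 𝕊.*-cong (col k∈ i) (𝕊.*-congˡ (row k∈ j))))))
                      (solve 3 (λ m x s → (m :- x) :- s := m :- (x :+ s)) refl (M i j) _ _)

 pivots-map : ∀ {U : Set} (f : U → V) (M : V → V → Carrier) xs → pivots M (map f xs) ≈ pivots (λ i j → M (f i) (f j)) xs
 pivots-map f M []       = refl
 pivots-map f M (x ∷ xs) = 𝕊.*-congˡ (pivots-map f (eliminate M (f x)) xs)

-- Sun graphs and the reduction of their determinant to the transfer product.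

module SunGraphs where
 open BinaryForms using (module DZ)
 open PowerSeries using (module Power)
 open Elimination
 open TransferMatrices using (trues)
 open CycleElimination
 open Jacobi using (kron; kron-same; kron-diff; kron-sum; δ≡kron)
 open SpectralMoments using (module GraphOf; sumFin≡sum)
 open LocalStructure using (qDet)
 open import Data.Nat.Base using (_≤_; _<_)
 open import Data.Fin.Base using (zero; suc)
 open import Data.List.Base using (map; allFin)
 open import Data.List.Membership.Propositional.Properties using (∈-map⁻; ∈-map⁺; ∈-++⁺ˡ; ∈-++⁺ʳ; ∈-allFin)
 open import Data.List.Membership.Propositional.Properties.WithK using (unique∧set⇒bag)
 open import Data.List.Relation.Binary.BagAndSetEquality using (∼bag⇒↭)
 open import Data.List.Relation.Binary.Permutation.Propositional as Perm using (_↭_)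
 import Data.List.Relation.Binary.Permutation.Propositional.Properties as PermP
 open import Data.List.Relation.Unary.All using (All; []; _∷_)
 import Data.List.Relation.Unary.All as All
 import Data.List.Relation.Unary.All.Properties as AllP
 open import Data.List.Relation.Unary.AllPairs using ([]; _∷_)
 open import Data.List.Relation.Unary.Unique.Propositional using (Unique)
 import Data.List.Relation.Unary.Unique.Propositional.Properties as UniqueP
 open import Function.Bundles using (mk⇔)

 private
   choose-yes : ∀ {A P : Set} (d : Dec P) {x y : A} → P → choose d x y ≡ x
   choose-yes (yes _) p = ≡.refl
   choose-yes (no ¬p) p = contradiction p ¬p

   choose-no : ∀ {A P : Set} (d : Dec P) {x y : A} → (P → ⊥) → choose d x y ≡ y
   choose-no (yes p) ¬p = contradiction p ¬p
   choose-no (no _)  ¬p = ≡.refl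

 next-wrap : ∀ {ℓ i} → suc i ≡ ℓ → next ℓ i ≡ 0
 next-wrap {ℓ} {i} p = choose-yes (suc i ℕ.≟ ℓ) p

 next-suc : ∀ {ℓ i} → suc i ≢ ℓ → next ℓ i ≡ suc i
 next-suc {ℓ} {i} p = choose-no (suc i ℕ.≟ ℓ) p

 iterate : ℕ → ℕ → ℕ → ℕ
 iterate ℓ zero    i = i
 iterate ℓ (suc k) i = next ℓ (iterate ℓ k i)

 private
   -- At most ℓ steps wrap around at most once. Both outcomes are written additively, so neither
   -- subtraction nor remainders occur.
   iterate-value : ∀ {ℓ i} k → i < ℓ → k ≤ ℓ → iterate ℓ k i < ℓ × ((iterate ℓ k i ≡ i ℕ.+ k) ⊎ (iterate ℓ k i ℕ.+ ℓ ≡ i ℕ.+ k))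
   iterate-value {i = i} zero i<ℓ _ = i<ℓ , inj₁ (≡.sym (ℕ.+-identityʳ i))
   iterate-value {ℓ} {i} (suc k) i<ℓ k<ℓ with iterate-value k i<ℓ (ℕ.<⇒≤ k<ℓ) | suc (iterate ℓ k i) ℕ.≟ ℓ
   ... | it<ℓ , inj₁ p | yes w = ℕ.≤-trans (s≤s z≤n) i<ℓ , inj₂ (≡.trans (≡.sym w) (≡.trans (cong suc p) (≡.sym (ℕ.+-suc i k))))
   ... | it<ℓ , inj₂ p | yes w = contradiction (≡.subst₂ _≤_ (cong suc (ℕ.+-suc i k)) (≡.trans (cong (ℕ._+ ℓ) (≡.sym w)) (cong suc p)) (ℕ.+-mono-≤ i<ℓ k<ℓ)) (ℕ.<-irrefl ≡.refl)
   ... | it<ℓ , inj₁ p | no w = ℕ.≤∧≢⇒< it<ℓ w , inj₁ (≡.trans (cong suc p) (≡.sym (ℕ.+-suc i k)))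
   ... | it<ℓ , inj₂ p | no w = ℕ.≤∧≢⇒< it<ℓ w , inj₂ (≡.trans (cong suc p) (≡.sym (ℕ.+-suc i k)))

 iterate≢ : ∀ {ℓ i} k → i < ℓ → suc k < ℓ → iterate ℓ (suc k) i ≢ i
 iterate≢ {ℓ} {i} k i<ℓ k<ℓ eq with iterate-value (suc k) i<ℓ (ℕ.<⇒≤ k<ℓ)
 ... | _ , inj₁ p = ℕ.m≢1+m+n i (≡.trans (≡.sym eq) (≡.trans p (ℕ.+-suc i k)))
 ... | _ , inj₂ p = ℕ.<⇒≢ k<ℓ (≡.sym (ℕ.+-cancelˡ-≡ i ℓ (suc k) (≡.trans (cong (ℕ._+ ℓ) (≡.sym eq)) p)))

 next< : ∀ {ℓ i} → i < ℓ → next ℓ i < ℓ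
 next< {ℓ} {i} i<ℓ = proj₁ (iterate-value {ℓ} {i} 1 i<ℓ (ℕ.≤-trans (s≤s z≤n) i<ℓ))

 next-injective : ∀ {ℓ i j} → next ℓ i ≡ next ℓ j → i ≡ j
 next-injective {ℓ} {i} {j} p with suc i ℕ.≟ ℓ | suc j ℕ.≟ ℓ
 ... | yes a | yes b = ℕ.suc-injective (≡.trans a (≡.sym b))
 ... | yes _ | no _ with () ← p
 ... | no _ | yes _ with () ← p
 ... | no _  | no _  = ℕ.suc-injective p

 next-surjective : ∀ {ℓ i} → i < ℓ → Σ ℕ λ p → p < ℓ × next ℓ p ≡ i
 next-surjective {suc ℓ} {zero}  _   = ℓ , ℕ.≤-refl , next-wrap ≡.refl
 next-surjective {suc ℓ} {suc i} i<ℓ = i , ℕ.<⇒≤ i<ℓ , next-suc (ℕ.<⇒≢ i<ℓ)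

 -- A sun graph: a cycle on ℓ core vertices, of which the i-th carries a pendant leaf exactly when b i holds.
 record Sun {n} (G : Graph n) (ℓ : ℕ) (b : ℕ → Bool) : Set where
   field
     core leaf  : ℕ → Fin n
     core-inj   : ∀ {i j} → i < ℓ → j < ℓ → core i ≡ core j → i ≡ j
     leaf-inj   : ∀ {i j} → i < ℓ → j < ℓ → b i ≡ true → b j ≡ true → leaf i ≡ leaf j → i ≡ j
     core≢leaf  : ∀ {i j} → i < ℓ → j < ℓ → b j ≡ true → core i ≢ leaf j
     locate     : ∀ u → (Σ ℕ λ i → i < ℓ × core i ≡ u) ⊎ (Σ ℕ λ i → i < ℓ × b i ≡ true × leaf i ≡ u)
     core-next  : ∀ {i} → i < ℓ → adj G (core i) (core (next ℓ i)) ≡ true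
     core-core  : ∀ {i j} → i < ℓ → j < ℓ → adj G (core i) (core j) ≡ true → (j ≡ next ℓ i) ⊎ (i ≡ next ℓ j)
     leaf-core  : ∀ {i} → i < ℓ → b i ≡ true → adj G (leaf i) (core i) ≡ true
     leaf-only  : ∀ {i u} → i < ℓ → b i ≡ true → adj G (leaf i) u ≡ true → u ≡ core i

 -- Degrees and walk counts are sums of zeros and ones; a repetition-free list of the places where
 -- the value is one evaluates them.
 count-unique : ∀ {n} (f : Fin n → Bool) (xs : List (Fin n)) → Unique xs → (∀ w → f w ≡ true → w ∈ xs) → (∀ {w} → w ∈ xs → f w ≡ true) →
   DZ.sum (λ w → b2z (f w)) ≡ + length xs
 count-unique f [] u from to = DZ.sum-0 (λ w → zeroAt w (f w) ≡.refl)
   where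
   zeroAt : ∀ w c → f w ≡ c → b2z (f w) ≡ + 0
   zeroAt w true  p with () ← from w p
   zeroAt w false p = cong b2z p
 count-unique {n} f (x ∷ xs) u@(_ ∷ u′) from to = ≡.trans (DZ.sum-cong split) (≡.trans (DZ.sum-+ (λ w → kron x w) (λ w → b2z (f′ w)))
   (cong₂ ℤ._+_ (≡.trans (DZ.sum-cong (λ w → ≡.sym (ℤ.*-identityʳ (kron x w)))) (kron-sum x (λ _ → + 1))) (count-unique f′ xs u′ from′ to′)))
   where
   f′ : Fin n → Bool
   f′ w = choose (w Fin.≟ x) false (f w)
   split : ∀ w → b2z (f w) ≡ kron x w ℤ.+ b2z (f′ w)
   split w with w Fin.≟ x
   ... | yes ≡.refl = ≡.trans (cong b2z (to (here ≡.refl))) (≡.sym (≡.trans (ℤ.+-identityʳ _) (kron-same x)))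
   ... | no p       = ≡.sym (≡.trans (cong (ℤ._+ b2z (f w)) (kron-diff (p ∘ ≡.sym))) (ℤ.+-identityˡ _))
   from′ : ∀ w → f′ w ≡ true → w ∈ xs
   from′ w p with w Fin.≟ x
   ... | no w≢x with from w p
   ...   | here w≡x = contradiction w≡x w≢x
   ...   | there q  = q
   to′ : ∀ {w} → w ∈ xs → f′ w ≡ true
   to′ {w} w∈ with w Fin.≟ x
   ... | yes w≡x = contradiction w≡x (head∉tail u w∈)
   ... | no _    = to (there w∈)

 unique-map : ∀ {A B : Set} (f : A → B) xs → (∀ {i j} → i ∈ xs → j ∈ xs → f i ≡ f j → i ≡ j) → Unique xs → Unique (map f xs)
 unique-map f []       inj u = []
 unique-map f (x ∷ xs) inj u@(_ ∷ u′) = AllP.map⁺ (All.tabulate (λ i∈ p → head∉tail u i∈ (inj (there i∈) (here ≡.refl) (≡.sym p))))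
   ∷ unique-map f xs (λ i∈ j∈ → inj (there i∈) (there j∈)) u′

 module SunProps {n : ℕ} {G : Graph n} {ℓ : ℕ} {b : ℕ → Bool} (sun : Sun G ℓ b) (3≤ℓ : 3 ≤ ℓ) where
   open Sun sun
   open GraphOf G

   adj-sym : ∀ {u w} → adj G u w ≡ true → adj G w u ≡ true
   adj-sym {u} {w} p = ≡.trans (Graph.sym G w u) p

   core-leaf : ∀ {i j} → i < ℓ → j < ℓ → b j ≡ true → adj G (core i) (leaf j) ≡ true → i ≡ j
   core-leaf i<ℓ j<ℓ bj p = core-inj i<ℓ j<ℓ (leaf-only j<ℓ bj (adj-sym p))

   d-leaf : ∀ {i} → i < ℓ → b i ≡ true → d (leaf i) ≡ + 1
   d-leaf {i} i<ℓ bi = count-unique (adj G (leaf i)) (core i ∷ []) ([] ∷ []) (λ w p → here (leaf-only i<ℓ bi p)) (λ { (here ≡.refl) → leaf-core i<ℓ bi })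

   next≢ : ∀ {i} → i < ℓ → next ℓ i ≢ i
   next≢ i<ℓ = iterate≢ 0 i<ℓ (ℕ.≤-trans (s≤s (s≤s z≤n)) 3≤ℓ)

   next²≢ : ∀ {i} → i < ℓ → next ℓ (next ℓ i) ≢ i
   next²≢ i<ℓ = iterate≢ 1 i<ℓ 3≤ℓ

   d-core : ∀ {i} → i < ℓ → d (core i) ≡ + 2 ℤ.+ b2z (b i)
   d-core {i} i<ℓ with next-surjective i<ℓ | b i in bi
   ... | p , p<ℓ , np | false = count-unique (adj G (core i)) (core (next ℓ i) ∷ core p ∷ []) ((distinct ∷ []) ∷ ([] ∷ []))
       from (λ { (here ≡.refl) → core-next i<ℓ ; (there (here ≡.refl)) → back })
     where
     distinct : core (next ℓ i) ≢ core p
     distinct q = next²≢ p<ℓ (≡.trans (cong (next ℓ) np) (core-inj (next< i<ℓ) p<ℓ q))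
     back : adj G (core i) (core p) ≡ true
     back = adj-sym (≡.subst (λ z → adj G (core p) (core z) ≡ true) np (core-next p<ℓ))
     from : ∀ w → adj G (core i) w ≡ true → w ∈ core (next ℓ i) ∷ core p ∷ []
     from w a with locate w
     ... | inj₁ (j , j<ℓ , ≡.refl) with core-core i<ℓ j<ℓ a
     ...   | inj₁ ≡.refl = here ≡.refl
     ...   | inj₂ q      = there (here (cong core (next-injective (≡.trans (≡.sym q) (≡.sym np)))))
     from w a | inj₂ (j , j<ℓ , bj , ≡.refl) with ≡.refl ← core-leaf i<ℓ j<ℓ bj a with () ← ≡.trans (≡.sym bj) bi
   ... | p , p<ℓ , np | true = count-unique (adj G (core i)) (leaf i ∷ core (next ℓ i) ∷ core p ∷ [])
       ((core≢leaf (next< i<ℓ) i<ℓ bi ∘ ≡.sym ∷ core≢leaf p<ℓ i<ℓ bi ∘ ≡.sym ∷ []) ∷ ((distinct ∷ []) ∷ ([] ∷ [])))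
       from (λ { (here ≡.refl) → adj-sym (leaf-core i<ℓ bi) ; (there (here ≡.refl)) → core-next i<ℓ ; (there (there (here ≡.refl))) → back })
     where
     distinct : core (next ℓ i) ≢ core p
     distinct q = next²≢ p<ℓ (≡.trans (cong (next ℓ) np) (core-inj (next< i<ℓ) p<ℓ q))
     back : adj G (core i) (core p) ≡ true
     back = adj-sym (≡.subst (λ z → adj G (core p) (core z) ≡ true) np (core-next p<ℓ))
     from : ∀ w → adj G (core i) w ≡ true → w ∈ leaf i ∷ core (next ℓ i) ∷ core p ∷ []
     from w a with locate w
     ... | inj₁ (j , j<ℓ , ≡.refl) with core-core i<ℓ j<ℓ a
     ...   | inj₁ ≡.refl = there (here ≡.refl)
     ...   | inj₂ q      = there (there (here (cong core (next-injective (≡.trans (≡.sym q) (≡.sym np))))))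
     from w a | inj₂ (j , j<ℓ , bj , ≡.refl) with ≡.refl ← core-leaf i<ℓ j<ℓ bj a = here ≡.refl

   -- The elimination order: with the leaves gone first, a weighted cycle remains.
   vertices : List (Fin n)
   vertices = map leaf (hubs b 0 ℓ) ++ map core (upFrom 0 ℓ)

   private
     hub< : ∀ {k} → k ∈ hubs b 0 ℓ → k < ℓ
     hub< k∈ = proj₁ (proj₂ (∈-hubs⁻ b 0 ℓ k∈))
     hub-b : ∀ {k} → k ∈ hubs b 0 ℓ → b k ≡ true
     hub-b k∈ = proj₂ (proj₂ (∈-hubs⁻ b 0 ℓ k∈))
     core< : ∀ {k} → k ∈ upFrom 0 ℓ → k < ℓ
     core< k∈ = proj₂ (∈-upFrom⁻ 0 ℓ k∈)

   vertices-unique : Unique vertices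
   vertices-unique = UniqueP.++⁺ (unique-map leaf (hubs b 0 ℓ) (λ i∈ j∈ → leaf-inj (hub< i∈) (hub< j∈) (hub-b i∈) (hub-b j∈)) (hubs-unique b 0 ℓ))
     (unique-map core (upFrom 0 ℓ) (λ i∈ j∈ → core-inj (core< i∈) (core< j∈)) (upFrom-unique 0 ℓ))
     (λ { (l , c) → disjoint (∈-map⁻ leaf l) (∈-map⁻ core c) })
     where
     disjoint : ∀ {v} → (Σ ℕ λ k → k ∈ hubs b 0 ℓ × v ≡ leaf k) → (Σ ℕ λ k → k ∈ upFrom 0 ℓ × v ≡ core k) → ⊥
     disjoint (k , k∈ , ≡.refl) (k′ , k′∈ , p) = core≢leaf (core< k′∈) (hub< k∈) (hub-b k∈) (≡.sym p)

   vertices-complete : ∀ v → v ∈ vertices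
   vertices-complete v with locate v
   ... | inj₁ (i , i<ℓ , ≡.refl)      = ∈-++⁺ʳ (map leaf (hubs b 0 ℓ)) (∈-map⁺ core (∈-upFrom⁺ 0 ℓ z≤n i<ℓ))
   ... | inj₂ (i , i<ℓ , bi , ≡.refl) = ∈-++⁺ˡ (∈-map⁺ leaf (∈-hubs⁺ b 0 ℓ z≤n i<ℓ bi))

   allFin↭vertices : allFin n ↭ vertices
   allFin↭vertices = ∼bag⇒↭ (unique∧set⇒bag (UniqueP.allFin⁺ n) vertices-unique (λ {v} → mk⇔ (λ _ → vertices-complete v) (λ _ → ∈-allFin v)))

   bits : List Bool
   bits = map b (upFrom 0 ℓ)

   private
     length-upFrom : ∀ k m → length (upFrom k m) ≡ m
     length-upFrom k zero    = ≡.refl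
     length-upFrom k (suc m) = cong suc (length-upFrom (suc k) m)

   length-bits : length bits ≡ ℓ
   length-bits = ≡.trans (List.length-map b (upFrom 0 ℓ)) (length-upFrom 0 ℓ)

   order≡ : n ≡ trues bits ℕ.+ ℓ
   order≡ = ≡.trans (≡.sym (List.length-tabulate {n = n} (λ i → i))) (≡.trans (PermP.↭-length allFin↭vertices) (≡.trans (List.length-++ (map leaf (hubs b 0 ℓ)))
     (cong₂ ℕ._+_ (≡.trans (List.length-map leaf (hubs b 0 ℓ)) (length-hubs b 0 ℓ)) (≡.trans (List.length-map core (upFrom 0 ℓ)) (length-upFrom 0 ℓ)))))

   module _ (a t : Power.Carrier) (a₀ : Power.coeff a 0 ≡ + 1) (t₀ : Power.coeff t 0 ≡ + 0) where
     open Power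
     open T𝕊
     open import Relation.Binary.Reasoning.Setoid setoid

     𝕄 : Fin n → Fin n → Carrier
     𝕄 u w = ι (Defs.δ u w) * a + ι (ℤ.- signlessLaplacian G u w) * t

     private
       𝕄-value : ∀ {u w k m x} → kron u w ≡ k → d u ≡ m → adj G u w ≡ x → 𝕄 u w ≈ ι k * (a - ι m * t) - ι (b2z x) * t
       𝕄-value {u} {w} ≡.refl ≡.refl ≡.refl = begin
         ι (Defs.δ u w) * a + ι (ℤ.- (Defs.δ u w ℤ.* Defs.degree G u ℤ.+ A u w)) * t
           ≈⟨ reflexive (cong₂ (λ k m → ι k * a + ι (ℤ.- (k ℤ.* m ℤ.+ A u w)) * t) (δ≡kron u w) (sumFin≡sum (A u))) ⟩
         ι (kron u w) * a + ι (ℤ.- (kron u w ℤ.* d u ℤ.+ A u w)) * t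
           ≈⟨ 𝕊.+-congˡ (𝕊.*-congʳ (trans (ι-neg (kron u w ℤ.* d u ℤ.+ A u w)) (𝕊.-‿cong (trans (ι-+ (kron u w ℤ.* d u) (A u w)) (𝕊.+-congʳ (ι-* (kron u w) (d u))))))) ⟩
         ι (kron u w) * a + - (ι (kron u w) * ι (d u) + ι (A u w)) * t
           ≈⟨ solve 5 (λ k a m x t → k :* a :+ (:- (k :* m :+ x)) :* t := k :* (a :- m :* t) :- x :* t) refl (ι (kron u w)) a (ι (d u)) (ι (A u w)) t ⟩
         ι (kron u w) * (a - ι (d u) * t) - ι (b2z (adj G u w)) * t ∎

       𝕄-diff : ∀ {u w x} → u ≢ w → adj G u w ≡ x → 𝕄 u w ≈ - (ι (b2z x) * t)
       𝕄-diff {u} {w} {x} u≢w p = trans (𝕄-value (kron-diff u≢w) ≡.refl p) (solve 2 (λ m z → con (+ 0) :* m :- z := :- z) refl (a - ι (d u) * t) (ι (b2z x) * t))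

       𝕄-same : ∀ {u m} → d u ≡ m → 𝕄 u u ≈ a - ι m * t
       𝕄-same {u} {m} p = trans (𝕄-value (kron-same u) p (Graph.irrefl G u)) (solve 2 (λ z t → con (+ 1) :* z :- con (+ 0) :* t := z) refl (a - ι m * t) t)

     π : Carrier
     π = a - t

     private
       coeff₀-t* : ∀ c → coeff (c * t) 0 ≡ + 0
       coeff₀-t* c = ≡.trans (coeff-cong (𝕊.*-comm c t) 0) (coeff₀-*0 t c t₀)

     π₀ : coeff π 0 ≡ + 1
     π₀ = coeff₀-minus0 a t a₀ t₀

     -- The diagonal entry of a cycle vertex once its leaf, if it has one, has been eliminated.
     weight : Bool → Carrier
     weight false = a - ι (+ 2) * t
     weight true  = a - ι (+ 3) * t - t * t * inv π

     private
       weight₀ : ∀ c → coeff (weight c) 0 ≡ + 1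
       weight₀ false = coeff₀-minus0 a (ι (+ 2) * t) a₀ (coeff₀-t* (ι (+ 2)))
       weight₀ true  = coeff₀-minus0 _ (t * t * inv π) (coeff₀-minus0 a (ι (+ 3) * t) a₀ (coeff₀-t* (ι (+ 3)))) (coeff₀-*0 (t * t) (inv π) (coeff₀-*0 t t t₀))

       𝕄-unital : ∀ xs → Unital 𝕄 xs
       𝕄-unital xs = unital (λ {i} _ → ≡.trans (coeff-cong (𝕄-same {i} ≡.refl) 0) (coeff₀-minus0 a _ a₀ (coeff₀-t* (ι (d i)))))
         (λ {i} {j} _ _ p → ≡.trans (coeff-cong (𝕄-diff p ≡.refl) 0) (≡.trans (coeff-neg _ 0) (cong ℤ.-_ (coeff₀-t* (ι (b2z (adj G i j)))))))

       open Pendant leaf π π₀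

       leaf-diag : ∀ {k} → k ∈ hubs b 0 ℓ → 𝕄 (leaf k) (leaf k) ≈ π
       leaf-diag k∈ = trans (𝕄-same (d-leaf (hub< k∈) (hub-b k∈))) (𝕊.+-congˡ (𝕊.-‿cong (𝕊.*-identityˡ t)))

       leaf-leaf : ∀ {k k′} → k ∈ hubs b 0 ℓ → k′ ∈ hubs b 0 ℓ → k ≢ k′ → 𝕄 (leaf k) (leaf k′) ≈ 0#
       leaf-leaf {k} {k′} k∈ k′∈ p = trans (𝕄-diff (p ∘ leaf-inj (hub< k∈) (hub< k′∈) (hub-b k∈) (hub-b k′∈)) (nonadj (adj G (leaf k) (leaf k′)) ≡.refl))
           (solve 1 (λ t → :- (con (+ 0) :* t) := con (+ 0)) refl t)
         where
         nonadj : ∀ x → adj G (leaf k) (leaf k′) ≡ x → adj G (leaf k) (leaf k′) ≡ false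
         nonadj true  q = contradiction (≡.sym (leaf-only (hub< k∈) (hub-b k∈) q)) (core≢leaf (hub< k∈) (hub< k′∈) (hub-b k′∈))
         nonadj false q = q

       adj-e : ∀ {u w k i} → (k ≡ i → adj G u w ≡ true) → (adj G u w ≡ true → k ≡ i) → ι (b2z (adj G u w)) ≈ e k i
       adj-e {u} {w} {k} {i} to from = byCases (adj G u w) ≡.refl (k ℕ.≟ i)
         where
         byCases : ∀ x → adj G u w ≡ x → Dec (k ≡ i) → ι (b2z (adj G u w)) ≈ e k i
         byCases x p (yes ≡.refl) = reflexive (≡.trans (cong (ι ∘ b2z) (to ≡.refl)) (≡.sym (e-same k)))
         byCases true p (no q) = contradiction (from p) q
         byCases false p (no q) = reflexive (≡.trans (cong (ι ∘ b2z) p) (≡.sym (e-diff q)))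

       leaf-core-entry : ∀ {k j} → k ∈ hubs b 0 ℓ → j < ℓ → 𝕄 (leaf k) (core j) ≈ - (e k j * t)
       leaf-core-entry {k} {j} k∈ j<ℓ = trans (𝕄-diff (core≢leaf j<ℓ (hub< k∈) (hub-b k∈) ∘ ≡.sym) ≡.refl)
         (𝕊.-‿cong (𝕊.*-congʳ (adj-e (λ { ≡.refl → leaf-core (hub< k∈) (hub-b k∈) }) (λ p → ≡.sym (core-inj j<ℓ (hub< k∈) (leaf-only (hub< k∈) (hub-b k∈) p))))))

       core-leaf-entry : ∀ {k j} → k ∈ hubs b 0 ℓ → j < ℓ → 𝕄 (core j) (leaf k) ≈ - (e k j * t)
       core-leaf-entry {k} {j} k∈ j<ℓ = trans (𝕄-diff (core≢leaf j<ℓ (hub< k∈) (hub-b k∈)) ≡.refl)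
         (𝕊.-‿cong (𝕊.*-congʳ (adj-e (λ { ≡.refl → adj-sym (leaf-core (hub< k∈) (hub-b k∈)) }) (λ p → ≡.sym (core-leaf j<ℓ (hub< k∈) (hub-b k∈) p)))))

       core-core-entry : ∀ {i j} → i < ℓ → j < ℓ → 𝕄 (core i) (core j) ≈ e i j * (a - ι (+ 2 ℤ.+ b2z (b i)) * t) - t * (e (next ℓ i) j + e (next ℓ j) i)
       core-core-entry {i} {j} i<ℓ j<ℓ with i ℕ.≟ j
       ... | yes ≡.refl = trans (𝕄-same (d-core i<ℓ)) (trans
             (solve 2 (λ z t → z := con (+ 1) :* z :- t :* (con (+ 0) :+ con (+ 0))) refl (a - ι (+ 2 ℤ.+ b2z (b i)) * t) t)
             (reflexive (cong (λ y → 1# * (a - ι (+ 2 ℤ.+ b2z (b i)) * t) - t * (y + y)) (≡.sym (e-diff (next≢ i<ℓ))))))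
       ... | no i≢j = trans (𝕄-diff (i≢j ∘ core-inj i<ℓ j<ℓ) ≡.refl) (trans (𝕊.-‿cong (𝕊.*-congʳ (value (next ℓ i ℕ.≟ j) (next ℓ j ℕ.≟ i))))
             (solve 3 (λ y t z → :- (y :* t) := con (+ 0) :* z :- t :* y) refl (e (next ℓ i) j + e (next ℓ j) i) t (a - ι (+ 2 ℤ.+ b2z (b i)) * t)))
         where
         value : Dec (next ℓ i ≡ j) → Dec (next ℓ j ≡ i) → ι (b2z (adj G (core i) (core j))) ≈ e (next ℓ i) j + e (next ℓ j) i
         value (yes ≡.refl) _ = trans (reflexive (cong (ι ∘ b2z) (core-next i<ℓ))) (sym (trans (reflexive (cong₂ _+_ (e-same (next ℓ i)) (e-diff (next²≢ i<ℓ)))) (𝕊.+-identityʳ 1#)))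
         value (no p) (yes ≡.refl) = trans (reflexive (cong (ι ∘ b2z) (adj-sym (core-next j<ℓ)))) (sym (trans (reflexive (cong₂ _+_ (e-diff (next²≢ j<ℓ)) (e-same (next ℓ j)))) (𝕊.+-identityˡ 1#)))
         value (no p) (no q) = trans (nonadj (adj G (core i) (core j)) ≡.refl) (sym (trans (reflexive (cong₂ _+_ (e-diff p) (e-diff q))) (𝕊.+-identityˡ 0#)))
           where
           nonadj : ∀ x → adj G (core i) (core j) ≡ x → ι (b2z (adj G (core i) (core j))) ≈ 0#
           nonadj false r = reflexive (cong (ι ∘ b2z) r)
           nonadj true r with core-core i<ℓ j<ℓ r
           ... | inj₁ s = contradiction (≡.sym s) p
           ... | inj₂ s = contradiction (≡.sym s) q

     module _ {m : ℕ} (ℓ≡ : ℓ ≡ suc (suc m)) where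
       private
         module C = Cycle t (weight ∘ b) t₀ (weight₀ ∘ b) (suc m)
         hs = hubs b 0 ℓ

         core-reduced : ∀ {i j} → i < ℓ → j < ℓ → reduced 𝕄 hs (core i) (core j) ≈ C.cycleMatrix i j
         core-reduced {i} {j} i<ℓ j<ℓ = trans (𝕊.+-cong (core-core-entry i<ℓ j<ℓ) (𝕊.-‿cong (trans
             (ΣL-cong hs (λ {k} k∈ → trans (𝕊.*-cong (core-leaf-entry k∈ i<ℓ) (𝕊.*-congˡ (leaf-core-entry k∈ j<ℓ)))
               (solve 4 (λ x y t u → (:- (x :* t)) :* (u :* (:- (y :* t))) := (t :* t :* u) :* (x :* y)) refl (e k i) (e k j) t (inv π))))
             (hubTerm (b i) ≡.refl)))) (trans (final (b i)) (reflexive (cong (λ z → e i j * weight (b i) - t * (e (next z i) j + e (next z j) i)) ℓ≡)))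
           where
           F : ℕ → Carrier
           F k = (t * t * inv π) * (e k i * e k j)
           F-off : ∀ {k} → k ≢ i → F k ≈ 0#
           F-off {k} p = trans (reflexive (cong (λ z → (t * t * inv π) * (z * e k j)) (e-diff p))) (solve 2 (λ x y → x :* (con (+ 0) :* y) := con (+ 0)) refl (t * t * inv π) (e k j))
           shift : Bool → Carrier
           shift true  = (t * t * inv π) * e i j
           shift false = 0#
           hubTerm : ∀ c → b i ≡ c → ΣL F hs ≈ shift (b i)
           hubTerm true bi = trans (ΣL-single hs i (hubs-unique b 0 ℓ) (∈-hubs⁺ b 0 ℓ z≤n i<ℓ bi) F-off)
             (trans (reflexive (cong (λ z → (t * t * inv π) * (z * e i j)) (e-same i))) (trans (𝕊.*-congˡ (𝕊.*-identityˡ (e i j))) (reflexive (cong shift (≡.sym bi)))))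
           hubTerm false bi = trans (ΣL-0 hs (λ k∈ → F-off (λ { ≡.refl → case (≡.trans (≡.sym (hub-b k∈)) bi) }))) (reflexive (cong shift (≡.sym bi)))
             where
             case : true ≡ false → ⊥
             case ()
           final : ∀ c → (e i j * (a - ι (+ 2 ℤ.+ b2z c) * t) - t * (e (next ℓ i) j + e (next ℓ j) i)) - shift c
             ≈ e i j * weight c - t * (e (next ℓ i) j + e (next ℓ j) i)
           final true  = solve 5 (λ x a t s v → (x :* (a :- con (+ 3) :* t) :- s) :- v :* x := x :* (a :- con (+ 3) :* t :- v) :- s) refl (e i j) a t (t * (e (next ℓ i) j + e (next ℓ j) i)) (t * t * inv π)
           final false = solve 4 (λ x a t s → (x :* (a :- con (+ 2) :* t) :- s) :- con (+ 0) := x :* (a :- con (+ 2) :* t) :- s) refl (e i j) a t (t * (e (next ℓ i) j + e (next ℓ j) i))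

         stepOf : Bool → M₂
         stepOf c = step t (weight c)

         X-product : ∀ k r → product stepOf (map b (upFrom k (suc r))) ≋ C.X k r ⊗ stepOf (b (k ℕ.+ r))
         X-product k zero    = ≋-trans (⊗-identityʳ _) (≋-trans (≡.subst (λ z → stepOf (b k) ≋ stepOf (b z)) (≡.sym (ℕ.+-identityʳ k)) ≋-refl) (≋-sym (⊗-identityˡ _)))
         X-product k (suc r) = ≋-trans (⊗-cong ≋-refl (X-product (suc k) r)) (≋-trans (≋-sym (⊗-assoc (stepOf (b k)) (C.X (suc k) r) _))
           (⊗-cong ≋-refl (≡.subst (λ z → stepOf (b z) ≋ stepOf (b (k ℕ.+ suc r))) (ℕ.+-suc k r) ≋-refl)))

         tr-X : tr (step t (weight (b 0)) ⊗ C.X 1 m ⊗ step t (weight (b (suc m)))) ≈ tr (product stepOf (map b (upFrom 0 (suc (suc m)))))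
         tr-X = tr-cong (⊗-cong ≋-refl (≋-sym (X-product 1 m)))

         scale-true : transfer a t true ≋ π ⊙ stepOf true
         scale-true = mat≈ (sym (trans (solve 4 (λ a t π u → π :* (a :- con (+ 3) :* t :- t :* t :* u) := (a :- con (+ 3) :* t) :* π :- t :* t :* (π :* u)) refl a t π (inv π))
              (trans (𝕊.+-congˡ (𝕊.-‿cong (𝕊.*-congˡ (inv-inverse π π₀)))) (𝕊.+-congˡ (𝕊.-‿cong (𝕊.*-identityʳ (t * t)))))))
           (solve 2 (λ t p → :- (t :* p) := p :* (:- t)) refl t π)
           (𝕊.*-comm t π)
           (sym (𝕊.zeroʳ π))

       -- Each leaf contributes a pivot π = a - t. Multiplied into the step of its hub, it clears
       -- the denominator of `weight` and gives the polynomial transfer matrix.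
       qDet≈cycleDet : qDet G a t ≈ cycleDet a t bits
       qDet≈cycleDet = begin
         qDet G a t ≈⟨ det-pivots (λ i → i) 𝕄 (UniqueP.allFin⁺ n) (𝕄-unital (allFin n)) ⟩
         pivots 𝕄 (allFin n) ≈⟨ pivots-↭ allFin↭vertices (UniqueP.allFin⁺ n) (𝕄-unital (allFin n)) ⟩
         pivots 𝕄 (map leaf hs ++ map core (upFrom 0 ℓ)) ≈⟨ pivots-leaves 𝕄 hs (map core (upFrom 0 ℓ)) (hubs-unique b 0 ℓ) leaf-diag leaf-leaf ⟩
         π ^ length hs * pivots (reduced 𝕄 hs) (map core (upFrom 0 ℓ)) ≈⟨ 𝕊.*-cong (reflexive (cong (π ^_) (length-hubs b 0 ℓ)))
           (trans (pivots-map core (reduced 𝕄 hs) (upFrom 0 ℓ)) (trans (pivots-cong-∈ (upFrom 0 ℓ) (λ i∈ j∈ → core-reduced (core< i∈) (core< j∈))) (reflexive (cong (λ z → pivots C.cycleMatrix (upFrom 0 z)) ℓ≡)))) ⟩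
         π ^ trues bits * pivots C.cycleMatrix (upFrom 0 (suc (suc m))) ≈⟨ 𝕊.*-congˡ closed ⟩
         π ^ trues bits * (tr (product stepOf (map b (upFrom 0 (suc (suc m))))) - ι (+ 2) * t ^ suc (suc m))
           ≈⟨ 𝕊.*-congˡ (reflexive (cong₂ (λ x y → tr (product stepOf (map b (upFrom 0 x))) - ι (+ 2) * t ^ y) (≡.sym ℓ≡) (≡.sym (≡.trans length-bits ℓ≡)))) ⟩
         π ^ trues bits * (tr (product stepOf bits) - ι (+ 2) * t ^ length bits)
           ≈⟨ solve 4 (λ p x c y → p :* (x :- c :* y) := p :* x :- c :* (y :* p)) refl (π ^ trues bits) (tr (product stepOf bits)) (ι (+ 2)) (t ^ length bits) ⟩
         π ^ trues bits * tr (product stepOf bits) - ι (+ 2) * (t ^ length bits * π ^ trues bits)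
           ≈⟨ 𝕊.+-congʳ (trans (sym (tr-⊙ (π ^ trues bits) (product stepOf bits))) (tr-cong (≋-sym (product-scale stepOf (transfer a t) π scale-true (mat≈ refl refl refl refl) bits)))) ⟩
         cycleDet a t bits ∎
         where
         closed : pivots C.cycleMatrix (upFrom 0 (suc (suc m))) ≈ tr (product stepOf (map b (upFrom 0 (suc (suc m))))) - ι (+ 2) * t ^ suc (suc m)
         closed = trans (C.pivots-cycle ≡.refl) (𝕊.+-congʳ tr-X)

-- The characteristic polynomial of a sun at the integers 0 and 1.

module LeadingCoefficients where
 open IntegerCoefficients using (module RingZ)
 open BinaryForms using (ℤ-ring; module DZ; det≡)
 open PowerSeries using (module Power)
 open Elimination using (module DS)
 open TransferMatrices using (module Two; trues)
 open CycleElimination using (module T𝕊)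
 open LocalStructure using (qDet)
 open SunGraphs using (Sun; module SunProps)
 open import Data.Nat.Base using (_≤_)
 open import Data.Integer.Base using (-1ℤ)
 open import Data.Integer.Tactic.RingSolver using (solve-∀)
 open import Data.Fin.Base using (zero; suc; punchIn)
 open import Data.List.Base using (replicate)
 open ≡

 private
   module P = Power
   open P using (Carrier; coeff; Deg≤; ι; q; 1#)

 module Tℤ = Two ℤ-ring

 -- At a = 1 + qx, t = q a form of degree n becomes a polynomial in q whose coefficient of q^n is
 -- the value of the form at (x, 1).
 record Top (n : ℕ) (f : Carrier) (c : ℤ) : Set where
   constructor top
   field
     degree : Deg≤ n f
     lead   : coeff f n ≡ c
 open Top

 top-cong : ∀ {n f g c} → f P.≈ g → Top n f c → Top n g c
 top-cong e (top d l) = top (P.deg-cong e d) (trans (sym (P.coeff-cong e _)) l)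

 top-+ : ∀ {n f g c d} → Top n f c → Top n g d → Top n (f P.+ g) (c ℤ.+ d)
 top-+ {n} {f} {g} (top p l) (top p′ l′) = top (P.deg-+ p p′) (trans (P.coeff-+ f g n) (cong₂ ℤ._+_ l l′))

 top-neg : ∀ {n f c} → Top n f c → Top n (P.- f) (ℤ.- c)
 top-neg {n} {f} (top p l) = top (P.deg-neg p) (trans (P.coeff-neg f n) (cong ℤ.-_ l))

 top-* : ∀ {m n f g c d} → Top m f c → Top n g d → Top (m ℕ.+ n) (f P.* g) (c ℤ.* d)
 top-* {m} {n} {f} {g} (top p l) (top p′ l′) = top (P.deg-* p p′) (trans (P.coeff-*-top m n f g p p′) (cong₂ ℤ._*_ l l′))

 top-0 : ∀ n → Top n P.0# (+ 0)
 top-0 n = top (λ k _ → P.coeff-0 k) (P.coeff-0 n)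

 top-ι : ∀ c → Top 0 (ι c) c
 top-ι c = top (P.deg-ι c) (P.coeff-ι-zero c)

 top-q : ∀ c → Top 1 (q P.* ι c) c
 top-q c = top (λ { (suc k) (s≤s lt) → trans (P.q*-suc (ι c) k) (P.deg-ι c k lt) }) (trans (P.q*-suc (ι c) 0) (P.coeff-ι-zero c))

 top-alt : ∀ {n m} {f : Fin m → Carrier} {g : Fin m → ℤ} → (∀ i → Top n (f i) (g i)) → Top n (DS.alt f) (DZ.alt g)
 top-alt {n} {zero}  p = top-0 n
 top-alt {n} {suc m} p = top-+ (p zero) (top-neg (top-alt (p ∘ suc)))

 top-det : ∀ {n} {M : Fin n → Fin n → Carrier} {N : Fin n → Fin n → ℤ} → (∀ i j → Top 1 (M i j) (N i j)) → Top n (DS.det M) (DZ.det N)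
 top-det {zero}  p = top-ι (+ 1)
 top-det {suc n} p = top-alt (λ j → top-* (p zero j) (top-det (λ i k → p (suc i) (punchIn j k))))

 open T𝕊 using (M₂; mat)

 record TopM (n : ℕ) (A : M₂) (B : Tℤ.M₂) : Set where
   constructor topM
   field
     t₁₁ : Top n (T𝕊.e₁₁ A) (Tℤ.e₁₁ B)
     t₁₂ : Top n (T𝕊.e₁₂ A) (Tℤ.e₁₂ B)
     t₂₁ : Top n (T𝕊.e₂₁ A) (Tℤ.e₂₁ B)
     t₂₂ : Top n (T𝕊.e₂₂ A) (Tℤ.e₂₂ B)
 open TopM

 topM-⊗ : ∀ {m n A B A′ B′} → TopM m A B → TopM n A′ B′ → TopM (m ℕ.+ n) (A T𝕊.⊗ A′) (B Tℤ.⊗ B′)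
 topM-⊗ (topM a b c d) (topM a′ b′ c′ d′) = topM
   (top-+ (top-* a a′) (top-* b c′)) (top-+ (top-* a b′) (top-* b d′))
   (top-+ (top-* c a′) (top-* d c′)) (top-+ (top-* c b′) (top-* d d′))

 size : List Bool → ℕ
 size []           = 0
 size (true ∷ bs)  = 2 ℕ.+ size bs
 size (false ∷ bs) = 1 ℕ.+ size bs

 size≡ : ∀ bs → size bs ≡ trues bs ℕ.+ length bs
 size≡ []           = refl
 size≡ (true ∷ bs)  = cong suc (trans (cong suc (size≡ bs)) (sym (ℕ.+-suc (trues bs) (length bs))))
 size≡ (false ∷ bs) = trans (cong suc (size≡ bs)) (sym (ℕ.+-suc (trues bs) (length bs)))

 topM-product : ∀ {T : Bool → M₂} {U : Bool → Tℤ.M₂} → TopM 2 (T true) (U true) → TopM 1 (T false) (U false) →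
   ∀ bs → TopM (size bs) (T𝕊.product T bs) (Tℤ.product U bs)
 topM-product tt tf []           = topM (top-ι (+ 1)) (top-0 0) (top-0 0) (top-ι (+ 1))
 topM-product tt tf (true ∷ bs)  = topM-⊗ tt (topM-product tt tf bs)
 topM-product tt tf (false ∷ bs) = topM-⊗ tf (topM-product tt tf bs)

 open import Algebra.Bundles using (module CommutativeRing)
 open import Algebra.Properties.Semiring.Exp (CommutativeRing.semiring ℤ-ring) using () renaming (_^_ to _^ℤ_)

 top-^ : ∀ {f c} → Top 1 f c → ∀ k → Top k (f P.^ k) (c ^ℤ k)
 top-^ p zero    = top-ι (+ 1)
 top-^ p (suc k) = top-* p (top-^ p k)

 private
   module RZ = RingZ ℤ-ring

   module AtInteger (x : ℤ) where
     a : Carrier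
     a = 1# P.+ q P.* ι x

     top-a : Top 1 a x
     top-a = top (P.deg-+ (P.deg-weaken z≤n (P.deg-ι (+ 1))) (degree (top-q x)))
       (trans (P.coeff-+ 1# (q P.* ι x) 1) (trans (cong₂ ℤ._+_ (P.deg-ι (+ 1) 1 ℕ.≤-refl) (lead (top-q x))) (ℤ.+-identityˡ x)))

     top-t : Top 1 q (+ 1)
     top-t = top-cong (P.𝕊.*-identityʳ q) (top-q (+ 1))

     top-π : Top 1 (a P.- q) (x ℤ.- + 1)
     top-π = top-+ top-a (top-neg top-t)

     top-sub : ∀ k → Top 1 (a P.- ι (+ k) P.* q) (x ℤ.- + k ℤ.* + 1)
     top-sub k = top-+ top-a (top-neg (top-* (top-ι (+ k)) top-t))

     transferℤ : Bool → Tℤ.M₂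
     transferℤ = Tℤ.transfer x (+ 1)

     topM-transfer : ∀ bs → TopM (size bs) (T𝕊.product (T𝕊.transfer a q) bs) (Tℤ.product transferℤ bs)
     topM-transfer = topM-product
       (topM (top-+ (top-* (top-sub 3) top-π) (top-neg (top-* top-t top-t))) (top-neg (top-* top-t top-π)) (top-* top-t top-π) (top-0 2))
       (topM (top-sub 2) (top-neg top-t) top-t (top-0 1))

     top-cycleDet : ∀ bs → Top (trues bs ℕ.+ length bs) (T𝕊.cycleDet a q bs) (Tℤ.cycleDet x (+ 1) bs)
     top-cycleDet bs = top-+ (subst (λ n → Top n (T𝕊.tr (T𝕊.product (T𝕊.transfer a q) bs)) (Tℤ.tr (Tℤ.product transferℤ bs))) (size≡ bs) (top-+ (t₁₁ (topM-transfer bs)) (t₂₂ (topM-transfer bs))))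
       (top-neg (top-* (top-ι (+ 2)) (subst (λ n → Top n (q P.^ length bs P.* (a P.- q) P.^ trues bs) ((+ 1) ^ℤ length bs ℤ.* (x ℤ.- + 1) ^ℤ trues bs)) (ℕ.+-comm (length bs) (trues bs)) (top-* (top-^ top-t (length bs)) (top-^ top-π (trues bs))))))

 -- The formula for `qDet` was proved by elimination, for a with constant term 1. Comparing leading
 -- coefficients at a = 1 + qx carries it to every integer x.
 charPoly≡cycleDet : ∀ {n} {G : Graph n} {ℓ b} (sun : Sun G ℓ b) (3≤ℓ : 3 ≤ ℓ) x →
   charPoly (signlessLaplacian G) x ≡ Tℤ.cycleDet x (+ 1) (SunProps.bits sun 3≤ℓ)
 charPoly≡cycleDet {ℓ = suc zero} sun (s≤s ()) x
 charPoly≡cycleDet {n} {G} {suc (suc m)} sun 3≤ℓ x = trans (sym (lead topLeft)) (lead topRight)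
   where
   open AtInteger x
   open SunProps sun 3≤ℓ
   a₀ : coeff a 0 ≡ + 1
   a₀ = trans (P.coeff-+ 1# (q P.* ι x) 0) (cong₂ ℤ._+_ P.coeff-1-zero (P.q*-zero (ι x)))
   topRight : Top n (qDet G a q) (Tℤ.cycleDet x (+ 1) bits)
   topRight = top-cong (P.sym (qDet≈cycleDet a q a₀ P.coeff-q-zero refl)) (subst (λ k → Top k (T𝕊.cycleDet a q bits) (Tℤ.cycleDet x (+ 1) bits)) (sym (trans order≡ (cong (trues bits ℕ.+_) (sym length-bits)))) (top-cycleDet bits))
   entry : ∀ i j → Top 1 (ι (Defs.δ i j) P.* a P.+ ι (ℤ.- signlessLaplacian G i j) P.* q) (x ℤ.* Defs.δ i j ℤ.- signlessLaplacian G i j)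
   entry i j = subst (Top 1 _) (rearr (Defs.δ i j) (signlessLaplacian G i j) x) (top-+ (top-* (top-ι (Defs.δ i j)) top-a) (top-* (top-ι (ℤ.- signlessLaplacian G i j)) top-t))
     where
     rearr : ∀ k l x → k ℤ.* x ℤ.+ (ℤ.- l) ℤ.* + 1 ≡ x ℤ.* k ℤ.- l
     rearr = solve-∀
   topLeft : Top n (qDet G a q) (charPoly (signlessLaplacian G) x)
   topLeft = subst (Top n (qDet G a q)) (sym (det≡ {M = λ i j → x ℤ.* Defs.δ i j ℤ.- signlessLaplacian G i j} (λ i j → refl))) (top-det entry)

 private
   sign : ℕ → ℤ
   sign k = -1ℤ ^ℤ k

   1^ : ∀ k → (+ 1) ^ℤ k ≡ + 1
   1^ zero    = refl
   1^ (suc k) = trans (ℤ.*-identityˡ _) (1^ k)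

   sign-cases : ∀ k → (sign k ≡ + 1) ⊎ (sign k ≡ -1ℤ)
   sign-cases zero = inj₁ refl
   sign-cases (suc k) with sign-cases k
   ... | inj₁ p = inj₂ (cong (-1ℤ ℤ.*_) p)
   ... | inj₂ p = inj₁ (cong (-1ℤ ℤ.*_) p)

   T₀ : Bool → Tℤ.M₂
   T₀ _ = Tℤ.mat (ℤ.- (+ 2)) -1ℤ (+ 1) (+ 0)

   -- The negative of T₀ is unipotent, so up to sign the entries of its powers are linear in the
   -- exponent.
   T₀-power : ∀ bs → let k = + length bs ; s = sign (length bs) in
     Tℤ.product T₀ bs Tℤ.≋ Tℤ.mat (s ℤ.* (k ℤ.+ + 1)) (s ℤ.* k) (ℤ.- (s ℤ.* k)) (s ℤ.* (+ 1 ℤ.- k))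
   T₀-power [] = Tℤ.mat≈ refl refl refl refl
   T₀-power (b ∷ bs) = Tℤ.≋-trans (Tℤ.⊗-cong {T₀ b} {T₀ b} Tℤ.≋-refl (T₀-power bs)) (Tℤ.mat≈ (e₁ s k) (e₂ s k) (e₃ s k) (e₄ s k))
     where
     s = sign (length bs)
     k = + length bs
     e₁ : ∀ s k → ℤ.- (+ 2) ℤ.* (s ℤ.* (k ℤ.+ + 1)) ℤ.+ -1ℤ ℤ.* (ℤ.- (s ℤ.* k)) ≡ (-1ℤ ℤ.* s) ℤ.* ((+ 1 ℤ.+ k) ℤ.+ + 1)
     e₁ = solve-∀
     e₂ : ∀ s k → ℤ.- (+ 2) ℤ.* (s ℤ.* k) ℤ.+ -1ℤ ℤ.* (s ℤ.* (+ 1 ℤ.- k)) ≡ (-1ℤ ℤ.* s) ℤ.* (+ 1 ℤ.+ k)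
     e₂ = solve-∀
     e₃ : ∀ s k → + 1 ℤ.* (s ℤ.* (k ℤ.+ + 1)) ℤ.+ + 0 ℤ.* (ℤ.- (s ℤ.* k)) ≡ ℤ.- ((-1ℤ ℤ.* s) ℤ.* (+ 1 ℤ.+ k))
     e₃ = solve-∀
     e₄ : ∀ s k → + 1 ℤ.* (s ℤ.* k) ℤ.+ + 0 ℤ.* (s ℤ.* (+ 1 ℤ.- k)) ≡ (-1ℤ ℤ.* s) ℤ.* (+ 1 ℤ.- (+ 1 ℤ.+ k))
     e₄ = solve-∀

   sign-odd : ∀ k → sign (suc (k ℕ.+ k)) ≡ -1ℤ
   sign-odd zero    = refl
   sign-odd (suc k) = trans (cong (λ z → sign (suc (suc z))) (ℕ.+-suc k k)) (trans (twice (sign (suc (k ℕ.+ k)))) (sign-odd k))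
     where
     twice : ∀ z → -1ℤ ℤ.* (-1ℤ ℤ.* z) ≡ z
     twice = solve-∀

 -- At a = 0, t = 1 a hub matrix is minus the plain one, so only signs distinguish suns of equal
 -- length. On an odd cycle the trace and the correction add up; on an even one, a bipartite graph,
 -- they would cancel.
 cycleDet-0 : ∀ bs k → length bs ≡ suc (k ℕ.+ k) → Tℤ.cycleDet (+ 0) (+ 1) bs ≡ ℤ.- (+ 4) ℤ.* sign (trues bs)
 cycleDet-0 bs k odd = trans (cong₂ (λ x y → x ℤ.- + 2 ℤ.* (y ℤ.* -1ℤ ^ℤ trues bs)) traceValue (1^ (length bs))) (combine (sign (trues bs)))
   where
   traceValue : Tℤ.tr (Tℤ.product (Tℤ.transfer (+ 0) (+ 1)) bs) ≡ ℤ.- (+ 2) ℤ.* sign (trues bs)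
   traceValue = trans (Tℤ.tr-cong (Tℤ.product-scale T₀ (Tℤ.transfer (+ 0) (+ 1)) -1ℤ (Tℤ.mat≈ refl refl refl refl) (Tℤ.mat≈ refl refl refl refl) bs))
     (trans (Tℤ.tr-⊙ (sign (trues bs)) (Tℤ.product T₀ bs)) (trans (cong (sign (trues bs) ℤ.*_) (trans (Tℤ.tr-cong (T₀-power bs))
       (trans (cong (λ s → s ℤ.* (+ length bs ℤ.+ + 1) ℤ.+ s ℤ.* (+ 1 ℤ.- + length bs)) (trans (cong sign odd) (sign-odd k))) (two (+ length bs)))))
       (ℤ.*-comm (sign (trues bs)) (ℤ.- (+ 2)))))
     where
     two : ∀ k → -1ℤ ℤ.* (k ℤ.+ + 1) ℤ.+ -1ℤ ℤ.* (+ 1 ℤ.- k) ≡ ℤ.- (+ 2)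
     two = solve-∀
   combine : ∀ s → ℤ.- (+ 2) ℤ.* s ℤ.- + 2 ℤ.* (+ 1 ℤ.* s) ≡ ℤ.- (+ 4) ℤ.* s
   combine = solve-∀

 cycleDet-0≢8X : ∀ bs k → length bs ≡ suc (k ℕ.+ k) → ∀ X → Tℤ.cycleDet (+ 0) (+ 1) bs ≢ + 8 ℤ.* X
 cycleDet-0≢8X bs k odd X eq = absurd ℤ.∣ X ∣ (trans (sym (ℤ.abs-* (+ 8) X)) (trans (cong ℤ.∣_∣ (trans (sym eq) (cycleDet-0 bs k odd))) four))
   where
   four : ℤ.∣ ℤ.- (+ 4) ℤ.* sign (trues bs) ∣ ≡ 4
   four with sign-cases (trues bs)
   ... | inj₁ p = cong (λ s → ℤ.∣ ℤ.- (+ 4) ℤ.* s ∣) p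
   ... | inj₂ p = cong (λ s → ℤ.∣ ℤ.- (+ 4) ℤ.* s ∣) p
   absurd : ∀ m → 8 ℕ.* m ≢ 4
   absurd zero    ()
   absurd (suc m) p = contradiction (ℕ.≤-trans (ℕ.m≤m*n 8 (suc m)) (ℕ.≤-reflexive p)) (ℕ.<⇒≱ (s≤s (s≤s (s≤s (s≤s (s≤s z≤n))))))

 -- A gap g stands for a hub followed by g vertices without leaf, so that consecutive hubs are at distance g + 1.
 bitsOf : List ℕ → List Bool
 bitsOf []       = []
 bitsOf (g ∷ gs) = true ∷ replicate g false ++ bitsOf gs

 -- At a = t = 1 the (1,1) entries of the powers of the plain transfer matrix run through 1, -1, 0
 -- with period 3, so a gap g ≡ 2 mod 3 would contribute a factor 0. In terms of hub distances g +
 -- 1, the multiples of 3 are excluded.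
 data Not≡2mod3 : ℕ → Set where
   zero′ : Not≡2mod3 0
   one′  : Not≡2mod3 1
   step′ : ∀ {g} → Not≡2mod3 g → Not≡2mod3 (3 ℕ.+ g)

 private
   T₁ : Bool → Tℤ.M₂
   T₁ = Tℤ.transfer (+ 1) (+ 1)

   -- At a = t = 1 a hub matrix has the single nonzero entry -1, in the corner. Products that start
   -- with a hub then have zero bottom row, and their corner entries multiply.
   unitRow : Tℤ.M₂ → Set
   unitRow A = ((Tℤ.e₁₁ A ≡ + 1) ⊎ (Tℤ.e₁₁ A ≡ -1ℤ)) × (Tℤ.e₂₁ A ≡ + 0) × (Tℤ.e₂₂ A ≡ + 0)

   ±1-* : ∀ {x y} → (x ≡ + 1) ⊎ (x ≡ -1ℤ) → (y ≡ + 1) ⊎ (y ≡ -1ℤ) → (x ℤ.* y ≡ + 1) ⊎ (x ℤ.* y ≡ -1ℤ)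
   ±1-* (inj₁ refl) (inj₁ refl) = inj₁ refl
   ±1-* (inj₁ refl) (inj₂ refl) = inj₂ refl
   ±1-* (inj₂ refl) (inj₁ refl) = inj₂ refl
   ±1-* (inj₂ refl) (inj₂ refl) = inj₁ refl

   -- The plain matrix has trace -1 and determinant 1, so its cube is the identity.
   falses : ∀ {g} → Not≡2mod3 g → (Tℤ.e₁₁ (Tℤ.product T₁ (replicate g false)) ≡ + 1) ⊎ (Tℤ.e₁₁ (Tℤ.product T₁ (replicate g false)) ≡ -1ℤ)
   falses zero′ = inj₁ refl
   falses one′  = inj₂ refl
   falses {suc (suc (suc g))} (step′ p) = subst (λ z → (z ≡ + 1) ⊎ (z ≡ -1ℤ)) (sym (cube (Tℤ.e₁₁ A) (Tℤ.e₂₁ A))) (falses p)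
     where
     A = Tℤ.product T₁ (replicate g false)
     cube : ∀ x y → -1ℤ ℤ.* (-1ℤ ℤ.* (-1ℤ ℤ.* x ℤ.+ -1ℤ ℤ.* y) ℤ.+ -1ℤ ℤ.* (+ 1 ℤ.* x ℤ.+ + 0 ℤ.* y)) ℤ.+ -1ℤ ℤ.* (+ 1 ℤ.* (-1ℤ ℤ.* x ℤ.+ -1ℤ ℤ.* y) ℤ.+ + 0 ℤ.* (+ 1 ℤ.* x ℤ.+ + 0 ℤ.* y)) ≡ x
     cube = solve-∀

   hubThen : ∀ {g} → Not≡2mod3 g → unitRow (Tℤ.product T₁ (true ∷ replicate g false))
   hubThen {g} p = subst (λ z → (z ≡ + 1) ⊎ (z ≡ -1ℤ)) (sym (top-row (Tℤ.e₁₁ A) (Tℤ.e₂₁ A))) (±1-* (inj₂ refl) (falses p)) , bottom (Tℤ.e₁₁ A) (Tℤ.e₂₁ A) , bottom (Tℤ.e₁₂ A) (Tℤ.e₂₂ A)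
     where
     A = Tℤ.product T₁ (replicate g false)
     top-row : ∀ x y → -1ℤ ℤ.* x ℤ.+ + 0 ℤ.* y ≡ -1ℤ ℤ.* x
     top-row = solve-∀
     bottom : ∀ x y → + 0 ℤ.* x ℤ.+ + 0 ℤ.* y ≡ + 0
     bottom = solve-∀

   unitRow-⊗ : ∀ A B → unitRow A → unitRow B → unitRow (A Tℤ.⊗ B)
   unitRow-⊗ (Tℤ.mat a b c d) (Tℤ.mat a′ b′ c′ d′) (u , refl , refl) (u′ , refl , refl) =
     subst (λ z → (z ≡ + 1) ⊎ (z ≡ -1ℤ)) (sym (corner a a′ b)) (±1-* u u′) , bottom a′ (+ 0) , bottom b′ (+ 0)
     where
     corner : ∀ a a′ b → a ℤ.* a′ ℤ.+ b ℤ.* + 0 ≡ a ℤ.* a′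
     corner = solve-∀
     bottom : ∀ x y → + 0 ℤ.* x ℤ.+ + 0 ℤ.* y ≡ + 0
     bottom = solve-∀

   unitRow-≋ : ∀ {A B} → A Tℤ.≋ B → unitRow A → unitRow B
   unitRow-≋ (Tℤ.mat≈ p _ r s) (u , v , w) = subst (λ z → (z ≡ + 1) ⊎ (z ≡ -1ℤ)) p u , trans (sym r) v , trans (sym s) w

   unitRow-gaps : ∀ g gs → (∀ {x} → x ∈ (g ∷ gs) → Not≡2mod3 x) → unitRow (Tℤ.product T₁ (bitsOf (g ∷ gs)))
   unitRow-gaps g [] p = unitRow-≋ (Tℤ.≋-sym (Tℤ.≋-trans (Tℤ.product-++ T₁ (true ∷ replicate g false) []) (Tℤ.⊗-identityʳ (Tℤ.product T₁ (true ∷ replicate g false))))) (hubThen (p (here refl)))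
   unitRow-gaps g (g′ ∷ gs) p = unitRow-≋ (Tℤ.≋-sym (Tℤ.product-++ T₁ (true ∷ replicate g false) (bitsOf (g′ ∷ gs))))
     (unitRow-⊗ (Tℤ.product T₁ (true ∷ replicate g false)) (Tℤ.product T₁ (bitsOf (g′ ∷ gs))) (hubThen (p (here refl))) (unitRow-gaps g′ gs (p ∘ there)))

 cycleDet-1≢0 : ∀ g gs → (∀ {x} → x ∈ (g ∷ gs) → Not≡2mod3 x) → Tℤ.cycleDet (+ 1) (+ 1) (bitsOf (g ∷ gs)) ≢ + 0
 cycleDet-1≢0 g gs p eq with unitRow-gaps g gs p
 ... | u , _ , e₂₂≡0 = notZero u (trans (sym value) eq)
   where
   A = Tℤ.product T₁ (bitsOf (g ∷ gs))
   value : Tℤ.cycleDet (+ 1) (+ 1) (bitsOf (g ∷ gs)) ≡ Tℤ.e₁₁ A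
   value = trans (cong₂ (λ x y → (Tℤ.e₁₁ A ℤ.+ x) ℤ.- + 2 ℤ.* (y ℤ.* (+ 0 ℤ.* (+ 0) ^ℤ trues (replicate g false ++ bitsOf gs)))) e₂₂≡0 (1^ (length (bitsOf (g ∷ gs)))))
     (simplify (Tℤ.e₁₁ A) ((+ 0) ^ℤ trues (replicate g false ++ bitsOf gs)))
     where
     simplify : ∀ x z → (x ℤ.+ + 0) ℤ.- + 2 ℤ.* (+ 1 ℤ.* (+ 0 ℤ.* z)) ≡ x
     simplify = solve-∀
   notZero : ∀ {x} → (x ≡ + 1) ⊎ (x ≡ -1ℤ) → x ≢ + 0
   notZero (inj₁ refl) ()
   notZero (inj₂ refl) ()

-- The trace of a gap word and the count of its short gaps.

module GapWords where
 open PowerSeries using (module Power)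
 open Elimination using (coeff₀-minus0)
 open TransferMatrices using (trues)
 open CycleElimination using (module T𝕊)
 open LeadingCoefficients using (bitsOf)
 open import Data.Nat.Base using (_≤_; _<_)
 open import Data.List.Base using (replicate; map)
 open import Data.List.Relation.Unary.All using (All; []; _∷_)
 open import Relation.Binary using (tri<; tri≈; tri>)

 open Power
 open T𝕊
 open import Relation.Binary.Reasoning.Setoid setoid

 -- With a = (1 + q)² and t = q the transfer matrix of a vertex without leaf has eigenvalues 1 and q²; in its
 -- eigenbasis, and after clearing 1 - q, a hub becomes the matrix hub below, where κ / ε = q (1 + q) / (1 - q³).
 ε κ : Carrier
 ε = 1# - q * q * q
 κ = q * (1# + q)

 hub : M₂
 hub = mat (ε - κ) κ (- κ) (ε + κ)

 plain : M₂
 plain = mat 1# 0# 0# (q * q)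

 eigen : Bool → M₂
 eigen true  = hub ⊗ plain
 eigen false = plain

 base : Carrier
 base = (1# + q) * (1# + q)

 private
   -- The columns are eigenvectors of the plain transfer matrix for 1 and q². The second one is
   -- scaled so that the off-diagonal entries of `hub` become κ and - κ.
   S : M₂
   S = mat 1# (- (q * q)) q (- q)

   cleared : Bool → M₂
   cleared true  = (1# - q) ⊙ transfer base q true
   cleared false = transfer base q false

   conjugate : ∀ c → cleared c ⊗ S ≋ S ⊗ eigen c
   conjugate false = mat≈
     (solve 1 (λ q → let a = (con (+ 1) :+ q) :* (con (+ 1) :+ q) in
         (a :- con (+ 2) :* q) :* con (+ 1) :+ (:- q) :* q := con (+ 1) :* con (+ 1) :+ (:- (q :* q)) :* con (+ 0)) refl q)
     (solve 1 (λ q → let a = (con (+ 1) :+ q) :* (con (+ 1) :+ q) in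
         (a :- con (+ 2) :* q) :* (:- (q :* q)) :+ (:- q) :* (:- q) := con (+ 1) :* con (+ 0) :+ (:- (q :* q)) :* (q :* q)) refl q)
     (solve 1 (λ q → q :* con (+ 1) :+ con (+ 0) :* q := q :* con (+ 1) :+ (:- q) :* con (+ 0)) refl q)
     (solve 1 (λ q → q :* (:- (q :* q)) :+ con (+ 0) :* (:- q) := q :* con (+ 0) :+ (:- q) :* (q :* q)) refl q)
   conjugate true = mat≈
     (solve 1 (λ q → let a = (con (+ 1) :+ q) :* (con (+ 1) :+ q) ; e = con (+ 1) :- q :* q :* q ; k = q :* (con (+ 1) :+ q) ; m = con (+ 1) :- q in
         (m :* ((a :- con (+ 3) :* q) :* (a :- q) :- q :* q)) :* con (+ 1) :+ (m :* (:- (q :* (a :- q)))) :* q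
         := con (+ 1) :* ((e :- k) :* con (+ 1) :+ k :* con (+ 0)) :+ (:- (q :* q)) :* ((:- k) :* con (+ 1) :+ (e :+ k) :* con (+ 0))) refl q)
     (solve 1 (λ q → let a = (con (+ 1) :+ q) :* (con (+ 1) :+ q) ; e = con (+ 1) :- q :* q :* q ; k = q :* (con (+ 1) :+ q) ; m = con (+ 1) :- q in
         (m :* ((a :- con (+ 3) :* q) :* (a :- q) :- q :* q)) :* (:- (q :* q)) :+ (m :* (:- (q :* (a :- q)))) :* (:- q)
         := con (+ 1) :* ((e :- k) :* con (+ 0) :+ k :* (q :* q)) :+ (:- (q :* q)) :* ((:- k) :* con (+ 0) :+ (e :+ k) :* (q :* q))) refl q)
     (solve 1 (λ q → let a = (con (+ 1) :+ q) :* (con (+ 1) :+ q) ; e = con (+ 1) :- q :* q :* q ; k = q :* (con (+ 1) :+ q) ; m = con (+ 1) :- q in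
         (m :* (q :* (a :- q))) :* con (+ 1) :+ (m :* con (+ 0)) :* q
         := q :* ((e :- k) :* con (+ 1) :+ k :* con (+ 0)) :+ (:- q) :* ((:- k) :* con (+ 1) :+ (e :+ k) :* con (+ 0))) refl q)
     (solve 1 (λ q → let a = (con (+ 1) :+ q) :* (con (+ 1) :+ q) ; e = con (+ 1) :- q :* q :* q ; k = q :* (con (+ 1) :+ q) ; m = con (+ 1) :- q in
         (m :* (q :* (a :- q))) :* (:- (q :* q)) :+ (m :* con (+ 0)) :* (:- q)
         := q :* ((e :- k) :* con (+ 0) :+ k :* (q :* q)) :+ (:- q) :* ((:- k) :* con (+ 0) :+ (e :+ k) :* (q :* q))) refl q)

   coeff₀-1-q* : ∀ f → coeff (1# - q * f) 0 ≡ + 1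
   coeff₀-1-q* f = coeff₀-minus0 1# (q * f) coeff-1-zero (q*-zero f)

   q-cancel : ∀ {f g} → q * f ≈ q * g → f ≈ g
   q-cancel {f} {g} p = q^-cancel 1 (trans (𝕊.*-congʳ (𝕊.*-identityʳ q)) (trans p (𝕊.*-congʳ (sym (𝕊.*-identityʳ q)))))

   -- The determinant of S is - q (1 - q²), which is not a unit: 1 - q² is cancelled as a unit and q
   -- by shifting coefficients.
   tr-eigen : ∀ bs → (1# - q) ^ trues bs * tr (product (transfer base q) bs) ≈ tr (product eigen bs)
   tr-eigen bs = trans (sym (trans (tr-cong (product-scale (transfer base q) cleared (1# - q) ≋-refl ≋-refl bs)) (tr-⊙ ((1# - q) ^ trues bs) (product (transfer base q) bs))))
     (unit-cancel (1# - q * q) (coeff₀-1-q* q) (q-cancel (trans (expand (tr (product cleared bs))) (trans (𝕊.-‿cong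
       (tr-conjugate (product cleared bs) (product eigen bs) S (intertwine {cleared} {eigen} {S} conjugate bs))) (sym (expand (tr (product eigen bs))))))))
     where
     expand : ∀ f → q * ((1# - q * q) * f) ≈ - (det₂ S * f)
     expand f = solve 2 (λ q f → q :* ((con (+ 1) :- q :* q) :* f) := :- ((con (+ 1) :* (:- q) :- (:- (q :* q)) :* q) :* f)) refl q f

 cycleDet-eigen : ∀ bs → (1# - q) ^ trues bs * cycleDet base q bs ≈ tr (product eigen bs) - ι (+ 2) * (q ^ length bs * ((1# - q) ^ trues bs * (base - q) ^ trues bs))
 cycleDet-eigen bs = trans (solve 5 (λ m x t l p → m :* (x :- t :* (l :* p)) := m :* x :- t :* (l :* (m :* p))) refl ((1# - q) ^ trues bs) (tr (product (transfer base q) bs)) (ι (+ 2)) (q ^ length bs) ((base - q) ^ trues bs))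
   (𝕊.+-congʳ (tr-eigen bs))

 -- Twice the hub distance g + 1: the eigenvalue q² is raised to that distance, since `eigen` counts
 -- the hub itself as one plain step.
 double : ℕ → ℕ
 double g = suc g ℕ.+ suc g

 gapMat : ℕ → M₂
 gapMat g = mat 1# 0# 0# (q ^ double g)

 word : List ℕ → M₂
 word []       = I₂
 word (g ∷ gs) = hub ⊗ gapMat g ⊗ word gs

 private
   plain-run : ∀ g → plain ⊗ product eigen (replicate g false) ≋ gapMat g
   plain-run zero = ≋-trans (⊗-identityʳ plain) (mat≈ refl refl refl (solve 1 (λ q → q :* q := q :* (q :* con (+ 1))) refl q))
   plain-run (suc g) = ≋-trans (⊗-cong ≋-refl (plain-run g)) (mat≈
       (solve 1 (λ x → con (+ 1) :* con (+ 1) :+ con (+ 0) :* con (+ 0) := con (+ 1)) refl q)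
       (solve 1 (λ x → con (+ 1) :* con (+ 0) :+ con (+ 0) :* x := con (+ 0)) refl (q ^ double g))
       (solve 1 (λ x → con (+ 0) :* con (+ 1) :+ x :* con (+ 0) := con (+ 0)) refl (q * q))
       (trans (solve 3 (λ q x y → con (+ 0) :* con (+ 0) :+ (q :* q) :* x := q :* (q :* x)) refl q (q ^ double g) q) (reflexive (cong (λ k → q * q ^ k) (≡.sym (ℕ.+-suc (suc g) (suc g)))))))

 product-eigen-bitsOf : ∀ gs → product eigen (bitsOf gs) ≋ word gs
 product-eigen-bitsOf []       = ≋-refl
 product-eigen-bitsOf (g ∷ gs) = ≋-trans (⊗-cong ≋-refl (product-++ eigen (replicate g false) (bitsOf gs)))
   (≋-trans (≋-sym (⊗-assoc (eigen true) _ _)) (≋-trans (⊗-cong (≋-trans (⊗-assoc hub plain _) (⊗-cong ≋-refl (plain-run g))) (product-eigen-bitsOf gs)) (⊗-assoc hub (gapMat g) (word gs))))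

 count : ℕ → List ℕ → ℕ
 count j []       = 0
 count j (h ∷ hs) with h ℕ.≟ j
 ... | yes _ = suc (count j hs)
 ... | no _  = count j hs

 double-injective : ∀ {a b} → a ℕ.+ a ≡ b ℕ.+ b → a ≡ b
 double-injective {a} {b} p with ℕ.<-cmp a b
 ... | tri< l _ _ = contradiction p (ℕ.<⇒≢ (ℕ.+-mono-< l l))
 ... | tri≈ _ e _ = e
 ... | tri> _ _ g = contradiction (≡.sym p) (ℕ.<⇒≢ (ℕ.+-mono-< g g))

 private
   powerSum : List ℕ → Carrier
   powerSum []       = 0#
   powerSum (h ∷ hs) = q ^ (h ℕ.+ h) + powerSum hs

   coeff-q^ : ∀ k n → coeff (q ^ k) n ≡ coeff (q ^ k * 1#) n
   coeff-q^ k n = coeff-cong (sym (𝕊.*-identityʳ (q ^ k))) n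

   coeff-q^-same : ∀ k → coeff (q ^ k) k ≡ + 1
   coeff-q^-same k = ≡.trans (coeff-q^ k k) (≡.trans (cong (coeff (q ^ k * 1#)) (≡.sym (ℕ.+-identityʳ k))) (≡.trans (q^*-shift k 1# 0) coeff-1-zero))

   coeff-q^-diff : ∀ {k n} → k ≢ n → coeff (q ^ k) n ≡ + 0
   coeff-q^-diff {k} {n} k≢n with ℕ.<-cmp n k
   ... | tri< n<k _ _ = ≡.trans (coeff-q^ k n) (q^*-low k 1# n n<k)
   ... | tri≈ _ n≡k _ = contradiction (≡.sym n≡k) k≢n
   ... | tri> _ _ n>k = ≡.trans (coeff-q^ k n) (≡.trans (cong (coeff (q ^ k * 1#)) (≡.trans (≡.sym (ℕ.m+[n∸m]≡n n>k)) (≡.sym (ℕ.+-suc k (n ℕ.∸ suc k)))))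
         (≡.trans (q^*-shift k 1# (suc (n ℕ.∸ suc k))) (coeff-1-suc (n ℕ.∸ suc k))))

   coeff-powerSum : ∀ hs j → coeff (powerSum hs) (j ℕ.+ j) ≡ + count j hs
   coeff-powerSum [] j = coeff-0 (j ℕ.+ j)
   coeff-powerSum (h ∷ hs) j with h ℕ.≟ j
   ... | yes ≡.refl = ≡.trans (coeff-+ (q ^ (j ℕ.+ j)) (powerSum hs) (j ℕ.+ j)) (cong₂ ℤ._+_ (coeff-q^-same (j ℕ.+ j)) (coeff-powerSum hs j))
   ... | no h≢j     = ≡.trans (coeff-+ (q ^ (h ℕ.+ h)) (powerSum hs) (j ℕ.+ j)) (≡.trans (cong₂ ℤ._+_ (coeff-q^-diff (h≢j ∘ double-injective)) (coeff-powerSum hs j)) (ℤ.+-identityˡ _))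

 -- For gaps ≥ g₀ the trace of a word is known modulo Z², where Z = q^{2 (g₀ + 1)}: only the paths that leave the
 -- first state at most once, for a single step, contribute.
 module Expansion (g₀ : ℕ) where
   private
     Z σ η : Carrier
     Z = q ^ double g₀
     σ = ε - κ
     η = ε + κ

     y : ℕ → Carrier
     y h = q ^ (h ℕ.+ h)

     shifted : List ℕ → M₂
     shifted hs = word (map (g₀ ℕ.+_) hs)

     gap-split : ∀ h → q ^ double (g₀ ℕ.+ h) ≈ Z * y h
     gap-split h = trans (reflexive (cong (q ^_) (rearrange g₀ h))) (^-homo-* q (double g₀) (h ℕ.+ h))
       where
       rearrange : ∀ a b → double (a ℕ.+ b) ≡ double a ℕ.+ (b ℕ.+ b)
       rearrange a b = ≡.trans (cong suc (≡.trans (ℕ.+-suc (a ℕ.+ b) (a ℕ.+ b)) (cong suc (interchange a b))))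
                              (cong (λ z → suc (z ℕ.+ (b ℕ.+ b))) (≡.sym (ℕ.+-suc a a)))
         where
         interchange : ∀ a b → (a ℕ.+ b) ℕ.+ (a ℕ.+ b) ≡ (a ℕ.+ a) ℕ.+ (b ℕ.+ b)
         interchange a b = ≡.trans (ℕ.+-assoc a b (a ℕ.+ b)) (≡.trans (cong (a ℕ.+_) (≡.trans (≡.sym (ℕ.+-assoc b a b)) (≡.trans (cong (ℕ._+ b) (ℕ.+-comm b a)) (ℕ.+-assoc a b b)))) (≡.sym (ℕ.+-assoc a a (b ℕ.+ b))))

     initSum : ℕ → List ℕ → Carrier
     initSum h []        = 0#
     initSum h (h′ ∷ hs) = y h + initSum h′ hs

     final : ℕ → List ℕ → ℕ
     final h []        = h
     final h (h′ ∷ hs) = final h′ hs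

     -- For n hubs the (1,1) entry is σ^n minus κ² σ^(n-2) Z times the sum over the inner gaps; the
     -- factor σ avoids the exponent n - 2. An excursion along the last gap closes up around the
     -- cycle and enters the trace through `e₂₂`. The cruder `b₁₁`, modulo Z, suffices for the lower
     -- row.
     record Approx (X : M₂) (E s l : Carrier) : Set where
       field
         r₁ r₂ r₃ r₄ r₅ : Carrier
         a₁₁ : σ * e₁₁ X ≈ (σ * (σ * E) - κ * κ * (E * (Z * s))) + Z * Z * r₁
         a₁₂ : e₁₂ X ≈ Z * (κ * (E * l)) + Z * Z * r₂
         a₂₁ : e₂₁ X ≈ - (κ * E) + Z * r₃
         a₂₂ : e₂₂ X ≈ Z * r₄
         b₁₁ : e₁₁ X ≈ σ * E + Z * r₅

     prepend : ∀ h X → hub ⊗ gapMat (g₀ ℕ.+ h) ⊗ X ≋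
       mat (σ * e₁₁ X + κ * (Z * y h) * e₂₁ X) (σ * e₁₂ X + κ * (Z * y h) * e₂₂ X)
           (- κ * e₁₁ X + η * (Z * y h) * e₂₁ X) (- κ * e₁₂ X + η * (Z * y h) * e₂₂ X)
     prepend h (mat a b c d) = mat≈ (entry σ κ a c) (entry σ κ b d) (entry (- κ) η a c) (entry (- κ) η b d)
       where
       entry : ∀ s k a c → s * (1# * a + 0# * c) + k * (0# * a + q ^ double (g₀ ℕ.+ h) * c) ≈ s * a + k * (Z * y h) * c
       entry s k a c = trans (𝕊.+-congˡ (𝕊.*-congˡ (𝕊.+-congˡ (𝕊.*-congʳ (gap-split h)))))
         (solve 5 (λ s k a c w → s :* (con (+ 1) :* a :+ con (+ 0) :* c) :+ k :* (con (+ 0) :* a :+ w :* c) := s :* a :+ k :* w :* c) refl s k a c (Z * y h))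

     approx : ∀ h hs → Approx (shifted (h ∷ hs)) (σ ^ length hs) (initSum h hs) (y (final h hs))
     approx h [] = record
       { r₁ = 0# ; r₂ = 0# ; r₃ = 0# ; r₄ = η * y h ; r₅ = 0#
       ; a₁₁ = trans (𝕊.*-congˡ (p₁₁ P)) (solve 4 (λ s k z y → s :* (s :* con (+ 1) :+ k :* (z :* y) :* con (+ 0)) := (s :* (s :* con (+ 1)) :- k :* k :* (con (+ 1) :* (z :* con (+ 0)))) :+ z :* z :* con (+ 0)) refl σ κ Z (y h))
       ; a₁₂ = trans (p₁₂ P) (solve 4 (λ s k z y → s :* con (+ 0) :+ k :* (z :* y) :* con (+ 1) := z :* (k :* (con (+ 1) :* y)) :+ z :* z :* con (+ 0)) refl σ κ Z (y h))
       ; a₂₁ = trans (p₂₁ P) (solve 4 (λ s k z y → (:- k) :* con (+ 1) :+ s :* (z :* y) :* con (+ 0) := :- (k :* con (+ 1)) :+ z :* con (+ 0)) refl η κ Z (y h))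
       ; a₂₂ = trans (p₂₂ P) (solve 4 (λ s k z y → (:- k) :* con (+ 0) :+ s :* (z :* y) :* con (+ 1) := z :* (s :* y)) refl η κ Z (y h))
       ; b₁₁ = trans (p₁₁ P) (solve 4 (λ s k z y → s :* con (+ 1) :+ k :* (z :* y) :* con (+ 0) := s :* con (+ 1) :+ z :* con (+ 0)) refl σ κ Z (y h)) }
       where
       P = prepend h I₂
     approx h (h′ ∷ hs) = record
       { r₁ = σ * A.r₁ + κ * (y h * (σ * A.r₃)) ; r₂ = σ * A.r₂ + κ * (y h * A.r₄) ; r₃ = - κ * A.r₅ + η * (y h * e₂₁ X)
       ; r₄ = - κ * (κ * (E * l) + Z * A.r₂) + η * (y h * (Z * A.r₄)) ; r₅ = σ * A.r₅ + κ * (y h * e₂₁ X)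
       ; a₁₁ = trans (𝕊.*-congˡ (p₁₁ P)) (trans (solve 5 (λ s k w a c → s :* (s :* a :+ k :* w :* c) := s :* (s :* a) :+ k :* w :* (s :* c)) refl σ κ (Z * y h) (e₁₁ X) (e₂₁ X))
           (trans (𝕊.+-cong (𝕊.*-congˡ A.a₁₁) (𝕊.*-congˡ (𝕊.*-congˡ A.a₂₁)))
           (solve 8 (λ s k z y E i r₁ r₃ → s :* ((s :* (s :* E) :- k :* k :* (E :* (z :* i))) :+ z :* z :* r₁) :+ k :* (z :* y) :* (s :* ((:- (k :* E)) :+ z :* r₃))
              := (s :* (s :* (s :* E)) :- k :* k :* ((s :* E) :* (z :* (y :+ i)))) :+ z :* z :* (s :* r₁ :+ k :* (y :* (s :* r₃)))) refl σ κ Z (y h) E i A.r₁ A.r₃)))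
       ; a₁₂ = trans (p₁₂ P) (trans (𝕊.+-cong (𝕊.*-congˡ A.a₁₂) (𝕊.*-congˡ A.a₂₂))
           (solve 8 (λ s k z y E l r₂ r₄ → s :* (z :* (k :* (E :* l)) :+ z :* z :* r₂) :+ k :* (z :* y) :* (z :* r₄)
              := z :* (k :* ((s :* E) :* l)) :+ z :* z :* (s :* r₂ :+ k :* (y :* r₄))) refl σ κ Z (y h) E l A.r₂ A.r₄))
       ; a₂₁ = trans (p₂₁ P) (trans (𝕊.+-congʳ (𝕊.*-congˡ A.b₁₁))
           (solve 8 (λ s k z y E n c r₅ → (:- k) :* (s :* E :+ z :* r₅) :+ n :* (z :* y) :* c := :- (k :* (s :* E)) :+ z :* ((:- k) :* r₅ :+ n :* (y :* c))) refl σ κ Z (y h) E η (e₂₁ X) A.r₅))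
       ; a₂₂ = trans (p₂₂ P) (trans (𝕊.+-cong (𝕊.*-congˡ A.a₁₂) (𝕊.*-congˡ A.a₂₂))
           (solve 8 (λ n k z y E l r₂ r₄ → (:- k) :* (z :* (k :* (E :* l)) :+ z :* z :* r₂) :+ n :* (z :* y) :* (z :* r₄)
              := z :* ((:- k) :* (k :* (E :* l) :+ z :* r₂) :+ n :* (y :* (z :* r₄)))) refl η κ Z (y h) E l A.r₂ A.r₄))
       ; b₁₁ = trans (p₁₁ P) (trans (𝕊.+-congʳ (𝕊.*-congˡ A.b₁₁))
           (solve 7 (λ s k z y E c r₅ → s :* (s :* E :+ z :* r₅) :+ k :* (z :* y) :* c := s :* (s :* E) :+ z :* (s :* r₅ :+ k :* (y :* c))) refl σ κ Z (y h) E (e₂₁ X) A.r₅)) }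
       where
       X = shifted (h′ ∷ hs)
       module A = Approx (approx h′ hs)
       E = σ ^ length hs
       i = initSum h′ hs
       l = y (final h′ hs)
       P = prepend h X

     powerSum-split : ∀ h hs → initSum h hs + y (final h hs) ≈ powerSum (h ∷ hs)
     powerSum-split h []        = 𝕊.+-comm 0# (y h)
     powerSum-split h (h′ ∷ hs) = trans (𝕊.+-assoc (y h) (initSum h′ hs) (y (final h′ hs))) (𝕊.+-congˡ (powerSum-split h′ hs))

     trace-approx : ∀ h h′ hs → Σ Carrier λ R → σ * tr (shifted (h ∷ h′ ∷ hs)) ≈
       (σ * (σ * (σ * σ ^ length hs)) - κ * κ * ((σ * σ ^ length hs) * (Z * powerSum (h ∷ h′ ∷ hs)))) + Z * Z * R
     trace-approx h h′ hs = R , (begin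
       σ * (e₁₁ W + e₂₂ W) ≈⟨ 𝕊.distribˡ σ (e₁₁ W) (e₂₂ W) ⟩
       σ * e₁₁ W + σ * e₂₂ W ≈⟨ 𝕊.+-cong B.a₁₁ (𝕊.*-congˡ (trans (p₂₂ (prepend h X)) (𝕊.+-cong (𝕊.*-congˡ A.a₁₂) (𝕊.*-congˡ A.a₂₂)))) ⟩
       ((σ * (σ * (σ * E)) - κ * κ * ((σ * E) * (Z * initSum h (h′ ∷ hs)))) + Z * Z * B.r₁) + σ * (- κ * (Z * (κ * (E * l)) + Z * Z * A.r₂) + η * (Z * y h) * (Z * A.r₄))
         ≈⟨ solve 11 (λ s n k z y E i l r₁ r₂ r₄ → ((s :* (s :* (s :* E)) :- k :* k :* ((s :* E) :* (z :* i))) :+ z :* z :* r₁) :+ s :* ((:- k) :* (z :* (k :* (E :* l)) :+ z :* z :* r₂) :+ n :* (z :* y) :* (z :* r₄))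
              := (s :* (s :* (s :* E)) :- k :* k :* ((s :* E) :* (z :* (i :+ l)))) :+ z :* z :* (r₁ :+ s :* ((:- k) :* r₂ :+ n :* (y :* r₄)))) refl σ η κ Z (y h) E (initSum h (h′ ∷ hs)) l B.r₁ A.r₂ A.r₄ ⟩
       (σ * (σ * (σ * E)) - κ * κ * ((σ * E) * (Z * (initSum h (h′ ∷ hs) + l)))) + Z * Z * R
         ≈⟨ 𝕊.+-congʳ (𝕊.+-congˡ (𝕊.-‿cong (𝕊.*-congˡ (𝕊.*-congˡ (𝕊.*-congˡ (powerSum-split h (h′ ∷ hs))))))) ⟩
       (σ * (σ * (σ * E)) - κ * κ * ((σ * E) * (Z * powerSum (h ∷ h′ ∷ hs)))) + Z * Z * R ∎)
       where
       X = shifted (h′ ∷ hs)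
       W = shifted (h ∷ h′ ∷ hs)
       module A = Approx (approx h′ hs)
       module B = Approx (approx h (h′ ∷ hs))
       E = σ ^ length hs
       l = y (final h′ hs)
       R = B.r₁ + σ * (- κ * A.r₂ + η * (y h * A.r₄))

     σ₀ : coeff σ 0 ≡ + 1
     σ₀ = coeff₀-minus0 ε κ (coeff₀-minus0 1# (q * q * q) coeff-1-zero (≡.trans (coeff-cong (𝕊.*-assoc q q q) 0) (q*-zero (q * q)))) (q*-zero (1# + q))

     unit-* : ∀ {f g} → coeff f 0 ≡ + 1 → coeff g 0 ≡ + 1 → coeff (f * g) 0 ≡ + 1
     unit-* {f} {g} p r = ≡.trans (coeff-*-zero f g) (cong₂ ℤ._*_ p r)

     unit-^ : ∀ {f} → coeff f 0 ≡ + 1 → ∀ k → coeff (f ^ k) 0 ≡ + 1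
     unit-^ p zero    = coeff-1-zero
     unit-^ p (suc k) = unit-* p (unit-^ p k)

     compare : ∀ {s k E z a b r r′ t t′} → s * t ≈ (s * (s * (s * E)) - k * k * ((s * E) * (z * a))) + z * z * r →
       s * t′ ≈ (s * (s * (s * E)) - k * k * ((s * E) * (z * b))) + z * z * r′ → t ≈ t′ → k * k * ((s * E) * (z * (a - b))) ≈ z * (z * (r - r′))
     compare {s} {k} {E} {z} {a} {b} {r} {r′} {t} {t′} p p′ e = begin
       k * k * ((s * E) * (z * (a - b))) ≈⟨ solve 8 (λ k s E z a b r r′ → k :* k :* ((s :* E) :* (z :* (a :- b)))
            := z :* z :* (r :- r′) :- (((s :* (s :* (s :* E)) :- k :* k :* ((s :* E) :* (z :* a))) :+ z :* z :* r) :- ((s :* (s :* (s :* E)) :- k :* k :* ((s :* E) :* (z :* b))) :+ z :* z :* r′))) refl k s E z a b r r′ ⟩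
       z * z * (r - r′) - (((s * (s * (s * E)) - k * k * ((s * E) * (z * a))) + z * z * r) - ((s * (s * (s * E)) - k * k * ((s * E) * (z * b))) + z * z * r′))
         ≈⟨ 𝕊.+-congˡ (𝕊.-‿cong (𝕊.+-cong (sym p) (𝕊.-‿cong (trans (sym p′) (𝕊.*-congˡ (sym e)))))) ⟩
       z * z * (r - r′) - (s * t - s * t) ≈⟨ solve 3 (λ z r m → z :* z :* r :- (m :- m) := z :* (z :* r)) refl z (r - r′) (s * t) ⟩
       z * (z * (r - r′)) ∎

     factor : ∀ z x o s E d → z * ((x * (x * 1#)) * ((o * o * (s * E)) * d)) ≈ (x * o) * (x * o) * ((s * E) * (z * d))
     factor = solve 6 (λ z q o s E d → z :* ((q :* (q :* con (+ 1))) :* ((o :* o :* (s :* E)) :* d)) := (q :* o) :* (q :* o) :* ((s :* E) :* (z :* d))) refl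

     assemble : ∀ z a b u v r → z * ((a * b) * ((u * v) * r)) ≈ z * (a * (u * (b * (v * r))))
     assemble = solve 6 (λ z a b u v r → z :* ((a :* b) :* ((u :* v) :* r)) := z :* (a :* (u :* (b :* (v :* r))))) refl

     -- Modulo Z² the traces differ by κ² Z times the difference of the power sums, up to a unit.
     -- Cancelling Z leaves the modulus Z = q^(2 g₀ + 2), and κ² uses up q². Hence the power sums
     -- agree below q^(2 g₀), which determines the number of gaps g₀, ..., 2 g₀ - 1.
     powerSums-agree : ∀ h h′ hs k k′ ks → length hs ≡ length ks → tr (shifted (h ∷ h′ ∷ hs)) ≈ tr (shifted (k ∷ k′ ∷ ks)) →
       Σ Carrier λ R → powerSum (h ∷ h′ ∷ hs) - powerSum (k ∷ k′ ∷ ks) ≈ q ^ (g₀ ℕ.+ g₀) * R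
     powerSums-agree h h′ hs k k′ ks len e = inv u * (R - R′) , unit-cancel u u₀ (q^-cancel 2 (q^-cancel (double g₀) chain))
       where
       R = proj₁ (trace-approx h h′ hs)
       R′ = proj₁ (trace-approx k k′ ks)
       E = σ ^ length hs
       Δ = powerSum (h ∷ h′ ∷ hs) - powerSum (k ∷ k′ ∷ ks)
       u = (1# + q) * (1# + q) * (σ * E)
       1+q₀ : coeff (1# + q) 0 ≡ + 1
       1+q₀ = ≡.trans (coeff-+ 1# q 0) (cong₂ ℤ._+_ coeff-1-zero coeff-q-zero)
       u₀ : coeff u 0 ≡ + 1
       u₀ = unit-* (unit-* 1+q₀ 1+q₀) (unit-* σ₀ (unit-^ σ₀ (length hs)))
       Z-split : Z ≈ q ^ 2 * q ^ (g₀ ℕ.+ g₀)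
       Z-split = trans (reflexive (cong (q ^_) (cong suc (ℕ.+-suc g₀ g₀)))) (^-homo-* q 2 (g₀ ℕ.+ g₀))
       p″ : σ * tr (shifted (k ∷ k′ ∷ ks)) ≈ (σ * (σ * (σ * E)) - κ * κ * ((σ * E) * (Z * powerSum (k ∷ k′ ∷ ks)))) + Z * Z * R′
       p″ = ≡.subst (λ m → σ * tr (shifted (k ∷ k′ ∷ ks)) ≈ (σ * (σ * (σ * σ ^ m)) - κ * κ * ((σ * σ ^ m) * (Z * powerSum (k ∷ k′ ∷ ks)))) + Z * Z * R′) (≡.sym len) (proj₂ (trace-approx k k′ ks))
       chain₁ : Z * (q ^ 2 * (u * Δ)) ≈ κ * κ * ((σ * E) * (Z * Δ))
       chain₁ = factor Z q (1# + q) σ E Δ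
       chain₂ : κ * κ * ((σ * E) * (Z * Δ)) ≈ Z * (Z * (R - R′))
       chain₂ = compare {σ} {κ} {E} {Z} {powerSum (h ∷ h′ ∷ hs)} {powerSum (k ∷ k′ ∷ ks)} {R} {R′} {tr (shifted (h ∷ h′ ∷ hs))} {tr (shifted (k ∷ k′ ∷ ks))} (proj₂ (trace-approx h h′ hs)) p″ e
       chain₃ : Z * (Z * (R - R′)) ≈ Z * ((q ^ 2 * q ^ (g₀ ℕ.+ g₀)) * ((u * inv u) * (R - R′)))
       chain₃ = 𝕊.*-congˡ (𝕊.*-cong Z-split (sym (trans (𝕊.*-congʳ (inv-inverse u u₀)) (𝕊.*-identityˡ (R - R′)))))
       chain : Z * (q ^ 2 * (u * Δ)) ≈ Z * (q ^ 2 * (u * (q ^ (g₀ ℕ.+ g₀) * (inv u * (R - R′)))))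
       chain = trans chain₁ (trans chain₂ (trans chain₃ (assemble Z (q ^ 2) (q ^ (g₀ ℕ.+ g₀)) u (inv u) (R - R′))))

     unshift : ∀ {gs} → All (g₀ ≤_) gs → Σ (List ℕ) λ hs → map (g₀ ℕ.+_) hs ≡ gs
     unshift []       = [] , ≡.refl
     unshift {g ∷ _} (p ∷ ps) with unshift ps
     ... | hs , e = g ℕ.∸ g₀ ∷ hs , cong₂ _∷_ (ℕ.m+[n∸m]≡n p) e

     count-shift : ∀ j hs → count (g₀ ℕ.+ j) (map (g₀ ℕ.+_) hs) ≡ count j hs
     count-shift j [] = ≡.refl
     count-shift j (h ∷ hs) with h ℕ.≟ j | g₀ ℕ.+ h ℕ.≟ g₀ ℕ.+ j
     ... | yes _ | yes _ = cong suc (count-shift j hs)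
     ... | yes ≡.refl | no q = contradiction ≡.refl q
     ... | no p | yes q = contradiction (ℕ.+-cancelˡ-≡ g₀ h j q) p
     ... | no _ | no _  = count-shift j hs

     counts-agree′ : ∀ hs ks → length hs ≡ length ks → 2 ≤ length hs → tr (shifted hs) ≈ tr (shifted ks) → ∀ j → j < g₀ → count j hs ≡ count j ks
     counts-agree′ (_ ∷ []) _ _ (s≤s ()) _ _ _
     counts-agree′ (h ∷ h′ ∷ hs) (k ∷ k′ ∷ ks) len _ e j j<g₀ = ℤ.+-injective (≡.trans (≡.sym (coeff-powerSum (h ∷ h′ ∷ hs) j)) (≡.trans (ℤ.i-j≡0⇒i≡j _ _
         (≡.trans (≡.sym (coeff-sub _ _ (j ℕ.+ j))) (≡.trans (coeff-cong (proj₂ agree) (j ℕ.+ j)) (q^*-low (g₀ ℕ.+ g₀) (proj₁ agree) (j ℕ.+ j) (ℕ.+-mono-< j<g₀ j<g₀))))) (coeff-powerSum (k ∷ k′ ∷ ks) j)))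
       where agree = powerSums-agree h h′ hs k k′ ks (ℕ.suc-injective (ℕ.suc-injective len)) e

   counts-agree : ∀ gs gs′ → All (g₀ ≤_) gs → All (g₀ ≤_) gs′ → length gs ≡ length gs′ → 2 ≤ length gs → tr (word gs) ≈ tr (word gs′) →
     ∀ j → j < g₀ → count (g₀ ℕ.+ j) gs ≡ count (g₀ ℕ.+ j) gs′
   counts-agree gs gs′ a a′ len two e j j<g₀ with unshift a | unshift a′
   ... | hs , ≡.refl | ks , ≡.refl = ≡.trans (count-shift j hs) (≡.trans
     (counts-agree′ hs ks (≡.trans (≡.sym (List.length-map _ hs)) (≡.trans len (List.length-map _ ks))) (≡.subst (2 ≤_) (List.length-map _ hs) two) e j j<g₀)
     (≡.sym (count-shift j ks)))

-- Reading a word off the trace by means of two long gaps.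

module Decode where
 open PowerSeries using (module Power)
 open Elimination using (coeff₀-*0; coeff₀-minus0)
 open CycleElimination using (module T𝕊)
 open GapWords using (ε; κ; hub; double; gapMat; word)
 open import Data.Nat.Base using (_≤_; _<_)
 open import Data.Integer.Base using (-1ℤ)
 open import Data.List.Base using (reverse; _∷ʳ_)
 open import Relation.Binary using (tri<; tri≈; tri>)

 open Power
 open T𝕊
 open import Relation.Binary.Reasoning.Setoid setoid

 -- The gaps strictly between length us + 1 consecutive hubs.
 block : List ℕ → M₂
 block []       = hub
 block (g ∷ us) = hub ⊗ gapMat g ⊗ block us

 word-block : ∀ us M gs → word (us ++ M ∷ gs) ≋ block us ⊗ gapMat M ⊗ word gs
 word-block []       M gs = ≋-refl
 word-block (g ∷ us) M gs = ≋-trans (⊗-cong ≋-refl (⊗-cong ≋-refl (word-block us M gs)))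
   (≋-trans (⊗-cong ≋-refl (≋-sym (⊗-assoc (gapMat g) (block us) _))) (≋-sym (⊗-assoc hub (gapMat g ⊗ block us) _)))

 private
   η σ : Carrier
   η = ε + κ
   σ = ε - κ

   x : ℕ → Carrier
   x g = q ^ double g

   block-cons : ∀ g us → block (g ∷ us) ≋
     mat (σ * e₁₁ (block us) + κ * (x g * e₂₁ (block us))) (σ * e₁₂ (block us) + κ * (x g * e₂₂ (block us)))
         (- κ * e₁₁ (block us) + η * (x g * e₂₁ (block us))) (- κ * e₁₂ (block us) + η * (x g * e₂₂ (block us)))
   block-cons g us = mat≈ (entry σ κ _ _) (entry σ κ _ _) (entry (- κ) η _ _) (entry (- κ) η _ _)
     where
     entry : ∀ s k a c → s * (1# * a + 0# * c) + k * (0# * a + x g * c) ≈ s * a + k * (x g * c)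
     entry s k a c = solve 5 (λ s k a c w → s :* (con (+ 1) :* a :+ con (+ 0) :* c) :+ k :* (con (+ 0) :* a :+ w :* c) := s :* a :+ k :* (w :* c)) refl s k a c (x g)

   ε₀ : coeff ε 0 ≡ + 1
   ε₀ = coeff₀-minus0 1# (q * q * q) coeff-1-zero (≡.trans (coeff-cong (𝕊.*-assoc q q q) 0) (q*-zero (q * q)))

   κ₀ : coeff κ 0 ≡ + 0
   κ₀ = q*-zero (1# + q)

   σ₀ : coeff σ 0 ≡ + 1
   σ₀ = coeff₀-minus0 ε κ ε₀ κ₀

   η₀ : coeff η 0 ≡ + 1
   η₀ = ≡.trans (coeff-+ ε κ 0) (cong₂ ℤ._+_ ε₀ κ₀)

   o₀ : coeff (1# + q) 0 ≡ + 1
   o₀ = ≡.trans (coeff-+ 1# q 0) (cong₂ ℤ._+_ coeff-1-zero coeff-q-zero)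

   x₀* : ∀ g f → coeff (x g * f) 0 ≡ + 0
   x₀* g f = q^*-low (double g) f 0 (s≤s z≤n)

   *₀ : ∀ {f g} → coeff f 0 ≡ + 1 → coeff g 0 ≡ + 1 → coeff (f * g) 0 ≡ + 1
   *₀ {f} {g} p r = ≡.trans (coeff-*-zero f g) (cong₂ ℤ._*_ p r)

   +₀ : ∀ {f g c d} → coeff f 0 ≡ c → coeff g 0 ≡ d → coeff (f + g) 0 ≡ c ℤ.+ d
   +₀ {f} {g} p r = ≡.trans (coeff-+ f g 0) (cong₂ ℤ._+_ p r)

   *0₀ : ∀ f {g} → coeff g 0 ≡ + 0 → coeff (f * g) 0 ≡ + 0
   *0₀ f {g} p = ≡.trans (coeff-cong (𝕊.*-comm f g) 0) (coeff₀-*0 g f p)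

   -- Both off-diagonal entries of a block have order exactly 1 in q. This locates the middle
   -- coefficients of the trace polynomial and makes the first gap of a block visible.
   record Leading (Y : M₂) : Set where
     field
       P Q   : Carrier
       e₁₁₀  : coeff (e₁₁ Y) 0 ≡ + 1
       e₁₂≈  : e₁₂ Y ≈ q * P
       e₂₁≈  : e₂₁ Y ≈ - (q * Q)
       P₀    : coeff P 0 ≡ + 1
       Q₀    : coeff Q 0 ≡ + 1

   leading : ∀ us → Leading (block us)
   leading [] = record { P = 1# + q ; Q = 1# + q ; e₁₁₀ = σ₀ ; e₁₂≈ = refl ; e₂₁≈ = refl ; P₀ = o₀ ; Q₀ = o₀ }
   leading (g ∷ us) = record
     { P = σ * A.P + (1# + q) * (x g * e₂₂ Y)
     ; Q = (1# + q) * e₁₁ Y + η * (x g * A.Q)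
     ; e₁₁₀ = ≡.trans (coeff-cong (p₁₁ (block-cons g us)) 0) (+₀ (*₀ σ₀ A.e₁₁₀) (*0₀ κ (x₀* g (e₂₁ Y))))
     ; e₁₂≈ = trans (p₁₂ (block-cons g us)) (trans (𝕊.+-congʳ (𝕊.*-congˡ A.e₁₂≈)) (solve 5 (λ s q P o w → s :* (q :* P) :+ (q :* o) :* w := q :* (s :* P :+ o :* w)) refl σ q A.P (1# + q) (x g * e₂₂ Y)))
     ; e₂₁≈ = trans (p₂₁ (block-cons g us)) (trans (𝕊.+-congˡ (𝕊.*-congˡ (𝕊.*-congˡ A.e₂₁≈))) (solve 6 (λ q o a n w Q → (:- (q :* o)) :* a :+ n :* (w :* (:- (q :* Q))) := :- (q :* (o :* a :+ n :* (w :* Q)))) refl q (1# + q) (e₁₁ Y) η (x g) A.Q))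
     ; P₀ = +₀ (*₀ σ₀ A.P₀) (*0₀ (1# + q) (x₀* g (e₂₂ Y)))
     ; Q₀ = +₀ (*₀ o₀ A.e₁₁₀) (*0₀ η (x₀* g A.Q)) }
     where
     Y = block us
     module A = Leading (leading us)

   record DegM (n : ℕ) (Y : M₂) : Set where
     constructor degM
     field
       d₁₁ : Deg≤ n (e₁₁ Y)
       d₁₂ : Deg≤ n (e₁₂ Y)
       d₂₁ : Deg≤ n (e₂₁ Y)
       d₂₂ : Deg≤ n (e₂₂ Y)

 -- A bound for the degrees in q of the entries of a block: at most 3 for each hub, and twice the
 -- distance for each gap.
 degree : List ℕ → ℕ
 degree []       = 3
 degree (g ∷ us) = 3 ℕ.+ (double g ℕ.+ degree us)

 private
   deg-q* : ∀ {n f} → Deg≤ n f → Deg≤ (suc n) (q * f)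
   deg-q* {n} {f} p (suc k) (s≤s lt) = ≡.trans (q*-suc f k) (p k lt)

   deg-q^ : ∀ k → Deg≤ k (q ^ k)
   deg-q^ zero    = deg-ι (+ 1)
   deg-q^ (suc k) = deg-q* (deg-q^ k)

   deg-ε : Deg≤ 3 ε
   deg-ε = deg-+ (deg-weaken z≤n (deg-ι (+ 1))) (deg-neg (deg-cong (solve 1 (λ q → q :* (q :* (q :* con (+ 1))) := q :* q :* q) refl q) (deg-q^ 3)))

   deg-κ : Deg≤ 3 κ
   deg-κ = deg-weaken (s≤s (s≤s z≤n)) (deg-q* (deg-+ (deg-weaken z≤n (deg-ι (+ 1))) (deg-cong (𝕊.*-identityʳ q) (deg-q^ 1))))

   deg-block : ∀ us → DegM (degree us) (block us)
   deg-block [] = degM (deg-+ deg-ε (deg-neg deg-κ)) deg-κ (deg-neg deg-κ) (deg-+ deg-ε deg-κ)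
   deg-block (g ∷ us) = degM (entry (deg-+ deg-ε (deg-neg deg-κ)) deg-κ (p₁₁ (block-cons g us)) A.d₁₁ A.d₂₁) (entry (deg-+ deg-ε (deg-neg deg-κ)) deg-κ (p₁₂ (block-cons g us)) A.d₁₂ A.d₂₂)
       (entry (deg-neg deg-κ) (deg-+ deg-ε deg-κ) (p₂₁ (block-cons g us)) A.d₁₁ A.d₂₁) (entry (deg-neg deg-κ) (deg-+ deg-ε deg-κ) (p₂₂ (block-cons g us)) A.d₁₂ A.d₂₂)
     where
     module A = DegM (deg-block us)
     entry : ∀ {s k a c z} → Deg≤ 3 s → Deg≤ 3 k → z ≈ s * a + k * (x g * c) → Deg≤ (degree us) a → Deg≤ (degree us) c → Deg≤ (degree (g ∷ us)) z
     entry ds dk e da dc = deg-cong (sym e) (deg-+ (deg-weaken (ℕ.+-monoʳ-≤ 3 (ℕ.m≤n+m (degree us) (double g))) (deg-* ds da)) (deg-* dk (deg-* (deg-q^ (double g)) dc)))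

 detBlock : List ℕ → Carrier
 detBlock []       = ε * ε
 detBlock (g ∷ us) = (ε * ε) * (x g * detBlock us)

 private
   det-hub : det₂ hub ≈ ε * ε
   det-hub = solve 2 (λ e k → (e :- k) :* (e :+ k) :- k :* (:- k) := e :* e) refl ε κ

   det₂-block : ∀ us → det₂ (block us) ≈ detBlock us
   det₂-block []       = det-hub
   det₂-block (g ∷ us) = trans (det₂-⊗ hub (gapMat g ⊗ block us)) (𝕊.*-cong det-hub (trans (det₂-⊗ (gapMat g) (block us))
     (𝕊.*-cong (solve 1 (λ w → con (+ 1) :* w :- con (+ 0) :* con (+ 0) := w) refl (x g)) (det₂-block us))))

 gapSum : List ℕ → ℕ
 gapSum []       = 0
 gapSum (g ∷ us) = double g ℕ.+ gapSum us

 private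
   detBlock≈ : ∀ us → detBlock us ≈ (ε * ε) ^ suc (length us) * q ^ gapSum us
   detBlock≈ []       = solve 1 (λ e → e := (e :* con (+ 1)) :* con (+ 1)) refl (ε * ε)
   detBlock≈ (g ∷ us) = trans (𝕊.*-congˡ (𝕊.*-congˡ (detBlock≈ us))) (trans
     (solve 4 (λ e w p r → e :* (w :* (p :* r)) := (e :* p) :* (w :* r)) refl (ε * ε) (x g) ((ε * ε) ^ suc (length us)) (q ^ gapSum us))
     (𝕊.*-congˡ (sym (^-homo-* q (double g) (gapSum us)))))

   -- The determinant of a block only knows its number of hubs and its total gap length. Two blocks
   -- that share out the gaps of `ws` have one hub more in total, hence the factor ε².
   detBlock-split : ∀ us vs ws → length us ℕ.+ length vs ≡ length ws → gapSum us ℕ.+ gapSum vs ≡ gapSum ws →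
     detBlock us * detBlock vs ≈ (ε * ε) * detBlock ws
   detBlock-split us vs ws l s = begin
     detBlock us * detBlock vs ≈⟨ 𝕊.*-cong (detBlock≈ us) (detBlock≈ vs) ⟩
     (E ^ suc (length us) * q ^ gapSum us) * (E ^ suc (length vs) * q ^ gapSum vs) ≈⟨ solve 4 (λ a b c d → (a :* b) :* (c :* d) := (a :* c) :* (b :* d)) refl _ _ _ _ ⟩
     (E ^ suc (length us) * E ^ suc (length vs)) * (q ^ gapSum us * q ^ gapSum vs) ≈⟨ 𝕊.*-cong (sym (^-homo-* E (suc (length us)) (suc (length vs)))) (sym (^-homo-* q (gapSum us) (gapSum vs))) ⟩
     E ^ (suc (length us) ℕ.+ suc (length vs)) * q ^ (gapSum us ℕ.+ gapSum vs) ≡⟨ cong₂ (λ a b → E ^ a * q ^ b) (≡.trans (cong suc (ℕ.+-suc (length us) (length vs))) (cong (suc ∘ suc) l)) s ⟩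
     E ^ suc (suc (length ws)) * q ^ gapSum ws ≈⟨ 𝕊.*-assoc _ _ _ ⟩
     E * (E ^ suc (length ws) * q ^ gapSum ws) ≈⟨ 𝕊.*-congˡ (detBlock≈ ws) ⟨
     E * detBlock ws ∎
     where
     E = ε * ε

   unit-cancelʳ : ∀ u → coeff u 0 ≡ + 1 → ∀ {f g} → f * u ≈ g * u → f ≈ g
   unit-cancelʳ u u₀ {f} {g} p = unit-cancel u u₀ (trans (𝕊.*-comm u f) (trans p (𝕊.*-comm g u)))

   κ-cancel : ∀ {f g} → κ * f ≈ κ * g → f ≈ g
   κ-cancel {f} {g} p = unit-cancel (1# + q) o₀ (q^-cancel 1 (trans (expand f) (trans p (sym (expand g)))))
     where
     expand : ∀ f → q ^ 1 * ((1# + q) * f) ≈ κ * f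
     expand f = solve 3 (λ q o f → (q :* con (+ 1)) :* (o :* f) := (q :* o) :* f) refl q (1# + q) f

   hub-cancel : ∀ {A B} → hub ⊗ A ≋ hub ⊗ B → A ≋ B
   hub-cancel {mat a b c d} {mat a′ b′ c′ d′} (mat≈ p r s t) = mat≈ (topRow p s) (topRow r t) (bottomRow p s) (bottomRow r t)
     where
     ε²-cancel : ∀ {f g} → (ε * ε) * f ≈ (ε * ε) * g → f ≈ g
     ε²-cancel = unit-cancel (ε * ε) (*₀ ε₀ ε₀)
     topRow : ∀ {a c a′ c′} → σ * a + κ * c ≈ σ * a′ + κ * c′ → - κ * a + η * c ≈ - κ * a′ + η * c′ → a ≈ a′
     topRow {a} {c} {a′} {c′} p s = ε²-cancel (trans (adjoint a c) (trans (𝕊.+-cong (𝕊.*-congˡ p) (𝕊.-‿cong (𝕊.*-congˡ s))) (sym (adjoint a′ c′))))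
       where
       adjoint : ∀ a c → (ε * ε) * a ≈ η * (σ * a + κ * c) - κ * (- κ * a + η * c)
       adjoint a c = solve 4 (λ e k a c → (e :* e) :* a := (e :+ k) :* ((e :- k) :* a :+ k :* c) :- k :* ((:- k) :* a :+ (e :+ k) :* c)) refl ε κ a c
     bottomRow : ∀ {a c a′ c′} → σ * a + κ * c ≈ σ * a′ + κ * c′ → - κ * a + η * c ≈ - κ * a′ + η * c′ → c ≈ c′
     bottomRow {a} {c} {a′} {c′} p s = ε²-cancel (trans (adjoint a c) (trans (𝕊.+-cong (𝕊.*-congˡ p) (𝕊.*-congˡ s)) (sym (adjoint a′ c′))))
       where
       adjoint : ∀ a c → (ε * ε) * c ≈ κ * (σ * a + κ * c) + σ * (- κ * a + η * c)
       adjoint a c = solve 4 (λ e k a c → (e :* e) :* c := k :* ((e :- k) :* a :+ k :* c) :+ (e :- k) :* ((:- k) :* a :+ (e :+ k) :* c)) refl ε κ a c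

   row₁ : ∀ a c → 1# * a + 0# * c ≈ a
   row₁ a c = solve 2 (λ a c → con (+ 1) :* a :+ con (+ 0) :* c := a) refl a c

   row₂ : ∀ a c (g : ℕ) → 0# * a + x g * c ≈ x g * c
   row₂ a c g = solve 3 (λ a c w → con (+ 0) :* a :+ w :* c := w :* c) refl a c (x g)

   -1≢0 : -1ℤ ≢ + 0
   -1≢0 ()

   leadingGap : ∀ {g h Q Q′} → g < h → coeff Q 0 ≡ + 1 → x g * - (q * Q) ≈ x h * - (q * Q′) → ⊥
   leadingGap {g} {h} {Q} {Q′} g<h Q₀ p = -1≢0 (≡.trans (≡.sym (at g Q 0 ⟨≡⟩ cong ℤ.-_ Q₀)) (≡.trans (coeff-cong p (double g ℕ.+ 1)) (q^*-low (double h) (- (q * Q′)) (double g ℕ.+ 1) bound)))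
     where
     _⟨≡⟩_ : ∀ {a b c : ℤ} → a ≡ b → b ≡ c → a ≡ c
     _⟨≡⟩_ = ≡.trans
     at : ∀ g Q n → coeff (x g * - (q * Q)) (double g ℕ.+ suc n) ≡ ℤ.- coeff Q n
     at g Q n = ≡.trans (q^*-shift (double g) (- (q * Q)) (suc n)) (≡.trans (coeff-neg (q * Q) (suc n)) (cong ℤ.-_ (q*-suc Q n)))
     bound : double g ℕ.+ 1 < double h
     bound = ℕ.≤-trans (ℕ.≤-reflexive (cong suc (≡.trans (ℕ.+-comm (double g) 1) (cong suc (≡.sym (ℕ.+-suc g (suc g)) ⟨≡ⁿ⟩ ℕ.+-suc g (suc g)))))) (ℕ.≤-trans (ℕ.≤-reflexive shape) (ℕ.+-mono-≤ (s≤s g<h) (s≤s g<h)))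
       where
       _⟨≡ⁿ⟩_ : ∀ {a b c : ℕ} → a ≡ b → b ≡ c → a ≡ c
       _⟨≡ⁿ⟩_ = ≡.trans
       shape : suc (suc (suc (g ℕ.+ suc g))) ≡ suc (suc g) ℕ.+ suc (suc g)
       shape = cong (suc ∘ suc) (≡.sym (ℕ.+-suc g (suc g)))

 -- Once the common first hub is cancelled, the lower left entry is q^(double g) times a series of
 -- order exactly 1. Its order reveals the first gap g, which can then be cancelled as well.
 block-injective : ∀ us ws → length us ≡ length ws → block us ≋ block ws → us ≡ ws
 block-injective []       []       _ _ = ≡.refl
 block-injective (g ∷ us) (h ∷ ws) l e = equal (ℕ.<-cmp g h)
   where
   open _≋_ (hub-cancel {gapMat g ⊗ block us} {gapMat h ⊗ block ws} e) renaming (p₁₁ to p; p₁₂ to r; p₂₁ to s; p₂₂ to t)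
   module A = Leading (leading us)
   module B = Leading (leading ws)
   s′ : x g * e₂₁ (block us) ≈ x h * e₂₁ (block ws)
   s′ = trans (sym (row₂ (e₁₁ (block us)) (e₂₁ (block us)) g)) (trans s (row₂ (e₁₁ (block ws)) (e₂₁ (block ws)) h))
   t′ : x g * e₂₂ (block us) ≈ x h * e₂₂ (block ws)
   t′ = trans (sym (row₂ (e₁₂ (block us)) (e₂₂ (block us)) g)) (trans t (row₂ (e₁₂ (block ws)) (e₂₂ (block ws)) h))
   s″ : x g * - (q * A.Q) ≈ x h * - (q * B.Q)
   s″ = trans (𝕊.*-congˡ (sym A.e₂₁≈)) (trans s′ (𝕊.*-congˡ B.e₂₁≈))
   equal : _ → g ∷ us ≡ h ∷ ws
   equal (tri< g<h _ _) = ⊥-elim (leadingGap g<h A.Q₀ s″)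
   equal (tri> _ _ h<g) = ⊥-elim (leadingGap h<g B.Q₀ (sym s″))
   equal (tri≈ _ ≡.refl _) = cong (g ∷_) (block-injective us ws (ℕ.suc-injective l) (mat≈
     (trans (sym (row₁ (e₁₁ (block us)) (e₂₁ (block us)))) (trans p (row₁ (e₁₁ (block ws)) (e₂₁ (block ws)))))
     (trans (sym (row₁ (e₁₂ (block us)) (e₂₂ (block us)))) (trans r (row₁ (e₁₂ (block ws)) (e₂₂ (block ws)))))
     (q^-cancel (double g) s′) (q^-cancel (double g) t′)))

 -- Reading a block backwards amounts to transposing and changing the sign of the off-diagonal entries.
 flip : M₂ → M₂
 flip (mat a b c d) = mat a (- c) (- b) d

 private
   flip-⊗ : ∀ A B → flip (A ⊗ B) ≋ flip B ⊗ flip A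
   flip-⊗ (mat a b c d) (mat a′ b′ c′ d′) = mat≈
     (solve 4 (λ a b a′ c′ → a :* a′ :+ b :* c′ := a′ :* a :+ (:- c′) :* (:- b)) refl a b a′ c′)
     (solve 4 (λ c d a′ c′ → :- (c :* a′ :+ d :* c′) := a′ :* (:- c) :+ (:- c′) :* d) refl c d a′ c′)
     (solve 4 (λ a b b′ d′ → :- (a :* b′ :+ b :* d′) := (:- b′) :* a :+ d′ :* (:- b)) refl a b b′ d′)
     (solve 4 (λ c d b′ d′ → c :* b′ :+ d :* d′ := (:- b′) :* (:- c) :+ d′ :* d) refl c d b′ d′)

   flip-hub : flip hub ≋ hub
   flip-hub = mat≈ refl (solve 1 (λ k → :- (:- k) := k) refl κ) refl refl

   flip-gap : ∀ g → flip (gapMat g) ≋ gapMat g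
   flip-gap g = mat≈ refl (solve 0 (:- con (+ 0) := con (+ 0)) refl) (solve 0 (:- con (+ 0) := con (+ 0)) refl) refl

   block-∷ʳ : ∀ us g → block (us ∷ʳ g) ≋ block us ⊗ gapMat g ⊗ hub
   block-∷ʳ []       g = ≋-refl
   block-∷ʳ (h ∷ us) g = ≋-trans (⊗-cong ≋-refl (⊗-cong ≋-refl (block-∷ʳ us g)))
     (≋-trans (⊗-cong ≋-refl (≋-sym (⊗-assoc (gapMat h) (block us) (gapMat g ⊗ hub)))) (≋-sym (⊗-assoc hub (gapMat h ⊗ block us) (gapMat g ⊗ hub))))

 -- `flip` is an anti-automorphism that fixes `hub` and every `gapMat`.
 flip-block : ∀ us → flip (block us) ≋ block (reverse us)
 flip-block []       = flip-hub
 flip-block (g ∷ us) = ≋-trans (flip-⊗ hub (gapMat g ⊗ block us)) (≋-trans (⊗-cong (≋-trans (flip-⊗ (gapMat g) (block us)) (⊗-cong (flip-block us) (flip-gap g))) flip-hub)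
   (≋-trans (⊗-assoc (block (reverse us)) (gapMat g) hub) (≋-trans (≋-sym (block-∷ʳ (reverse us) g)) (≡.subst (λ z → block (reverse us ∷ʳ g) ≋ block z) (≡.sym (List.unfold-reverse g us)) ≋-refl))))

 -- tr (Y d_M s d_M′) = P₀ + q^m P₁ + q^m′ P₂ + q^(m + m′) P₃ with the following coefficients.
 record Coefficients (D : ℕ) : Set where
   field
     P₀ P₃ U₁ U₂ : Carrier
     degP₀ : Deg≤ D P₀
     degP₁ : Deg≤ D (- (q ^ 2 * U₁))
     degP₂ : Deg≤ D (- (q ^ 2 * U₂))
     U₁₀   : coeff U₁ 0 ≡ + 1
     U₂₀   : coeff U₂ 0 ≡ + 1
   P₁ P₂ : Carrier
   P₁ = - (q ^ 2 * U₁)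
   P₂ = - (q ^ 2 * U₂)

   poly : ℕ → ℕ → Carrier
   poly m m′ = P₀ + (q ^ m * P₁ + (q ^ m′ * P₂ + q ^ (m ℕ.+ m′) * P₃))

 private
   coefficients : ∀ us vs → Coefficients (degree us ℕ.+ degree vs)
   coefficients us vs = record
     { P₀ = e₁₁ Y * e₁₁ s ; P₃ = e₂₂ Y * e₂₂ s ; U₁ = A.P * B.Q ; U₂ = A.Q * B.P
     ; degP₀ = deg-* DA.d₁₁ DB.d₁₁
     ; degP₁ = deg-cong (trans (𝕊.*-cong A.e₁₂≈ B.e₂₁≈) (solve 3 (λ q a b → (q :* a) :* (:- (q :* b)) := :- ((q :* (q :* con (+ 1))) :* (a :* b))) refl q A.P B.Q)) (deg-* DA.d₁₂ DB.d₂₁)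
     ; degP₂ = deg-cong (trans (𝕊.*-cong A.e₂₁≈ B.e₁₂≈) (solve 3 (λ q a b → (:- (q :* a)) :* (q :* b) := :- ((q :* (q :* con (+ 1))) :* (a :* b))) refl q A.Q B.P)) (deg-* DA.d₂₁ DB.d₁₂)
     ; U₁₀ = *₀ A.P₀ B.Q₀ ; U₂₀ = *₀ A.Q₀ B.P₀ }
     where
     Y = block us
     s = block vs
     module A = Leading (leading us)
     module B = Leading (leading vs)
     module DA = DegM (deg-block us)
     module DB = DegM (deg-block vs)

   module _ (us vs : List ℕ) where
     private
       module C = Coefficients (coefficients us vs)
       module A = Leading (leading us)
       module B = Leading (leading vs)
       Y = block us
       s = block vs

     P₁≈ : C.P₁ ≈ e₁₂ Y * e₂₁ s
     P₁≈ = sym (trans (𝕊.*-cong A.e₁₂≈ B.e₂₁≈) (solve 3 (λ q a b → (q :* a) :* (:- (q :* b)) := :- ((q :* (q :* con (+ 1))) :* (a :* b))) refl q A.P B.Q))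

     P₂≈ : C.P₂ ≈ e₂₁ Y * e₁₂ s
     P₂≈ = sym (trans (𝕊.*-cong A.e₂₁≈ B.e₁₂≈) (solve 3 (λ q a b → (:- (q :* a)) :* (q :* b) := :- ((q :* (q :* con (+ 1))) :* (a :* b))) refl q A.Q B.P))

     tr-word : ∀ M M′ → tr (word (us ++ M ∷ vs ++ M′ ∷ [])) ≈ C.poly (double M) (double M′)
     tr-word M M′ = begin
       tr (word (us ++ M ∷ vs ++ M′ ∷ [])) ≈⟨ tr-cong (≋-trans (word-block us M (vs ++ M′ ∷ [])) (⊗-cong ≋-refl (⊗-cong ≋-refl (≋-trans (word-block vs M′ []) (⊗-cong ≋-refl (⊗-identityʳ (gapMat M′))))))) ⟩
       tr (Y ⊗ gapMat M ⊗ s ⊗ gapMat M′)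
         ≈⟨ solve 10 (λ a b c d a′ b′ c′ d′ w w′ →
              (a :* (con (+ 1) :* (a′ :* con (+ 1) :+ b′ :* con (+ 0)) :+ con (+ 0) :* (c′ :* con (+ 1) :+ d′ :* con (+ 0))) :+ b :* (con (+ 0) :* (a′ :* con (+ 1) :+ b′ :* con (+ 0)) :+ w :* (c′ :* con (+ 1) :+ d′ :* con (+ 0))))
              :+ (c :* (con (+ 1) :* (a′ :* con (+ 0) :+ b′ :* w′) :+ con (+ 0) :* (c′ :* con (+ 0) :+ d′ :* w′)) :+ d :* (con (+ 0) :* (a′ :* con (+ 0) :+ b′ :* w′) :+ w :* (c′ :* con (+ 0) :+ d′ :* w′)))
              := a :* a′ :+ (w :* (b :* c′) :+ (w′ :* (c :* b′) :+ (w :* w′) :* (d :* d′))))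
            refl (e₁₁ Y) (e₁₂ Y) (e₂₁ Y) (e₂₂ Y) (e₁₁ s) (e₁₂ s) (e₂₁ s) (e₂₂ s) (x M) (x M′) ⟩
       e₁₁ Y * e₁₁ s + (x M * (e₁₂ Y * e₂₁ s) + (x M′ * (e₂₁ Y * e₁₂ s) + (x M * x M′) * (e₂₂ Y * e₂₂ s)))
         ≈⟨ 𝕊.+-congˡ (𝕊.+-cong (𝕊.*-congˡ (sym P₁≈)) (𝕊.+-cong (𝕊.*-congˡ (sym P₂≈)) (𝕊.*-congʳ (sym (^-homo-* q (double M) (double M′)))))) ⟩
       C.poly (double M) (double M′) ∎

   separate : ∀ {D k f f′ g g′} → D < k → Deg≤ D f → Deg≤ D f′ → f + q ^ k * g ≈ f′ + q ^ k * g′ → (f ≈ f′) × (g ≈ g′)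
   separate {D} {k} {f} {f′} {g} {g′} D<k df df′ e = f≈f′ , q^-cancel k (begin
     q ^ k * g ≈⟨ solve 2 (λ a b → b := (a :+ b) :- a) refl f (q ^ k * g) ⟩
     (f + q ^ k * g) - f ≈⟨ 𝕊.+-cong e (𝕊.-‿cong f≈f′) ⟩
     (f′ + q ^ k * g′) - f′ ≈⟨ solve 2 (λ a b → (a :+ b) :- a := b) refl f′ (q ^ k * g′) ⟩
     q ^ k * g′ ∎)
     where
     low : ∀ h j n → n < k → coeff (h + q ^ k * j) n ≡ coeff h n
     low h j n n<k = ≡.trans (coeff-+ h (q ^ k * j) n) (≡.trans (cong (λ z → coeff h n ℤ.+ z) (q^*-low k j n n<k)) (ℤ.+-identityʳ _))
     f≈f′ : f ≈ f′
     f≈f′ = coeff-ext (λ n → at n (n ℕ.<? k))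
       where
       at : ∀ n → _ → coeff f n ≡ coeff f′ n
       at n (yes n<k) = ≡.trans (≡.sym (low f g n n<k)) (≡.trans (coeff-cong e n) (low f′ g′ n n<k))
       at n (no n≮k)  = ≡.trans (df n D<n) (≡.sym (df′ n D<n))
         where
         D<n = ℕ.<-≤-trans D<k (ℕ.≮⇒≥ n≮k)

   module Values {D} (C : Coefficients D) (m m′ : ℕ) where
     open Coefficients C

     q²U-low : ∀ k U n → n < k ℕ.+ 2 → coeff (q ^ k * - (q ^ 2 * U)) n ≡ + 0
     q²U-low k U n lt = ≡.trans (coeff-cong (trans (solve 3 (λ a b u → a :* (:- (b :* u)) := (a :* b) :* (:- u)) refl (q ^ k) (q ^ 2) U) (𝕊.*-congʳ (sym (^-homo-* q k 2)))) n) (q^*-low (k ℕ.+ 2) (- U) n lt)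

     q²U-at : ∀ k U → coeff U 0 ≡ + 1 → coeff (q ^ k * - (q ^ 2 * U)) (k ℕ.+ 2) ≡ -1ℤ
     q²U-at k U U₀ = ≡.trans (q^*-shift k (- (q ^ 2 * U)) 2) (≡.trans (coeff-neg (q ^ 2 * U) 2) (cong ℤ.-_ (≡.trans (q^*-shift 2 U 0) U₀)))

     coeff-poly : ∀ n → coeff (poly m m′) n ≡ coeff P₀ n ℤ.+ (coeff (q ^ m * P₁) n ℤ.+ (coeff (q ^ m′ * P₂) n ℤ.+ coeff (q ^ (m ℕ.+ m′) * P₃) n))
     coeff-poly n = ≡.trans (coeff-+ _ _ n) (cong (λ z → coeff P₀ n ℤ.+ z) (≡.trans (coeff-+ _ _ n) (cong (λ z → coeff (q ^ m * P₁) n ℤ.+ z) (coeff-+ _ _ n))))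

     private
       sum₄ : ∀ {a b c d a′ b′ c′ d′ : ℤ} → a ≡ a′ → b ≡ b′ → c ≡ c′ → d ≡ d′ → a ℤ.+ (b ℤ.+ (c ℤ.+ d)) ≡ a′ ℤ.+ (b′ ℤ.+ (c′ ℤ.+ d′))
       sum₄ ≡.refl ≡.refl ≡.refl ≡.refl = ≡.refl

     value-at : D < m ℕ.+ 2 → m < m′ → m ℕ.+ 2 < m ℕ.+ m′ → coeff (poly m m′) (m ℕ.+ 2) ≡ -1ℤ
     value-at D< m<m′ m+2< = ≡.trans (coeff-poly (m ℕ.+ 2)) (sum₄ (degP₀ _ D<) (q²U-at m U₁ U₁₀) (q²U-low m′ U₂ _ (ℕ.+-monoˡ-< 2 m<m′)) (q^*-low (m ℕ.+ m′) P₃ _ m+2<))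

     value-zero : ∀ n → D < n → n < m ℕ.+ 2 → n < m′ ℕ.+ 2 → n < m ℕ.+ m′ → coeff (poly m m′) n ≡ + 0
     value-zero n D< a b c = ≡.trans (coeff-poly n) (sum₄ (degP₀ n D<) (q²U-low m U₁ n a) (q²U-low m′ U₂ n b) (q^*-low (m ℕ.+ m′) P₃ n c))

     value-beyond : ∀ n → m ℕ.+ D < n → n < m′ ℕ.+ 2 → n < m ℕ.+ m′ → coeff (poly m m′) n ≡ + 0
     value-beyond n a b c = ≡.trans (coeff-poly n) (sum₄ (degP₀ n (ℕ.≤-<-trans (ℕ.m≤n+m D m) a)) (deg-* (deg-q^ m) degP₁ n a) (q²U-low m′ U₂ n b) (q^*-low (m ℕ.+ m′) P₃ n c))

   -- P₁ starts with - q², so q^m P₁ shows as -1 at exponent m + 2 when nothing else reaches there.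
   -- If l < m, or if m ≤ D < l, exponent l + 2 distinguishes the two sides; if D < m < l, exponent
   -- m + 2 does. The case m ≤ D is where l > 2D enters: P₀ and q^m P₁ then end below l.
   m≡l : ∀ {D} (C C′ : Coefficients D) {m m′ l l′} → Coefficients.poly C m m′ ≈ Coefficients.poly C′ l l′ →
     m ≤ m′ → m ℕ.+ m′ ≡ l ℕ.+ l′ → 2 < D → D ℕ.+ D < l → l ℕ.+ D < l′ → m ≡ l
   m≡l {D} C C′ {m} {m′} {l} {l′} e m≤m′ sum≡ 2<D D+D<l l+D<l′ with ℕ.<-cmp m l
   ... | tri≈ _ p _ = p
   ... | tri> _ _ l<m = ⊥-elim (-1≢0 (≡.trans (≡.sym at-l) (≡.trans (≡.sym (coeff-cong e (l ℕ.+ 2))) zero-l)))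
     where
     D<l : D < l
     D<l = ℕ.≤-<-trans (ℕ.m≤m+n D D) D+D<l
     l<l′ : l < l′
     l<l′ = ℕ.≤-<-trans (ℕ.m≤m+n l D) l+D<l′
     2<l′ : 2 < l′
     2<l′ = ℕ.<-trans 2<D (ℕ.<-trans D<l l<l′)
     D<l+2 : D < l ℕ.+ 2
     D<l+2 = ℕ.<-≤-trans D<l (ℕ.m≤m+n l 2)
     at-l = Values.value-at C′ l l′ D<l+2 l<l′ (ℕ.+-monoʳ-< l 2<l′)
     zero-l = Values.value-zero C m m′ (l ℕ.+ 2) D<l+2 (ℕ.+-monoˡ-< 2 l<m) (ℕ.+-monoˡ-< 2 (ℕ.<-≤-trans l<m m≤m′)) (≡.subst (l ℕ.+ 2 <_) (≡.sym sum≡) (ℕ.+-monoʳ-< l 2<l′))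
   ... | tri< m<l _ _ with D ℕ.<? m
   ...   | yes D<m = ⊥-elim (-1≢0 (≡.trans (≡.sym at-m) (≡.trans (coeff-cong e (m ℕ.+ 2)) zero-m)))
     where
     l<l′ : l < l′
     l<l′ = ℕ.≤-<-trans (ℕ.m≤m+n l D) l+D<l′
     l′<m′ : l′ < m′
     l′<m′ = ℕ.+-cancelˡ-< m l′ m′ (ℕ.<-≤-trans (ℕ.+-monoˡ-< l′ m<l) (ℕ.≤-reflexive (≡.sym sum≡)))
     2<l′ : 2 < l′
     2<l′ = ℕ.<-trans 2<D (ℕ.<-trans D<m (ℕ.<-trans m<l l<l′))
     D<m+2 : D < m ℕ.+ 2
     D<m+2 = ℕ.<-≤-trans D<m (ℕ.m≤m+n m 2)
     at-m = Values.value-at C m m′ D<m+2 (ℕ.<-trans m<l (ℕ.<-trans l<l′ l′<m′)) (ℕ.+-monoʳ-< m (ℕ.<-trans 2<l′ l′<m′))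
     zero-m = Values.value-zero C′ l l′ (m ℕ.+ 2) D<m+2 (ℕ.+-monoˡ-< 2 m<l) (ℕ.+-monoˡ-< 2 (ℕ.<-trans m<l l<l′)) (ℕ.<-trans (ℕ.+-monoˡ-< 2 m<l) (ℕ.+-monoʳ-< l 2<l′))
   ...   | no D≮m = ⊥-elim (-1≢0 (≡.trans (≡.sym at-l) (≡.trans (≡.sym (coeff-cong e (l ℕ.+ 2))) zero-l)))
     where
     D<l : D < l
     D<l = ℕ.≤-<-trans (ℕ.m≤m+n D D) D+D<l
     l<l′ : l < l′
     l<l′ = ℕ.≤-<-trans (ℕ.m≤m+n l D) l+D<l′
     l′<m′ : l′ < m′
     l′<m′ = ℕ.+-cancelˡ-< m l′ m′ (ℕ.<-≤-trans (ℕ.+-monoˡ-< l′ m<l) (ℕ.≤-reflexive (≡.sym sum≡)))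
     2<l′ : 2 < l′
     2<l′ = ℕ.<-trans 2<D (ℕ.<-trans D<l l<l′)
     at-l = Values.value-at C′ l l′ (ℕ.<-≤-trans D<l (ℕ.m≤m+n l 2)) l<l′ (ℕ.+-monoʳ-< l 2<l′)
     zero-l = Values.value-beyond C m m′ (l ℕ.+ 2) (ℕ.≤-<-trans (ℕ.+-monoˡ-≤ D (ℕ.≮⇒≥ D≮m)) (ℕ.<-≤-trans D+D<l (ℕ.m≤m+n l 2)))
       (ℕ.+-monoˡ-< 2 (ℕ.<-trans l<l′ l′<m′)) (≡.subst (l ℕ.+ 2 <_) (≡.sym sum≡) (ℕ.+-monoʳ-< l 2<l′))

   -- Writing q^l′ = q^l q^o nests the sum. As l and o both exceed the degree bound D, the
   -- coefficients P₀, P₁ and P₂ peel off one at a time.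
   poly-separate : ∀ {D} (C C′ : Coefficients D) {l l′} → Coefficients.poly C l l′ ≈ Coefficients.poly C′ l l′ → D < l → l ℕ.+ D < l′ →
     (Coefficients.P₀ C ≈ Coefficients.P₀ C′) × (Coefficients.P₁ C ≈ Coefficients.P₁ C′) × (Coefficients.P₂ C ≈ Coefficients.P₂ C′) × (Coefficients.P₃ C ≈ Coefficients.P₃ C′)
   poly-separate {D} C C′ {l} {l′} e D<l l+D<l′ = proj₁ step₁ , proj₁ step₂ , proj₁ step₃ , proj₂ step₃
     where
     module C = Coefficients C
     module C′ = Coefficients C′
     o = l′ ℕ.∸ l
     l+o : l ℕ.+ o ≡ l′
     l+o = ℕ.m+[n∸m]≡n (ℕ.≤-trans (ℕ.m≤m+n l D) (ℕ.<⇒≤ l+D<l′))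
     nested : ∀ a b p r s t → p + (a * r + ((a * b) * s + (a * (a * b)) * t)) ≈ p + a * (r + b * (s + a * t))
     nested = solve 6 (λ a b p r s t → p :+ (a :* r :+ ((a :* b) :* s :+ (a :* (a :* b)) :* t)) := p :+ a :* (r :+ b :* (s :+ a :* t))) refl
     nest : ∀ (E : Coefficients D) → Coefficients.poly E l l′ ≈ Coefficients.P₀ E + q ^ l * (Coefficients.P₁ E + q ^ o * (Coefficients.P₂ E + q ^ l * Coefficients.P₃ E))
     nest E = trans (𝕊.+-congˡ (𝕊.+-congˡ (𝕊.+-cong (𝕊.*-congʳ split) (𝕊.*-congʳ (trans (^-homo-* q l l′) (𝕊.*-congˡ split))))))
       (nested (q ^ l) (q ^ o) (Coefficients.P₀ E) (Coefficients.P₁ E) (Coefficients.P₂ E) (Coefficients.P₃ E))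
       where
       split : q ^ l′ ≈ q ^ l * q ^ o
       split = trans (reflexive (cong (q ^_) (≡.sym l+o))) (^-homo-* q l o)
     rest rest′ : Carrier
     rest = C.P₂ + q ^ l * C.P₃
     rest′ = C′.P₂ + q ^ l * C′.P₃
     step₁ : (C.P₀ ≈ C′.P₀) × (C.P₁ + q ^ o * rest ≈ C′.P₁ + q ^ o * rest′)
     step₁ = separate D<l C.degP₀ C′.degP₀ (trans (sym (nest C)) (trans e (nest C′)))
     step₂ : (C.P₁ ≈ C′.P₁) × (rest ≈ rest′)
     step₂ = separate (ℕ.+-cancelˡ-< l D o (≡.subst (l ℕ.+ D <_) (≡.sym l+o) l+D<l′)) C.degP₁ C′.degP₁ (proj₂ step₁)
     step₃ : (C.P₂ ≈ C′.P₂) × (C.P₃ ≈ C′.P₃)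
     step₃ = separate D<l C.degP₂ C′.degP₂ (proj₂ step₂)

   1≢0 : + 1 ≢ + 0
   1≢0 ()

   -- The determinants of the three blocks turn the four coefficient identities into (ε² β + κ² A)(ε² δ + κ² B) = 0,
   -- where β and δ are the products of the off-diagonal entries of the two blocks; either factor has leading term - q²
   -- unless the corresponding block is a single hub.
   oneBlockTrivial : ∀ us vs ws → length us ℕ.+ length vs ≡ length ws → gapSum us ℕ.+ gapSum vs ≡ gapSum ws →
     let Y = block us ; s = block vs ; w = block ws in
     e₁₁ Y * e₁₁ s ≈ e₁₁ w * σ → e₁₂ Y * e₂₁ s ≈ e₁₂ w * - κ → e₂₁ Y * e₁₂ s ≈ e₂₁ w * κ → e₂₂ Y * e₂₂ s ≈ e₂₂ w * η →
     (us ≡ []) ⊎ (vs ≡ [])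
   oneBlockTrivial [] vs ws _ _ _ _ _ _ = inj₁ ≡.refl
   oneBlockTrivial (_ ∷ _) [] ws _ _ _ _ _ _ = inj₂ ≡.refl
   oneBlockTrivial us@(g ∷ us′) vs@(h ∷ vs′) ws len sum p₀ p₁ p₂ p₃ = ⊥-elim (1≢0 (≡.trans (≡.sym one) (≡.trans (coeff-cong product≈0 4) (coeff-0 4))))
     where
     Y = block us
     s = block vs
     w = block ws
     module A = Leading (leading us)
     module B = Leading (leading vs)
     α = e₁₁ Y * e₂₂ Y
     β = e₁₂ Y * e₂₁ Y
     γ = e₁₁ s * e₂₂ s
     δ′ = e₁₂ s * e₂₁ s
     dA = det₂ Y
     dB = det₂ s
     dW = det₂ w
     E = ε * ε
     K = κ * κ
     AB : dA * dB ≈ E * dW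
     AB = trans (𝕊.*-cong (det₂-block us) (det₂-block vs)) (trans (detBlock-split us vs ws len sum) (𝕊.*-congˡ (sym (det₂-block ws))))
     αγ : α * γ ≈ (E - K) * (e₁₁ w * e₂₂ w)
     αγ = trans (solve 4 (λ a d a′ d′ → (a :* d) :* (a′ :* d′) := (a :* a′) :* (d :* d′)) refl (e₁₁ Y) (e₂₂ Y) (e₁₁ s) (e₂₂ s))
       (trans (𝕊.*-cong p₀ p₃) (solve 4 (λ a d e k → (a :* (e :- k)) :* (d :* (e :+ k)) := (e :* e :- k :* k) :* (a :* d)) refl (e₁₁ w) (e₂₂ w) ε κ))
     βδ : β * δ′ ≈ - (K * (e₁₂ w * e₂₁ w))
     βδ = trans (solve 4 (λ b c b′ c′ → (b :* c) :* (b′ :* c′) := (b :* c′) :* (c :* b′)) refl (e₁₂ Y) (e₂₁ Y) (e₁₂ s) (e₂₁ s))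
       (trans (𝕊.*-cong p₁ p₂) (solve 3 (λ b c k → (b :* (:- k)) :* (c :* k) := :- ((k :* k) :* (b :* c))) refl (e₁₂ w) (e₂₁ w) κ))
     product≈0 : (E * β + K * dA) * (E * δ′ + K * dB) ≈ 0#
     product≈0 = begin
       (E * β + K * (α - β)) * (E * δ′ + K * (γ - δ′))
         ≈⟨ solve 6 (λ E K α β γ δ → (E :* β :+ K :* (α :- β)) :* (E :* δ :+ K :* (γ :- δ))
              := (E :* E :- E :* K) :* (β :* δ) :+ (E :* K) :* (α :* γ) :+ (K :* K :- E :* K) :* ((α :- β) :* (γ :- δ))) refl E K α β γ δ′ ⟩
       (E * E - E * K) * (β * δ′) + (E * K) * (α * γ) + (K * K - E * K) * (dA * dB)
         ≈⟨ 𝕊.+-cong (𝕊.+-cong (𝕊.*-congˡ βδ) (𝕊.*-congˡ αγ)) (𝕊.*-congˡ AB) ⟩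
       (E * E - E * K) * - (K * (e₁₂ w * e₂₁ w)) + (E * K) * ((E - K) * (e₁₁ w * e₂₂ w)) + (K * K - E * K) * (E * dW)
         ≈⟨ solve 4 (λ E K a b → (E :* E :- E :* K) :* (:- (K :* b)) :+ (E :* K) :* ((E :- K) :* a) :+ (K :* K :- E :* K) :* (E :* (a :- b)) := con (+ 0)) refl E K (e₁₁ w * e₂₂ w) (e₁₂ w * e₂₁ w) ⟩
       0# ∎
     factor : ∀ f ks (L : Leading (block (f ∷ ks))) → let open Leading L ; Z = block (f ∷ ks) in
       Σ Carrier λ U → (E * (e₁₂ Z * e₂₁ Z) + K * det₂ Z ≈ - (q ^ 2 * U)) × (coeff U 0 ≡ + 1)
     factor f ks L = U , trans (𝕊.+-cong (𝕊.*-congˡ (𝕊.*-cong e₁₂≈ e₂₁≈)) (𝕊.*-congˡ (det₂-block (f ∷ ks))))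
         (solve 6 (λ E q o P Q d → E :* ((q :* P) :* (:- (q :* Q))) :+ ((q :* o) :* (q :* o)) :* d := :- ((q :* (q :* con (+ 1))) :* (E :* (P :* Q) :- (o :* o) :* d))) refl E q (1# + q) P Q (detBlock (f ∷ ks))) ,
       coeff₀-minus0 (E * (P * Q)) ((1# + q) * (1# + q) * detBlock (f ∷ ks)) (*₀ (*₀ ε₀ ε₀) (*₀ P₀ Q₀)) (*0₀ ((1# + q) * (1# + q)) (*0₀ E (x₀* f (detBlock ks))))
       where
       open Leading L
       U = E * (P * Q) - (1# + q) * (1# + q) * detBlock (f ∷ ks)
     one : coeff ((E * β + K * dA) * (E * δ′ + K * dB)) 4 ≡ + 1
     one = let U , e , U₀ = factor g us′ (leading us) ; U′ , e′ , U′₀ = factor h vs′ (leading vs) in ≡.trans (coeff-cong (trans (𝕊.*-cong e e′) (solve 3 (λ q U V → (:- ((q :* (q :* con (+ 1))) :* U)) :* (:- ((q :* (q :* con (+ 1))) :* V)) := (q :* (q :* (q :* (q :* con (+ 1))))) :* (U :* V)) refl q U U′)) 4)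
         (≡.trans (q^*-shift 4 (U * U′) 0) (*₀ U₀ U′₀))

 -- On the right the second block is a single hub, with entries ε - κ, κ, - κ, ε + κ. Once one block
 -- on the left is known to be a single hub too, cancelling its entries gives the block of `ws`
 -- itself, or, if the hub stands first, its transpose with the off-diagonal signs changed, which is
 -- the block of the reversal.
 decode : ∀ us vs ws M M′ L L′ → tr (word (us ++ M ∷ vs ++ M′ ∷ [])) ≈ tr (word (ws ++ L ∷ L′ ∷ [])) →
   length us ℕ.+ length vs ≡ length ws → gapSum us ℕ.+ gapSum vs ≡ gapSum ws → degree us ℕ.+ degree vs ≡ degree ws ℕ.+ 3 →
   M ≤ M′ → double M ℕ.+ double M′ ≡ double L ℕ.+ double L′ →
   (degree ws ℕ.+ 3) ℕ.+ (degree ws ℕ.+ 3) < double L → double L ℕ.+ (degree ws ℕ.+ 3) < double L′ →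
   (double M ≡ double L) × (double M′ ≡ double L′) × ((us ≡ ws × vs ≡ []) ⊎ (us ≡ [] × vs ≡ reverse ws))
 decode us vs ws M M′ L L′ e len sum deg M≤M′ lsum big bigger = conclude
   where
   D = degree ws ℕ.+ 3
   C : Coefficients D
   C = ≡.subst Coefficients deg (coefficients us vs)
   C′ : Coefficients D
   C′ = coefficients ws []
   poly-subst : ∀ {d d′} (p : d ≡ d′) (c : Coefficients d) m m′ → Coefficients.poly (≡.subst Coefficients p c) m m′ ≡ Coefficients.poly c m m′
   poly-subst ≡.refl c m m′ = ≡.refl
   e′ : Coefficients.poly C (double M) (double M′) ≈ Coefficients.poly C′ (double L) (double L′)
   e′ = trans (reflexive (poly-subst deg (coefficients us vs) (double M) (double M′))) (trans (sym (tr-word us vs M M′)) (trans e (tr-word ws [] L L′)))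
   2<D : 2 < D
   2<D = ℕ.m≤n+m 3 (degree ws)
   M≡L : double M ≡ double L
   M≡L = m≡l C C′ e′ (ℕ.+-mono-≤ (s≤s M≤M′) (s≤s M≤M′)) lsum 2<D big bigger
   M′≡L′ : double M′ ≡ double L′
   M′≡L′ = ℕ.+-cancelˡ-≡ (double L) (double M′) (double L′) (≡.trans (cong (ℕ._+ double M′) (≡.sym M≡L)) lsum)
   e″ : Coefficients.poly C (double L) (double L′) ≈ Coefficients.poly C′ (double L) (double L′)
   e″ = trans (reflexive (cong₂ (Coefficients.poly C) (≡.sym M≡L) (≡.sym M′≡L′))) e′
   fields : ∀ {d d′} (p : d ≡ d′) (c : Coefficients d) → (Coefficients.P₀ (≡.subst Coefficients p c) ≡ Coefficients.P₀ c) × (Coefficients.P₁ (≡.subst Coefficients p c) ≡ Coefficients.P₁ c)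
     × (Coefficients.P₂ (≡.subst Coefficients p c) ≡ Coefficients.P₂ c) × (Coefficients.P₃ (≡.subst Coefficients p c) ≡ Coefficients.P₃ c)
   fields ≡.refl c = ≡.refl , ≡.refl , ≡.refl , ≡.refl
   Y = block us
   s = block vs
   w = block ws
   identities : (e₁₁ Y * e₁₁ s ≈ e₁₁ w * σ) × (e₁₂ Y * e₂₁ s ≈ e₁₂ w * - κ) × (e₂₁ Y * e₁₂ s ≈ e₂₁ w * κ) × (e₂₂ Y * e₂₂ s ≈ e₂₂ w * η)
   identities = let p₀ , p₁ , p₂ , p₃ = poly-separate C C′ e″ (ℕ.≤-<-trans (ℕ.m≤m+n D D) big) bigger ; f₀ , f₁ , f₂ , f₃ = fields deg (coefficients us vs) in trans (reflexive (≡.sym f₀)) p₀ ,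
     trans (sym (P₁≈ us vs)) (trans (reflexive (≡.sym f₁)) (trans p₁ (P₁≈ ws []))) ,
     trans (sym (P₂≈ us vs)) (trans (reflexive (≡.sym f₂)) (trans p₂ (P₂≈ ws []))) ,
     trans (reflexive (≡.sym f₃)) p₃
   words : (us ≡ []) ⊎ (vs ≡ []) → (us ≡ ws × vs ≡ []) ⊎ (us ≡ [] × vs ≡ reverse ws)
   words (inj₂ ≡.refl) = let i₀ , i₁ , i₂ , i₃ = identities in inj₁ (block-injective us ws (≡.trans (≡.sym (ℕ.+-identityʳ _)) len) (mat≈ (unit-cancelʳ σ σ₀ i₀)
       (κ-cancel (trans (neg (e₁₂ Y)) (trans (𝕊.-‿cong i₁) (sym (neg (e₁₂ w)))))) (κ-cancel (trans (𝕊.*-comm κ (e₂₁ Y)) (trans i₂ (𝕊.*-comm (e₂₁ w) κ)))) (unit-cancelʳ η η₀ i₃)) , ≡.refl)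
     where
     neg : ∀ f → κ * f ≈ - (f * - κ)
     neg f = solve 2 (λ k f → k :* f := :- (f :* (:- k))) refl κ f
   words (inj₁ ≡.refl) = let i₀ , i₁ , i₂ , i₃ = identities in inj₂ (≡.refl , block-injective vs (reverse ws) (≡.trans len (≡.sym (List.length-reverse ws))) (≋-trans (mat≈ (unit-cancelʳ σ σ₀ (trans (𝕊.*-comm (e₁₁ s) σ) i₀))
       (κ-cancel (trans (solve 2 (λ k f → k :* f := :- ((:- k) :* f)) refl κ (e₁₂ s)) (trans (𝕊.-‿cong i₂) (solve 2 (λ k f → :- (f :* k) := k :* (:- f)) refl κ (e₂₁ w)))))
       (κ-cancel (trans i₁ (solve 2 (λ k f → f :* (:- k) := k :* (:- f)) refl κ (e₁₂ w))))
       (unit-cancelʳ η η₀ (trans (𝕊.*-comm (e₂₂ s) η) i₃))) (flip-block ws)))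
   conclude : (double M ≡ double L) × (double M′ ≡ double L′) × ((us ≡ ws × vs ≡ []) ⊎ (us ≡ [] × vs ≡ reverse ws))
   conclude = let i₀ , i₁ , i₂ , i₃ = identities in M≡L , M′≡L′ , words (oneBlockTrivial us vs ws len sum i₀ i₁ i₂ i₃)

-- A connected graph with the local structure of a sun is a sun.

module CoreWalk where
 open BinaryForms using (module DZ)
 open Jacobi using (kron; kron-same; kron-diff; kron-sum)
 open SpectralMoments
 open LocalStructure using (h-values; leaf-neighbour)
 open CycleElimination using (choose; next)
 open SunGraphs using (Sun; next-wrap; next-suc)
 open import Data.Nat.Base using (_≤_; _<_)
 open import Data.Integer.Base using (+≤+; -1ℤ; _+_; _*_; _-_; -_)
 open import Data.Integer.Tactic.RingSolver using (solve-∀)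
 open import Data.Bool.Base using (_∧_)
 open import Data.Fin.Base using (zero; suc; toℕ)
 open ≡

 private
   b2z-nonneg : ∀ c → + 0 ℤ.≤ b2z c
   b2z-nonneg true  = +≤+ z≤n
   b2z-nonneg false = +≤+ z≤n

   true≢false : true ≢ false
   true≢false ()

   bool-cases : ∀ c → (c ≡ true) ⊎ (c ≡ false)
   bool-cases true  = inj₁ refl
   bool-cases false = inj₂ refl

   without : ∀ {n} → (Fin n → Bool) → Fin n → Fin n → Bool
   without f w x = choose (x Fin.≟ w) false (f x)

   without-other : ∀ {n} (f : Fin n → Bool) w {x} → x ≢ w → without f w x ≡ f x
   without-other f w {x} x≢w with x Fin.≟ w
   ... | yes p = contradiction p x≢w
   ... | no _  = refl

   without-true : ∀ {n} (f : Fin n → Bool) w {x} → without f w x ≡ true → x ≢ w × f x ≡ true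
   without-true f w {x} p with x Fin.≟ w
   without-true f w {x} () | yes _
   without-true f w {x} p  | no q = q , p

   sum-without : ∀ {n} (f : Fin n → Bool) w → f w ≡ true → DZ.sum (λ x → b2z (f x)) ≡ + 1 + DZ.sum (λ x → b2z (without f w x))
   sum-without f w fw = trans (DZ.sum-cong split) (trans (DZ.sum-+ (λ x → kron w x) (λ x → b2z (without f w x)))
     (cong (_+ DZ.sum (λ x → b2z (without f w x))) (trans (DZ.sum-cong (λ x → sym (ℤ.*-identityʳ (kron w x)))) (kron-sum w (λ _ → + 1)))))
     where
     split : ∀ x → b2z (f x) ≡ kron w x + b2z (without f w x)
     split x with x Fin.≟ w
     ... | yes refl = trans (cong b2z fw) (sym (trans (ℤ.+-identityʳ _) (kron-same x)))
     ... | no p     = sym (trans (cong (_+ b2z (f x)) (kron-diff (p ∘ sym))) (ℤ.+-identityˡ _))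

   sum-positive : ∀ {n} (f : Fin n → Bool) → DZ.sum (λ x → b2z (f x)) ≢ + 0 → Σ (Fin n) λ w → f w ≡ true
   sum-positive {zero}  f p = contradiction refl p
   sum-positive {suc n} f p with bool-cases (f zero)
   ... | inj₁ t = zero , t
   ... | inj₂ e with sum-positive (f ∘ suc) (λ q → p (cong₂ _+_ (cong b2z e) q))
   ...   | w , t = suc w , t

   sum-zero : ∀ {n} (f : Fin n → Bool) → DZ.sum (λ x → b2z (f x)) ≡ + 0 → ∀ w → f w ≡ false
   sum-zero f p w with bool-cases (f w)
   ... | inj₂ e = e
   ... | inj₁ t with () ← trans (sym (cong b2z t)) (sum-nonneg-zero (λ x → b2z (f x)) (λ x → b2z-nonneg (f x)) p w)

   ≢-respˡ : ∀ {x a b : ℤ} → x ≡ a → a ≢ b → x ≢ b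
   ≢-respˡ refl p = p

   +-cancelˡ : ∀ {a b c} → a + b ≡ a + c → b ≡ c
   +-cancelˡ {a} {b} {c} p = trans (isolate a b) (trans (cong (_- a) p) (sym (isolate a c)))
     where
     isolate : ∀ a b → b ≡ (a + b) - a
     isolate = solve-∀

   sum-two : ∀ {n} (f : Fin n → Bool) → DZ.sum (λ x → b2z (f x)) ≡ + 2 → ∀ w → f w ≡ true →
     Σ (Fin n) λ w′ → w′ ≢ w × f w′ ≡ true × (∀ {x} → f x ≡ true → (x ≡ w) ⊎ (x ≡ w′))
   sum-two f s w fw with +-cancelˡ {+ 1} {c = + 1} (trans (sym (sum-without f w fw)) s)
   ... | s′ with sum-positive (without f w) (≢-respˡ s′ λ ())
   ...   | w′ , t with without-true f w t
   ...     | w′≢w , fw′ = w′ , w′≢w , fw′ , only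
     where
     none : ∀ x → without (without f w) w′ x ≡ false
     none = sum-zero (without (without f w) w′) (+-cancelˡ {+ 1} {c = + 0} (trans (sym (sum-without (without f w) w′ t)) s′))
     only : ∀ {x} → f x ≡ true → (x ≡ w) ⊎ (x ≡ w′)
     only {x} fx with x Fin.≟ w | x Fin.≟ w′
     ... | yes p | _     = inj₁ p
     ... | no _  | yes q = inj₂ q
     ... | no p  | no q  = ⊥-elim (true≢false (trans (sym (trans (without-other (without f w) w′ q) (trans (without-other f w p) fx))) (none x)))

 -- All that is kept of the spectrum; from here on the argument is purely about graphs.
 record Sunlike {n} (G : Graph n) : Set where
   open GraphOf G
   field
     cube      : ∀ i → h i * h i * h i ≡ h i
     edges     : ∀ i j → edgeDefect i j ≡ + 0
     sum-h     : DZ.sum h ≡ + 0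
     noTwins   : ∀ {u v w} → u ≢ v → d u ≡ + 1 → d v ≡ + 1 → adj G u w ≡ true → adj G v w ≡ true → ⊥
     connected : ∀ (S : Fin n → Bool) → (∀ i j → adj G i j ≡ true → S i ≡ S j) → ∀ r r′ → S r ≡ true → S r′ ≡ false → ⊥

 module Walk {n : ℕ} (G : Graph n) (sunlike : Sunlike G) where
   open Sunlike sunlike
   open GraphOf G

   private
     adj-sym : ∀ {u w} → adj G u w ≡ true → adj G w u ≡ true
     adj-sym {u} {w} p = trans (Graph.sym G w u) p

     no-loop : ∀ {u} → adj G u u ≡ true → ⊥
     no-loop {u} p = true≢false (trans (sym p) (Graph.irrefl G u))

     data Kind (u : Fin n) : Set where
       isLeaf : d u ≡ + 1 → Kind u
       isMid  : d u ≡ + 2 → Kind u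
       isHub  : d u ≡ + 3 → Kind u

     kind : ∀ u → Kind u
     kind u with h-values (h u) (cube u)
     ... | inj₁ p        = isLeaf (ℤ.i-j≡0⇒i≡j (d u) (+ 1) (trans (shift (d u)) (cong (_+ + 1) p)))
       where
       shift : ∀ d → d - + 1 ≡ (d - + 2) + + 1
       shift = solve-∀
     ... | inj₂ (inj₁ p) = isMid (ℤ.i-j≡0⇒i≡j (d u) (+ 2) p)
     ... | inj₂ (inj₂ p) = isHub (ℤ.i-j≡0⇒i≡j (d u) (+ 3) (trans (shift (d u)) (cong (_- + 1) p)))
       where
       shift : ∀ d → d - + 3 ≡ (d - + 2) - + 1
       shift = solve-∀

     -- With numerals for both degrees the defect of the edge computes, so a forbidden pair of
     -- degrees is refuted by an absurd pattern.
     edge-value : ∀ {u w} → adj G u w ≡ true → ∀ {x y} → d u ≡ x → d w ≡ y →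
       + 1 * (+ 2 * ((x - + 2) * (y - + 2)) + ((x - + 2) * (x - + 2) - (x - + 2)) + ((y - + 2) * (y - + 2) - (y - + 2))) ≡ + 0
     edge-value {u} {w} a refl refl = trans (cong (λ c → b2z c * (+ 2 * (h u * h w) + (h u * h u - h u) + (h w * h w - h w))) (sym a)) (edges u w)

     leaf-hub : ∀ {u w} → d u ≡ + 1 → adj G u w ≡ true → d w ≡ + 3
     leaf-hub {u} {w} du a with kind w
     ... | isLeaf dw with () ← edge-value a du dw
     ... | isMid dw  with () ← edge-value a du dw
     ... | isHub dw  = dw

   hubs-apart : ∀ {u w} → d u ≡ + 3 → d w ≡ + 3 → adj G u w ≡ true → ⊥
   hubs-apart du dw a with () ← edge-value a du dw

   private
     leaf? hub? core? : Fin n → Bool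
     leaf? u = choose (d u ℤ.≟ + 1) true false
     core? u = choose (d u ℤ.≟ + 1) false true

   hub? u = choose (d u ℤ.≟ + 3) true false

   private
     leaf?-yes : ∀ {u} → d u ≡ + 1 → leaf? u ≡ true
     leaf?-yes {u} p with d u ℤ.≟ + 1
     ... | yes _ = refl
     ... | no q  = contradiction p q

     leaf?-no : ∀ {u} → d u ≢ + 1 → leaf? u ≡ false
     leaf?-no {u} p with d u ℤ.≟ + 1
     ... | yes q = contradiction q p
     ... | no _  = refl

     leaf?-d : ∀ {u} → leaf? u ≡ true → d u ≡ + 1
     leaf?-d {u} p with d u ℤ.≟ + 1
     leaf?-d {u} p  | yes q = q
     leaf?-d {u} () | no _

     core?-yes : ∀ {u} → d u ≢ + 1 → core? u ≡ true
     core?-yes {u} p with d u ℤ.≟ + 1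
     ... | yes q = contradiction q p
     ... | no _  = refl

     core?-d : ∀ {u} → core? u ≡ true → d u ≢ + 1
     core?-d {u} p with d u ℤ.≟ + 1
     core?-d {u} () | yes q
     core?-d {u} p  | no q = q

     hub?-yes : ∀ {u} → d u ≡ + 3 → hub? u ≡ true
     hub?-yes {u} p with d u ℤ.≟ + 3
     ... | yes _ = refl
     ... | no q  = contradiction p q

     hub?-no : ∀ {u} → d u ≢ + 3 → hub? u ≡ false
     hub?-no {u} p with d u ℤ.≟ + 3
     ... | yes q = contradiction q p
     ... | no _  = refl

   hub?-d : ∀ {u} → hub? u ≡ true → d u ≡ + 3
   hub?-d {u} p with d u ℤ.≟ + 3
   hub?-d {u} p  | yes q = q
   hub?-d {u} () | no _

   private
     neighbour : ∀ u → d u ≢ + 0 → Σ (Fin n) λ w → adj G u w ≡ true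
     neighbour u p = sum-positive (adj G u) p

     leafNbr : ∀ u → Fin n → Bool
     leafNbr w u = leaf? u ∧ adj G w u

     leafNbr-true : ∀ {w u} → leafNbr w u ≡ true → d u ≡ + 1 × adj G w u ≡ true
     leafNbr-true {w} {u} p with leaf? u in l | adj G w u
     ... | true | true = leaf?-d l , refl

     leaves : Fin n → ℤ
     leaves w = DZ.sum (λ u → b2z (leafNbr w u))

     ∧-* : ∀ a c → b2z (a ∧ c) ≡ b2z a * b2z c
     ∧-* true  true  = refl
     ∧-* true  false = refl
     ∧-* false true  = refl
     ∧-* false false = refl

     -- A neighbour of a leaf is a hub, and a hub has at most one leaf because there are no twins.
     leaves≤hub : ∀ w → + 0 ℤ.≤ b2z (hub? w) - leaves w
     leaves≤hub w with ℤ._≟_ (leaves w) (+ 0)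
     ... | yes p = subst (λ z → + 0 ℤ.≤ b2z (hub? w) - z) (sym p) (subst (+ 0 ℤ.≤_) (sym (ℤ.+-identityʳ _)) (b2z-nonneg (hub? w)))
     ... | no p with sum-positive (leafNbr w) p
     ...   | u , t with leafNbr-true t
     ...     | du , a = subst (+ 0 ℤ.≤_) (sym (cong₂ _-_ (cong b2z (hub?-yes (leaf-hub du (adj-sym a)))) one)) ℤ.≤-refl
       where
       none : ∀ x → b2z (without (leafNbr w) u x) ≡ + 0
       none x with bool-cases (without (leafNbr w) u x)
       ... | inj₂ e = cong b2z e
       ... | inj₁ e with without-true (leafNbr w) u e
       ...   | x≢u , e′ with leafNbr-true e′
       ...     | dx , a′ = ⊥-elim (noTwins x≢u dx du (adj-sym a′) (adj-sym a))
       one : leaves w ≡ + 1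
       one = trans (sum-without (leafNbr w) u t) (cong (λ z → + 1 + z) (DZ.sum-0 none))

     sum-leaves : DZ.sum leaves ≡ DZ.sum (λ u → b2z (leaf? u))
     sum-leaves = trans (DZ.sum-swap (λ w u → b2z (leafNbr w u))) (DZ.sum-cong (λ u → trans (DZ.sum-cong (λ w → trans (∧-* (leaf? u) (adj G w u)) (cong (b2z (leaf? u) *_) (A-sym w u))))
       (trans (DZ.sum-* (b2z (leaf? u)) (A u)) (degreeOne u))))
       where
       degreeOne : ∀ u → b2z (leaf? u) * d u ≡ b2z (leaf? u)
       degreeOne u with bool-cases (leaf? u)
       ... | inj₁ p = trans (cong₂ (λ c z → b2z c * z) p (leaf?-d p)) (cong b2z (sym p))
       ... | inj₂ p = trans (cong (λ c → b2z c * d u) p) (trans (ℤ.*-zeroˡ (d u)) (cong b2z (sym p)))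

     h-split : ∀ u → h u ≡ b2z (hub? u) - b2z (leaf? u)
     h-split u with kind u
     ... | isLeaf p = trans (cong (_- + 2) p) (sym (cong₂ (λ a c → b2z a - b2z c) (hub?-no (≢-respˡ p λ ())) (leaf?-yes p)))
     ... | isMid p  = trans (cong (_- + 2) p) (sym (cong₂ (λ a c → b2z a - b2z c) (hub?-no (≢-respˡ p λ ())) (leaf?-no (≢-respˡ p λ ()))))
     ... | isHub p  = trans (cong (_- + 2) p) (sym (cong₂ (λ a c → b2z a - b2z c) (hub?-yes p) (leaf?-no (≢-respˡ p λ ()))))

     sum-minus : ∀ (f g : Fin n → ℤ) → DZ.sum (λ i → f i - g i) ≡ DZ.sum f - DZ.sum g
     sum-minus f g = trans (DZ.sum-+ f (λ i → - g i)) (cong (λ z → DZ.sum f + z)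
       (trans (DZ.sum-cong (λ i → sym (ℤ.-1*i≡-i (g i)))) (trans (DZ.sum-* -1ℤ g) (ℤ.-1*i≡-i (DZ.sum g)))))

     -- Leaves hang on distinct hubs and there are as many leaves as hubs.
     leaves-hub : ∀ w → b2z (hub? w) ≡ leaves w
     leaves-hub w = ℤ.i-j≡0⇒i≡j _ _ (sum-nonneg-zero (λ w → b2z (hub? w) - leaves w) leaves≤hub
       (trans (sum-minus (λ w → b2z (hub? w)) leaves) (trans (cong (λ z → DZ.sum (λ w → b2z (hub? w)) - z) sum-leaves)
         (trans (sym (sum-minus (λ w → b2z (hub? w)) (λ w → b2z (leaf? w)))) (trans (sym (DZ.sum-cong h-split)) sum-h)))) w)

     hub-leaf : ∀ w → hub? w ≡ true → Σ (Fin n) λ u → d u ≡ + 1 × adj G w u ≡ true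
     hub-leaf w p with sum-positive (leafNbr w) (≢-respˡ (trans (sym (leaves-hub w)) (cong b2z p)) λ ())
     ... | u , t = u , leafNbr-true t

     coreNbr : Fin n → Fin n → Bool
     coreNbr u w = core? w ∧ adj G u w

     coreNbr-true : ∀ {u w} → coreNbr u w ≡ true → core? w ≡ true × adj G u w ≡ true
     coreNbr-true {u} {w} p with core? w | adj G u w
     ... | true | true = refl , refl

     coreNbr-intro : ∀ {u w} → core? w ≡ true → adj G u w ≡ true → coreNbr u w ≡ true
     coreNbr-intro p r rewrite p | r = refl

     -- The degree of a core vertex is 2, plus 1 for a hub, and a hub has exactly one leaf. Two core
     -- neighbours remain in either case.
     core-degree : ∀ u → core? u ≡ true → DZ.sum (λ w → b2z (coreNbr u w)) ≡ + 2
     core-degree u cu = +-cancelˡ {leaves u} (trans (sym (DZ.sum-+ (λ w → b2z (leafNbr u w)) (λ w → b2z (coreNbr u w)))) (trans (DZ.sum-cong split) (trans degrees (cong (_+ + 2) (leaves-hub u)))))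
       where
       split : ∀ w → b2z (leafNbr u w) + b2z (coreNbr u w) ≡ A u w
       split w with d w ℤ.≟ + 1
       ... | yes _ = ℤ.+-identityʳ _
       ... | no _  = ℤ.+-identityˡ _
       degrees : d u ≡ b2z (hub? u) + + 2
       degrees with kind u
       ... | isLeaf p = contradiction p (core?-d cu)
       ... | isMid p  = trans p (cong (λ c → b2z c + + 2) (sym (hub?-no (≢-respˡ p λ ()))))
       ... | isHub p  = trans p (cong (λ c → b2z c + + 2) (sym (hub?-yes p)))

     -- A directed edge of the core. Every core vertex has exactly two core neighbours, so a dart
     -- determines the whole walk without turning back.
     record Dart : Set where
       field
         src tgt : Fin n
         src-core : core? src ≡ true
         tgt-core : core? tgt ≡ true
         joined   : adj G src tgt ≡ true
     open Dart

     turn : ∀ (a : Dart) → Σ (Fin n) λ w → w ≢ src a × coreNbr (tgt a) w ≡ true × (∀ {x} → coreNbr (tgt a) x ≡ true → (x ≡ src a) ⊎ (x ≡ w))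
     turn a = sum-two (coreNbr (tgt a)) (core-degree (tgt a) (tgt-core a)) (src a) (coreNbr-intro (src-core a) (adj-sym (joined a)))

     advance : Dart → Dart
     advance a = record { src = tgt a ; tgt = proj₁ (turn a) ; src-core = tgt-core a
       ; tgt-core = proj₁ (coreNbr-true {tgt a} (proj₁ (proj₂ (proj₂ (turn a))))) ; joined = proj₂ (coreNbr-true {tgt a} (proj₁ (proj₂ (proj₂ (turn a))))) }

   record Cycle : Set where
     field
       length′  : ℕ
       3≤length : 3 ≤ length′
       at       : ℕ → Fin n
       at-core  : ∀ k → d (at k) ≢ + 1
       at-inj   : ∀ {i j} → i < length′ → j < length′ → at i ≡ at j → i ≡ j
       at-next  : ∀ {i} → i < length′ → adj G (at i) (at (next length′ i)) ≡ true
       at-at    : ∀ {i x} → i < length′ → d x ≢ + 1 → adj G (at i) x ≡ true → Σ ℕ λ j → j < length′ × x ≡ at j × ((j ≡ next length′ i) ⊎ (i ≡ next length′ j))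

   module Trail (v : ℕ → Fin n) (v-core : ∀ k → core? (v k) ≡ true) (v-adj : ∀ k → adj G (v k) (v (suc k)) ≡ true) (v-turn : ∀ k → v (suc (suc k)) ≢ v k)
     (v-only : ∀ k {x} → core? x ≡ true → adj G (v (suc k)) x ≡ true → (x ≡ v k) ⊎ (x ≡ v (suc (suc k)))) where
     private
       Distinct : ℕ → Set
       Distinct m = ∀ {i j} → i < m → j < m → v i ≡ v j → i ≡ j

       earlier : ∀ m k → (Σ ℕ λ i → i < k × v i ≡ v m) ⊎ (∀ {i} → i < k → v i ≢ v m)
       earlier m zero = inj₂ (λ ())
       earlier m (suc k) with v k Fin.≟ v m | earlier m k
       ... | yes p | _ = inj₁ (k , ℕ.≤-refl , p)
       ... | no _  | inj₁ (i , i<k , p) = inj₁ (i , ℕ.m≤n⇒m≤1+n i<k , p)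
       ... | no q  | inj₂ none = inj₂ λ {i} i<sk → byCases i i<sk (ℕ.m<1+n⇒m<n∨m≡n i<sk)
         where
         byCases : ∀ i → i < suc k → (i < k) ⊎ (i ≡ k) → v i ≢ v m
         byCases i _ (inj₁ i<k)  = none i<k
         byCases i _ (inj₂ refl) = q

       extend : ∀ {m} → Distinct m → (∀ {i} → i < m → v i ≢ v m) → Distinct (suc m)
       extend {m} D new {i} {j} i< j< p with ℕ.m<1+n⇒m<n∨m≡n i< | ℕ.m<1+n⇒m<n∨m≡n j<
       ... | inj₁ a    | inj₁ c    = D a c p
       ... | inj₁ a    | inj₂ refl = contradiction p (new a)
       ... | inj₂ refl | inj₁ c    = contradiction (sym p) (new c)
       ... | inj₂ refl | inj₂ refl = refl

       -- The sum of `fuel` and m stays n + 1. If the fuel ran out, n + 1 distinct vertices would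
       -- contradict the pigeonhole principle.
       search : ∀ fuel m → fuel ℕ.+ m ≡ suc n → Distinct m → Σ ℕ λ m → Distinct m × Σ ℕ λ i → i < m × v i ≡ v m
       search zero m e D with Fin.pigeonhole (ℕ.n<1+n n) (λ (i : Fin (suc n)) → v (toℕ i))
       ... | i , j , i<j , p = ⊥-elim (ℕ.<⇒≢ i<j (D (subst (toℕ i <_) (sym e) (Fin.toℕ<n i)) (subst (toℕ j <_) (sym e) (Fin.toℕ<n j)) p))
       search (suc fuel) m e D with earlier m m
       ... | inj₁ r    = m , D , r
       ... | inj₂ none = search fuel (suc m) (trans (ℕ.+-suc fuel m) e) (extend D none)

       repetition : Σ ℕ λ m → Distinct m × Σ ℕ λ i → i < m × v i ≡ v m
       repetition = search (suc n) 0 (ℕ.+-identityʳ _) (λ ())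

       ℓ : ℕ
       ℓ = proj₁ repetition

       distinct : Distinct ℓ
       distinct = proj₁ (proj₂ repetition)

       -- The walk first repeats at its start. If it met v i with i > 0, its last vertex would be a
       -- core neighbour of v i, hence v (i - 1) or v (i + 1); this is an earlier repetition, a turn
       -- back or a loop.
       returns : ∀ m → Distinct m → ∀ i → i < m → v i ≡ v m → i ≡ 0
       returns m D zero i<m p = refl
       returns (suc m) D (suc i) i<m p with v-only i (v-core m) (adj-sym (subst (λ z → adj G (v m) z ≡ true) (sym p) (v-adj m)))
       ... | inj₁ q = contradiction (cong suc (sym (D ℕ.≤-refl (ℕ.<⇒≤ i<m) q))) (ℕ.<⇒≢ i<m)
       ... | inj₂ q with ℕ.m≤n⇒m<n∨m≡n i<m
       ...   | inj₁ i+2<m with refl ← D ℕ.≤-refl i+2<m q = ⊥-elim (v-turn (suc i) (sym p))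
       ...   | inj₂ refl = ⊥-elim (no-loop (subst (λ z → adj G (v (suc i)) z ≡ true) (sym p) (v-adj (suc i))))

       closes : v 0 ≡ v ℓ
       closes = let i , i<ℓ , p = proj₂ (proj₂ repetition) in subst (λ i → v i ≡ v ℓ) (returns ℓ distinct i i<ℓ p) p

       ℓ-positive : 0 < ℓ
       ℓ-positive = ℕ.≤-<-trans z≤n (proj₁ (proj₂ (proj₂ (proj₂ repetition))))

       3≤ : ∀ m → 0 < m → v 0 ≡ v m → 3 ≤ m
       3≤ (suc zero) _ p = ⊥-elim (no-loop (subst (λ z → adj G (v 0) z ≡ true) (sym p) (v-adj 0)))
       3≤ (suc (suc zero)) _ p = ⊥-elim (v-turn 0 (sym p))
       3≤ (suc (suc (suc m))) _ p = s≤s (s≤s (s≤s z≤n))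

     cycle : Cycle
     cycle = build ℓ distinct ℓ-positive closes
       where
       build : ∀ m → Distinct m → 0 < m → v 0 ≡ v m → Cycle
       build (suc m′) D′ 0<m p′ = record
         { length′ = suc m′ ; 3≤length = 3≤m ; at = v ; at-core = λ k → core?-d (v-core k) ; at-inj = D′ ; at-next = nxt ; at-at = nbrs }
         where
         3≤m : 3 ≤ suc m′
         3≤m = 3≤ (suc m′) 0<m p′
         nxt : ∀ {i} → i < suc m′ → adj G (v i) (v (next (suc m′) i)) ≡ true
         nxt {i} i< with suc i ℕ.≟ suc m′
         ... | yes refl = subst (λ z → adj G (v i) z ≡ true) (sym p′) (v-adj i)
         ... | no _     = v-adj i
         nbrs : ∀ {i x} → i < suc m′ → d x ≢ + 1 → adj G (v i) x ≡ true → Σ ℕ λ j → j < suc m′ × x ≡ v j × ((j ≡ next (suc m′) i) ⊎ (i ≡ next (suc m′) j))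
         nbrs {suc i} {x} i< dx a with v-only i (core?-yes dx) a
         ... | inj₁ q = i , ℕ.<⇒≤ i< , q , inj₂ (sym (next-suc (ℕ.<⇒≢ i<)))
         ... | inj₂ q with suc (suc i) ℕ.≟ suc m′
         ...   | yes e = 0 , s≤s z≤n , trans q (trans (cong v e) (sym p′)) , inj₁ refl
         ...   | no e  = suc (suc i) , ℕ.≤∧≢⇒< i< e , q , inj₁ refl
         nbrs {zero} {x} i< dx a with v-only m′ (core?-yes dx) (subst (λ z → adj G z x ≡ true) p′ a)
         ... | inj₁ q = m′ , ℕ.≤-refl , q , inj₂ (sym (next-wrap refl))
         ... | inj₂ q = 1 , ℕ.≤-trans (s≤s (s≤s z≤n)) 3≤m , trans q (sym one) , inj₁ (sym (next-suc (λ e → ℕ.<⇒≢ (ℕ.≤-trans (s≤s (s≤s z≤n)) 3≤m) e)))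
           where
           -- After its return the walk continues as it began: v 1 is a core neighbour of v (m′ + 1)
           -- = v 0, and it differs from v m′ because the cycle has length at least 3.
           one : v 1 ≡ v (suc (suc m′))
           one with v-only m′ (v-core 1) (subst (λ z → adj G z (v 1) ≡ true) p′ (v-adj 0))
           ... | inj₂ r = r
           ... | inj₁ r = ⊥-elim (1≢m′ (D′ (ℕ.≤-trans (s≤s (s≤s z≤n)) 3≤m) ℕ.≤-refl r))
             where
             1≢m′ : 1 ≢ m′
             1≢m′ refl with s≤s (s≤s ()) ← 3≤m

   private
     module From (a₀ : Dart) where
       darts : ℕ → Dart
       darts zero    = a₀
       darts (suc k) = advance (darts k)

       cycle : Cycle
       cycle = Trail.cycle (λ k → src (darts k)) (λ k → src-core (darts k)) (λ k → joined (darts k)) (λ k → proj₁ (proj₂ (turn (darts k))))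
         (λ k cx a → proj₂ (proj₂ (proj₂ (turn (darts k)))) (coreNbr-intro cx a))

   module OnCycle (C : Cycle) where
     private
       module C = Cycle C

       -- Sends a leaf to its hub and fixes the core, so that lying on the sun becomes a condition
       -- on core vertices.
       anchor : Fin n → Fin n
       anchor u with d u ℤ.≟ + 1
       ... | yes p = proj₁ (neighbour u (≢-respˡ p λ ()))
       ... | no _  = u

       anchor-core : ∀ {u} → d u ≢ + 1 → anchor u ≡ u
       anchor-core {u} p with d u ℤ.≟ + 1
       ... | yes q = contradiction q p
       ... | no _  = refl

       anchor-leaf : ∀ {u} → d u ≡ + 1 → adj G u (anchor u) ≡ true
       anchor-leaf {u} p with d u ℤ.≟ + 1
       ... | yes q = proj₂ (neighbour u _)
       ... | no q  = contradiction p q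

       onCycle : ∀ k u → Dec (Σ ℕ λ i → i < k × u ≡ C.at i)
       onCycle zero u = no λ { (_ , () , _) }
       onCycle (suc k) u with u Fin.≟ C.at k | onCycle k u
       ... | yes p | _ = yes (k , ℕ.≤-refl , p)
       ... | no _  | yes (i , i<k , p) = yes (i , ℕ.m≤n⇒m≤1+n i<k , p)
       ... | no q  | no none = no λ { (i , i< , p) → byCases i p (ℕ.m<1+n⇒m<n∨m≡n i<) }
         where
         byCases : ∀ i → u ≡ C.at i → (i < k) ⊎ (i ≡ k) → ⊥
         byCases i p (inj₁ i<k)  = none (i , i<k , p)
         byCases i p (inj₂ refl) = q p

       -- The set to which connectedness is applied. It is closed under adjacency because both core
       -- neighbours of a cycle vertex lie on the cycle.
       reached : Fin n → Bool
       reached u = choose (onCycle C.length′ (anchor u)) true false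

       reached-yes : ∀ {u} → Σ ℕ (λ i → i < C.length′ × anchor u ≡ C.at i) → reached u ≡ true
       reached-yes {u} p with onCycle C.length′ (anchor u)
       ... | yes _ = refl
       ... | no q  = contradiction p q

       reached-only : ∀ {u} → reached u ≡ true → Σ ℕ λ i → i < C.length′ × anchor u ≡ C.at i
       reached-only {u} p with onCycle C.length′ (anchor u)
       reached-only {u} p  | yes q = q
       reached-only {u} () | no _

       closed→ : ∀ u w → adj G u w ≡ true → reached u ≡ true → reached w ≡ true
       closed→ u w a r = go (reached-only {u} r) (d u ℤ.≟ + 1) (d w ℤ.≟ + 1)
         where
         go : Σ ℕ (λ i → i < C.length′ × anchor u ≡ C.at i) → Dec (d u ≡ + 1) → Dec (d w ≡ + 1) → reached w ≡ true
         go (i , i< , p) (yes du) (yes dw) with () ← trans (sym (leaf-hub du a)) dw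
         go (i , i< , p) (yes du) (no dw)  = reached-yes {w} (i , i< , trans (anchor-core dw) (trans (leaf-neighbour G du (anchor-leaf du) a) p))
         go (i , i< , p) (no du)  (yes dw) = reached-yes {w} (i , i< , trans (sym (leaf-neighbour G dw (anchor-leaf dw) (adj-sym a))) (trans (sym (anchor-core du)) p))
         go (i , i< , p) (no du)  (no dw)  = let j , j< , q , _ = C.at-at i< dw (subst (λ z → adj G z w ≡ true) (trans (sym (anchor-core du)) p) a)
           in reached-yes {w} (j , j< , trans (anchor-core dw) q)

       bool-iff : ∀ {a c} → (a ≡ true → c ≡ true) → (c ≡ true → a ≡ true) → a ≡ c
       bool-iff {true}  {c} f g = sym (f refl)
       bool-iff {false} {true} f g = g refl
       bool-iff {false} {false} f g = refl

       all-reached : ∀ u → reached u ≡ true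
       all-reached u with bool-cases (reached u)
       ... | inj₁ p = p
       ... | inj₂ p = ⊥-elim (connected reached (λ i j a → bool-iff (closed→ i j a) (closed→ j i (adj-sym a))) (C.at 0) u
           (reached-yes {C.at 0} (0 , ℕ.≤-trans (s≤s z≤n) C.3≤length , anchor-core (C.at-core 0))) p)

       bit : ℕ → Bool
       bit i = hub? (C.at i)

       leafOf : ∀ u → Fin n
       leafOf u with bool-cases (hub? u)
       ... | inj₁ p = proj₁ (hub-leaf u p)
       ... | inj₂ _ = u

       leafOf-hub : ∀ {u} → hub? u ≡ true → d (leafOf u) ≡ + 1 × adj G u (leafOf u) ≡ true
       leafOf-hub {u} p with bool-cases (hub? u)
       ... | inj₁ q = proj₂ (hub-leaf u q)
       ... | inj₂ q = ⊥-elim (true≢false (trans (sym p) q))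

       lf : ℕ → Fin n
       lf i = leafOf (C.at i)

     sun : Σ ℕ λ ℓ → 3 ≤ ℓ × Σ (ℕ → Bool) λ b → Sun G ℓ b × (∀ {i} → i < ℓ → b i ≡ true → b (next ℓ i) ≡ true → ⊥)
     sun = C.length′ , C.3≤length , bit , record
       { core = C.at ; leaf = lf ; core-inj = C.at-inj
       ; leaf-inj = λ {i} {j} i< j< bi bj p → C.at-inj i< j< (leaf-neighbour G (proj₁ (leafOf-hub bj)) (adj-sym (proj₂ (leafOf-hub bj))) (subst (λ z → adj G z (C.at i) ≡ true) p (adj-sym (proj₂ (leafOf-hub bi)))))
       ; core≢leaf = λ {i} {j} i< j< bj p → C.at-core i (trans (cong d p) (proj₁ (leafOf-hub bj)))
       ; locate = locate
       ; core-next = C.at-next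
       ; core-core = λ {i} {j} i< j< a → cc i< j< (C.at-at i< (C.at-core j) a)
       ; leaf-core = λ {i} i< bi → adj-sym (proj₂ (leafOf-hub bi))
       ; leaf-only = λ {i} i< bi a → leaf-neighbour G (proj₁ (leafOf-hub bi)) (adj-sym (proj₂ (leafOf-hub bi))) a } ,
       λ i< bi bn → hubs-apart (hub?-d bi) (hub?-d bn) (C.at-next i<)
       where
       cc : ∀ {i j} → i < C.length′ → j < C.length′ → Σ ℕ (λ k → k < C.length′ × C.at j ≡ C.at k × ((k ≡ next C.length′ i) ⊎ (i ≡ next C.length′ k))) → (j ≡ next C.length′ i) ⊎ (i ≡ next C.length′ j)
       cc i< j< (k , k< , p , r) with refl ← C.at-inj j< k< p = r
       locate : ∀ u → (Σ ℕ λ i → i < C.length′ × C.at i ≡ u) ⊎ (Σ ℕ λ i → i < C.length′ × bit i ≡ true × lf i ≡ u)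
       locate u = go (d u ℤ.≟ + 1)
         where
         open Σ (reached-only {u} (all-reached u)) renaming (proj₁ to i; proj₂ to found)
         i< = proj₁ found
         p = proj₂ found
         attached : d u ≡ + 1 → adj G u (C.at i) ≡ true
         attached du = subst (λ z → adj G u z ≡ true) p (anchor-leaf du)
         hub : d u ≡ + 1 → hub? (C.at i) ≡ true
         hub du = hub?-yes (leaf-hub du (attached du))
         equal : d u ≡ + 1 → Dec (lf i ≡ u) → lf i ≡ u
         equal _  (yes q) = q
         equal du (no q)  = ⊥-elim (noTwins q (proj₁ (leafOf-hub (hub du))) du (adj-sym (proj₂ (leafOf-hub (hub du)))) (attached du))
         go : Dec (d u ≡ + 1) → _
         go (no du)  = inj₁ (i , i< , trans (sym p) (anchor-core du))
         go (yes du) = inj₂ (i , i< , hub du , equal du (lf i Fin.≟ u))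

   private
     someCore : Fin n → Σ (Fin n) λ u → core? u ≡ true
     someCore u with d u ℤ.≟ + 1
     ... | no p  = u , core?-yes p
     ... | yes p with neighbour u (≢-respˡ p λ ())
     ...   | w , a = w , core?-yes (≢-respˡ (leaf-hub p a) λ ())

     someDart : Fin n → Dart
     someDart z with someCore z
     ... | u , cu with sum-positive (coreNbr u) (≢-respˡ (core-degree u cu) λ ())
     ...   | w , t = record { src = u ; tgt = w ; src-core = cu ; tgt-core = proj₁ (coreNbr-true {u} t) ; joined = proj₂ (coreNbr-true {u} t) }

   sunlike⇒sun : Fin n → Σ ℕ λ ℓ → 3 ≤ ℓ × Σ (ℕ → Bool) λ b → Sun G ℓ b × (∀ {i} → i < ℓ → b i ≡ true → b (next ℓ i) ≡ true → ⊥)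
   sunlike⇒sun z = OnCycle.sun (From.cycle (someDart z))

-- Suns up to isomorphism, rotation and reflection, and their spectral data.

module SunIsomorphism where
 open BinaryForms using (module DZ)
 open PowerSeries using (module Power)
 open SpectralMoments
 open Jacobi using (power; trace)
 open LocalStructure using (qDet; cospectral-traces)
 open TransferMatrices using (trues)
 open CycleElimination using (module T𝕊; next; upFrom; hubs; ∈-hubs⁻; ∈-hubs⁺; hubs-unique; length-hubs; choose)
 open SunGraphs
 open GapWords using (double-injective; base; cycleDet-eigen; word; product-eigen-bitsOf; eigen)
 open LeadingCoefficients using (bitsOf)
 open import Data.Nat.Base using (_≤_; _<_; _∸_)
 open import Data.Integer.Base using (-1ℤ)
 open import Data.Integer.Tactic.RingSolver using (solve-∀)
 open import Data.Fin.Permutation using (permutation; _⟨$⟩ʳ_; _⟨$⟩ˡ_; inverseˡ; inverseʳ)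
 open import Data.List.Base using (map; reverse; _∷ʳ_)
 open import Data.List.Membership.Propositional.Properties using (∈-map⁻; ∈-map⁺)
 open ≡

 module Transport {n : ℕ} {G H : Graph n} {ℓ : ℕ} {b c : ℕ → Bool} (s : Sun G ℓ b) (t : Sun H ℓ c) (b≡c : ∀ {i} → i < ℓ → b i ≡ c i) where
   private
     module A = Sun s
     module B = Sun t

   to : Fin n → Fin n
   to u with A.locate u
   ... | inj₁ (i , _)     = B.core i
   ... | inj₂ (i , _ , _) = B.leaf i

   to-core : ∀ {i} → i < ℓ → to (A.core i) ≡ B.core i
   to-core {i} i< with A.locate (A.core i)
   ... | inj₁ (j , j< , p)      = cong B.core (A.core-inj j< i< p)
   ... | inj₂ (j , j< , bj , p) = ⊥-elim (A.core≢leaf i< j< bj (sym p))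

   to-leaf : ∀ {i} → i < ℓ → b i ≡ true → to (A.leaf i) ≡ B.leaf i
   to-leaf {i} i< bi with A.locate (A.leaf i)
   ... | inj₁ (j , j< , p)      = ⊥-elim (A.core≢leaf j< i< bi p)
   ... | inj₂ (j , j< , bj , p) = cong B.leaf (A.leaf-inj j< i< bj bi p)

   to-adj : ∀ u w → adj G u w ≡ true → adj H (to u) (to w) ≡ true
   to-adj u w a with A.locate u | A.locate w
   ... | inj₁ (i , i< , refl) | inj₁ (j , j< , refl) with A.core-core i< j< a
   ...   | inj₁ refl = B.core-next i<
   ...   | inj₂ refl = trans (Graph.sym H (B.core i) (B.core j)) (B.core-next j<)
   to-adj u w a | inj₁ (i , i< , refl) | inj₂ (j , j< , bj , refl)
     with refl ← A.core-inj i< j< (A.leaf-only j< bj (trans (Graph.sym G (A.leaf j) (A.core i)) a))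
     = trans (Graph.sym H (B.core i) (B.leaf i)) (B.leaf-core i< (trans (sym (b≡c i<)) bj))
   to-adj u w a | inj₂ (i , i< , bi , refl) | inj₁ (j , j< , refl)
     with refl ← A.core-inj j< i< (A.leaf-only i< bi a)
     = B.leaf-core i< (trans (sym (b≡c i<)) bi)
   to-adj u w a | inj₂ (i , i< , bi , refl) | inj₂ (j , j< , bj , refl) = ⊥-elim (A.core≢leaf i< j< bj (sym (A.leaf-only i< bi a)))

 private
   bool-iff : ∀ {a c} → (a ≡ true → c ≡ true) → (c ≡ true → a ≡ true) → a ≡ c
   bool-iff {true}  {c} f g = sym (f refl)
   bool-iff {false} {true} f g = g refl
   bool-iff {false} {false} f g = refl

 sun-unique : ∀ {n} {G H : Graph n} {ℓ b c} → Sun G ℓ b → Sun H ℓ c → (∀ {i} → i < ℓ → b i ≡ c i) → G ≅ H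
 sun-unique {n} {G} {H} {ℓ} {b} {c} s t e = permutation F.to B.to forth back , λ i j →
     bool-iff (λ a → subst₂ (λ x y → adj G x y ≡ true) (back i) (back j) (B.to-adj (F.to i) (F.to j) a)) (F.to-adj i j)
   where
   module F = Transport s t e
   module B = Transport t s (λ i< → sym (e i<))
   forth : ∀ u → F.to (B.to u) ≡ u
   forth u with Sun.locate t u
   ... | inj₁ (i , i< , refl)      = F.to-core i<
   ... | inj₂ (i , i< , ci , refl) = F.to-leaf i< (trans (e i<) ci)
   back : ∀ u → B.to (F.to u) ≡ u
   back u with Sun.locate s u
   ... | inj₁ (i , i< , refl)      = B.to-core i<
   ... | inj₂ (i , i< , bi , refl) = B.to-leaf i< (trans (sym (e i<)) bi)

 sun-transport : ∀ {n} {G H : Graph n} {ℓ b} → G ≅ H → Sun G ℓ b → Sun H ℓ b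
 sun-transport {G = G} {H} (σ , p) s = record
   { core = λ i → σ ⟨$⟩ʳ core i ; leaf = λ i → σ ⟨$⟩ʳ leaf i
   ; core-inj = λ i< j< q → core-inj i< j< (injective q)
   ; leaf-inj = λ i< j< bi bj q → leaf-inj i< j< bi bj (injective q)
   ; core≢leaf = λ i< j< bj q → core≢leaf i< j< bj (injective q)
   ; locate = λ u → locate′ u (locate (σ ⟨$⟩ˡ u))
   ; core-next = λ i< → trans (p _ _) (core-next i<)
   ; core-core = λ i< j< a → core-core i< j< (trans (sym (p _ _)) a)
   ; leaf-core = λ i< bi → trans (p _ _) (leaf-core i< bi)
   ; leaf-only = λ {i} {u} i< bi a → trans (sym (inverseʳ σ)) (cong (σ ⟨$⟩ʳ_) (leaf-only i< bi (trans (sym (p _ _)) (trans (cong (adj H (σ ⟨$⟩ʳ leaf i)) (inverseʳ σ)) a)))) }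
   where
   open Sun s
   injective : ∀ {u w} → σ ⟨$⟩ʳ u ≡ σ ⟨$⟩ʳ w → u ≡ w
   injective q = trans (sym (inverseˡ σ)) (trans (cong (σ ⟨$⟩ˡ_) q) (inverseˡ σ))
   locate′ : ∀ u → _ → _
   locate′ u (inj₁ (i , i< , q))      = inj₁ (i , i< , trans (cong (σ ⟨$⟩ʳ_) q) (inverseʳ σ))
   locate′ u (inj₂ (i , i< , bi , q)) = inj₂ (i , i< , bi , trans (cong (σ ⟨$⟩ʳ_) q) (inverseʳ σ))

 rotate : ∀ {n} {G : Graph n} {ℓ b} → Sun G ℓ b → Sun G ℓ (b ∘ next ℓ)
 rotate {ℓ = ℓ} s = record
   { core = core ∘ next ℓ ; leaf = leaf ∘ next ℓ
   ; core-inj = λ i< j< q → next-injective (core-inj (next< i<) (next< j<) q)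
   ; leaf-inj = λ i< j< bi bj q → next-injective (leaf-inj (next< i<) (next< j<) bi bj q)
   ; core≢leaf = λ i< j< bj → core≢leaf (next< i<) (next< j<) bj
   ; locate = λ u → locate′ u (locate u)
   ; core-next = λ i< → core-next (next< i<)
   ; core-core = λ i< j< a → shift (core-core (next< i<) (next< j<) a)
   ; leaf-core = λ i< bi → leaf-core (next< i<) bi
   ; leaf-only = λ i< bi a → leaf-only (next< i<) bi a }
   where
   open Sun s
   shift : ∀ {i j} → (next ℓ j ≡ next ℓ (next ℓ i)) ⊎ (next ℓ i ≡ next ℓ (next ℓ j)) → (j ≡ next ℓ i) ⊎ (i ≡ next ℓ j)
   shift (inj₁ p) = inj₁ (next-injective p)
   shift (inj₂ p) = inj₂ (next-injective p)
   locate′ : ∀ u → _ → _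
   locate′ u (inj₁ (i , i< , refl)) with next-surjective i<
   ... | j , j< , refl = inj₁ (j , j< , refl)
   locate′ u (inj₂ (i , i< , bi , refl)) with next-surjective i<
   ... | j , j< , refl = inj₂ (j , j< , bi , refl)

 private
   mirror-next : ∀ {m i} → i ≤ m → next (suc m) (m ∸ next (suc m) i) ≡ m ∸ i
   mirror-next {m} {i} i≤m with suc i ℕ.≟ suc m
   ... | yes refl = trans (next-wrap refl) (sym (ℕ.n∸n≡0 i))
   ... | no p     = trans (next-suc (λ q → ℕ.<⇒≢ (ℕ.∸-monoʳ-< {m} (s≤s z≤n) i<m) (ℕ.suc-injective q)))
                         (trans (sym (ℕ.+-∸-assoc 1 i<m)) refl)
     where
     i<m : i < m
     i<m = ℕ.≤∧≢⇒< i≤m (p ∘ cong suc)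

 mirror : ∀ {n} {G : Graph n} {m b} → Sun G (suc m) b → Sun G (suc m) (λ i → b (m ∸ i))
 mirror {G = G} {m} {b} s = record
   { core = λ i → core (m ∸ i) ; leaf = λ i → leaf (m ∸ i)
   ; core-inj = λ {i} {j} i< j< q → cancel i< j< (core-inj (small i) (small j) q)
   ; leaf-inj = λ {i} {j} i< j< bi bj q → cancel i< j< (leaf-inj (small i) (small j) bi bj q)
   ; core≢leaf = λ {i} {j} i< j< bj → core≢leaf (small i) (small j) bj
   ; locate = λ u → locate′ u (locate u)
   ; core-next = λ {i} i< → trans (Graph.sym G _ _) (subst (λ z → adj G (core (m ∸ next (suc m) i)) (core z) ≡ true) (mirror-next (ℕ.≤-pred i<)) (core-next (small (next (suc m) i))))
   ; core-core = λ {i} {j} i< j< a → shift i< j< (core-core (small i) (small j) a)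
   ; leaf-core = λ {i} i< bi → leaf-core (small i) bi
   ; leaf-only = λ {i} i< bi a → leaf-only (small i) bi a }
   where
   open Sun s
   small : ∀ i → m ∸ i < suc m
   small i = s≤s (ℕ.m∸n≤m m i)
   cancel : ∀ {i j} → i < suc m → j < suc m → m ∸ i ≡ m ∸ j → i ≡ j
   cancel i< j< p = ℕ.∸-cancelˡ-≡ (ℕ.≤-pred i<) (ℕ.≤-pred j<) p
   shift : ∀ {i j} → i < suc m → j < suc m → (m ∸ j ≡ next (suc m) (m ∸ i)) ⊎ (m ∸ i ≡ next (suc m) (m ∸ j)) → (j ≡ next (suc m) i) ⊎ (i ≡ next (suc m) j)
   shift {i} {j} i< j< (inj₁ p) = inj₂ (sym (cancel (next< j<) i< (next-injective (trans (mirror-next (ℕ.≤-pred j<)) p))))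
   shift {i} {j} i< j< (inj₂ p) = inj₁ (sym (cancel (next< i<) j< (next-injective (trans (mirror-next (ℕ.≤-pred i<)) p))))
   locate′ : ∀ u → _ → _
   locate′ u (inj₁ (i , i< , q)) = inj₁ (m ∸ i , small i , trans (cong core (ℕ.m∸[m∸n]≡n (ℕ.≤-pred i<))) q)
   locate′ u (inj₂ (i , i< , bi , q)) = inj₂ (m ∸ i , small i , subst (λ z → b z ≡ true) (sym (ℕ.m∸[m∸n]≡n (ℕ.≤-pred i<))) bi , trans (cong leaf (ℕ.m∸[m∸n]≡n (ℕ.≤-pred i<))) q)

 private
   map-upFrom-cong : ∀ {b c : ℕ → Bool} k m → (∀ {i} → k ≤ i → i < k ℕ.+ m → b i ≡ c i) → map b (upFrom k m) ≡ map c (upFrom k m)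
   map-upFrom-cong k zero    p = refl
   map-upFrom-cong k (suc m) p = cong₂ _∷_ (p ℕ.≤-refl (ℕ.m<m+n k (s≤s z≤n)))
     (map-upFrom-cong (suc k) m (λ {i} l u → p (ℕ.<⇒≤ l) (subst (i <_) (sym (ℕ.+-suc k m)) u)))

   map-upFrom-injective : ∀ {b c : ℕ → Bool} k m → map b (upFrom k m) ≡ map c (upFrom k m) → ∀ {i} → k ≤ i → i < k ℕ.+ m → b i ≡ c i
   map-upFrom-injective k zero    p l u = contradiction (ℕ.<-≤-trans u (ℕ.≤-trans (ℕ.≤-reflexive (ℕ.+-identityʳ k)) l)) (ℕ.<-irrefl refl)
   map-upFrom-injective k (suc m) p {i} l u with k ℕ.≟ i
   ... | yes refl = List.∷-injectiveˡ p
   ... | no k≢i   = map-upFrom-injective (suc k) m (List.∷-injectiveʳ p) (ℕ.≤∧≢⇒< l k≢i) (subst (i <_) (ℕ.+-suc k m) u)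

   upFrom-∷ʳ : ∀ k m → upFrom k (suc m) ≡ upFrom k m ∷ʳ (k ℕ.+ m)
   upFrom-∷ʳ k zero    = cong (_∷ []) (sym (ℕ.+-identityʳ k))
   upFrom-∷ʳ k (suc m) = cong (k ∷_) (trans (upFrom-∷ʳ (suc k) m) (cong (upFrom (suc k) m ∷ʳ_) (sym (ℕ.+-suc k m))))

   map-shift : ∀ (b : ℕ → Bool) k m → map (b ∘ suc) (upFrom k m) ≡ map b (upFrom (suc k) m)
   map-shift b k zero    = refl
   map-shift b k (suc m) = cong (b (suc k) ∷_) (map-shift b (suc k) m)

   length-upFrom : ∀ (b : ℕ → Bool) k m → length (map b (upFrom k m)) ≡ m
   length-upFrom b k zero    = refl
   length-upFrom b k (suc m) = cong suc (length-upFrom b (suc k) m)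

   mirror-bits : ∀ (b : ℕ → Bool) m k → map (λ i → b ((m ℕ.+ k) ∸ i)) (upFrom k (suc m)) ≡ reverse (map b (upFrom 0 (suc m)))
   mirror-bits b zero k = cong (λ z → b z ∷ []) (ℕ.n∸n≡0 k)
   mirror-bits b (suc m) k = trans (cong₂ _∷_ (cong b (ℕ.m+n∸n≡m (suc m) k)) (trans (map-upFrom-cong (suc k) (suc m) (λ {i} _ _ → cong (λ z → b (z ∸ i)) (sym (ℕ.+-suc m k)))) (mirror-bits b m (suc k))))
     (trans (sym (List.reverse-++ (map b (upFrom 0 (suc m))) (b (suc m) ∷ []))) (cong reverse (trans (sym (List.map-++ b (upFrom 0 (suc m)) (suc m ∷ []))) (cong (map b) (sym (upFrom-∷ʳ 0 (suc m)))))))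

 -- Hides the labelling of the cycle. Its symmetries become operations on lists, and two graphs with
 -- the same list are isomorphic.
 record HasBits {n} (G : Graph n) (bs : List Bool) : Set where
   constructor hasBits
   field
     {ℓ}  : ℕ
     {b}  : ℕ → Bool
     sun  : Sun G ℓ b
     bits : map b (upFrom 0 ℓ) ≡ bs

 hasBits-length : ∀ {n} {G : Graph n} {bs} (s : HasBits G bs) → HasBits.ℓ s ≡ length bs
 hasBits-length (hasBits {ℓ} {b} s refl) = sym (length-upFrom b 0 ℓ)

 hasBits-unique : ∀ {n} {G H : Graph n} {bs} → HasBits G bs → HasBits H bs → G ≅ H
 hasBits-unique (hasBits {ℓ} {b} s p) (hasBits {ℓ′} {c} t r) with refl ← trans (sym (length-upFrom b 0 ℓ)) (trans (cong length (trans p (sym r))) (length-upFrom c 0 ℓ′))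
   = sun-unique s t (λ i< → map-upFrom-injective 0 ℓ (trans p (sym r)) z≤n i<)

 hasBits-rotate : ∀ {n} {G : Graph n} b bs → HasBits G (b ∷ bs) → HasBits G (bs ∷ʳ b)
 hasBits-rotate c bs (hasBits {suc m} {b} s refl) = hasBits (rotate s) (trans (cong (map (b ∘ next (suc m))) (upFrom-∷ʳ 0 m))
   (trans (List.map-++ (b ∘ next (suc m)) (upFrom 0 m) (m ∷ [])) (cong₂ _++_ (trans (map-upFrom-cong 0 m (λ _ u → cong b (next-suc (λ e → ℕ.<⇒≢ u (ℕ.suc-injective e))))) (map-shift b 0 m)) (cong (λ z → b z ∷ []) (next-wrap refl)))))

 hasBits-rotates : ∀ {n} {G : Graph n} bs cs → HasBits G (bs ++ cs) → HasBits G (cs ++ bs)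
 hasBits-rotates [] cs s = subst (HasBits _) (sym (List.++-identityʳ cs)) s
 hasBits-rotates (b ∷ bs) cs s = subst (HasBits _) (List.++-assoc cs (b ∷ []) bs)
   (hasBits-rotates bs (cs ∷ʳ b) (subst (HasBits _) (List.++-assoc bs cs (b ∷ [])) (hasBits-rotate b (bs ++ cs) s)))

 hasBits-reverse : ∀ {n} {G : Graph n} bs → HasBits G bs → HasBits G (reverse bs)
 hasBits-reverse bs (hasBits {zero} s refl) = hasBits s refl
 hasBits-reverse bs (hasBits {suc m} {b} s refl) = hasBits (mirror s) (trans (map-upFrom-cong 0 (suc m) (λ {i} _ _ → cong (λ z → b (z ∸ i)) (sym (ℕ.+-identityʳ m)))) (mirror-bits b m 0))

 hasBits-transport : ∀ {n} {G H : Graph n} {bs} → G ≅ H → HasBits G bs → HasBits H bs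
 hasBits-transport e (hasBits s p) = hasBits (sun-transport e s) p

 hasBits-order : ∀ {n} {G : Graph n} {bs} → 3 ≤ length bs → HasBits G bs → n ≡ trues bs ℕ.+ length bs
 hasBits-order 3≤ (hasBits {ℓ} {b} s refl) = trans (SunProps.order≡ s (subst (3 ≤_) (length-upFrom b 0 ℓ) 3≤)) (cong (trues (map b (upFrom 0 ℓ)) ℕ.+_) (sym (length-upFrom b 0 ℓ)))

 private
   module P = Power

 -- The power of 1 - q and the correction term depend only on the length of the cycle and the number
 -- of hubs, which are equal on both sides.
 hasBits-trace : ∀ {n} {G H : Graph n} gs gs′ → 3 ≤ length (bitsOf gs) → HasBits G (bitsOf gs) → HasBits H (bitsOf gs′) →
   length (bitsOf gs) ≡ length (bitsOf gs′) → trues (bitsOf gs) ≡ trues (bitsOf gs′) →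
   qDet G base P.q P.≈ qDet H base P.q → T𝕊.tr (word gs) P.≈ T𝕊.tr (word gs′)
 hasBits-trace {G = G} {H} gs gs′ 3≤ s t len tru e = begin
   T𝕊.tr (word gs) ≈⟨ T𝕊.tr-cong (T𝕊.≋-sym (product-eigen-bitsOf gs)) ⟩
   tr′ bs ≈⟨ expand bs ⟩
   (m ^ trues bs * T𝕊.cycleDet base q bs) + rest bs ≈⟨ 𝕊.+-cong (𝕊.*-cong (reflexive (cong (m ^_) tru)) (P.trans (P.sym (formula bs 3≤ s)) (P.trans e (formula bs′ (subst (3 ≤_) len 3≤) t))))
       (reflexive (cong₂ (λ l k → ι (+ 2) * (q ^ l * (m ^ k * (base - q) ^ k))) len tru)) ⟩
   (m ^ trues bs′ * T𝕊.cycleDet base q bs′) + rest bs′ ≈⟨ P.sym (expand bs′) ⟩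
   tr′ bs′ ≈⟨ T𝕊.tr-cong (product-eigen-bitsOf gs′) ⟩
   T𝕊.tr (word gs′) ∎
   where
   open P hiding (refl; sym; trans)
   open import Relation.Binary.Reasoning.Setoid P.setoid
   bs = bitsOf gs
   bs′ = bitsOf gs′
   m = 1# - q
   tr′ rest : List Bool → Carrier
   tr′ bs = T𝕊.tr (T𝕊.product eigen bs)
   rest bs = ι (+ 2) * (q ^ length bs * (m ^ trues bs * (base - q) ^ trues bs))
   expand : ∀ bs → tr′ bs ≈ (m ^ trues bs * T𝕊.cycleDet base q bs) + rest bs
   expand bs = P.trans (solve 2 (λ a r → a := (a :- r) :+ r) P.refl (tr′ bs) (rest bs)) (𝕊.+-congʳ (P.sym (cycleDet-eigen bs)))
   base₀ : coeff base 0 ≡ + 1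
   base₀ = trans (coeff-*-zero (1# + q) (1# + q)) (cong₂ ℤ._*_ o₀ o₀)
     where
     o₀ : coeff (1# + q) 0 ≡ + 1
     o₀ = trans (coeff-+ 1# q 0) (cong₂ ℤ._+_ coeff-1-zero coeff-q-zero)
   formula : ∀ {G} bs → 3 ≤ length bs → HasBits G bs → qDet G base q ≈ T𝕊.cycleDet base q bs
   formula {G} bs 3≤ (hasBits {ℓ} {b} s refl) = go ℓ s (subst (3 ≤_) (length-upFrom b 0 ℓ) 3≤)
     where
     go : ∀ ℓ → Sun G ℓ b → 3 ≤ ℓ → qDet G base q ≈ T𝕊.cycleDet base q (map b (upFrom 0 ℓ))
     go (suc zero) s (s≤s ())
     go (suc (suc m)) s 3≤ = SunProps.qDet≈cycleDet s 3≤ base q base₀ coeff-q-zero refl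

 module _ {n : ℕ} {G : Graph n} {ℓ : ℕ} {b : ℕ → Bool} (s : Sun G ℓ b) (3≤ℓ : 3 ≤ ℓ) where
   open Sun s
   open SunProps s 3≤ℓ
   open GraphOf G

   h-core : ∀ {i} → i < ℓ → h (core i) ≡ b2z (b i)
   h-core {i} i< = trans (cong (ℤ._- + 2) (d-core i<)) (cancel (b2z (b i)))
     where
     cancel : ∀ z → (+ 2 ℤ.+ z) ℤ.- + 2 ≡ z
     cancel = solve-∀

   h-leaf : ∀ {i} → i < ℓ → b i ≡ true → h (leaf i) ≡ -1ℤ
   h-leaf i< bi = cong (ℤ._- + 2) (d-leaf i< bi)

   private
     hs = hubs b 0 ℓ

     hub< : ∀ {k} → k ∈ hs → k < ℓ
     hub< k∈ = proj₁ (proj₂ (∈-hubs⁻ b 0 ℓ k∈))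

     hub-b : ∀ {k} → k ∈ hs → b k ≡ true
     hub-b k∈ = proj₂ (proj₂ (∈-hubs⁻ b 0 ℓ k∈))

     is : ℤ → Fin n → Bool
     is z u = choose (h u ℤ.≟ z) true false

     is-yes : ∀ {z u} → h u ≡ z → is z u ≡ true
     is-yes {z} {u} p with h u ℤ.≟ z
     ... | yes _ = refl
     ... | no q  = contradiction p q

     yes-is : ∀ {z u} → is z u ≡ true → h u ≡ z
     yes-is {z} {u} p with h u ℤ.≟ z
     yes-is p  | yes q = q
     yes-is () | no _

     kinds : ∀ u → (Σ ℕ λ i → i ∈ hs × core i ≡ u × h u ≡ + 1) ⊎ (Σ ℕ λ i → i ∈ hs × leaf i ≡ u × h u ≡ -1ℤ) ⊎ h u ≡ + 0
     kinds u with locate u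
     ... | inj₂ (i , i< , bi , refl) = inj₂ (inj₁ (i , ∈-hubs⁺ b 0 ℓ z≤n i< bi , refl , h-leaf i< bi))
     ... | inj₁ (i , i< , refl) with b i in bi
     ...   | true  = inj₁ (i , ∈-hubs⁺ b 0 ℓ z≤n i< bi , refl , trans (h-core i<) (cong b2z bi))
     ...   | false = inj₂ (inj₂ (trans (h-core i<) (cong b2z bi)))

     count-is : ∀ z (f : ℕ → Fin n) → (∀ {i j} → i ∈ hs → j ∈ hs → f i ≡ f j → i ≡ j) → (∀ u → h u ≡ z → u ∈ map f hs) → (∀ {i} → i ∈ hs → h (f i) ≡ z) →
       DZ.sum (λ u → b2z (is z u)) ≡ + trues bits
     count-is z f inj from at = trans (count-unique (is z) (map f hs) (unique-map f hs inj (hubs-unique b 0 ℓ)) (λ u p → from u (yes-is p)) into)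
       (cong +_ (trans (List.length-map f hs) (length-hubs b 0 ℓ)))
       where
       into : ∀ {u} → u ∈ map f hs → is z u ≡ true
       into u∈ with ∈-map⁻ f u∈
       ... | i , i∈ , refl = is-yes (at i∈)

     count-hubs : DZ.sum (λ u → b2z (is (+ 1) u)) ≡ + trues bits
     count-hubs = count-is (+ 1) core (λ i∈ j∈ → core-inj (hub< i∈) (hub< j∈)) from (λ i∈ → trans (h-core (hub< i∈)) (cong b2z (hub-b i∈)))
       where
       from : ∀ u → h u ≡ + 1 → u ∈ map core hs
       from u p with kinds u
       ... | inj₁ (i , i∈ , refl , _) = ∈-map⁺ core i∈
       ... | inj₂ (inj₁ (_ , _ , _ , q)) with () ← trans (sym p) q
       ... | inj₂ (inj₂ q) with () ← trans (sym p) q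

     count-leaves : DZ.sum (λ u → b2z (is -1ℤ u)) ≡ + trues bits
     count-leaves = count-is -1ℤ leaf (λ i∈ j∈ → leaf-inj (hub< i∈) (hub< j∈) (hub-b i∈) (hub-b j∈)) from (λ i∈ → h-leaf (hub< i∈) (hub-b i∈))
       where
       from : ∀ u → h u ≡ -1ℤ → u ∈ map leaf hs
       from u p with kinds u
       ... | inj₂ (inj₁ (i , i∈ , refl , _)) = ∈-map⁺ leaf i∈
       ... | inj₁ (_ , _ , _ , q) with () ← trans (sym p) q
       ... | inj₂ (inj₂ q) with () ← trans (sym p) q

     split : ∀ u → (h u ≡ -1ℤ ℤ.* b2z (is -1ℤ u) ℤ.+ b2z (is (+ 1) u)) × (h u ℤ.* h u ≡ b2z (is -1ℤ u) ℤ.+ b2z (is (+ 1) u))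
     split u with h u | kinds u
     ... | _ | inj₁ (_ , _ , _ , refl) = refl , refl
     ... | _ | inj₂ (inj₁ (_ , _ , _ , refl)) = refl , refl
     ... | _ | inj₂ (inj₂ refl) = refl , refl

   sum-h² : DZ.sum (λ u → h u ℤ.* h u) ≡ + (trues bits ℕ.+ trues bits)
   sum-h² = trans (DZ.sum-cong (λ u → proj₂ (split u))) (trans (DZ.sum-+ (λ u → b2z (is -1ℤ u)) (λ u → b2z (is (+ 1) u))) (cong₂ ℤ._+_ count-leaves count-hubs))

   sum-h≡0 : DZ.sum h ≡ + 0
   sum-h≡0 = trans (DZ.sum-cong (λ u → proj₁ (split u))) (trans (DZ.sum-+ (λ u → -1ℤ ℤ.* b2z (is -1ℤ u)) (λ u → b2z (is (+ 1) u)))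
     (trans (cong₂ ℤ._+_ (trans (DZ.sum-* -1ℤ (λ u → b2z (is -1ℤ u))) (cong (-1ℤ ℤ.*_) count-leaves)) count-hubs) (cancel (+ trues bits))))
     where
     cancel : ∀ z → -1ℤ ℤ.* z ℤ.+ z ≡ + 0
     cancel = solve-∀

 private
   sum-h²-cospectral : ∀ {n} {G H : Graph n} → QCospectral G H → DZ.sum (λ u → GraphOf.h G u ℤ.* GraphOf.h G u) ≡ DZ.sum (λ u → GraphOf.h H u ℤ.* GraphOf.h H u)
   sum-h²-cospectral {n} {G} {H} c = trans (eq G) (trans (cong₂ (λ x y → x ℤ.- y ℤ.- DZ.sum {n} (λ _ → + 2)) (cospectral-traces {G = G} {H} c 1) (cospectral-traces {G = G} {H} c 0)) (sym (eq H)))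
     where
     eq : ∀ (G : Graph n) → DZ.sum (λ u → GraphOf.h G u ℤ.* GraphOf.h G u) ≡ trace (power (GraphOf.M G) 2) ℤ.- trace (power (GraphOf.M G) 1) ℤ.- DZ.sum {n} (λ _ → + 2)
     eq G = sym (trans (cong₂ (λ x y → x ℤ.- y ℤ.- S₂) tr₂′ tr₁) (cancel (DZ.sum (λ u → h u ℤ.* h u)) (DZ.sum h) S₂))
       where
       open GraphOf G
       S₂ = DZ.sum {n} (λ _ → + 2)
       tr₂′ : trace (power M 2) ≡ DZ.sum (λ u → h u ℤ.* h u) ℤ.+ (DZ.sum h ℤ.+ S₂)
       tr₂′ = trans tr₂ (trans (DZ.sum-+ (λ u → h u ℤ.* h u) d) (cong (λ z → DZ.sum (λ u → h u ℤ.* h u) ℤ.+ z)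
         (trans (DZ.sum-cong (λ u → add-back (d u))) (DZ.sum-+ h (λ _ → + 2)))))
         where
         add-back : ∀ d → d ≡ (d ℤ.- + 2) ℤ.+ + 2
         add-back = solve-∀
       cancel : ∀ a c e → (a ℤ.+ (c ℤ.+ e)) ℤ.- c ℤ.- e ≡ a
       cancel = solve-∀

 -- As d = h + 2, the sum of the h² is a combination of the first two traces and the order. Each hub
 -- contributes 1 to it, and so does each leaf, so it is twice the number of hubs.
 cospectral-trues : ∀ {n} {G H : Graph n} {bs cs} → QCospectral G H → 3 ≤ length bs → 3 ≤ length cs → HasBits G bs → HasBits H cs → trues bs ≡ trues cs
 cospectral-trues {G = G} {H} c 3≤ 3≤′ (hasBits {ℓ} {b} s refl) (hasBits {ℓ′} {b′} t refl) = double-injective (ℤ.+-injective (trans (sym (sum-h² s (subst (3 ≤_) (length-upFrom b 0 ℓ) 3≤)))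
   (trans (sum-h²-cospectral {G = G} {H} c) (sum-h² t (subst (3 ≤_) (length-upFrom b′ 0 ℓ′) 3≤′)))))

-- Existence of suns with prescribed bits, and their tameness.

module SunConstruction where
 open BinaryForms using (module DZ)
 open Jacobi using (kron; kron-same)
 open SpectralMoments
 open LocalStructure using (Tame)
 open TransferMatrices using (trues)
 open Elimination using (head∉tail)
 open CycleElimination using (next; upFrom; hubs; ∈-hubs⁻; ∈-hubs⁺; hubs-unique; length-hubs)
 open SunGraphs
 open SunIsomorphism using (h-core; h-leaf; HasBits; hasBits)
 open import Data.Nat.Base using (_≤_; _<_)
 open import Data.Bool.Base using (_∨_; _∧_)
 import Data.Bool.Properties as Bool
 open import Data.Fin.Base using (zero; suc; toℕ; fromℕ<; _↑ˡ_; _↑ʳ_; splitAt; join)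
 open import Data.List.Base using (map; lookup)
 open import Data.List.Membership.Propositional.Properties using (∈-lookup)
 open import Data.List.Membership.DecPropositional ℕ._≟_ using (_∈?_)
 open import Data.List.Relation.Unary.Any using (index)
 open import Data.List.Relation.Unary.Any.Properties using (lookup-index)
 open import Data.List.Relation.Unary.All using ([]; _∷_)
 open import Data.List.Relation.Unary.AllPairs using ([]; _∷_)
 open import Data.List.Relation.Unary.Unique.Propositional using (Unique)
 open import Relation.Nullary.Decidable using (⌊_⌋)
 open ≡

 private
   lookup-injective : ∀ {xs : List ℕ} → Unique xs → ∀ i j → lookup xs i ≡ lookup xs j → i ≡ j
   lookup-injective (_ ∷ _) zero zero p = refl
   lookup-injective {x ∷ xs} u@(_ ∷ _) zero (suc j) p = contradiction (sym p) (head∉tail u (∈-lookup j))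
   lookup-injective {x ∷ xs} u@(_ ∷ _) (suc i) zero p = contradiction p (head∉tail u (∈-lookup i))
   lookup-injective (_ ∷ u) (suc i) (suc j) p = cong suc (lookup-injective u i j p)

   ⌊⌋-true : ∀ {P : Set} (d : Dec P) → ⌊ d ⌋ ≡ true → P
   ⌊⌋-true (yes p) _ = p

   true-⌊⌋ : ∀ {P : Set} (d : Dec P) → P → ⌊ d ⌋ ≡ true
   true-⌊⌋ (yes _) _ = refl
   true-⌊⌋ (no ¬p) p = contradiction p ¬p

   ∨-true : ∀ a c → a ∨ c ≡ true → (a ≡ true) ⊎ (c ≡ true)
   ∨-true true  c _ = inj₁ refl
   ∨-true false c p = inj₂ p

   ∧-true : ∀ a c → a ∧ c ≡ true → (a ≡ true) × (c ≡ true)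
   ∧-true true true _ = refl , refl

 module Construct (m : ℕ) (b : ℕ → Bool) (3≤ℓ : 3 ≤ suc m) where
   private
     ℓ = suc m
     hs = hubs b 0 ℓ
     N = length hs

     Position : Set
     Position = Fin N ⊎ Fin ℓ

     joined : Position → Position → Bool
     joined (inj₁ k) (inj₁ k′) = false
     joined (inj₁ k) (inj₂ i)  = ⌊ lookup hs k ℕ.≟ toℕ i ⌋
     joined (inj₂ i) (inj₁ k)  = ⌊ lookup hs k ℕ.≟ toℕ i ⌋
     joined (inj₂ i) (inj₂ j)  = ⌊ next ℓ (toℕ i) ℕ.≟ toℕ j ⌋ ∨ ⌊ next ℓ (toℕ j) ℕ.≟ toℕ i ⌋

     joined-sym : ∀ p r → joined p r ≡ joined r p
     joined-sym (inj₁ _) (inj₁ _) = refl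
     joined-sym (inj₁ _) (inj₂ _) = refl
     joined-sym (inj₂ _) (inj₁ _) = refl
     joined-sym (inj₂ i) (inj₂ j) = Bool.∨-comm ⌊ next ℓ (toℕ i) ℕ.≟ toℕ j ⌋ ⌊ next ℓ (toℕ j) ℕ.≟ toℕ i ⌋

     next≢ : ∀ {i} → i < ℓ → next ℓ i ≢ i
     next≢ i<ℓ = iterate≢ 0 i<ℓ (ℕ.≤-trans (s≤s (s≤s z≤n)) 3≤ℓ)

     joined-irrefl : ∀ p → joined p p ≡ false
     joined-irrefl (inj₁ _) = refl
     joined-irrefl (inj₂ i) with next ℓ (toℕ i) ℕ.≟ toℕ i
     ... | yes p = contradiction p (next≢ (Fin.toℕ<n i))
     ... | no _  = refl

   graph : Graph (N ℕ.+ ℓ)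
   graph = record
     { adj    = λ u w → joined (splitAt N u) (splitAt N w)
     ; sym    = λ u w → joined-sym (splitAt N u) (splitAt N w)
     ; irrefl = λ u → joined-irrefl (splitAt N u) }

   private
     fin : ℕ → Fin ℓ
     fin i with i ℕ.<? ℓ
     ... | yes p = fromℕ< p
     -- Labels are natural numbers, so those beyond the cycle need some value; `Sun` makes claims
     -- only about indices below ℓ.
     ... | no _  = zero

     toℕ-fin : ∀ {i} → i < ℓ → toℕ (fin i) ≡ i
     toℕ-fin {i} i<ℓ with i ℕ.<? ℓ
     ... | yes p = Fin.toℕ-fromℕ< p
     ... | no p  = contradiction i<ℓ p

     core leaf : ℕ → Fin (N ℕ.+ ℓ)
     core i = N ↑ʳ fin i
     leaf i with i ∈? hs
     ... | yes p = index p ↑ˡ ℓ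
     ... | no _  = core 0

     split-core : ∀ i → splitAt N (core i) ≡ inj₂ (fin i)
     split-core i = Fin.splitAt-↑ʳ N ℓ (fin i)

     split-leaf : ∀ {i} → i < ℓ → b i ≡ true → Σ (Fin N) λ k → splitAt N (leaf i) ≡ inj₁ k × lookup hs k ≡ i
     split-leaf {i} i<ℓ bi with i ∈? hs
     ... | yes p = index p , Fin.splitAt-↑ˡ N (index p) ℓ , sym (lookup-index p)
     ... | no p  = contradiction (∈-hubs⁺ b 0 ℓ z≤n i<ℓ bi) p

     inj₁≢inj₂ : ∀ {k : Fin N} {i : Fin ℓ} → _≢_ {A = Position} (inj₁ k) (inj₂ i)
     inj₁≢inj₂ ()

     inj₁-injective′ : ∀ {k k′ : Fin N} → _≡_ {A = Position} (inj₁ k) (inj₁ k′) → k ≡ k′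
     inj₁-injective′ refl = refl

     inj₂-injective′ : ∀ {i i′ : Fin ℓ} → _≡_ {A = Position} (inj₂ i) (inj₂ i′) → i ≡ i′
     inj₂-injective′ refl = refl

     core-inj : ∀ {i j} → i < ℓ → j < ℓ → core i ≡ core j → i ≡ j
     core-inj {i} {j} i< j< p = trans (sym (toℕ-fin i<)) (trans (cong toℕ (inj₂-injective′ (trans (sym (split-core i)) (trans (cong (splitAt N) p) (split-core j))))) (toℕ-fin j<))

     leaf-at : ∀ k → leaf (lookup hs k) ≡ k ↑ˡ ℓ
     leaf-at k with lookup hs k ∈? hs
     ... | yes p = cong (_↑ˡ ℓ) (lookup-injective (hubs-unique b 0 ℓ) (index p) k (sym (lookup-index p)))
     ... | no p  = contradiction (∈-lookup k) p

     adj-core : ∀ {i j} → i < ℓ → j < ℓ → adj graph (core i) (core j) ≡ (⌊ next ℓ i ℕ.≟ j ⌋ ∨ ⌊ next ℓ j ℕ.≟ i ⌋)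
     adj-core {i} {j} i< j< = trans (cong₂ joined (split-core i) (split-core j)) (cong₂ (λ x y → ⌊ next ℓ x ℕ.≟ y ⌋ ∨ ⌊ next ℓ y ℕ.≟ x ⌋) (toℕ-fin i<) (toℕ-fin j<))

   sun : Sun graph ℓ b
   sun = record
     { core = core ; leaf = leaf ; core-inj = core-inj
     ; leaf-inj = λ i< j< bi bj p → leaf-inj i< j< bi bj p
     ; core≢leaf = λ {i} {j} i< j< bj p → inj₁≢inj₂ (trans (sym (proj₁ (proj₂ (split-leaf j< bj)))) (trans (cong (splitAt N) (sym p)) (split-core i)))
     ; locate = locate
     ; core-next = λ {i} i< → trans (adj-core i< (next< i<)) (cong (_∨ ⌊ next ℓ (next ℓ i) ℕ.≟ i ⌋) (true-⌊⌋ (next ℓ i ℕ.≟ next ℓ i) refl))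
     ; core-core = λ {i} {j} i< j< a → nbr i< j< (∨-true ⌊ next ℓ i ℕ.≟ j ⌋ ⌊ next ℓ j ℕ.≟ i ⌋ (trans (sym (adj-core i< j<)) a))
     ; leaf-core = leaf-core
     ; leaf-only = leaf-only }
     where
     leaf-inj : ∀ {i j} → i < ℓ → j < ℓ → b i ≡ true → b j ≡ true → leaf i ≡ leaf j → i ≡ j
     leaf-inj i< j< bi bj p with split-leaf i< bi | split-leaf j< bj
     ... | k , e , l | k′ , e′ , l′ = trans (sym l) (trans (cong (lookup hs) (inj₁-injective′ (trans (sym e) (trans (cong (splitAt N) p) e′)))) l′)
     locate : ∀ u → (Σ ℕ λ i → i < ℓ × core i ≡ u) ⊎ (Σ ℕ λ i → i < ℓ × b i ≡ true × leaf i ≡ u)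
     locate u with splitAt N u in e
     ... | inj₂ i = inj₁ (toℕ i , Fin.toℕ<n i , trans (cong (N ↑ʳ_) (Fin.toℕ-injective (toℕ-fin (Fin.toℕ<n i)))) (trans (cong (join N ℓ) (sym e)) (Fin.join-splitAt N ℓ u)))
     ... | inj₁ k with ∈-hubs⁻ b 0 ℓ (∈-lookup {xs = hs} k)
     ...   | _ , k< , bk = inj₂ (lookup hs k , k< , bk , trans (leaf-at k) (trans (cong (join N ℓ) (sym e)) (Fin.join-splitAt N ℓ u)))
     nbr : ∀ {i j} → i < ℓ → j < ℓ → (⌊ next ℓ i ℕ.≟ j ⌋ ≡ true) ⊎ (⌊ next ℓ j ℕ.≟ i ⌋ ≡ true) → (j ≡ next ℓ i) ⊎ (i ≡ next ℓ j)
     nbr {i} {j} i< j< (inj₁ p) = inj₁ (sym (⌊⌋-true (next ℓ i ℕ.≟ j) p))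
     nbr {i} {j} i< j< (inj₂ p) = inj₂ (sym (⌊⌋-true (next ℓ j ℕ.≟ i) p))
     leaf-core : ∀ {i} → i < ℓ → b i ≡ true → adj graph (leaf i) (core i) ≡ true
     leaf-core {i} i< bi with split-leaf i< bi
     ... | k , e , l = trans (cong₂ joined e (split-core i)) (true-⌊⌋ (lookup hs k ℕ.≟ toℕ (fin i)) (trans l (sym (toℕ-fin i<))))
     leaf-only : ∀ {i u} → i < ℓ → b i ≡ true → adj graph (leaf i) u ≡ true → u ≡ core i
     leaf-only {i} {u} i< bi a with split-leaf i< bi | splitAt N u in e
     ... | k , e′ , l | inj₁ k′ with () ← trans (sym a) (cong (λ z → joined z (inj₁ k′)) e′)
     ... | k , e′ , l | inj₂ j = trans (sym (Fin.join-splitAt N ℓ u)) (trans (cong (join N ℓ) e) (cong (N ↑ʳ_) (Fin.toℕ-injective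
           (trans (sym (⌊⌋-true (lookup hs k ℕ.≟ toℕ j) (trans (cong (λ z → joined z (inj₂ j)) (sym e′)) a))) (trans l (sym (toℕ-fin i<)))))))

 nth : List Bool → ℕ → Bool
 nth []       i       = false
 nth (c ∷ cs) zero    = c
 nth (c ∷ cs) (suc i) = nth cs i

 map-nth : ∀ cs → map (nth cs) (upFrom 0 (length cs)) ≡ cs
 map-nth cs = go cs (nth cs) 0 (λ i → refl)
   where
   go : ∀ cs (b : ℕ → Bool) k → (∀ i → b (k ℕ.+ i) ≡ nth cs i) → map b (upFrom k (length cs)) ≡ cs
   go []       b k p = refl
   go (c ∷ cs) b k p = cong₂ _∷_ (trans (cong b (sym (ℕ.+-identityʳ k))) (p 0)) (go cs b (suc k) (λ i → trans (cong b (sym (ℕ.+-suc k i))) (p (suc i))))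

 construct : ∀ {n} bs → n ≡ trues bs ℕ.+ length bs → 3 ≤ length bs → Σ (Graph n) λ G → HasBits G bs
 construct bs@(c ∷ cs) refl 3≤ = go (length-hubs (nth bs) 0 (length bs)) (map-nth bs)
   where
   open Construct (length cs) (nth bs) 3≤
   go : ∀ {l} → length (hubs (nth bs) 0 (length bs)) ≡ trues l → l ≡ bs → Σ (Graph (trues bs ℕ.+ length bs)) λ G → HasBits G bs
   go p refl = subst (λ N → Σ (Graph (N ℕ.+ length bs)) λ G → HasBits G bs) p (graph , hasBits sun (map-nth bs))

 module _ {n : ℕ} {G : Graph n} {ℓ : ℕ} {b : ℕ → Bool} (s : Sun G ℓ b) (5≤ℓ : 5 ≤ ℓ) (apart : ∀ {i} → i < ℓ → b i ≡ true → b (next ℓ i) ≡ true → ⊥) where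
   private
     3≤ℓ : 3 ≤ ℓ
     3≤ℓ = ℕ.≤-trans (s≤s (s≤s (s≤s z≤n))) 5≤ℓ

   open Sun s
   open SunProps s 3≤ℓ using (adj-sym; core-leaf)
   open GraphOf G

   private
     no-loop : ∀ {u} → adj G u u ≡ true → ⊥
     no-loop {u} p with () ← trans (sym p) (Graph.irrefl G u)

     apart-iterate : ∀ k {i} → suc k < 5 → i < ℓ → iterate ℓ (suc k) i ≢ i
     apart-iterate k k< i< = iterate≢ k i< (ℕ.≤-trans k< 5≤ℓ)

     leaf-same : ∀ {i u w} → i < ℓ → b i ≡ true → adj G (leaf i) u ≡ true → adj G (leaf i) w ≡ true → u ≡ w
     leaf-same i< bi a c = trans (leaf-only i< bi a) (sym (leaf-only i< bi c))

     -- A leaf has one neighbour, so a triangle lies on the cycle. Two of the orientation patterns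
     -- go around in one direction and would give a return after three steps, impossible as ℓ ≥ 5;
     -- all others turn back.
     triangle : ∀ u w x → adj G u w ≡ true → adj G u x ≡ true → adj G x w ≡ true → ⊥
     triangle u w x a c e with locate u | locate w | locate x
     ... | inj₂ (i , i< , bi , refl) | _ | _ with refl ← leaf-same i< bi a c = no-loop e
     triangle u w x a c e | inj₁ _ | inj₂ (j , j< , bj , refl) | _ with refl ← leaf-same j< bj (adj-sym a) (adj-sym e) = no-loop c
     triangle u w x a c e | inj₁ _ | inj₁ _ | inj₂ (k , k< , bk , refl) with refl ← leaf-same k< bk (adj-sym c) e = no-loop a
     triangle u w x a c e | inj₁ (i , i< , refl) | inj₁ (j , j< , refl) | inj₁ (k , k< , refl) = go (core-core i< j< a) (core-core i< k< c) (core-core k< j< e)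
       where
       N = next ℓ
       loop : ∀ {i j} → i ≡ j → adj G (core i) (core j) ≡ true → ⊥
       loop refl = no-loop
       go : (j ≡ N i) ⊎ (i ≡ N j) → (k ≡ N i) ⊎ (i ≡ N k) → (j ≡ N k) ⊎ (k ≡ N j) → ⊥
       go (inj₁ p) (inj₁ r) _        = loop (trans r (sym p)) e
       go (inj₁ p) (inj₂ r) (inj₁ t) = loop (trans r (sym t)) a
       go (inj₁ p) (inj₂ r) (inj₂ t) = apart-iterate 2 (s≤s (s≤s (s≤s (s≤s z≤n)))) k< (sym (trans t (cong N (trans p (cong N r)))))
       go (inj₂ p) (inj₁ r) (inj₁ t) = apart-iterate 2 (s≤s (s≤s (s≤s (s≤s z≤n)))) j< (sym (trans t (cong N (trans r (cong N p)))))
       go (inj₂ p) (inj₁ r) (inj₂ t) = loop (trans p (sym t)) c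
       go (inj₂ p) (inj₂ r) _        = loop (next-injective (trans (sym r) p)) e

     -- The two patterns that go around in one direction would give a return after four steps; this
     -- is what ℓ ≥ 5 excludes. All others turn back at some vertex.
     square : ∀ u w x y → u ≢ w → adj G u x ≡ true → adj G x w ≡ true → adj G u y ≡ true → adj G y w ≡ true → x ≡ y
     square u w x y u≢w a c a′ c′ with locate u | locate w | locate x | locate y
     ... | inj₂ (i , i< , bi , refl) | _ | _ | _ = leaf-same i< bi a a′
     ... | inj₁ _ | inj₂ (j , j< , bj , refl) | _ | _ = leaf-same j< bj (adj-sym c) (adj-sym c′)
     ... | inj₁ _ | inj₁ _ | inj₂ (k , k< , bk , refl) | _ = contradiction (leaf-same k< bk (adj-sym a) c) u≢w
     ... | inj₁ _ | inj₁ _ | inj₁ _ | inj₂ (k , k< , bk , refl) = contradiction (leaf-same k< bk (adj-sym a′) c′) u≢w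
     ... | inj₁ (i , i< , refl) | inj₁ (j , j< , refl) | inj₁ (k , k< , refl) | inj₁ (m , m< , refl) =
       go (core-core i< k< a) (core-core k< j< c) (core-core i< m< a′) (core-core m< j< c′)
       where
       N = next ℓ
       go : (k ≡ N i) ⊎ (i ≡ N k) → (j ≡ N k) ⊎ (k ≡ N j) → (m ≡ N i) ⊎ (i ≡ N m) → (j ≡ N m) ⊎ (m ≡ N j) → core k ≡ core m
       go (inj₁ p) _        (inj₁ r) _        = cong core (trans p (sym r))
       go (inj₂ p) _        (inj₂ r) _        = cong core (next-injective (trans (sym p) r))
       go (inj₁ p) (inj₂ t) _        _        = contradiction (cong core (next-injective (trans (sym p) t))) u≢w
       go _        _        (inj₁ r) (inj₂ t) = contradiction (cong core (next-injective (trans (sym r) t))) u≢w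
       go _        (inj₁ p) (inj₂ r) (inj₁ t) = cong core (next-injective (trans (sym p) t))
       go (inj₁ p) (inj₁ t) (inj₂ r) (inj₂ z) = contradiction (sym (trans r (cong N (trans z (cong N (trans t (cong N p))))))) (apart-iterate 3 ℕ.≤-refl i<)
       go (inj₂ p) (inj₁ t) (inj₁ r) (inj₁ z) = cong core (next-injective (trans (sym t) z))
       go (inj₂ p) (inj₂ t) (inj₁ r) (inj₁ z) = contradiction (sym (trans p (cong N (trans t (cong N (trans z (cong N r))))))) (apart-iterate 3 ℕ.≤-refl i<)

     cube′ : ∀ u → h u ℤ.* h u ℤ.* h u ≡ h u
     cube′ u with locate u
     ... | inj₂ (i , i< , bi , refl) = trans (cong (λ z → z ℤ.* z ℤ.* z) (h-leaf s 3≤ℓ i< bi)) (sym (h-leaf s 3≤ℓ i< bi))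
     ... | inj₁ (i , i< , refl) = trans (cong (λ z → z ℤ.* z ℤ.* z) (h-core s 3≤ℓ i<)) (trans (bit (b i)) (sym (h-core s 3≤ℓ i<)))
       where
       bit : ∀ c → b2z c ℤ.* b2z c ℤ.* b2z c ≡ b2z c
       bit true  = refl
       bit false = refl

     both : Fin n → Fin n → Fin n → Bool
     both u w x = adj G u x ∧ adj G x w

     walks-both : ∀ u w → walks₂ u w ≡ DZ.sum (λ x → b2z (both u w x))
     walks-both u w = DZ.sum-cong (λ x → ∧-* (adj G u x) (adj G x w))
       where
       ∧-* : ∀ a c → b2z a ℤ.* b2z c ≡ b2z (a ∧ c)
       ∧-* true  true  = refl
       ∧-* true  false = refl
       ∧-* false true  = refl
       ∧-* false false = refl

     search : ∀ (f : Fin n → Bool) → (Σ (Fin n) λ x → f x ≡ true) ⊎ (∀ x → f x ≡ true → ⊥)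
     search f with Fin.any? (λ x → f x Bool.≟ true)
     ... | yes (x , p) = inj₁ (x , p)
     ... | no none     = inj₂ λ x p → none (x , p)

     walks-0 : ∀ u w → (∀ x → both u w x ≡ true → ⊥) → walks₂ u w ≡ + 0
     walks-0 u w none = trans (walks-both u w) (count-unique (both u w) [] [] (λ x p → ⊥-elim (none x p)) (λ ()))

     triangleFree′ : ∀ u w → A u w ℤ.* walks₂ u w ≡ + 0
     triangleFree′ u w with adj G u w in a
     ... | false = ℤ.*-zeroˡ (walks₂ u w)
     ... | true  = cong (+ 1 ℤ.*_) (walks-0 u w (λ x p → triangle u w x a (proj₁ (∧-true _ _ p)) (proj₂ (∧-true _ _ p))))

     paths′ : ∀ u w → pathDefect u w ≡ + 0
     paths′ u w with u Fin.≟ w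
     ... | yes refl = trans (cong (λ z → (+ 1 ℤ.- z) ℤ.* (walks₂ u u ℤ.* walks₂ u u ℤ.- walks₂ u u)) (kron-same u)) (ℤ.*-zeroˡ (walks₂ u u ℤ.* walks₂ u u ℤ.- walks₂ u u))
     ... | no u≢w with search (both u w)
     ...   | inj₂ none = trans (cong (λ z → K ℤ.* (z ℤ.* z ℤ.- z)) (walks-0 u w none)) (ℤ.*-zeroʳ K)
       where K = + 1 ℤ.- kron u w
     ...   | inj₁ (x , p) = trans (cong (λ z → K ℤ.* (z ℤ.* z ℤ.- z)) (trans (walks-both u w) (count-unique (both u w) (x ∷ []) ([] ∷ []) only (λ { (here refl) → p })))) (ℤ.*-zeroʳ K)
       where
       K = + 1 ℤ.- kron u w
       only : ∀ y → both u w y ≡ true → y ∈ x ∷ []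
       only y r = here (square u w y x u≢w (proj₁ (∧-true _ _ r)) (proj₂ (∧-true _ _ r)) (proj₁ (∧-true _ _ p)) (proj₂ (∧-true _ _ p)))

     Edge : ℤ → ℤ → ℤ
     Edge x y = + 2 ℤ.* (x ℤ.* y) ℤ.+ (x ℤ.* x ℤ.- x) ℤ.+ (y ℤ.* y ℤ.- y)

     core-edge : ∀ {i} → i < ℓ → Edge (h (core i)) (h (core (next ℓ i))) ≡ + 0 × Edge (h (core (next ℓ i))) (h (core i)) ≡ + 0
     core-edge {i} i< = bits (b i) (b (next ℓ i)) refl refl
       where
       bits : ∀ x y → b i ≡ x → b (next ℓ i) ≡ y → Edge (h (core i)) (h (core (next ℓ i))) ≡ + 0 × Edge (h (core (next ℓ i))) (h (core i)) ≡ + 0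
       bits true true p r = ⊥-elim (apart i< p r)
       bits true false p r = cong₂ Edge (trans (h-core s 3≤ℓ i<) (cong b2z p)) (trans (h-core s 3≤ℓ (next< i<)) (cong b2z r)) , cong₂ Edge (trans (h-core s 3≤ℓ (next< i<)) (cong b2z r)) (trans (h-core s 3≤ℓ i<) (cong b2z p))
       bits false true p r = cong₂ Edge (trans (h-core s 3≤ℓ i<) (cong b2z p)) (trans (h-core s 3≤ℓ (next< i<)) (cong b2z r)) , cong₂ Edge (trans (h-core s 3≤ℓ (next< i<)) (cong b2z r)) (trans (h-core s 3≤ℓ i<) (cong b2z p))
       bits false false p r = cong₂ Edge (trans (h-core s 3≤ℓ i<) (cong b2z p)) (trans (h-core s 3≤ℓ (next< i<)) (cong b2z r)) , cong₂ Edge (trans (h-core s 3≤ℓ (next< i<)) (cong b2z r)) (trans (h-core s 3≤ℓ i<) (cong b2z p))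

     edge : ∀ u w → adj G u w ≡ true → Edge (h u) (h w) ≡ + 0
     edge u w a with locate u | locate w
     ... | inj₁ (i , i< , refl) | inj₁ (j , j< , refl) with core-core i< j< a
     ...   | inj₁ refl = proj₁ (core-edge i<)
     ...   | inj₂ refl = proj₂ (core-edge j<)
     edge u w a | inj₁ (i , i< , refl) | inj₂ (j , j< , bj , refl) with refl ← core-leaf i< j< bj a = cong₂ Edge (trans (h-core s 3≤ℓ i<) (cong b2z bj)) (h-leaf s 3≤ℓ j< bj)
     edge u w a | inj₂ (i , i< , bi , refl) | inj₁ (j , j< , refl) with refl ← core-leaf j< i< bi (adj-sym a) = cong₂ Edge (h-leaf s 3≤ℓ i< bi) (trans (h-core s 3≤ℓ j<) (cong b2z bi))
     edge u w a | inj₂ (i , i< , bi , refl) | inj₂ (j , j< , bj , refl) = ⊥-elim (core≢leaf i< j< bj (sym (leaf-only i< bi a)))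

     edges′ : ∀ u w → edgeDefect u w ≡ + 0
     edges′ u w with adj G u w in a
     ... | true  = cong (+ 1 ℤ.*_) (edge u w a)
     ... | false = ℤ.*-zeroˡ (Edge (h u) (h w))

   tame : Tame G
   tame = record { cube = cube′ ; triangleFree = triangleFree′ ; edges = edges′ ; paths = paths′ }

-- Combinatorics of gap lists.

module GapLists where
 open TransferMatrices using (trues)
 open LeadingCoefficients using (bitsOf)
 open GapWords using (count; double)
 open Decode using (degree; gapSum)
 open CycleElimination using (upFrom)
 open import Data.Nat.Base using (_+_; _*_; _≤_; _<_)
 open import Data.Nat.Tactic.RingSolver using (solve-∀)
 open import Data.List.Base using (replicate; reverse; map; _∷ʳ_)
 open import Data.List.Relation.Unary.All as All using (All; []; _∷_)
 open import Data.Unit.Base using (⊤; tt)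
 open ≡

 bitsOf-++ : ∀ us vs → bitsOf (us ++ vs) ≡ bitsOf us ++ bitsOf vs
 bitsOf-++ []       vs = refl
 bitsOf-++ (g ∷ us) vs = cong (true ∷_) (trans (cong (replicate g false ++_) (bitsOf-++ us vs)) (sym (List.++-assoc (replicate g false) (bitsOf us) (bitsOf vs))))

 trues-false : ∀ g bs → trues (replicate g false ++ bs) ≡ trues bs
 trues-false zero    bs = refl
 trues-false (suc g) bs = trues-false g bs

 trues-bitsOf : ∀ gs → trues (bitsOf gs) ≡ length gs
 trues-bitsOf []       = refl
 trues-bitsOf (g ∷ gs) = cong suc (trans (trues-false g (bitsOf gs)) (trues-bitsOf gs))

 length-bitsOf-∷ : ∀ g gs → length (bitsOf (g ∷ gs)) ≡ suc g + length (bitsOf gs)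
 length-bitsOf-∷ g gs = cong suc (trans (List.length-++ (replicate g false)) (cong (_+ length (bitsOf gs)) (List.length-replicate g)))

 length≤bits : ∀ gs → length gs ≤ length (bitsOf gs)
 length≤bits []       = z≤n
 length≤bits (g ∷ gs) = subst (suc (length gs) ≤_) (sym (length-bitsOf-∷ g gs)) (s≤s (ℕ.≤-trans (length≤bits gs) (ℕ.m≤n+m _ g)))

 gapSum-bits : ∀ gs → gapSum gs ≡ length (bitsOf gs) + length (bitsOf gs)
 gapSum-bits []       = refl
 gapSum-bits (g ∷ gs) = trans (cong (λ z → double g + z) (gapSum-bits gs)) (trans (rearrange (suc g) (length (bitsOf gs))) (sym (cong₂ _+_ (length-bitsOf-∷ g gs) (length-bitsOf-∷ g gs))))
   where
   rearrange : ∀ a b → (a + a) + (b + b) ≡ (a + b) + (a + b)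
   rearrange = solve-∀

 gapSum-++ : ∀ us vs → gapSum (us ++ vs) ≡ gapSum us + gapSum vs
 gapSum-++ []       vs = refl
 gapSum-++ (g ∷ us) vs = trans (cong (λ z → double g + z) (gapSum-++ us vs)) (sym (ℕ.+-assoc (double g) (gapSum us) (gapSum vs)))

 degree-gapSum : ∀ us → degree us ≡ 3 + (3 * length us + gapSum us)
 degree-gapSum []       = refl
 degree-gapSum (g ∷ us) = trans (cong (λ z → 3 + (double g + z)) (degree-gapSum us)) (rearrange (double g) (length us) (gapSum us))
   where
   rearrange : ∀ d l s → 3 + (d + (3 + (3 * l + s))) ≡ 3 + (3 * suc l + (d + s))
   rearrange = solve-∀

 -- The run of m false bits at the front is the gap of a hub placed before it: a bit list rotated to
 -- start with a hub becomes a gap list.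
 parse : ∀ bs → Σ ℕ λ m → Σ (List ℕ) λ gs → bs ≡ replicate m false ++ bitsOf gs
 parse [] = 0 , [] , refl
 parse (true ∷ bs) with parse bs
 ... | m , gs , refl = 0 , m ∷ gs , refl
 parse (false ∷ bs) with parse bs
 ... | m , gs , refl = suc m , gs , refl

 firstTrue : ∀ bs → 1 ≤ trues bs → Σ (List Bool) λ xs → Σ (List Bool) λ ys → bs ≡ xs ++ true ∷ ys
 firstTrue (true ∷ bs)  _ = [] , bs , refl
 firstTrue (false ∷ bs) p with firstTrue bs p
 ... | xs , ys , refl = false ∷ xs , ys , refl

 -- A gap follows its hub, but precedes it after reversal. One more hub bounds the last run on its
 -- other side, so that both readings coincide.
 true∷reverse-bitsOf : ∀ gs → true ∷ reverse (bitsOf gs) ≡ bitsOf (reverse gs) ∷ʳ true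
 true∷reverse-bitsOf [] = refl
 true∷reverse-bitsOf (g ∷ gs) = begin
   true ∷ reverse (true ∷ F ++ bitsOf gs) ≡⟨ cong (true ∷_) (List.unfold-reverse true (F ++ bitsOf gs)) ⟩
   true ∷ reverse (F ++ bitsOf gs) ∷ʳ true ≡⟨ cong (λ z → true ∷ z ∷ʳ true) (List.reverse-++ F (bitsOf gs)) ⟩
   ((true ∷ reverse (bitsOf gs)) ++ reverse F) ∷ʳ true ≡⟨ cong₂ (λ y z → (y ++ z) ∷ʳ true) (true∷reverse-bitsOf gs) (reverse-replicate g) ⟩
   ((bitsOf (reverse gs) ∷ʳ true) ++ F) ∷ʳ true ≡⟨ cong (_∷ʳ true) (trans (List.++-assoc (bitsOf (reverse gs)) (true ∷ []) F) (cong (λ z → bitsOf (reverse gs) ++ true ∷ z) (sym (List.++-identityʳ F)))) ⟩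
   (bitsOf (reverse gs) ++ bitsOf (g ∷ [])) ∷ʳ true ≡⟨ cong (_∷ʳ true) (bitsOf-++ (reverse gs) (g ∷ [])) ⟨
   bitsOf (reverse gs ++ g ∷ []) ∷ʳ true ≡⟨ cong (λ z → bitsOf z ∷ʳ true) (List.unfold-reverse g gs) ⟨
   bitsOf (reverse (g ∷ gs)) ∷ʳ true ∎
   where
   open ≡-Reasoning
   F = replicate g false
   replicate-∷ʳ : ∀ k → replicate k false ∷ʳ false ≡ false ∷ replicate k false
   replicate-∷ʳ zero    = refl
   replicate-∷ʳ (suc k) = cong (false ∷_) (replicate-∷ʳ k)
   reverse-replicate : ∀ k → reverse (replicate k false) ≡ replicate k false
   reverse-replicate zero    = refl
   reverse-replicate (suc k) = trans (List.unfold-reverse false (replicate k false)) (trans (cong (_∷ʳ false) (reverse-replicate k)) (replicate-∷ʳ k))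

 -- Every true is followed by a false, so that no two are cyclically adjacent.
 Apart : List Bool → Set
 Apart []                 = ⊤
 Apart (false ∷ bs)       = Apart bs
 Apart (true ∷ [])        = ⊥
 Apart (true ∷ true ∷ bs) = ⊥
 Apart (true ∷ false ∷ bs) = Apart bs

 bitsOf-apart : ∀ {gs} → All (1 ≤_) gs → Apart (bitsOf gs)
 bitsOf-apart [] = tt
 bitsOf-apart {suc g ∷ gs} (s≤s _ ∷ ps) = falses g
   where
   falses : ∀ k → Apart (replicate k false ++ bitsOf gs)
   falses zero    = bitsOf-apart ps
   falses (suc k) = falses k

 private
   apart-tail : ∀ c bs → Apart (c ∷ bs) → Apart bs
   apart-tail false bs          a = a
   apart-tail true  (false ∷ _) a = a

   apart-head : ∀ bs → Apart (true ∷ bs) → Σ (List Bool) λ cs → bs ≡ false ∷ cs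
   apart-head (false ∷ cs) _ = cs , refl

 apart-follow : ∀ (b : ℕ → Bool) k m → Apart (map b (upFrom k m)) → ∀ {i} → k ≤ i → i < k + m → b i ≡ true → suc i < k + m × b (suc i) ≡ false
 apart-follow b k zero    a k≤i i< bi = contradiction (ℕ.<-≤-trans i< (ℕ.≤-trans (ℕ.≤-reflexive (ℕ.+-identityʳ k)) k≤i)) (ℕ.<-irrefl refl)
 apart-follow b k (suc m) a {i} k≤i i< bi with k ℕ.≟ i
 ... | no k≢i = let l , f = apart-follow b (suc k) m (apart-tail (b k) (map b (upFrom (suc k) m)) a) (ℕ.≤∧≢⇒< k≤i k≢i) (subst (i <_) (ℕ.+-suc k m) i<) bi
                in subst (suc i <_) (sym (ℕ.+-suc k m)) l , f
 ... | yes refl = at m (apart-head (map b (upFrom (suc k) m)) (subst (λ c → Apart (c ∷ map b (upFrom (suc k) m))) bi a))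
   where
   at : ∀ m → Σ (List Bool) (λ cs → map b (upFrom (suc k) m) ≡ false ∷ cs) → suc k < k + suc m × b (suc k) ≡ false
   at (suc m) (_ , p) = subst (suc k <_) (sym (trans (ℕ.+-suc k (suc m)) (cong suc (ℕ.+-suc k m)))) (s≤s (s≤s (ℕ.m≤m+n k m))) , List.∷-injectiveˡ p

 count-≢ : ∀ {j h} hs → h ≢ j → count j (h ∷ hs) ≡ count j hs
 count-≢ {j} {h} hs p with h ℕ.≟ j
 ... | yes q = contradiction q p
 ... | no _  = refl

 count-++ : ∀ j us vs → count j (us ++ vs) ≡ count j us + count j vs
 count-++ j []       vs = refl
 count-++ j (h ∷ us) vs with h ℕ.≟ j
 ... | yes _ = cong suc (count-++ j us vs)
 ... | no _  = count-++ j us vs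

 -- The step by which counting improves a lower bound on all gaps.
 raise : ∀ {j gs} → All (j ≤_) gs → count j gs ≡ 0 → All (suc j ≤_) gs
 raise [] _ = []
 raise {j} {g ∷ gs} (p ∷ ps) c with g ℕ.≟ j
 raise {j} {g ∷ gs} (p ∷ ps) () | yes _
 raise {j} {g ∷ gs} (p ∷ ps) c  | no g≢j = ℕ.≤∧≢⇒< p (g≢j ∘ sym) ∷ raise ps c

 count-below : ∀ {j gs} → All (suc j ≤_) gs → count j gs ≡ 0
 count-below [] = refl
 count-below {j} {g ∷ gs} (p ∷ ps) = trans (count-≢ gs (ℕ.<⇒≢ p ∘ sym)) (count-below ps)

 Letter : ℕ → Set
 Letter g = (g ≡ 3) ⊎ (g ≡ 4)

 letters : List ℕ → ℕ
 letters gs = count 3 gs + count 4 gs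

 private
   letters-4 : ∀ gs → letters (4 ∷ gs) ≡ suc (letters gs)
   letters-4 gs = ℕ.+-suc (count 3 gs) (count 4 gs)

   letters-other : ∀ {g} gs → g ≢ 3 → g ≢ 4 → letters (g ∷ gs) ≡ letters gs
   letters-other gs p r = cong₂ _+_ (count-≢ gs p) (count-≢ gs r)

 letters≤length : ∀ gs → letters gs ≤ length gs
 letters≤length [] = z≤n
 letters≤length (g ∷ gs) with g ℕ.≟ 3 | g ℕ.≟ 4
 ... | yes refl | no _  = s≤s (letters≤length gs)
 ... | no _  | yes refl = subst (_≤ suc (length gs)) (sym (letters-4 gs)) (s≤s (letters≤length gs))
 ... | no _  | no _     = ℕ.m≤n⇒m≤1+n (letters≤length gs)

 -- The coefficients 8 and 10 are `double 3` and `double 4`. So the counts of the two letters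
 -- determine all data that `decode` compares.
 letters-all : ∀ gs → All Letter gs → length gs ≡ letters gs × gapSum gs ≡ 8 * count 3 gs + 10 * count 4 gs
 letters-all [] [] = refl , refl
 letters-all (_ ∷ gs) (inj₁ refl ∷ ps) = let l , s = letters-all gs ps in cong suc l , trans (cong (λ z → 8 + z) s) (rearrange (count 3 gs) (count 4 gs))
   where
   rearrange : ∀ a b → 8 + (8 * a + 10 * b) ≡ 8 * suc a + 10 * b
   rearrange = solve-∀
 letters-all (_ ∷ gs) (inj₂ refl ∷ ps) = let l , s = letters-all gs ps in trans (cong suc l) (sym (letters-4 gs)) , trans (cong (λ z → 10 + z) s) (rearrange (count 3 gs) (count 4 gs))
   where
   rearrange : ∀ a b → 10 + (8 * a + 10 * b) ≡ 8 * a + 10 * suc b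
   rearrange = solve-∀

 all-letters : ∀ gs → letters gs ≡ length gs → All Letter gs
 all-letters [] _ = []
 all-letters (g ∷ gs) p with g ℕ.≟ 3 | g ℕ.≟ 4
 ... | yes refl | no _  = inj₁ refl ∷ all-letters gs (ℕ.suc-injective p)
 ... | no _  | yes refl = inj₂ refl ∷ all-letters gs (ℕ.suc-injective (trans (sym (letters-4 gs)) p))
 ... | no _  | no _     = contradiction (letters≤length gs) (ℕ.<⇒≱ (ℕ.≤-reflexive (sym p)))

 -- A splitting at the first gap that is not a letter, with k further such gaps behind it; two
 -- applications isolate the two long gaps.
 Peeled : ℕ → List ℕ → Set
 Peeled k gs = Σ (List ℕ) λ us → Σ ℕ λ M → Σ (List ℕ) λ vs → gs ≡ us ++ M ∷ vs × All Letter us × M ≢ 3 × M ≢ 4 × letters vs + k ≡ length vs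

 peel : ∀ k gs → letters gs + suc k ≡ length gs → Peeled k gs
 peel k (g ∷ gs) p = go (g ℕ.≟ 3) (g ℕ.≟ 4)
   where
   add : Letter g → Peeled k gs → Peeled k (g ∷ gs)
   add l (us , M , vs , refl , a , r) = g ∷ us , M , vs , refl , l ∷ a , r
   go : Dec (g ≡ 3) → Dec (g ≡ 4) → Peeled k (g ∷ gs)
   go (yes refl) _ = add (inj₁ refl) (peel k gs (ℕ.suc-injective p))
   go (no _) (yes refl) = add (inj₂ refl) (peel k gs (ℕ.suc-injective (trans (cong (_+ suc k) (sym (letters-4 gs))) p)))
   go (no p₃) (no p₄) = [] , g , gs , refl , [] , p₃ , p₄ , ℕ.suc-injective (trans (sym (ℕ.+-suc (letters gs) k)) (trans (cong (_+ suc k) (sym (letters-other gs p₃ p₄))) p))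

-- Every cospectral mate of a suitable sun is a sun.

module Recognition where
 open SpectralMoments
 open LocalStructure using (cospectral-cube; cospectral-edges; cospectral-sum-h; disconnected⇒8∣det; twinLeaves⇒charPoly-1≡0)
 open CycleElimination using (next; upFrom)
 open SunGraphs
 open LeadingCoefficients
 open CoreWalk using (Sunlike; module Walk)
 open SunIsomorphism
 open SunConstruction using (tame)
 open GapLists using (bitsOf-apart; apart-follow; Apart)
 open import Data.Nat.Base using (_≤_; _<_)
 open import Data.List.Base using (map)
 open import Data.List.Relation.Unary.All using (All)
 open import Relation.Nullary.Decidable using (⌊_⌋)
 open ≡

 -- `long` excludes triangles and squares, `positive` adjacent hubs, `odd` a determinant divisible
 -- by 8, and `residues` the eigenvalue 1.
 record Wide (gs : List ℕ) : Set where
   field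
     nonempty : 1 ≤ length gs
     long     : 5 ≤ length (bitsOf gs)
     positive : All (1 ≤_) gs
     half     : ℕ
     odd      : length (bitsOf gs) ≡ suc (half ℕ.+ half)
     residues : ∀ {x} → x ∈ gs → Not≡2mod3 x

 module _ {n : ℕ} {G H : Graph n} {gs : List ℕ} (s : HasBits G (bitsOf gs)) (wide : Wide gs) (c : QCospectral G H) where
   private
     open HasBits s
     open Wide wide

     5≤ℓ : 5 ≤ ℓ
     5≤ℓ = subst (5 ≤_) (sym (hasBits-length s)) long

     3≤ℓ : 3 ≤ ℓ
     3≤ℓ = ℕ.≤-trans (s≤s (s≤s (s≤s z≤n))) 5≤ℓ

     apart : ∀ {i} → i < ℓ → b i ≡ true → b (next ℓ i) ≡ true → ⊥
     apart {i} i< bi bn = case (trans (sym bn) (trans (cong b (next-suc (ℕ.<⇒≢ (proj₁ follow)))) (proj₂ follow)))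
       where
       follow = apart-follow b 0 ℓ (subst Apart (sym bits) (bitsOf-apart positive)) z≤n i< bi
       case : true ≢ false
       case ()

     charPoly-H : ∀ x → charPoly (signlessLaplacian H) x ≡ Tℤ.cycleDet x (+ 1) (bitsOf gs)
     charPoly-H x = trans (sym (c x)) (trans (charPoly≡cycleDet sun 3≤ℓ x) (cong (Tℤ.cycleDet x (+ 1)) bits))

     charPoly-1 : charPoly (signlessLaplacian H) (+ 1) ≢ + 0
     charPoly-1 p = go gs nonempty residues (trans (sym (charPoly-H (+ 1))) p)
       where
       go : ∀ gs → 1 ≤ length gs → (∀ {x} → x ∈ gs → Not≡2mod3 x) → Tℤ.cycleDet (+ 1) (+ 1) (bitsOf gs) ≢ + 0
       go (g ∷ gs) _ = cycleDet-1≢0 g gs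

     connected : ∀ (S : Fin n → Bool) → (∀ i j → adj H i j ≡ true → S i ≡ S j) → ∀ r r′ → S r ≡ true → S r′ ≡ false → ⊥
     connected S closed r r′ p p′ = let X , e = disconnected⇒8∣det H S closed r r′ p p′ in cycleDet-0≢8X (bitsOf gs) half odd X (trans (sym (charPoly-H (+ 0))) e)

     module H = GraphOf H

     another : ∀ i → Σ (Fin n) λ r → r ≢ i
     another i with Sun.core sun 0 Fin.≟ i
     ... | no p = Sun.core sun 0 , p
     ... | yes refl = Sun.core sun 1 , λ e → 1≢0 (Sun.core-inj sun (ℕ.≤-trans (s≤s (s≤s z≤n)) 3≤ℓ) (ℕ.≤-trans (s≤s z≤n) 3≤ℓ) e)
       where
       1≢0 : 1 ≢ 0
       1≢0 ()

     -- An isolated vertex is a component of its own, and a second vertex exists, so the determinant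
     -- argument applies. It uses no traces and may thus precede them.
     noIsolated : ∀ i → H.d i ≢ + 0
     noIsolated i di = connected (λ u → ⌊ u Fin.≟ i ⌋) closed i (proj₁ (another i)) (isI i refl) (notI (proj₂ (another i)))
       where
       isI : ∀ u → u ≡ i → ⌊ u Fin.≟ i ⌋ ≡ true
       isI u p with u Fin.≟ i
       ... | yes _ = refl
       ... | no q  = contradiction p q
       notI : ∀ {u} → u ≢ i → ⌊ u Fin.≟ i ⌋ ≡ false
       notI {u} p with u Fin.≟ i
       ... | yes q = contradiction q p
       ... | no _  = refl
       none : ∀ w → adj H i w ≡ true → ⊥
       none w p with () ← trans (sym (sum-nonneg-zero (H.A i) (H.A-nonneg i) di w)) (cong b2z p)
       closed : ∀ u w → adj H u w ≡ true → ⌊ u Fin.≟ i ⌋ ≡ ⌊ w Fin.≟ i ⌋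
       closed u w a = trans (notI λ { refl → none w a }) (sym (notI λ { refl → none u (trans (Graph.sym H w u) a) }))

     sunlike : Sunlike H
     sunlike = record
       { cube = cospectral-cube {G = G} {H} c tm noIsolated ; edges = cospectral-edges {G = G} {H} c tm noIsolated
       ; sum-h = trans (sym (cospectral-sum-h {G = G} {H} c)) (sum-h≡0 sun 3≤ℓ)
       ; noTwins = λ u≢v du dv uw vw → charPoly-1 (twinLeaves⇒charPoly-1≡0 H u≢v du dv uw vw)
       ; connected = connected }
       where
       tm = tame sun 5≤ℓ apart

   cospectral-hasBits : Σ (List Bool) λ bs → 3 ≤ length bs × HasBits H bs
   cospectral-hasBits = let ℓ′ , 3≤ , b′ , sun′ , _ = Walk.sunlike⇒sun H sunlike (Sun.core sun 0) in
     map b′ (upFrom 0 ℓ′) , subst (3 ≤_) (hasBits-length (hasBits sun′ refl)) 3≤ , hasBits sun′ refl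

   cospectral-apart : ∀ {bs} → 3 ≤ suc (suc (length bs)) → HasBits H (true ∷ true ∷ bs) → ⊥
   cospectral-apart {bs} 3≤ t = go (HasBits.sun t) (HasBits.bits t) (subst (3 ≤_) (sym (hasBits-length t)) 3≤)
     where
     go : ∀ {ℓ b} → Sun H ℓ b → map b (upFrom 0 ℓ) ≡ true ∷ true ∷ bs → 3 ≤ ℓ → ⊥
     go {ℓ} {b} sun′ p (s≤s (s≤s (s≤s _))) = Walk.hubs-apart H sunlike (hub 0 (s≤s z≤n) (List.∷-injectiveˡ p)) (hub 1 (s≤s (s≤s z≤n)) (List.∷-injectiveˡ (List.∷-injectiveʳ p)))
       (Sun.core-next sun′ (s≤s z≤n))
       where
       hub : ∀ i → i < ℓ → b i ≡ true → H.d (Sun.core sun′ i) ≡ + 3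
       hub i i< bi = trans (SunProps.d-core sun′ (s≤s (s≤s (s≤s z≤n))) i<) (cong (λ z → + 2 ℤ.+ b2z z) bi)

-- Recovery of the gap list from the spectrum.

module Reconstructions where
 open PowerSeries using (module Power)
 open LocalStructure using (qDet-cospectral)
 open TransferMatrices using (trues)
 open CycleElimination using (module T𝕊)
 open LeadingCoefficients
 open GapWords using (count; double; double-injective; word; base; module Expansion)
 open Decode using (degree; gapSum; decode)
 open SunIsomorphism
 open GapLists
 open Recognition
 open import Data.Nat.Base using (_+_; _*_; _≤_; _<_)
 open import Data.Nat.Tactic.RingSolver using (solve-∀)
 open import Data.List.Base using (replicate; reverse; _∷ʳ_)
 open import Data.List.Relation.Unary.All as All using (All; []; _∷_)
 import Data.List.Relation.Unary.All.Properties as All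
 open import Data.List.Membership.Propositional.Properties using (∈-++⁻; ∈-∃++)
 open ≡

 rotateGaps : ∀ {n} {G : Graph n} us vs → HasBits G (bitsOf (us ++ vs)) → HasBits G (bitsOf (vs ++ us))
 rotateGaps us vs s = subst (HasBits _) (sym (bitsOf-++ vs us)) (hasBits-rotates (bitsOf us) (bitsOf vs) (subst (HasBits _) (bitsOf-++ us vs) s))

 reverseGaps : ∀ {n} {G : Graph n} gs → HasBits G (bitsOf gs) → HasBits G (bitsOf (reverse gs))
 reverseGaps [] s = s
 reverseGaps gs@(g ∷ gs′) s = subst (HasBits _) (List.∷ʳ-injectiveˡ (true ∷ reverse X) (bitsOf (reverse gs)) (trans (cong (true ∷_) (sym unfold)) (true∷reverse-bitsOf gs)))
   (hasBits-rotates (reverse X) (true ∷ []) (subst (HasBits _) unfold (hasBits-reverse (bitsOf gs) s)))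
   where
   X = replicate g false ++ bitsOf gs′
   unfold : reverse (bitsOf gs) ≡ reverse X ∷ʳ true
   unfold = List.unfold-reverse true X

 -- Equal letter counts force equal lengths and equal total gaps. The degree bounds differ by 3
 -- because two blocks have one hub more than one block with the same gaps.
 merge : ∀ us vs w → All Letter us → All Letter vs → All Letter w → count 3 us + count 3 vs ≡ count 3 w → count 4 us + count 4 vs ≡ count 4 w →
   (length us + length vs ≡ length w) × (gapSum us + gapSum vs ≡ gapSum w) × (degree us + degree vs ≡ degree w + 3)
 merge us vs w a a′ a″ p₃ p₄ = len , sum , deg
   where
   lengths : ∀ a b c d → (a + b) + (c + d) ≡ (a + c) + (b + d)
   lengths = solve-∀
   sums : ∀ a b c d → (8 * a + 10 * b) + (8 * c + 10 * d) ≡ 8 * (a + c) + 10 * (b + d)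
   sums = solve-∀
   degrees : ∀ l s l′ s′ → (3 + (3 * l + s)) + (3 + (3 * l′ + s′)) ≡ (3 + (3 * (l + l′) + (s + s′))) + 3
   degrees = solve-∀
   U = letters-all us a
   V = letters-all vs a′
   W = letters-all w a″
   len : length us + length vs ≡ length w
   len = trans (cong₂ _+_ (proj₁ U) (proj₁ V)) (trans (lengths (count 3 us) (count 4 us) (count 3 vs) (count 4 vs)) (trans (cong₂ _+_ p₃ p₄) (sym (proj₁ W))))
   sum : gapSum us + gapSum vs ≡ gapSum w
   sum = trans (cong₂ _+_ (proj₂ U) (proj₂ V)) (trans (sums (count 3 us) (count 4 us) (count 3 vs) (count 4 vs)) (trans (cong₂ (λ x y → 8 * x + 10 * y) p₃ p₄) (sym (proj₂ W))))
   deg : degree us + degree vs ≡ degree w + 3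
   deg = trans (cong₂ _+_ (degree-gapSum us) (degree-gapSum vs)) (trans (degrees (length us) (gapSum us) (length vs) (gapSum vs))
     (cong (_+ 3) (trans (cong₂ (λ l s → 3 + (3 * l + s)) len sum) (sym (degree-gapSum w)))))

 -- The bound `degree w + 3` is that of the block of w times a single hub. The first inequality
 -- makes 2L larger than the degrees of two trace coefficients together; the second does the same
 -- for the offset between the long gaps and one coefficient.
 record Admissible (w : List ℕ) (L L′ : ℕ) : Set where
   field
     nonempty   : 1 ≤ length w
     small      : All Letter w
     residue    : Not≡2mod3 L
     residue′   : Not≡2mod3 L′
     separated  : (degree w + 3) + (degree w + 3) < double L
     separated′ : double L + (degree w + 3) < double L′
     half       : ℕ
     odd        : length (bitsOf (w ++ L ∷ L′ ∷ [])) ≡ suc (half + half)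

 module _ {w : List ℕ} {L L′ : ℕ} (adm : Admissible w L L′) where
   open Admissible adm

   private
     gs : List ℕ
     gs = w ++ L ∷ L′ ∷ []

     12<L : 12 < double L
     12<L = ℕ.≤-<-trans (ℕ.+-mono-≤ 6≤ 6≤) separated
       where
       6≤ : 6 ≤ degree w + 3
       6≤ = ℕ.+-monoˡ-≤ 3 (subst (3 ≤_) (sym (degree-gapSum w)) (ℕ.m≤m+n 3 _))

     5≤ : ∀ {g} → 12 < double g → 5 ≤ g
     5≤ {g} p = ℕ.≮⇒≥ λ g<5 → ℕ.<⇒≱ p (ℕ.≤-trans (ℕ.+-mono-≤ g<5 g<5) (ℕ.m≤m+n 10 2))

     5≤L : 5 ≤ L
     5≤L = 5≤ 12<L

     5≤L′ : 5 ≤ L′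
     5≤L′ = 5≤ (ℕ.<-trans 12<L (ℕ.≤-<-trans (ℕ.m≤m+n _ _) separated′))

     letter≥3 : ∀ {g} → Letter g → 3 ≤ g
     letter≥3 (inj₁ refl) = ℕ.≤-refl
     letter≥3 (inj₂ refl) = ℕ.m≤m+n 3 1

     gaps≥3 : All (3 ≤_) gs
     gaps≥3 = All.++⁺ (All.map letter≥3 small) (ℕ.≤-trans (ℕ.m≤m+n 3 2) 5≤L ∷ ℕ.≤-trans (ℕ.m≤m+n 3 2) 5≤L′ ∷ [])

     length-gs : length gs ≡ length w + 2
     length-gs = List.length-++ w

     3≤length : 3 ≤ length gs
     3≤length = subst (3 ≤_) (sym length-gs) (ℕ.+-monoˡ-≤ 2 nonempty)

     3≤bits : 3 ≤ length (bitsOf gs)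
     3≤bits = ℕ.≤-trans 3≤length (length≤bits gs)

     count-gs : ∀ j → j < 5 → count j gs ≡ count j w
     count-gs j j<5 = trans (count-++ j w (L ∷ L′ ∷ [])) (trans (cong (λ z → count j w + z) (count-below (ℕ.≤-trans j<5 5≤L ∷ ℕ.≤-trans j<5 5≤L′ ∷ []))) (ℕ.+-identityʳ _))

   wide : Wide gs
   wide = record
     { nonempty = ℕ.≤-trans (s≤s z≤n) 3≤length ; positive = All.map (ℕ.≤-trans (s≤s z≤n)) gaps≥3 ; half = half ; odd = odd
     ; long = subst (5 ≤_) (sym (trans (cong length (bitsOf-++ w (L ∷ L′ ∷ []))) (List.length-++ (bitsOf w)))) (ℕ.≤-trans (subst (5 ≤_) (sym (length-bitsOf-∷ L (L′ ∷ [])))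
         (ℕ.≤-trans 5≤L (ℕ.≤-trans (ℕ.n≤1+n L) (ℕ.m≤m+n (suc L) _)))) (ℕ.m≤n+m _ (length (bitsOf w))))
     ; residues = λ x∈ → residues (∈-++⁻ w x∈) }
     where
     letterResidue : ∀ {g} → Letter g → Not≡2mod3 g
     letterResidue (inj₁ refl) = step′ zero′
     letterResidue (inj₂ refl) = step′ one′
     residues : ∀ {x} → (x ∈ w) ⊎ (x ∈ L ∷ L′ ∷ []) → Not≡2mod3 x
     residues (inj₁ x∈)                  = letterResidue (All.lookup small x∈)
     residues (inj₂ (here refl))         = residue
     residues (inj₂ (there (here refl))) = residue′

   -- The data that any gap list of a mate shares with `gs`. It is established anew for the
   -- rearranged list before decoding.
   record Matching (ks : List ℕ) : Set where
     field
       lengths : length ks ≡ length gs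
       orders  : length (bitsOf ks) ≡ length (bitsOf gs)
       traces  : T𝕊.tr (word ks) Power.≈ T𝕊.tr (word gs)

   open Matching

   Decoded : List ℕ → List ℕ → ℕ → ℕ → Set
   Decoded us vs M M′ = M ≡ L × M′ ≡ L′ × ((us ≡ w × vs ≡ []) ⊎ (us ≡ [] × vs ≡ reverse w))

   decodeMatching : ∀ us vs {M M′} → Matching (us ++ M ∷ vs ++ M′ ∷ []) → M ≤ M′ → All Letter us → All Letter vs →
     count 3 us + count 3 vs ≡ count 3 w → count 4 us + count 4 vs ≡ count 4 w → Decoded us vs M M′
   decodeMatching us vs {M} {M′} m M≤M′ a a′ p₃ p₄ = ℕ.suc-injective (double-injective (proj₁ D)) , ℕ.suc-injective (double-injective (proj₁ (proj₂ D))) , proj₂ (proj₂ D)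
     where
     S = merge us vs w a a′ small p₃ p₄
     total : gapSum (us ++ M ∷ vs ++ M′ ∷ []) ≡ gapSum gs
     total = trans (gapSum-bits (us ++ M ∷ vs ++ M′ ∷ [])) (trans (cong (λ z → z + z) (orders m)) (sym (gapSum-bits gs)))
     expand : gapSum (us ++ M ∷ vs ++ M′ ∷ []) ≡ (gapSum us + gapSum vs) + (double M + double M′)
     expand = trans (gapSum-++ us (M ∷ vs ++ M′ ∷ [])) (trans (cong (λ z → gapSum us + (double M + z)) (gapSum-++ vs (M′ ∷ []))) (rearrange (gapSum us) (gapSum vs) (double M) (double M′)))
       where
       rearrange : ∀ s s′ d d′ → s + (d + (s′ + (d′ + 0))) ≡ (s + s′) + (d + d′)
       rearrange = solve-∀
     expand′ : gapSum gs ≡ gapSum w + (double L + double L′)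
     expand′ = trans (gapSum-++ w (L ∷ L′ ∷ [])) (cong (λ z → gapSum w + (double L + z)) (ℕ.+-identityʳ (double L′)))
     doubles : double M + double M′ ≡ double L + double L′
     doubles = ℕ.+-cancelˡ-≡ (gapSum w) _ _ (trans (cong (_+ (double M + double M′)) (sym (proj₁ (proj₂ S)))) (trans (sym expand) (trans total expand′)))
     D = decode us vs w M M′ L L′ (traces m) (proj₁ S) (proj₁ (proj₂ S)) (proj₂ (proj₂ S)) M≤M′ doubles separated separated′

   module Reconstruction {n : ℕ} {G H : Graph n} (s : HasBits G (bitsOf gs)) (c : QCospectral G H) where
     matching : ∀ ks → 3 ≤ length (bitsOf ks) → HasBits H (bitsOf ks) → Matching ks
     matching ks 3≤ t = record
       { lengths = trans (sym (trues-bitsOf ks)) (trans (sym truesEq) (trues-bitsOf gs)) ; orders = sym orderEq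
       ; traces = Power.sym (hasBits-trace {G = G} {H} gs ks 3≤bits s t orderEq truesEq (qDet-cospectral {G = G} {H} c base Power.q)) }
       where
       truesEq : trues (bitsOf gs) ≡ trues (bitsOf ks)
       truesEq = cospectral-trues {G = G} {H} c 3≤bits 3≤ s t
       orderEq : length (bitsOf gs) ≡ length (bitsOf ks)
       orderEq = ℕ.+-cancelˡ-≡ (trues (bitsOf gs)) _ _ (trans (sym (hasBits-order 3≤bits s)) (trans (hasBits-order 3≤ t) (cong (_+ length (bitsOf ks)) (sym truesEq))))

     gapList : Σ (List ℕ) λ hs → 3 ≤ length (bitsOf hs) × HasBits H (bitsOf hs)
     gapList = go (cospectral-hasBits {G = G} {H} s wide c)
       where
       go : (Σ (List Bool) λ bs → 3 ≤ length bs × HasBits H bs) → Σ (List ℕ) λ hs → 3 ≤ length (bitsOf hs) × HasBits H (bitsOf hs)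
       go (bs , 3≤ , t) with firstTrue bs (subst (1 ≤_) (trans (sym (trues-bitsOf gs)) (cospectral-trues {G = G} {H} c 3≤bits 3≤ s t)) (ℕ.≤-trans (s≤s z≤n) 3≤length))
       ... | xs , ys , refl with parse (ys ++ xs)
       ...   | m , hs , e = m ∷ hs , subst (3 ≤_) (trans (List.length-++-comm xs (true ∷ ys)) (cong (λ z → suc (length z)) e)) 3≤ ,
           subst (λ z → HasBits H (true ∷ z)) e (hasBits-rotates xs (true ∷ ys) t)

     -- A gap 0, rotated to the front, yields a bit list that starts with two hubs, and these would
     -- be adjacent.
     positive : ∀ hs → length hs ≡ length gs → HasBits H (bitsOf hs) → All (1 ≤_) hs
     positive hs len t = All.tabulate (λ {x} → nonzero x)
       where
       start : ∀ ks → 2 ≤ length ks → HasBits H (true ∷ bitsOf ks) → ⊥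
       start (g ∷ ks) 2≤ t = cospectral-apart {G = G} {H} s wide c (s≤s (ℕ.≤-trans 2≤ (length≤bits (g ∷ ks)))) t
       nonzero : ∀ x → x ∈ hs → 1 ≤ x
       nonzero (suc x) _ = s≤s z≤n
       nonzero zero x∈ with ∈-∃++ x∈
       ... | us , vs , refl = ⊥-elim (start (vs ++ us) (ℕ.≤-pred (subst (3 ≤_) (List.length-++-comm us (0 ∷ vs)) (subst (3 ≤_) (sym len) 3≤length))) (rotateGaps us (0 ∷ vs) t))

     module _ (hs : List ℕ) (t : HasBits H (bitsOf hs)) (m : Matching hs) where
       private
         -- A lower bound g₀ yields the counts of the gaps g₀, ..., 2 g₀ - 1. From 1, as hubs are
         -- not adjacent, the bound rises to 2 and then to 3, because `gs` has no gaps 1 or 2. The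
         -- bound 3 reaches both letters 3 and 4.
         agree : ∀ g₀ → All (g₀ ≤_) hs → All (g₀ ≤_) gs → ∀ j → j < g₀ → count (g₀ + j) hs ≡ count (g₀ + j) gs
         agree g₀ a a′ = Expansion.counts-agree g₀ hs gs a a′ (lengths m) (subst (2 ≤_) (sym (lengths m)) (ℕ.≤-trans (s≤s (s≤s z≤n)) 3≤length)) (traces m)

         hs≥1 : All (1 ≤_) hs
         hs≥1 = positive hs (lengths m) t

         gs≥2 : All (2 ≤_) gs
         gs≥2 = All.map (ℕ.≤-trans (s≤s (s≤s z≤n))) gaps≥3

         hs≥2 : All (2 ≤_) hs
         hs≥2 = raise hs≥1 (trans (agree 1 hs≥1 (All.map (ℕ.≤-trans (s≤s z≤n)) gaps≥3) 0 (s≤s z≤n)) (count-below gs≥2))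

         hs≥3 : All (3 ≤_) hs
         hs≥3 = raise hs≥2 (trans (agree 2 hs≥2 gs≥2 0 (s≤s z≤n)) (count-below gaps≥3))

         count₃ : count 3 hs ≡ count 3 w
         count₃ = trans (agree 3 hs≥3 gaps≥3 0 (s≤s z≤n)) (count-gs 3 (ℕ.m≤m+n 4 1))

         count₄ : count 4 hs ≡ count 4 w
         count₄ = trans (agree 3 hs≥3 gaps≥3 1 (s≤s (s≤s z≤n))) (count-gs 4 ℕ.≤-refl)

         letters+2 : letters hs + 2 ≡ length hs
         letters+2 = trans (cong (_+ 2) (trans (cong₂ _+_ count₃ count₄) (sym (proj₁ (letters-all w small))))) (trans (sym length-gs) (sym (lengths m)))

       Arrangement : Set
       Arrangement = Σ (List ℕ) λ us → Σ (List ℕ) λ vs → Σ ℕ λ M → Σ ℕ λ M′ → HasBits H (bitsOf (us ++ M ∷ vs ++ M′ ∷ [])) × M ≤ M′ × All Letter us × All Letter vs ×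
         count 3 us + count 3 vs ≡ count 3 w × count 4 us + count 4 vs ≡ count 4 w

       arrangement : Arrangement
       arrangement with peel 1 hs letters+2
       ... | A , M , rest , refl , a , M≢3 , M≢4 , p with peel 0 rest p
       ...   | B , M′ , C , refl , b , M′≢3 , M′≢4 , r = order (ℕ.≤-total M M′)
         where
         c′ : All Letter C
         c′ = all-letters C (trans (sym (ℕ.+-identityʳ _)) r)
         counts : ∀ {j} → M ≢ j → M′ ≢ j → count j hs ≡ count j A + (count j B + count j C)
         counts {j} p r = trans (count-++ j A (M ∷ B ++ M′ ∷ C)) (cong (λ z → count j A + z) (trans (count-≢ (B ++ M′ ∷ C) p)
           (trans (count-++ j B (M′ ∷ C)) (cong (λ z → count j B + z) (count-≢ C r)))))
         joined : ∀ {j} → M ≢ j → M′ ≢ j → count j hs ≡ count j w → count j (C ++ A) + count j B ≡ count j w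
         joined {j} p r e = trans (trans (cong (_+ count j B) (count-++ j C A)) (rearrange (count j C) (count j A) (count j B))) (trans (sym (counts p r)) e)
           where
           rearrange : ∀ x y z → (x + y) + z ≡ y + (z + x)
           rearrange = solve-∀
         -- The cyclic list A, M, B, M′, C is rotated so that the larger long gap comes last; the
         -- letters in C and A then form one block.
         order : (M ≤ M′) ⊎ (M′ ≤ M) → Arrangement
         order (inj₁ M≤M′) = C ++ A , B , M , M′ , subst (λ z → HasBits H (bitsOf z)) (sym (List.++-assoc C A (M ∷ B ++ M′ ∷ [])))
             (rotateGaps (A ++ M ∷ B ++ M′ ∷ []) C (subst (λ z → HasBits H (bitsOf z)) (sym (trans (List.++-assoc A (M ∷ B ++ M′ ∷ []) C) (cong (λ z → A ++ M ∷ z) (List.++-assoc B (M′ ∷ []) C)))) t)) ,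
           M≤M′ , All.++⁺ c′ a , b , joined M≢3 M′≢3 count₃ , joined M≢4 M′≢4 count₄
         order (inj₂ M′≤M) = B , C ++ A , M′ , M , subst (λ z → HasBits H (bitsOf z)) (trans (List.++-assoc B (M′ ∷ C) (A ++ M ∷ [])) (cong (λ z → B ++ M′ ∷ z) (sym (List.++-assoc C A (M ∷ [])))))
             (rotateGaps (A ++ M ∷ []) (B ++ M′ ∷ C) (subst (λ z → HasBits H (bitsOf z)) (sym (List.++-assoc A (M ∷ []) (B ++ M′ ∷ C))) t)) ,
           M′≤M , b , All.++⁺ c′ a , swap {count 3 (C ++ A)} (joined M≢3 M′≢3 count₃) , swap {count 4 (C ++ A)} (joined M≢4 M′≢4 count₄)
           where
           swap : ∀ {x y z} → x + y ≡ z → y + x ≡ z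
           swap {x} {y} p = trans (ℕ.+-comm y x) p

     restored : HasBits H (bitsOf gs)
     restored = conclude (arrangement hs t (matching hs (proj₁ (proj₂ gapList)) t))
       where
       hs = proj₁ gapList
       t = proj₂ (proj₂ gapList)
       conclude : Arrangement hs t (matching hs (proj₁ (proj₂ gapList)) t) → HasBits H (bitsOf gs)
       conclude (us , vs , M , M′ , t′ , M≤M′ , a , a′ , p₃ , p₄) = cases (decodeMatching us vs (matching (us ++ M ∷ vs ++ M′ ∷ []) 3≤′ t′) M≤M′ a a′ p₃ p₄)
         where
         3≤′ : 3 ≤ length (bitsOf (us ++ M ∷ vs ++ M′ ∷ []))
         3≤′ = ℕ.≤-trans (subst (3 ≤_) len 3≤length) (length≤bits (us ++ M ∷ vs ++ M′ ∷ []))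
           where
           len : length gs ≡ length (us ++ M ∷ vs ++ M′ ∷ [])
           len = trans length-gs (trans (cong (_+ 2) (sym (proj₁ (merge us vs w a a′ small p₃ p₄)))) (trans (rearrange (length us) (length vs))
             (sym (trans (List.length-++ us) (cong (λ z → length us + suc z) (List.length-++ vs))))))
             where
             rearrange : ∀ x y → (x + y) + 2 ≡ x + suc (y + 1)
             rearrange = solve-∀
         cases : Decoded us vs M M′ → HasBits H (bitsOf gs)
         cases (refl , refl , inj₁ (refl , refl)) = t′
         -- Here the list is L, then w reversed, then L′. Rotating L′ to the front and reading
         -- backwards gives w, L, L′.
         cases (refl , refl , inj₂ (refl , refl)) = subst (λ z → HasBits H (bitsOf z)) reversed (reverseGaps (L′ ∷ L ∷ reverse w) (rotateGaps (L ∷ reverse w) (L′ ∷ []) t′))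
           where
           reversed : reverse (L′ ∷ L ∷ reverse w) ≡ gs
           reversed = trans (cong reverse (sym (List.reverse-++ w (L ∷ L′ ∷ [])))) (List.reverse-involutive gs)

   determined : ∀ {n} {G : Graph n} → HasBits G (bitsOf gs) → DQS G
   determined {G = G} s H c = hasBits-unique (Reconstruction.restored {G = G} {H} s c) s

   -- An isomorphism makes both lists descriptions of one graph, so their traces agree and the
   -- decoding applies to the graph as its own mate.
   words-injective : ∀ {n} {G G′ : Graph n} {w′} → All Letter w′ → count 3 w′ ≡ count 3 w → count 4 w′ ≡ count 4 w →
     HasBits G (bitsOf gs) → HasBits G′ (bitsOf (w′ ++ L ∷ L′ ∷ [])) → G ≅ G′ → w′ ≡ w
   words-injective {G = G} {G′} {w′} a p₃ p₄ s s′ e = cases (decodeMatching w′ [] (record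
       { lengths = len ; orders = sym orderEq
       ; traces = Power.sym (hasBits-trace {G = G′} {G′} gs ks 3≤bits t s′ orderEq truesEq Power.refl) })
       (ℕ.<⇒≤ L<L′) a [] (trans (ℕ.+-identityʳ _) p₃) (trans (ℕ.+-identityʳ _) p₄))
     where
     ks = w′ ++ L ∷ L′ ∷ []
     t : HasBits G′ (bitsOf gs)
     t = hasBits-transport e s
     M = merge w′ [] w a [] small (trans (ℕ.+-identityʳ _) p₃) (trans (ℕ.+-identityʳ _) p₄)
     len : length ks ≡ length gs
     len = trans (List.length-++ w′) (trans (cong (_+ 2) (trans (sym (ℕ.+-identityʳ _)) (proj₁ M))) (sym length-gs))
     truesEq : trues (bitsOf gs) ≡ trues (bitsOf ks)
     truesEq = trans (trues-bitsOf gs) (trans (sym len) (sym (trues-bitsOf ks)))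
     orderEq : length (bitsOf gs) ≡ length (bitsOf ks)
     orderEq = ℕ.+-cancelˡ-≡ (trues (bitsOf gs)) _ _ (trans (sym (hasBits-order 3≤bits t)) (trans (hasBits-order (ℕ.≤-trans (subst (3 ≤_) (sym len) 3≤length) (length≤bits ks)) s′) (cong (_+ length (bitsOf ks)) (sym truesEq))))
     L<L′ : L < L′
     L<L′ = ℕ.≮⇒≥ λ { (s≤s L′≤L) → ℕ.<⇒≱ (ℕ.≤-<-trans (ℕ.m≤m+n (double L) (degree w + 3)) separated′) (ℕ.+-mono-≤ (s≤s L′≤L) (s≤s L′≤L)) }
     cases : Decoded w′ [] L L′ → w′ ≡ w
     cases (_ , _ , inj₁ (p , _)) = p
     cases (_ , _ , inj₂ (p , r)) = trans p (trans (sym (cong reverse (sym r))) (List.reverse-involutive w))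

-- The exponential family and the choice of its parameters.

module GapFamily where
 open TransferMatrices using (trues)
 open LeadingCoefficients
 open GapWords using (count; double)
 open Decode using (degree; gapSum)
 open GapLists
 open SunIsomorphism using (HasBits)
 open SunConstruction using (construct)
 open Recognition using (module Wide)
 open Reconstructions using (Admissible; wide; determined; words-injective)
 open import Data.Nat.Base using (_+_; _*_; _^_; _≤_; _<_; NonZero)
 open import Data.Nat.DivMod using (_/_; _%_; m≡m%n+[m/n]*n; m%n<n; /-monoˡ-≤)
 open import Data.Nat.Tactic.RingSolver using (solve-∀)
 open import Data.Fin.Base using (zero; suc; finToFun; funToFin; combine)
 open import Data.List.Base using (replicate)
 open import Data.List.Relation.Unary.All using (All; []; _∷_)
 import Data.List.Relation.Unary.All.Properties as All
 open import Data.Unit.Base using (tt)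
 open ≡

 -- Gaps 3 and 4 stand for hub distances 4 and 5. Each choice uses one of either kind, so all words
 -- have the same letter counts and their suns the same order.
 blocks : ∀ s → (Fin s → Fin 2) → List ℕ
 blocks zero    f = []
 blocks (suc s) f with f zero
 ... | zero  = 3 ∷ 4 ∷ blocks s (f ∘ suc)
 ... | suc _ = 4 ∷ 3 ∷ blocks s (f ∘ suc)

 blocks-letters : ∀ s f → All Letter (blocks s f)
 blocks-letters zero    f = []
 blocks-letters (suc s) f with f zero
 ... | zero  = inj₁ refl ∷ inj₂ refl ∷ blocks-letters s (f ∘ suc)
 ... | suc _ = inj₂ refl ∷ inj₁ refl ∷ blocks-letters s (f ∘ suc)

 blocks-count : ∀ s f → count 3 (blocks s f) ≡ s × count 4 (blocks s f) ≡ s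
 blocks-count zero    f = refl , refl
 blocks-count (suc s) f with f zero | blocks-count s (f ∘ suc)
 ... | zero  | p , r = cong suc p , cong suc r
 ... | suc _ | p , r = cong suc p , cong suc r

 blocks-injective : ∀ s f g → blocks s f ≡ blocks s g → ∀ i → f i ≡ g i
 blocks-injective (suc s) f g p i with f zero in f₀ | g zero in g₀
 blocks-injective (suc s) f g p zero    | zero  | zero  = trans f₀ (sym g₀)
 blocks-injective (suc s) f g p (suc i) | zero  | zero  = blocks-injective s (f ∘ suc) (g ∘ suc) (List.∷-injectiveʳ (List.∷-injectiveʳ p)) i
 blocks-injective (suc s) f g p zero    | suc zero | suc zero = trans f₀ (sym g₀)
 blocks-injective (suc s) f g p (suc i) | suc _ | suc _ = blocks-injective s (f ∘ suc) (g ∘ suc) (List.∷-injectiveʳ (List.∷-injectiveʳ p)) i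
 blocks-injective (suc s) f g () i | zero | suc _
 blocks-injective (suc s) f g () i | suc _ | zero

 finToFun-injective : ∀ {m} n (i j : Fin (m ^ n)) → (∀ k → finToFun {m} {n} i k ≡ finToFun j k) → i ≡ j
 finToFun-injective {m} n i j p = trans (sym (Fin.funToFin-finToFin {n} {m} i)) (trans (funToFin-cong n (finToFun i) (finToFun j) p) (Fin.funToFin-finToFin {n} {m} j))
   where
   funToFin-cong : ∀ n (f g : Fin n → Fin m) → (∀ k → f k ≡ g k) → funToFin f ≡ funToFin g
   funToFin-cong zero    f g p = refl
   funToFin-cong (suc n) f g p = cong₂ combine (p zero) (funToFin-cong n (f ∘ suc) (g ∘ suc) (p ∘ suc))

 letterWord : ∀ e s → Fin (2 ^ s) → List ℕ
 letterWord e s i = replicate e 3 ++ blocks s (finToFun i)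

 module _ (e s : ℕ) (i : Fin (2 ^ s)) where
   private
     w = letterWord e s i
     B = blocks s (finToFun i)

   letterWord-letters : All Letter w
   letterWord-letters = All.++⁺ (All.replicate⁺ e (inj₁ refl)) (blocks-letters s (finToFun i))

   letterWord-count₃ : count 3 w ≡ e + s
   letterWord-count₃ = trans (count-++ 3 (replicate e 3) B) (cong₂ _+_ (go e) (proj₁ (blocks-count s (finToFun i))))
     where
     go : ∀ e → count 3 (replicate e 3) ≡ e
     go zero    = refl
     go (suc e) = cong suc (go e)

   letterWord-count₄ : count 4 w ≡ s
   letterWord-count₄ = trans (count-++ 4 (replicate e 3) B) (cong₂ _+_ (go e) (proj₂ (blocks-count s (finToFun i))))
     where
     go : ∀ e → count 4 (replicate e 3) ≡ 0
     go zero    = refl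
     go (suc e) = go e

   letterWord-length : length w ≡ (e + s) + s
   letterWord-length = trans (proj₁ (letters-all w letterWord-letters)) (cong₂ _+_ letterWord-count₃ letterWord-count₄)

   letterWord-gapSum : gapSum w ≡ 8 * (e + s) + 10 * s
   letterWord-gapSum = trans (proj₂ (letters-all w letterWord-letters)) (cong₂ (λ x y → 8 * x + 10 * y) letterWord-count₃ letterWord-count₄)

   letterWord-degree : degree w + 3 ≡ 24 * s + 11 * e + 6
   letterWord-degree = trans (cong (_+ 3) (trans (degree-gapSum w) (cong₂ (λ l g → 3 + (3 * l + g)) letterWord-length letterWord-gapSum))) (rearrange e s)
     where
     rearrange : ∀ e s → (3 + (3 * ((e + s) + s) + (8 * (e + s) + 10 * s))) + 3 ≡ 24 * s + 11 * e + 6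
     rearrange = solve-∀

   letterWord-bits : length (bitsOf w) ≡ 4 * (e + s) + 5 * s
   letterWord-bits = ℕ.*-cancelˡ-≡ _ _ 2 (trans (twice (length (bitsOf w))) (trans (sym (gapSum-bits w)) (trans letterWord-gapSum (rearrange e s))))
     where
     twice : ∀ a → 2 * a ≡ a + a
     twice = solve-∀
     rearrange : ∀ e s → 8 * (e + s) + 10 * s ≡ 2 * (4 * (e + s) + 5 * s)
     rearrange = solve-∀

 letterWord-injective : ∀ e s i j → letterWord e s i ≡ letterWord e s j → i ≡ j
 letterWord-injective e s i j p = finToFun-injective s i j (blocks-injective s (finToFun i) (finToFun j) (List.++-cancelˡ (replicate e 3) _ _ p))

 -- The sum of the two long gaps is prescribed by the order, and both must avoid the residue 2. If
 -- the remainder X has it, one vertex moves to the other long gap, which is otherwise a multiple of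
 -- 3.
 shorten : ∀ X → Σ ℕ λ c → Σ ℕ λ Y → X ≡ c + Y × c ≤ 1 × Not≡2mod3 c × Not≡2mod3 Y
 shorten 0 = 0 , 0 , refl , z≤n , zero′ , zero′
 shorten 1 = 0 , 1 , refl , z≤n , zero′ , one′
 shorten 2 = 1 , 1 , refl , s≤s z≤n , one′ , one′
 shorten (suc (suc (suc X))) with shorten X
 ... | c , Y , refl , c≤1 , p , r = c , 3 + Y , rearrange c Y , c≤1 , p , step′ r
   where
   rearrange : ∀ c Y → 3 + (c + Y) ≡ c + (3 + Y)
   rearrange = solve-∀

 +-double-suc : ∀ a k → a + (suc k + suc k) ≡ suc (suc (a + (k + k)))
 +-double-suc = solve-∀

 oddDifference : ∀ a k h → a + (k + k) ≡ suc (h + h) → Σ ℕ λ half → a ≡ suc (half + half)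
 oddDifference a zero    h p = h , trans (sym (ℕ.+-identityʳ a)) p
 oddDifference a (suc k) zero    p with () ← ℕ.suc-injective (trans (sym (+-double-suc a k)) p)
 oddDifference a (suc k) (suc h) p = oddDifference a k h (ℕ.suc-injective (ℕ.suc-injective (trans (sym (+-double-suc a k)) (trans p (+-double-suc 1 h)))))

 -- One extra letter for even orders makes the cycle odd.
 parity : ∀ n → 1 ≤ n → Σ ℕ λ e → Σ ℕ λ h → e ≤ 1 × n ≡ e + suc (h + h)
 parity 1 _ = 0 , 0 , z≤n , refl
 parity 2 _ = 1 , 0 , s≤s z≤n , refl
 parity (suc (suc (suc n))) _ with parity (suc n) (s≤s z≤n)
 ... | e , h , e≤1 , p = e , suc h , e≤1 , trans (cong (λ z → suc (suc z)) p) (rearrange e h)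
   where
   rearrange : ∀ e h → suc (suc (e + suc (h + h))) ≡ e + suc (suc h + suc h)
   rearrange = solve-∀

 record Layout (n : ℕ) : Set where
   field
     e s L L′   : ℕ
     admissible : ∀ i → Admissible (letterWord e s i) L L′
     order      : ∀ i → let bs = bitsOf (letterWord e s i ++ L ∷ L′ ∷ []) in n ≡ trues bs + length bs
     n≤200s     : n ≤ s * 200

 layout : ∀ n → 400 ≤ n → Layout n
 layout n 400≤n = record
   { e = e ; s = s ; L = L ; L′ = L′ ; order = order ; n≤200s = n≤200s
   ; admissible = λ i → record
     { nonempty = subst (1 ≤_) (sym (letterWord-length e s i)) (ℕ.≤-trans 1≤s (ℕ.m≤n+m s (e + s)))
     ; small = letterWord-letters e s i ; residue = multiple (6 + 8 * s) (proj₁ (proj₂ (proj₂ (proj₂ (proj₂ short))))) ; residue′ = proj₂ (proj₂ (proj₂ (proj₂ (proj₂ short))))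
     ; separated = subst (λ D → D + D < double L) (sym (letterWord-degree e s i)) (ℕ.+-mono-< (s≤s D≤L) (s≤s D≤L))
     ; separated′ = subst (λ D → double L + D < double L′) (sym (letterWord-degree e s i)) (subst (_< double L′) (sym (ℕ.+-assoc (suc L) (suc L) D)) (ℕ.+-mono-<-≤ (s≤s L<L′) (s≤s L+D≤L′)))
     ; half = proj₁ (half i) ; odd = proj₂ (half i) } }
   where
   -- A pair of letters takes 4 vertices for its hubs and leaves and 7 in its gaps; the long gaps
   -- take about 24 s and 48 s. Together this is 83 s and at most 64 more, which 100 s covers once s
   -- ≥ 4, that is, n ≥ 400.
   s = n / 100
   e = proj₁ (parity n (ℕ.≤-trans (s≤s z≤n) 400≤n))
   h = proj₁ (proj₂ (parity n (ℕ.≤-trans (s≤s z≤n) 400≤n)))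
   e≤1 : e ≤ 1
   e≤1 = proj₁ (proj₂ (proj₂ (parity n (ℕ.≤-trans (s≤s z≤n) 400≤n))))
   n≡ : n ≡ e + suc (h + h)
   n≡ = proj₂ (proj₂ (proj₂ (parity n (ℕ.≤-trans (s≤s z≤n) 400≤n))))
   4≤s : 4 ≤ s
   4≤s = /-monoˡ-≤ 100 400≤n
   1≤s : 1 ≤ s
   1≤s = ℕ.≤-trans (s≤s z≤n) 4≤s
   n≤200s : n ≤ s * 200
   n≤200s = ℕ.≤-trans (ℕ.≤-reflexive (m≡m%n+[m/n]*n n 100)) (ℕ.≤-trans (ℕ.+-monoˡ-≤ (s * 100) (ℕ.≤-trans (ℕ.<⇒≤ (m%n<n n 100)) (ℕ.*-monoˡ-≤ 100 1≤s)))
     (ℕ.≤-reflexive (sym (ℕ.*-distribˡ-+ s 100 100))))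
   enough : (35 * s + 5 * e + 22) + (48 * s + 37) ≤ n
   enough = ℕ.≤-trans (ℕ.≤-reflexive (rearrange s e)) (ℕ.≤-trans (ℕ.+-monoʳ-≤ (83 * s) (ℕ.+-monoˡ-≤ 59 (ℕ.*-monoʳ-≤ 5 e≤1))) (ℕ.≤-trans (ℕ.+-monoʳ-≤ (83 * s) (ℕ.≤-trans (ℕ.m≤m+n 64 4) (ℕ.*-monoʳ-≤ 17 4≤s)))
     (ℕ.≤-trans (ℕ.≤-reflexive (collect s)) (ℕ.≤-trans (ℕ.m≤n+m (s * 100) (n % 100)) (ℕ.≤-reflexive (sym (m≡m%n+[m/n]*n n 100)))))))
     where
     rearrange : ∀ s e → (35 * s + 5 * e + 22) + (48 * s + 37) ≡ 83 * s + (5 * e + 59)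
     rearrange = solve-∀
     collect : ∀ s → 83 * s + 17 * s ≡ s * 100
     collect = solve-∀
   o = proj₁ (ℕ.m≤n⇒∃[o]m+o≡n enough)
   short = shorten ((48 * s + 37) + o)
   c = proj₁ short
   L′ = proj₁ (proj₂ short)
   X≡ : (48 * s + 37) + o ≡ c + L′
   X≡ = proj₁ (proj₂ (proj₂ short))
   c≤1 : c ≤ 1
   c≤1 = proj₁ (proj₂ (proj₂ (proj₂ short)))
   -- The degree bound D is at most 24 s + 17, and 24 s + 18 is the next multiple of 3, so c decides
   -- the residue. All vertices left over go into L′.
   L = (6 + 8 * s) * 3 + c
   D = 24 * s + 11 * e + 6
   multiple : ∀ k {c} → Not≡2mod3 c → Not≡2mod3 (k * 3 + c)
   multiple zero    p = p
   multiple (suc k) p = step′ (multiple k p)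
   D≤ : D ≤ 24 * s + 17
   D≤ = ℕ.≤-trans (ℕ.+-monoˡ-≤ 6 (ℕ.+-monoʳ-≤ (24 * s) (ℕ.*-monoʳ-≤ 11 e≤1))) (ℕ.≤-reflexive (ℕ.+-assoc (24 * s) 11 6))
   D≤L : D ≤ L
   D≤L = ℕ.≤-trans D≤ (ℕ.≤-trans (ℕ.m≤m+n _ (1 + c)) (ℕ.≤-reflexive (rearrange s c)))
     where
     rearrange : ∀ s c → (24 * s + 17) + (1 + c) ≡ (6 + 8 * s) * 3 + c
     rearrange = solve-∀
   L+D≤L′ : L + D ≤ L′
   L+D≤L′ = ℕ.≤-trans (ℕ.+-mono-≤ (ℕ.+-monoʳ-≤ ((6 + 8 * s) * 3) c≤1) D≤) (ℕ.≤-trans (ℕ.≤-reflexive (rearrange s))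
     (ℕ.≤-pred (ℕ.≤-trans (ℕ.≤-reflexive (shift s)) (ℕ.≤-trans (ℕ.m≤m+n (48 * s + 37) o) (ℕ.≤-trans (ℕ.≤-reflexive X≡) (ℕ.+-monoˡ-≤ L′ c≤1))))))
     where
     rearrange : ∀ s → ((6 + 8 * s) * 3 + 1) + (24 * s + 17) ≡ 48 * s + 36
     rearrange = solve-∀
     shift : ∀ s → suc (48 * s + 36) ≡ 48 * s + 37
     shift = solve-∀
   L<L′ : L < L′
   L<L′ = ℕ.≤-trans (ℕ.≤-trans (ℕ.≤-reflexive (ℕ.+-comm 1 L)) (ℕ.+-monoʳ-≤ L (ℕ.≤-trans (s≤s z≤n) (ℕ.m≤n+m 6 _)))) L+D≤L′
   bits : ∀ i → length (bitsOf (letterWord e s i ++ L ∷ L′ ∷ [])) ≡ (4 * (e + s) + 5 * s) + (suc L + suc L′)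
   bits i = trans (cong length (bitsOf-++ (letterWord e s i) (L ∷ L′ ∷ []))) (trans (List.length-++ (bitsOf (letterWord e s i))) (cong₂ _+_ (letterWord-bits e s i)
     (trans (length-bitsOf-∷ L (L′ ∷ [])) (cong (λ z → suc L + z) (trans (length-bitsOf-∷ L′ []) (ℕ.+-identityʳ (suc L′)))))))
   hubCount : ∀ i → length (letterWord e s i ++ L ∷ L′ ∷ []) ≡ ((e + s) + s) + 2
   hubCount i = trans (List.length-++ (letterWord e s i)) (cong (_+ 2) (letterWord-length e s i))
   total : (((e + s) + s) + 2) + ((4 * (e + s) + 5 * s) + (suc L + suc L′)) ≡ n
   total = trans (rearrange e s c L′) (trans (cong (λ z → (35 * s + 5 * e + 22) + z) (sym X≡)) (trans (sym (ℕ.+-assoc (35 * s + 5 * e + 22) (48 * s + 37) o)) (proj₂ (ℕ.m≤n⇒∃[o]m+o≡n enough))))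
     where
     rearrange : ∀ e s c L′ → (((e + s) + s) + 2) + ((4 * (e + s) + 5 * s) + (suc ((6 + 8 * s) * 3 + c) + suc L′)) ≡ (35 * s + 5 * e + 22) + (c + L′)
     rearrange = solve-∀
   order : ∀ i → let bs = bitsOf (letterWord e s i ++ L ∷ L′ ∷ []) in n ≡ trues bs + length bs
   order i = sym (trans (cong₂ _+_ (trans (trues-bitsOf (letterWord e s i ++ L ∷ L′ ∷ [])) (hubCount i)) (bits i)) total)
   half : ∀ i → Σ ℕ λ half → length (bitsOf (letterWord e s i ++ L ∷ L′ ∷ [])) ≡ suc (half + half)
   half i = oddDifference _ (suc s) h (ℕ.+-cancelˡ-≡ e _ _ (trans (rearrange e s (length (bitsOf (letterWord e s i ++ L ∷ L′ ∷ [])))) (trans (cong (λ z → (((e + s) + s) + 2) + z) (bits i)) (trans total n≡))))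
     where
     rearrange : ∀ e s ℓ → e + (ℓ + (suc s + suc s)) ≡ (((e + s) + s) + 2) + ℓ
     rearrange = solve-∀

 -- The exponent n is padded to the multiple s t and the padding is cancelled at the end, so neither
 -- roots nor logarithms are required.
 power-bound : ∀ p q .{{_ : NonZero q}} t → q ≤ p → p ^ t ≤ 2 * q ^ t → ∀ s n → n ≤ s * t → p ^ n ≤ 2 ^ s * q ^ n
 power-bound p q t q≤p base s n n≤ = ℕ.*-cancelʳ-≤ (p ^ n) (2 ^ s * q ^ n) (q ^ m) {{ℕ.m^n≢0 q m}} (begin
   p ^ n * q ^ m ≤⟨ ℕ.*-monoʳ-≤ (p ^ n) (ℕ.^-monoˡ-≤ m q≤p) ⟩
   p ^ n * p ^ m ≡⟨ ℕ.^-distribˡ-+-* p n m ⟨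
   p ^ (n + m) ≡⟨ cong (p ^_) total ⟩
   p ^ (t * s) ≡⟨ ℕ.^-*-assoc p t s ⟨
   (p ^ t) ^ s ≤⟨ ℕ.^-monoˡ-≤ s base ⟩
   (2 * q ^ t) ^ s ≡⟨ distribute 2 (q ^ t) s ⟩
   2 ^ s * (q ^ t) ^ s ≡⟨ cong (2 ^ s *_) (trans (ℕ.^-*-assoc q t s) (trans (cong (q ^_) (sym total)) (ℕ.^-distribˡ-+-* q n m))) ⟩
   2 ^ s * (q ^ n * q ^ m) ≡⟨ ℕ.*-assoc (2 ^ s) (q ^ n) (q ^ m) ⟨
   2 ^ s * q ^ n * q ^ m ∎)
   where
   open ℕ.≤-Reasoning
   m = proj₁ (ℕ.m≤n⇒∃[o]m+o≡n n≤)
   total : n + m ≡ t * s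
   total = trans (proj₂ (ℕ.m≤n⇒∃[o]m+o≡n n≤)) (ℕ.*-comm s t)
   distribute : ∀ a b s → (a * b) ^ s ≡ a ^ s * b ^ s
   distribute a b zero    = refl
   distribute a b (suc s) = trans (cong (a * b *_) (distribute a b s)) (interchange a b (a ^ s) (b ^ s))
     where
     interchange : ∀ a b x y → (a * b) * (x * y) ≡ (a * x) * (b * y)
     interchange = solve-∀

 abstract
   -- The ratio (1 + 1/400)^200 is about 1.65. The comparison is done by computation and then
   -- sealed, so that these large powers are not unfolded again.
   growth : 401 ^ 200 ≤ 2 * 400 ^ 200
   growth = ℕ.≤ᵇ⇒≤ (401 ^ 200) (2 * 400 ^ 200) tt
   1≤400 : 1 ≤ 400
   1≤400 = s≤s z≤n

   400<401 : 400 < 401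
   400<401 = ℕ.≤-refl

 family : ∀ n → 400 ≤ n → Σ ℕ λ k → Σ (Fin k → Graph n) λ G →
   (∀ i → DQS (G i)) × (∀ i j → i ≢ j → ¬ (G i ≅ G j)) × (401 ^ n ≤ k * 400 ^ n)
 family n 400≤n = 2 ^ s , (λ i → proj₁ (built i)) , (λ i → determined (admissible i) (proj₂ (built i))) ,
   (λ i j i≢j iso → i≢j (letterWord-injective e s i j (sym (words-injective (admissible i) (letterWord-letters e s j)
       (trans (letterWord-count₃ e s j) (sym (letterWord-count₃ e s i))) (trans (letterWord-count₄ e s j) (sym (letterWord-count₄ e s i)))
       (proj₂ (built i)) (proj₂ (built j)) iso)))) ,
   power-bound 401 400 200 (ℕ.<⇒≤ 400<401) growth s n n≤200s
   where
   open Layout (layout n 400≤n)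
   built : ∀ i → Σ (Graph n) λ G → HasBits G (bitsOf (letterWord e s i ++ L ∷ L′ ∷ []))
   built i = construct _ (order i) (ℕ.≤-trans (s≤s (s≤s (s≤s z≤n))) (Wide.long (wide (admissible i))))

open import Defs
open import Data.Nat using (ℕ; _≤_; _<_; _^_; _*_)
open import Data.Fin using (Fin)
open import Data.Product using (Σ; ∃; _×_; _,_)
open import Relation.Binary.PropositionalEquality using (_≢_)
open import Relation.Nullary using (¬_)

open GapFamily using (1≤400; 400<401; family)

theorem2p8 : Σ ℕ λ p → Σ ℕ λ q → (1 ≤ q) × (q < p) × (Σ ℕ λ N0 → ∀ (n : ℕ) → N0 ≤ n →
    Σ ℕ λ k → Σ (Fin k → Graph n) λ G →
    (∀ i → DQS (G i)) × (∀ i j → i ≢ j → ¬ (G i ≅ G j)) × (p ^ n ≤ k * q ^ n))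
theorem2p8 = 401 , 400 , 1≤400 , 400<401 , 400 , family
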